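{- Let $\nu \geqslant 1$ be a fixed integer. For positive integers $M,N$ define the restricted divisor function $\tau_{M,N}(k) = \#\{(m,n) : 1 \leqslant m \leqslant M,\ 1 \leqslant n \leqslant N,\ mn = k\}$ for positive integers $k$. For a prime $q$ and positive integers $M,N,R$ define $$\Gamma_q(M,N,R) = \sum_{a=1}^{q-1} \left| \sum_{r=1}^{R} \sum_{\substack{k\geqslant 1\\ k \equiv ar \pmod q}} \tau_{M,N}(k) - \frac{MNR}{q}\right|^2.$$ Then for a prime $q$ and positive integers $M,N,R < q$, with $L = \min\{M,N,R\}$, $$\Gamma_q(M,N,R) \leqslant MNR\, L^{1-2/\nu} q^{(\nu+1)/(2\nu^2) + o(1)},$$ that is, for every $\varepsilon>0$ there is a constant $C=C(\nu,\varepsilon)$ such that $\Gamma_q(M,N,R) \leqslant C\, MNR\, L^{1-2/\nu} q^{(\nu+1)/(2\nu^2)+\varepsilon}$ for all primes $q$ and all positive integers $M,N,R<q$.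
   Context: The term $q^{o(1)}$ denotes a factor $q^{\eta(q)}$ with $\eta(q)\to 0$ as $q\to\infty$, uniformly in $M,N,R$ (depending only on the fixed $\nu$). -}

module Defs where

open import Data.Nat as ℕ using (ℕ; zero; suc; _+_; _*_; _≤_; _<_; _≡ᵇ_; _%_; pred; _⊔_; _⊓_)
open import Data.Bool using (Bool; if_then_else_)
open import Data.Integer using (+_)
open import Data.Rational as ℚ using (ℚ; _-_; _/_)

sumℕ : ℕ → (ℕ → ℕ) → ℕ
sumℕ zero    f = 0
sumℕ (suc n) f = sumℕ n f + f (suc n)

sumℚ : ℕ → (ℕ → ℚ) → ℚ
sumℚ zero    f = ℚ.0ℚ
sumℚ (suc n) f = sumℚ n f ℚ.+ f (suc n)

_^ℚ_ : ℚ → ℕ → ℚ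
x ^ℚ zero  = ℚ.1ℚ
x ^ℚ suc n = x ℚ.* (x ^ℚ n)

ind : Bool → ℕ
ind b = if b then 1 else 0

-- congruence a ≡ b (mod q), for q ≥ 1 (here q is a prime, so q ≥ 2)
congMod : ℕ → ℕ → ℕ → Bool
congMod q a b = (a % suc (pred q)) ≡ᵇ (b % suc (pred q))

tau : ℕ → ℕ → ℕ → ℕ
tau M N k = sumℕ M (λ m → sumℕ N (λ n → ind ((m * n) ≡ᵇ k)))

-- Σ_{k ≥ 1, k ≡ a r (mod q)} τ_{M,N}(k); τ_{M,N}(k) = 0 for k > M N,
-- so the sum over k ranges over 1 ≤ k ≤ M N.
innerSum : ℕ → ℕ → ℕ → ℕ → ℕ → ℕ
innerSum q M N a r = sumℕ (M * N) (λ k → ind (congMod q k (a * r)) * tau M N k)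

Gamma : ℕ → ℕ → ℕ → ℕ → ℚ
Gamma q M N R =
  sumℚ (pred q) (λ a →
    let d = (+ sumℕ R (λ r → innerSum q M N a r) / 1) - ((+ (M * N * R)) / suc (pred q))
    in d ℚ.* d)

ℕtoℚ : ℕ → ℚ
ℕtoℚ n = (+ n) / 1

minL : ℕ → ℕ → ℕ → ℕ
minL M N R = M ⊓ (N ⊓ R)

{-# OPTIONS --safe #-}
-- q² Γ is the sum over nontrivial characters χ of |S_M S_N S_R|², S_n = Σ_{m ≤ n} χ(m). Characters are
-- not needed one at a time: ℤ[F_q*] modulo the sum of all group elements carries a universal nontrivial
-- character, a cone of squares and a functional positive on it that replaces the sum over χ.
-- Single sums are bounded trivially, by Pólya–Vinogradov, or by Burgess with fourth moments; the Weil
-- bound needed there comes from Stepanov's method over a tower of quadratic extensions, each step down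
-- taking a square root of the error. With the fourth moment (lattice points) and the sixth moment
-- (divisor bound) of S_n, the size of L against powers of q decides which bounds are combined.
module Submission where

open import Level using (0ℓ)
open import Algebra using (CommutativeRing; CommutativeSemiring)
open import Data.Nat as N using (ℕ; zero; suc; z≤n; s≤s; NonZero; pred; _≤_; _<_)
open import Data.List using (List; []; _∷_; _++_; length; filter; map; cartesianProduct; lookup; concatMap)
open import Data.List.Membership.Propositional using (_∈_)
open import Data.List.Membership.Propositional.Properties using (∈-filter⁻; ∈-map⁻; ∈-map⁺; ∈-cartesianProduct⁻)
open import Data.List.Relation.Unary.Any using (here; there)
open import Data.List.Relation.Unary.All as All using (All; []; _∷_)
open import Data.List.Relation.Unary.AllPairs using ([]; _∷_)
open import Data.List.Relation.Unary.Unique.Propositional using (Unique)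
open import Data.Product using (Σ; ∃; _×_; _,_; proj₁; proj₂)
open import Data.Sum using (_⊎_; inj₁; inj₂; [_,_]′)
open import Data.Bool using (true; false)
open import Function using (_∘_)
open import Relation.Nullary using (¬_; Dec; yes; no; does; ¬?; contradiction)
open import Data.Nat.Primality using (Prime; prime⇒nonZero)
open import Data.Nat.Divisibility using (_∣_; divides; _∣?_; ∣⇒≤)
open import Data.Nat.DivMod using (m/n*n≤m; m≡m%n+[m/n]*n; m%n<n; /-monoˡ-≤; m<n⇒m/n≡0)
open import Data.Nat.Tactic.RingSolver using (solve-∀)
open import Data.List.Relation.Binary.Permutation.Propositional using (_↭_)
import Data.Nat.Properties as N
open import Data.Nat.Properties using (*-cancelˡ-≡; *-cancelˡ-≤; *-mono-<; *-mono-≤; *-monoʳ-≤; *-monoˡ-≤; *-suc; +-*-commutativeSemiring; +-cancelʳ-≡; +-cancelʳ-≤; +-mono-≤; +-monoʳ-≤; +-monoˡ-<; +-monoˡ-≤; +-suc; <-irrefl; <-trans; <-≤-trans; <⇒≢; <⇒≤; <⇒≱; ^-*-assoc; ^-distribˡ-+-*; ^-monoʳ-≤; ^-monoˡ-≤; m+[n∸m]≡n; m<n⇒m<1+n; m^n>0; m^n≢0; m∸n+n≡m; m∸n≡0⇒m≤n; m∸n≤m; m≤m+n; m≤n+m; m≤n+o⇒m∸n≤o; n<1+n; n≢0⇒n>0; n≤1+n; suc-injective; suc-pred; ≤-<-trans; ≤-antisym; ≤-pred; ≤-refl; ≤-total; ≤-trans; ≤ᵇ⇒≤; ≤∧≢⇒<;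 ≮⇒≥; ≰⇒>) renaming (≤-reflexive to ≡⇒≤)
import Data.Integer.Properties as ℤ
import Data.List.Properties as List
import Data.List.Relation.Unary.Unique.Propositional.Properties as Unique
import Data.Fin.Properties as Fin
import Relation.Binary.PropositionalEquality as E
open E using (_≡_; _≢_; cong; cong₂; subst)

module Alg where
 open import Algebra using (RawRing)
 open import Data.Integer as ℤ using (ℤ; +_; -[1+_]; _⊖_)
 open import Data.Sign as Sign using (Sign)
 open import Data.List.Relation.Binary.Permutation.Propositional using (prep; swap) renaming (refl to ↭-refl; trans to ↭-trans)
 open import Data.Maybe using (Maybe; just; nothing)
 open E using (_≡_)
 open import Algebra.Solver.Ring.AlmostCommutativeRing using (AlmostCommutativeRing; fromCommutativeRing; _-Raw-AlmostCommutative⟶_; Induced-equivalence)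
 import Algebra.Solver.Ring as Solver

 rng : ℕ -> List ℕ
 rng zero = []
 rng(suc n)= n ∷ rng n

 ∈-rng⁻ : ∀{n i}-> i ∈ rng n -> i < n
 ∈-rng⁻{suc n}(here E.refl)= n<1+n n
 ∈-rng⁻{suc n}(there p)= m<n⇒m<1+n(∈-rng⁻ p)

 ∈-rng⁺ : ∀{n i}-> i < n -> i ∈ rng n
 ∈-rng⁺{suc n}{i}i<1+n with i N.≟ n
 ... | yes E.refl = here E.refl
 ... | no i≢n = there(∈-rng⁺(≤∧≢⇒<(≤-pred i<1+n)i≢n))

 length-rng : ∀ n -> length(rng n)≡ n
 length-rng zero = E.refl
 length-rng(suc n)= cong suc(length-rng n)

 module Sums (S : CommutativeSemiring 0ℓ 0ℓ) where
  open CommutativeSemiring S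
  open import Relation.Binary.Reasoning.Setoid setoid

  Ʃ :{I : Set}-> List I ->(I -> Carrier)-> Carrier
  Ʃ [] f = 0#
  Ʃ(x ∷ xs)f = f x + Ʃ xs f

  private
   interchange : ∀ a b c d ->(a + b)+(c + d)≈(a + c)+(b + d)
   interchange a b c d = begin
    _ ≈⟨ +-assoc a b(c + d)⟩
    _ ≈⟨ +-congˡ(sym(+-assoc b c d))⟩
    _ ≈⟨ +-congˡ(+-congʳ(+-comm b c))⟩
    _ ≈⟨ +-congˡ(+-assoc c b d)⟩
    _ ≈⟨ sym(+-assoc a c(b + d))⟩
    _ ∎

  module _{I : Set}where
   Ʃ-cong-∈ : ∀(xs : List I){f g : I -> Carrier}->(∀{x}-> x ∈ xs -> f x ≈ g x)-> Ʃ xs f ≈ Ʃ xs g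
   Ʃ-cong-∈ [] h = refl
   Ʃ-cong-∈(x ∷ xs)h = +-cong(h(here E.refl))(Ʃ-cong-∈ xs(h ∘ there))

   Ʃ-cong : ∀(xs : List I){f g : I -> Carrier}->(∀ x -> f x ≈ g x)-> Ʃ xs f ≈ Ʃ xs g
   Ʃ-cong xs h = Ʃ-cong-∈ xs(\{x}_ -> h x)

   Ʃ-zero : ∀(xs : List I)-> Ʃ xs(\_ -> 0#)≈ 0#
   Ʃ-zero [] = refl
   Ʃ-zero(x ∷ xs)= trans(+-identityˡ _)(Ʃ-zero xs)

   Ʃ-≈0 : ∀(xs : List I){f : I -> Carrier}->(∀{x}-> x ∈ xs -> f x ≈ 0#)-> Ʃ xs f ≈ 0#
   Ʃ-≈0 xs h = trans(Ʃ-cong-∈ xs h)(Ʃ-zero xs)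

   Ʃ-+ : ∀(xs : List I)(f g : I -> Carrier)-> Ʃ xs(\x -> f x + g x)≈ Ʃ xs f + Ʃ xs g
   Ʃ-+ [] f g = sym(+-identityˡ 0#)
   Ʃ-+(x ∷ xs)f g = trans(+-congˡ(Ʃ-+ xs f g))(interchange _ _ _ _)

   Ʃ-*ˡ : ∀(xs : List I)c(f : I -> Carrier)-> Ʃ xs(\x -> c * f x)≈ c * Ʃ xs f
   Ʃ-*ˡ [] c f = sym(zeroʳ c)
   Ʃ-*ˡ(x ∷ xs)c f = trans(+-congˡ(Ʃ-*ˡ xs c f))(sym(distribˡ c _ _))

   Ʃ-*ʳ : ∀(xs : List I)c(f : I -> Carrier)-> Ʃ xs(\x -> f x * c)≈ Ʃ xs f * c
   Ʃ-*ʳ [] c f = sym(zeroˡ c)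
   Ʃ-*ʳ(x ∷ xs)c f = trans(+-congˡ(Ʃ-*ʳ xs c f))(sym(distribʳ c _ _))

   Ʃ-++ : ∀(xs ys : List I)(f : I -> Carrier)-> Ʃ(xs ++ ys)f ≈ Ʃ xs f + Ʃ ys f
   Ʃ-++ [] ys f = sym(+-identityˡ _)
   Ʃ-++(x ∷ xs)ys f = trans(+-congˡ(Ʃ-++ xs ys f))(sym(+-assoc _ _ _))

   Ʃ-↭ : ∀{xs ys : List I}-> xs ↭ ys ->(f : I -> Carrier)-> Ʃ xs f ≈ Ʃ ys f
   Ʃ-↭ ↭-refl f = refl
   Ʃ-↭(prep x p)f = +-congˡ(Ʃ-↭ p f)
   Ʃ-↭(swap{xs}{ys}x y p)f = begin
    _ ≈⟨ sym(+-assoc _ _ _)⟩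
    _ ≈⟨ +-cong(+-comm _ _)(Ʃ-↭ p f)⟩
    _ ≈⟨ +-assoc _ _ _ ⟩
    _ ∎
   Ʃ-↭(↭-trans p p')f = trans(Ʃ-↭ p f)(Ʃ-↭ p' f)

  Ʃ-map :{I J : Set}(h : I -> J)(xs : List I)(f : J -> Carrier)-> Ʃ(map h xs)f ≈ Ʃ xs(f ∘ h)
  Ʃ-map h [] f = refl
  Ʃ-map h(x ∷ xs)f = +-congˡ(Ʃ-map h xs f)

  Ʃ-swap :{I J : Set}(xs : List I)(ys : List J)(f : I -> J -> Carrier)->
       Ʃ xs(\x -> Ʃ ys(f x))≈ Ʃ ys(\y -> Ʃ xs(\x -> f x y))
  Ʃ-swap [] ys f = sym(Ʃ-zero ys)
  Ʃ-swap(x ∷ xs)ys f = trans(+-congˡ(Ʃ-swap xs ys f))(sym(Ʃ-+ ys _ _))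

  Ʃ-*Ʃ :{I J : Set}(xs : List I)(ys : List J)(f : I -> Carrier)(g : J -> Carrier)->
      Ʃ xs f * Ʃ ys g ≈ Ʃ xs(\x -> Ʃ ys(\y -> f x * g y))
  Ʃ-*Ʃ xs ys f g = trans(sym(Ʃ-*ʳ xs(Ʃ ys g)f))(Ʃ-cong xs(\x -> sym(Ʃ-*ˡ ys(f x)g)))

  Ʃ-concatMap :{I J : Set}(h : I -> List J)(xs : List I)(f : J -> Carrier)->
         Ʃ(concatMap h xs)f ≈ Ʃ xs(\x -> Ʃ(h x)f)
  Ʃ-concatMap h [] f = refl
  Ʃ-concatMap h(x ∷ xs)f = trans(Ʃ-++(h x)(concatMap h xs)f)(+-congˡ(Ʃ-concatMap h xs f))

  Ʃ-rng-+ : ∀ m n(f : ℕ -> Carrier)-> Ʃ(rng(n N.+ m))f ≈ Ʃ(rng m)f + Ʃ(rng n)(\i -> f(i N.+ m))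
  Ʃ-rng-+ m zero f = sym(+-identityʳ _)
  Ʃ-rng-+ m(suc n)f = begin
   _ ≈⟨ +-congˡ(Ʃ-rng-+ m n f)⟩
   _ ≈⟨ sym(+-assoc _ _ _)⟩
   _ ≈⟨ +-congʳ(+-comm _ _)⟩
   _ ≈⟨ +-assoc _ _ _ ⟩
   _ ∎

 module RingKit (R : CommutativeRing 0ℓ 0ℓ) where
  open CommutativeRing R
  open import Algebra.Properties.Ring ring
  open import Relation.Binary.Reasoning.Setoid setoid
  open Sums commutativeSemiring public

  ⟨_⟩ : ℕ -> Carrier
  ⟨ zero ⟩ = 0#
  ⟨ suc n ⟩ = 1# + ⟨ n ⟩

  ⟨⟩-+ : ∀ m n -> ⟨ m N.+ n ⟩ ≈ ⟨ m ⟩ + ⟨ n ⟩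
  ⟨⟩-+ zero n = sym(+-identityˡ _)
  ⟨⟩-+(suc m)n = trans(+-congˡ(⟨⟩-+ m n))(sym(+-assoc _ _ _))

  ⟨⟩-* : ∀ m n -> ⟨ m N.* n ⟩ ≈ ⟨ m ⟩ * ⟨ n ⟩
  ⟨⟩-* zero n = sym(zeroˡ _)
  ⟨⟩-*(suc m)n = begin
   _ ≈⟨ ⟨⟩-+ n(m N.* n)⟩
   _ ≈⟨ +-cong(sym(*-identityˡ _))(⟨⟩-* m n)⟩
   _ ≈⟨ sym(distribʳ _ _ _)⟩
   _ ∎

  ⟨1⟩ : ⟨ 1 ⟩ ≈ 1#
  ⟨1⟩ = +-identityʳ 1#

  private
   ⟦_⟧ : ℤ -> Carrier
   ⟦ + n ⟧ = ⟨ n ⟩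
   ⟦ -[1+ n ] ⟧ = - ⟨ suc n ⟩

   ⊖-homo : ∀ m n -> ⟦ m ⊖ n ⟧ ≈ ⟨ m ⟩ - ⟨ n ⟩
   ⊖-homo zero zero = sym(-‿inverseʳ 0#)
   ⊖-homo zero(suc n)= sym(+-identityˡ _)
   ⊖-homo(suc m)zero = sym(trans(+-congˡ -0#≈0#)(+-identityʳ _))
   ⊖-homo(suc m)(suc n)= begin
    _ ≡⟨ cong ⟦_⟧(ℤ.[1+m]⊖[1+n]≡m⊖n m n)⟩
    _ ≈⟨ ⊖-homo m n ⟩
    _ ≈⟨ +-congʳ(sym(+-identityʳ _))⟩
    _ ≈⟨ +-congʳ(+-congˡ(sym(-‿inverseʳ 1#)))⟩
    _ ≈⟨ +-congʳ(sym(+-assoc _ _ _))⟩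
    _ ≈⟨ +-assoc _ _ _ ⟩
    _ ≈⟨ +-cong(+-comm _ _)(⁻¹-∙-comm 1# ⟨ n ⟩)⟩
    _ ∎
    where open import Algebra.Properties.AbelianGroup +-abelianGroup using (⁻¹-∙-comm)

   neg-homo : ∀ i -> ⟦ ℤ.- i ⟧ ≈ - ⟦ i ⟧
   neg-homo(+ zero)= sym -0#≈0#
   neg-homo(+ suc n)= refl
   neg-homo -[1+ n ] = sym(-‿involutive _)

   +-homo : ∀ i j -> ⟦ i ℤ.+ j ⟧ ≈ ⟦ i ⟧ + ⟦ j ⟧
   +-homo(+ m)(+ n)= ⟨⟩-+ m n
   +-homo(+ m)-[1+ n ] = ⊖-homo m(suc n)
   +-homo -[1+ m ](+ n)= trans(⊖-homo n(suc m))(+-comm _ _)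
   +-homo -[1+ m ] -[1+ n ] = begin
    _ ≡⟨ cong(\z -> - ⟨ suc z ⟩)(E.sym(+-suc m n))⟩
    _ ≈⟨ -‿cong(⟨⟩-+(suc m)(suc n))⟩
    _ ≈⟨ sym(⁻¹-∙-comm _ _)⟩
    _ ∎
    where open import Algebra.Properties.AbelianGroup +-abelianGroup using (⁻¹-∙-comm)

   ◃-homo : ∀ n -> ⟦ Sign.- ℤ.◃ n ⟧ ≈ - ⟨ n ⟩
   ◃-homo zero = sym -0#≈0#
   ◃-homo(suc n)= refl

   *-homo : ∀ i j -> ⟦ i ℤ.* j ⟧ ≈ ⟦ i ⟧ * ⟦ j ⟧
   *-homo(+ m)(+ n)= trans(reflexive(cong ⟦_⟧(ℤ.+◃n≡+n(m N.* n))))(⟨⟩-* m n)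
   *-homo(+ m)-[1+ n ] = trans(◃-homo(m N.* suc n))(trans(-‿cong(⟨⟩-* m(suc n)))(-‿distribʳ-* _ _))
   *-homo -[1+ m ](+ n)= trans(◃-homo(suc m N.* n))(trans(-‿cong(⟨⟩-*(suc m)n))(-‿distribˡ-* _ _))
   *-homo -[1+ m ] -[1+ n ] = begin
    _ ≡⟨ cong ⟦_⟧(ℤ.+◃n≡+n(suc m N.* suc n))⟩
    _ ≈⟨ ⟨⟩-*(suc m)(suc n)⟩
    _ ≈⟨ sym(-‿involutive _)⟩
    _ ≈⟨ -‿cong(-‿distribˡ-* _ _)⟩
    _ ≈⟨ -‿distribʳ-* _ _ ⟩
    _ ∎

   morphism : ℤ.+-*-rawRing -Raw-AlmostCommutative⟶ fromCommutativeRing R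
   morphism = record
    {⟦_⟧ = ⟦_⟧ ; +-homo = +-homo ; *-homo = *-homo ; -‿homo = neg-homo
    ; 0-homo = refl ; 1-homo = +-identityʳ 1#}

   _coeff≟_ :(i j : ℤ)-> Maybe(⟦ i ⟧ ≈ ⟦ j ⟧)
   i coeff≟ j with i ℤ.≟ j
   ... | yes E.refl = just refl
   ... | no _ = nothing

  open Solver ℤ.+-*-rawRing (fromCommutativeRing R) morphism _coeff≟_ public
   using (Polynomial; solve; _:=_; _:+_; _:*_; :-_; _:-_; var; op; _:^_) renaming (con to conℤ)

  con : ∀{n}-> ℕ -> Polynomial n
  con m = conℤ(+ m)

  module _{I : Set}where
   Ʃ-neg : ∀(xs : List I)(f : I -> Carrier)-> Ʃ xs(\x -> - f x)≈ - Ʃ xs f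
   Ʃ-neg [] f = sym -0#≈0#
   Ʃ-neg(x ∷ xs)f = trans(+-congˡ(Ʃ-neg xs f))(⁻¹-∙-comm _ _)
    where open import Algebra.Properties.AbelianGroup +-abelianGroup using (⁻¹-∙-comm)

   Ʃ-− : ∀(xs : List I)(f g : I -> Carrier)-> Ʃ xs(\x -> f x - g x)≈ Ʃ xs f - Ʃ xs g
   Ʃ-− xs f g = trans(Ʃ-+ xs f(\x -> - g x))(+-congˡ(Ʃ-neg xs g))

   Ʃ-const : ∀(xs : List I)c -> Ʃ xs(\_ -> c)≈ ⟨ length xs ⟩ * c
   Ʃ-const [] c = sym(zeroˡ c)
   Ʃ-const(x ∷ xs)c = trans(+-cong(sym(*-identityˡ c))(Ʃ-const xs c))(sym(distribʳ c _ _))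

   Ʃ-⟨⟩ : ∀(xs : List I)(f : I -> ℕ)-> Ʃ xs(\x -> ⟨ f x ⟩)≈ ⟨ Sums.Ʃ +-*-commutativeSemiring xs f ⟩
   Ʃ-⟨⟩ [] f = refl
   Ʃ-⟨⟩(x ∷ xs)f = trans(+-congˡ(Ʃ-⟨⟩ xs f))(sym(⟨⟩-+(f x)_))

 module NatSums where
  open Sums +-*-commutativeSemiring public

  module _{I : Set}where
   Ʃ-mono-≤ : ∀(xs : List I){f g : I -> ℕ}->(∀{x}-> x ∈ xs -> f x ≤ g x)-> Ʃ xs f ≤ Ʃ xs g
   Ʃ-mono-≤ [] h = N.z≤n
   Ʃ-mono-≤(x ∷ xs)h = +-mono-≤(h(here E.refl))(Ʃ-mono-≤ xs(h ∘ there))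

   Ʃ-const : ∀(xs : List I)c -> Ʃ xs(\_ -> c)≡ length xs N.* c
   Ʃ-const [] c = E.refl
   Ʃ-const(x ∷ xs)c = cong(c N.+_)(Ʃ-const xs c)

   Ʃ-≤-const : ∀(xs : List I){f : I -> ℕ}c ->(∀{x}-> x ∈ xs -> f x ≤ c)-> Ʃ xs f ≤ length xs N.* c
   Ʃ-≤-const xs c h = ≤-trans(Ʃ-mono-≤ xs h)(≡⇒≤(Ʃ-const xs c))

   ∈⇒≤Ʃ : ∀{xs : List I}{x}(f : I -> ℕ)-> x ∈ xs -> f x ≤ Ʃ xs f
   ∈⇒≤Ʃ f(here E.refl)= m≤m+n _ _
   ∈⇒≤Ʃ f(there p)= ≤-trans(∈⇒≤Ʃ f p)(m≤n+m _ _)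

   Ʃ-squeeze : ∀(xs : List I){f g : I -> ℕ}->(∀ x -> f x ≤ g x)-> Ʃ xs g ≤ Ʃ xs f -> ∀{x}-> x ∈ xs -> f x ≡ g x
   Ʃ-squeeze(x ∷ xs){f}{g}h t(here E.refl)= ≤-antisym(h x)
    (+-cancelʳ-≤(Ʃ xs g)(g x)(f x)(≤-trans t(+-monoʳ-≤(f x)(Ʃ-mono-≤ xs(\{y}_ -> h y)))))
   Ʃ-squeeze(x ∷ xs){f}{g}h t(there p)= Ʃ-squeeze xs h
    (N.+-cancelˡ-≤(g x)(Ʃ xs g)(Ʃ xs f)(≤-trans t(+-monoˡ-≤(Ʃ xs f)(h x))))p

module Cone where
 open E using (_≡_)
 open Alg

 record StarRing : Set₁ where
  field
   cring : CommutativeRing 0ℓ 0ℓ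
  open CommutativeRing cring
  infixl 9 _⋆
  field
   _⋆ : Carrier -> Carrier
   ⋆-cong : ∀{x y}-> x ≈ y -> x ⋆ ≈ y ⋆
   ⋆-+ : ∀ x y ->(x + y)⋆ ≈ x ⋆ + y ⋆
   ⋆-* : ∀ x y ->(x * y)⋆ ≈ x ⋆ * y ⋆
   ⋆-involutive : ∀ x -> x ⋆ ⋆ ≈ x
   torsion-free : ∀ n x -> RingKit.⟨_⟩ cring(suc n)* x ≈ 0# -> x ≈ 0#

 module Positivity (S : StarRing) where
  open StarRing S public
  open CommutativeRing cring public hiding (ring)
  open RingKit cring public
  open import Algebra.Properties.Ring (CommutativeRing.ring cring) public
   using(-0#≈0#; -‿involutive; -‿distribˡ-*; -‿distribʳ-*; x+x≈x⇒x≈0)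
  open import Relation.Binary.Reasoning.Setoid setoid public

  x≈y⇒x-y≈0 : ∀{x y}-> x ≈ y -> x - y ≈ 0#
  x≈y⇒x-y≈0 p = trans(+-congʳ p)(-‿inverseʳ _)

  x-y≈0⇒x≈y : ∀ x y -> x - y ≈ 0# -> x ≈ y
  x-y≈0⇒x≈y x y p = trans(solve 2(\x y -> x :=(x :- y):+ y)refl x y)(trans(+-congʳ p)(+-identityˡ y))

  Self : Carrier -> Set
  Self x = x ⋆ ≈ x

  1⋆ : Self 1#
  1⋆ = begin
   1# ⋆ ≈⟨ sym(*-identityʳ _)⟩
   _ ≈⟨ *-congˡ(sym(⋆-involutive 1#))⟩
   _ ≈⟨ sym(⋆-* 1#(1# ⋆))⟩
   _ ≈⟨ ⋆-cong(*-identityˡ _)⟩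
   _ ≈⟨ ⋆-involutive 1# ⟩
   1# ∎

  0⋆ : Self 0#
  0⋆ = x+x≈x⇒x≈0 _(trans(sym(⋆-+ 0# 0#))(⋆-cong(+-identityˡ 0#)))

  ⋆-neg : ∀ x ->(- x)⋆ ≈ -(x ⋆)
  ⋆-neg x = begin
   _ ≈⟨ solve 2(\a b -> a :=(a :+ b):- b)refl((- x)⋆)(x ⋆)⟩
   _ ≈⟨ +-congʳ(trans(sym(⋆-+ _ _))(trans(⋆-cong(-‿inverseˡ x))0⋆))⟩
   _ ≈⟨ +-identityˡ _ ⟩
   _ ∎

  ⋆-Ʃ :{I : Set}(xs : List I)(f : I -> Carrier)->(Ʃ xs f)⋆ ≈ Ʃ xs(\x -> f x ⋆)
  ⋆-Ʃ [] f = 0⋆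
  ⋆-Ʃ(x ∷ xs)f = trans(⋆-+ _ _)(+-congˡ(⋆-Ʃ xs f))

  self-⟨⟩ : ∀ n -> Self ⟨ n ⟩
  self-⟨⟩ zero = 0⋆
  self-⟨⟩(suc n)= trans(⋆-+ _ _)(+-cong 1⋆(self-⟨⟩ n))

  self-+ : ∀{x y}-> Self x -> Self y -> Self(x + y)
  self-+ p q = trans(⋆-+ _ _)(+-cong p q)

  self-* : ∀{x y}-> Self x -> Self y -> Self(x * y)
  self-* p q = trans(⋆-* _ _)(*-cong p q)

  self-neg : ∀{x}-> Self x -> Self(- x)
  self-neg p = trans(⋆-neg _)(-‿cong p)

  self-Ʃ :{I : Set}(xs : List I){f : I -> Carrier}->(∀ x -> Self(f x))-> Self(Ʃ xs f)
  self-Ʃ xs h = trans(⋆-Ʃ xs _)(Ʃ-cong xs h)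

  N : Carrier -> Carrier
  N x = x * x ⋆

  N-cong : ∀{x y}-> x ≈ y -> N x ≈ N y
  N-cong p = *-cong p(⋆-cong p)

  self-N : ∀ x -> Self(N x)
  self-N x = trans(⋆-* _ _)(trans(*-congˡ(⋆-involutive x))(*-comm _ _))

  N-* : ∀ x y -> N(x * y)≈ N x * N y
  N-* x y = trans(*-congˡ(⋆-* x y))
   (solve 4(\a b c d ->(a :* b):*(c :* d):=(a :* c):*(b :* d))refl x y(x ⋆)(y ⋆))

  N-⋆ : ∀ x -> N(x ⋆)≈ N x
  N-⋆ x = trans(*-congˡ(⋆-involutive x))(*-comm _ _)

  data Pos : Carrier -> Set where
   sq : ∀ h -> Pos(N h)
   add : ∀{a b}-> Pos a -> Pos b -> Pos(a + b)
   div : ∀ n{a}-> Pos(⟨ suc n ⟩ * a)-> Pos a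
   resp : ∀{a b}-> a ≈ b -> Pos a -> Pos b

  pos-0 : Pos 0#
  pos-0 = resp(zeroˡ _)(sq 0#)

  pos-1 : Pos 1#
  pos-1 = resp(trans(*-congˡ 1⋆)(*-identityˡ 1#))(sq 1#)

  pos-⟨⟩ : ∀ n -> Pos ⟨ n ⟩
  pos-⟨⟩ zero = pos-0
  pos-⟨⟩(suc n)= add pos-1(pos-⟨⟩ n)

  pos-self : ∀{a}-> Pos a -> Self a
  pos-self(sq h)= self-N h
  pos-self(add p q)= self-+(pos-self p)(pos-self q)
  pos-self(resp e p)= trans(⋆-cong(sym e))(trans(pos-self p)e)
  pos-self(div n{a}p)= x-y≈0⇒x≈y _ _(torsion-free n _(begin
   _ ≈⟨ solve 3(\k b c -> k :*(b :- c):= k :* b :- k :* c)refl ⟨ suc n ⟩(a ⋆)a ⟩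
   _ ≈⟨ +-congʳ(*-congʳ(sym(self-⟨⟩(suc n))))⟩
   _ ≈⟨ x≈y⇒x-y≈0(trans(sym(⋆-* _ _))(pos-self p))⟩
   0# ∎))

  private
   pos-N* : ∀ h{b}-> Pos b -> Pos(N h * b)
   pos-N* h(sq k)= resp(N-* h k)(sq(h * k))
   pos-N* h(add p q)= resp(sym(distribˡ _ _ _))(add(pos-N* h p)(pos-N* h q))
   pos-N* h(resp e p)= resp(*-congˡ e)(pos-N* h p)
   pos-N* h(div n{a}p)= div n(resp
    (solve 3(\x k y -> x :*(k :* y):= k :*(x :* y))refl(N h)⟨ suc n ⟩ a)(pos-N* h p))

  pos-* : ∀{a b}-> Pos a -> Pos b -> Pos(a * b)
  pos-*(sq h)q = pos-N* h q
  pos-*(add p p')q = resp(sym(distribʳ _ _ _))(add(pos-* p q)(pos-* p' q))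
  pos-*(resp e p)q = resp(*-congʳ e)(pos-* p q)
  pos-*(div n{a}p)q = div n(resp(*-assoc _ _ _)(pos-* p q))

  pos-Ʃ :{I : Set}(xs : List I){f : I -> Carrier}->(∀{x}-> x ∈ xs -> Pos(f x))-> Pos(Ʃ xs f)
  pos-Ʃ [] h = pos-0
  pos-Ʃ(x ∷ xs)h = add(h(here E.refl))(pos-Ʃ xs(\p -> h(there p)))

  pos-sq : ∀{a}-> Self a -> Pos(a * a)
  pos-sq{a}s = resp(*-congˡ s)(sq a)

  infix 4 _≲_
  record _≲_(a b : Carrier): Set where
   constructor by
   field pos : Pos(b - a)
  open _≲_ public

  ≲-resp : ∀{a a' b b'}-> a ≈ a' -> b ≈ b' -> a ≲ b -> a' ≲ b'
  ≲-resp p q(by r)= by(resp(+-cong q(-‿cong p))r)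

  ≲-respʳ : ∀{a b b'}-> b ≈ b' -> a ≲ b -> a ≲ b'
  ≲-respʳ = ≲-resp refl

  ≲-respˡ : ∀{a a' b}-> a ≈ a' -> a ≲ b -> a' ≲ b
  ≲-respˡ p = ≲-resp p refl

  ≈⇒≲ : ∀{a b}-> a ≈ b -> a ≲ b
  ≈⇒≲{a}{b}p = by(resp(sym(x≈y⇒x-y≈0(sym p)))pos-0)

  ≲-refl : ∀{a}-> a ≲ a
  ≲-refl = ≈⇒≲ refl

  ≲-trans : ∀{a b c}-> a ≲ b -> b ≲ c -> a ≲ c
  ≲-trans{a}{b}{c}(by p)(by q)=
   by(resp(solve 3(\a b c ->(b :- a):+(c :- b):= c :- a)refl a b c)(add p q))

  +-mono : ∀{a b c d}-> a ≲ b -> c ≲ d -> a + c ≲ b + d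
  +-mono{a}{b}{c}{d}(by p)(by q)=
   by(resp(solve 4(\a b c d ->(b :- a):+(d :- c):=(b :+ d):-(a :+ c))refl a b c d)(add p q))

  *-monoˡ : ∀{a b c}-> Pos c -> a ≲ b -> c * a ≲ c * b
  *-monoˡ{a}{b}{c}p(by q)=
   by(resp(solve 3(\a b c -> c :*(b :- a):= c :* b :- c :* a)refl a b c)(pos-* p q))

  *-monoʳ : ∀{a b c}-> Pos c -> a ≲ b -> a * c ≲ b * c
  *-monoʳ p q = ≲-resp(*-comm _ _)(*-comm _ _)(*-monoˡ p q)

  *-mono : ∀{a b c d}-> Pos a -> Pos d -> a ≲ b -> c ≲ d -> a * c ≲ b * d
  *-mono pa pd p q = ≲-trans(*-monoˡ pa q)(*-monoʳ pd p)

  pos⇒≲ : ∀{a}-> Pos a -> 0# ≲ a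
  pos⇒≲{a}p = by(resp(solve 1(\a -> a := a :- con 0)refl a)p)

  ≲-+ˡ : ∀{a b}-> Pos b -> a ≲ b + a
  ≲-+ˡ{a}{b}p = by(resp(solve 2(\a b -> b :=(b :+ a):- a)refl a b)p)

  ≲-+ʳ : ∀{a b}-> Pos b -> a ≲ a + b
  ≲-+ʳ{a}{b}p = ≲-respʳ(+-comm b a)(≲-+ˡ p)

  ⟨⟩-mono : ∀{m n}-> m ≤ n -> ⟨ m ⟩ ≲ ⟨ n ⟩
  ⟨⟩-mono{m}{n}p = ≲-respʳ(trans(sym(⟨⟩-+ m(n N.∸ m)))(reflexive(cong ⟨_⟩(m+[n∸m]≡n p))))(≲-+ʳ(pos-⟨⟩(n N.∸ m)))

  Ʃ-mono :{I : Set}(xs : List I){f g : I -> Carrier}->(∀{x}-> x ∈ xs -> f x ≲ g x)-> Ʃ xs f ≲ Ʃ xs g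
  Ʃ-mono [] h = ≲-refl
  Ʃ-mono(x ∷ xs)h = +-mono(h(here E.refl))(Ʃ-mono xs(\p -> h(there p)))

  Ʃ-∈≲ :{I : Set}(xs : List I){f : I -> Carrier}->(∀ x -> Pos(f x))-> ∀{x}-> x ∈ xs -> f x ≲ Ʃ xs f
  Ʃ-∈≲(x ∷ xs)h(here E.refl)= ≲-+ʳ(pos-Ʃ xs(\{y}_ -> h y))
  Ʃ-∈≲(x ∷ xs)h(there p)= ≲-trans(Ʃ-∈≲ xs h p)(≲-+ˡ(h x))

  ≲-div : ∀ n{a b}-> ⟨ suc n ⟩ * a ≲ ⟨ suc n ⟩ * b -> a ≲ b
  ≲-div n{a}{b}(by p)=
   by(div n(resp(solve 3(\k a b -> k :* b :- k :* a := k :*(b :- a))refl ⟨ suc n ⟩ a b)p))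

  N-weighted : ∀ n u v -> ⟨ n ⟩ * N(u + v)≲ ⟨ n ⟩ *(⟨ suc n ⟩ * N u)+ ⟨ suc n ⟩ * N v
  N-weighted n u v = by(resp(begin
   _ ≈⟨ *-congˡ(trans(⋆-+ _ _)(+-cong(trans(⋆-* _ _)(*-congʳ(self-⟨⟩ n)))(⋆-neg v)))⟩
   _ ≈⟨ solve 5(\k u v a b ->(k :* u :- v):*(k :* a :- b):=
       (k :*((con 1 :+ k):*(u :* a)):+(con 1 :+ k):*(v :* b)):- k :*((u :+ v):*(a :+ b)))
      refl ⟨ n ⟩ u v(u ⋆)(v ⋆)⟩
   _ ≈⟨ +-cong(+-cong(*-congˡ(*-congʳ(+-congʳ ⟨1⟩)))(*-congʳ(+-congʳ ⟨1⟩)))(-‿cong(*-congˡ(*-congˡ(sym(⋆-+ u v)))))⟩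
   _ ∎)(sq(⟨ n ⟩ * u - v)))

  N-+ : ∀ u v -> N(u + v)≲ ⟨ 2 ⟩ * N u + ⟨ 2 ⟩ * N v
  N-+ u v = ≲-resp(trans(*-congʳ ⟨1⟩)(*-identityˡ _))(+-congʳ(trans(*-congʳ ⟨1⟩)(*-identityˡ _)))(N-weighted 1 u v)

  N-Ʃ :{I : Set}(xs : List I)(f : I -> Carrier)-> N(Ʃ xs f)≲ ⟨ length xs ⟩ * Ʃ xs(\x -> N(f x))
  N-Ʃ [] f = ≈⇒≲(trans(zeroˡ _)(sym(zeroˡ _)))
  N-Ʃ(x ∷ [])f = ≈⇒≲(trans(N-cong(+-identityʳ _))
              (sym(trans(*-cong ⟨1⟩(+-identityʳ _))(*-identityˡ _))))
  N-Ʃ(x ∷ y ∷ ys)f = ≲-div(length ys)(≲-trans(N-weighted n(f x)(Ʃ xs f))(≲-respʳ eq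
    (+-mono ≲-refl(*-monoˡ(pos-⟨⟩(suc n))(N-Ʃ(y ∷ ys)f)))))
   where
   xs = y ∷ ys
   n = length xs
   eq : ⟨ n ⟩ *(⟨ suc n ⟩ * N(f x))+ ⟨ suc n ⟩ *(⟨ n ⟩ * Ʃ xs(\z -> N(f z)))≈
      ⟨ n ⟩ *(⟨ suc n ⟩ *(N(f x)+ Ʃ xs(\z -> N(f z))))
   eq = solve 4(\k l a b -> k :*(l :* a):+ l :*(k :* b):= k :*(l :*(a :+ b)))refl ⟨ n ⟩ ⟨ suc n ⟩ _ _

  cross : ∀ u v -> u * v ⋆ + u ⋆ * v ≲ N u + N v
  cross u v = by(resp(begin
   _ ≈⟨ *-congˡ(trans(⋆-+ _ _)(+-congˡ(⋆-neg v)))⟩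
   _ ≈⟨ solve 4(\u v a b ->(u :- v):*(a :- b):=(u :* a :+ v :* b):-(u :* b :+ a :* v))
                   refl u v(u ⋆)(v ⋆)⟩
   _ ∎)(sq(u - v)))

  sq-≲⇒≲ : ∀ K{x}-> Pos x -> x * x ≲ ⟨ suc K ⟩ * ⟨ suc K ⟩ -> x ≲ ⟨ suc K ⟩
  sq-≲⇒≲ K{x}px(by p)= by(div(K N.+ suc K)(resp eq
    (add(pos-sq(self-+(self-⟨⟩(suc K))(self-neg(pos-self px))))p)))
   where
   k = ⟨ suc K ⟩
   eq :(k - x)*(k - x)+(k * k - x * x)≈ ⟨ suc K N.+ suc K ⟩ *(k - x)
   eq = trans(solve 2(\k x ->(k :- x):*(k :- x):+(k :* k :- x :* x):=(k :+ k):*(k :- x))refl k x)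
         (*-congʳ(sym(⟨⟩-+(suc K)(suc K))))

  Ʃ²-weighted :{I : Set}(xs : List I)(ν : I -> ℕ)(w : I -> Carrier)->(∀ x -> Self(w x))->
   Ʃ xs(\x -> ⟨ ν x ⟩ * w x)* Ʃ xs(\x -> ⟨ ν x ⟩ * w x)≲
   Ʃ xs(\x -> ⟨ ν x ⟩ * ⟨ ν x ⟩)* Ʃ xs(\x -> w x * w x)
  Ʃ²-weighted{I}xs ν w sw = ≲-div 1(≲-resp left right
    (Ʃ-mono xs{\x -> Ʃ xs(A x)}{\x -> Ʃ xs(B x)}\{x}_ -> Ʃ-mono xs{A x}{B x}\{y}_ -> by(resp
     (solve 4(\a b c d ->(a :* d :- b :* c):*(a :* d :- b :* c):=
       ((a :* a):*(d :* d):+(b :* b):*(c :* c)):- con 2 :*((a :* c):*(b :* d)))refl ⟨ ν x ⟩ ⟨ ν y ⟩(w x)(w y))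
     (pos-sq(self-+(self-*(self-⟨⟩(ν x))(sw y))(self-neg(self-*(self-⟨⟩(ν y))(sw x))))))))
   where
   A B : I -> I -> Carrier
   A x y = ⟨ 2 ⟩ *((⟨ ν x ⟩ * w x)*(⟨ ν y ⟩ * w y))
   B x y =(⟨ ν x ⟩ * ⟨ ν x ⟩)*(w y * w y)+(⟨ ν y ⟩ * ⟨ ν y ⟩)*(w x * w x)
   F = \x -> ⟨ ν x ⟩ * w x
   P = Ʃ xs(\x -> ⟨ ν x ⟩ * ⟨ ν x ⟩)
   W = Ʃ xs(\x -> w x * w x)
   left : Ʃ xs(\x -> Ʃ xs(A x))≈ ⟨ 2 ⟩ *(Ʃ xs F * Ʃ xs F)
   left = trans(Ʃ-cong xs(\x -> Ʃ-*ˡ xs ⟨ 2 ⟩ _))(trans(Ʃ-*ˡ xs ⟨ 2 ⟩ _)(*-congˡ(sym(Ʃ-*Ʃ xs xs F F))))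
   right : Ʃ xs(\x -> Ʃ xs(B x))≈ ⟨ 2 ⟩ *(P * W)
   right = begin
    _ ≈⟨ Ʃ-cong xs(\x -> Ʃ-+ xs _ _)⟩
    _ ≈⟨ Ʃ-+ xs _ _ ⟩
    _ ≈⟨ +-cong(sym(Ʃ-*Ʃ xs xs _ _))(trans(Ʃ-swap xs xs _)(sym(Ʃ-*Ʃ xs xs _ _)))⟩
    _ ≈⟨ solve 2(\p w -> p :* w :+ p :* w := con 2 :*(p :* w))refl P W ⟩
    _ ∎

  cubic : ∀ a b{l}-> Pos l -> ⟨ a ⟩ * ⟨ a ⟩ * ⟨ b ⟩ * l ≲ ⟨ a ⟩ * ⟨ a ⟩ * ⟨ a ⟩ + ⟨ b ⟩ * ⟨ b ⟩ * ⟨ b ⟩ *(l * l * l)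
  cubic a b{l}p = by(resp
   (solve 3(\a b l ->(l :* b :+ a):*((l :* b :- a):*(l :* b :- a)):+ a :* b :* b :*(l :* l):=
     (a :* a :* a :+ b :* b :* b :*(l :* l :* l)):- a :* a :* b :* l)refl ⟨ a ⟩ ⟨ b ⟩ l)
   (add(pos-*(add(pos-* p(pos-⟨⟩ b))(pos-⟨⟩ a))(pos-sq(self-+(self-*(pos-self p)(self-⟨⟩ b))(self-neg(self-⟨⟩ a)))))
      (pos-*(pos-*(pos-*(pos-⟨⟩ a)(pos-⟨⟩ b))(pos-⟨⟩ b))(pos-* p p))))

module Field where
 open import Algebra.Structures using (IsCommutativeRing)
 open import Algebra.Core using (Op₁; Op₂)
 open import Data.Bool using (if_then_else_)
 open import Data.List using (foldr)
 open import Data.List.Membership.Propositional using (_∉_; lose; find)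
 open import Data.List.Membership.Propositional.Properties using (∈-∃++; ∈-++⁺ˡ; ∈-++⁺ʳ; ∈-++⁻; ∈-filter⁺; ∈-cartesianProduct⁺)
 open import Data.List.Relation.Unary.Any using (any?)
 open import Data.List.Relation.Unary.All using (all?)
 open import Data.List.Relation.Unary.All.Properties using (¬All⇒Any¬)
 open import Data.List.Relation.Binary.Permutation.Propositional using (↭-sym; ↭-refl; ↭-trans; prep)
 open import Data.List.Relation.Binary.Permutation.Propositional.Properties using (shift; ↭-length; All-resp-↭)
 open import Data.Product.Properties using (≡-dec)
 open import Data.Empty using (⊥; ⊥-elim)
 open import Relation.Binary.Definitions using (DecidableEquality)
 open E
 open Alg

 unique-↭ :{A : Set}{xs ys : List A}-> Unique xs -> Unique ys ->
       (∀{x}-> x ∈ xs -> x ∈ ys)->(∀{x}-> x ∈ ys -> x ∈ xs)-> xs ↭ ys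
 unique-↭{xs = []}{[]}_ _ _ _ = ↭-refl
 unique-↭{xs = []}{y ∷ ys}_ _ _ g with ()← g(here refl)
 unique-↭{xs = x ∷ xs}(x∉ ∷ uxs)uys f g with ∈-∃++(f(here refl))
 ... | as , bs , refl = ↭-trans(prep x(unique-↭ uxs(uniq as uys)f' g'))(↭-sym(shift x as bs))
  where
  uniq : ∀ as -> Unique(as ++ x ∷ bs)-> Unique(as ++ bs)
  uniq [](_ ∷ u)= u
  uniq(a ∷ as)(a∉ ∷ u)= drop as a∉ ∷ uniq as u
   where
   drop : ∀{P : _ -> Set}as -> All P(as ++ x ∷ bs)-> All P(as ++ bs)
   drop [](_ ∷ p)= p
   drop(a ∷ as)(q ∷ p)= q ∷ drop as p
  x∉as++bs : ∀ as -> Unique(as ++ x ∷ bs)-> x ∉ as ++ bs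
  x∉as++bs [](p ∷ _)q = All.lookup p q refl
  x∉as++bs(a ∷ as)(p ∷ _)(here refl)= All.lookup p(∈-++⁺ʳ as(here refl))refl
  x∉as++bs(a ∷ as)(_ ∷ u)(there q)= x∉as++bs as u q
  f' : ∀{y}-> y ∈ xs -> y ∈ as ++ bs
  f'{y}p with ∈-++⁻ as(f(there p))
  ... | inj₁ q = ∈-++⁺ˡ q
  ... | inj₂(here refl)= contradiction refl(All.lookup x∉ p)
  ... | inj₂(there q)= ∈-++⁺ʳ as q
  g' : ∀{y}-> y ∈ as ++ bs -> y ∈ xs
  g'{y}p with g([ ∈-++⁺ˡ , ∈-++⁺ʳ as ∘ there ]′(∈-++⁻ as p))
  ... | here refl = contradiction p(x∉as++bs as uys)
  ... | there q = q

 record FiniteField : Set₁ where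
  infixl 7 _*_
  infixl 6 _+_
  infix 8 -_
  infix 9 _⁻¹
  field
   Carrier : Set
   _+_ _*_ : Op₂ Carrier
   -_ : Op₁ Carrier
   0# 1# : Carrier
   isCommutativeRing : IsCommutativeRing _≡_ _+_ _*_ -_ 0# 1#
   _⁻¹ : Op₁ Carrier
   inverseʳ : ∀{x}-> x ≢ 0# -> x * x ⁻¹ ≡ 1#
   0⁻¹ : 0# ⁻¹ ≡ 0#
   1≢0 : 1# ≢ 0#
   _≟_ : DecidableEquality Carrier
   elems : List Carrier
   complete : ∀ x -> x ∈ elems
   unique : Unique elems

 module FieldKit (F : FiniteField) where
  open FiniteField F public
  ring : CommutativeRing 0ℓ 0ℓ
  ring = record{isCommutativeRing = isCommutativeRing}
  open CommutativeRing ring public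
   using(+-assoc; +-comm; +-identityˡ; +-identityʳ; *-assoc; *-comm; *-identityˡ; *-identityʳ; zeroˡ; zeroʳ; distribˡ; distribʳ; -‿inverseʳ; -‿inverseˡ; _-_; commutativeSemiring; semiring; *-isCommutativeMonoid)
  module K = RingKit ring
  open K public using (solve; _:=_; _:+_; _:*_; :-_; _:-_; con)
  open import Algebra.Properties.Semiring.Exp semiring public using (_^_; ^-homo-*; ^-assocʳ)
  open import Algebra.Properties.CommutativeSemiring.Exp commutativeSemiring public using (^-distrib-*)

  size : ℕ
  size = length elems

  *-nonzero : ∀{x y}-> x ≢ 0# -> y ≢ 0# -> x * y ≢ 0#
  *-nonzero{x}{y}p q e = q(begin
   y ≡⟨ sym(*-identityˡ y)⟩
   1# * y ≡⟨ cong(_* y)(sym(inverseʳ p))⟩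
   _ ≡⟨ solve 3(\x i y -> x :* i :* y := i :*(x :* y))refl x(x ⁻¹)y ⟩
   _ ≡⟨ cong(x ⁻¹ *_)e ⟩
   _ ≡⟨ zeroʳ _ ⟩
   0# ∎)where open ≡-Reasoning

  *-zero : ∀{x y}-> x * y ≡ 0# -> x ≡ 0# ⊎ y ≡ 0#
  *-zero{x}{y}e with x ≟ 0# | y ≟ 0#
  ... | yes p | _ = inj₁ p
  ... | no _ | yes q = inj₂ q
  ... | no p | no q = contradiction e(*-nonzero p q)

  ⁻¹-nonzero : ∀{x}-> x ≢ 0# -> x ⁻¹ ≢ 0#
  ⁻¹-nonzero{x}p e = 1≢0(trans(sym(inverseʳ p))(trans(cong(x *_)e)(zeroʳ x)))

  inverseˡ : ∀{x}-> x ≢ 0# -> x ⁻¹ * x ≡ 1#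
  inverseˡ p = trans(*-comm _ _)(inverseʳ p)

  *-cancelˡ : ∀{x y z}-> x ≢ 0# -> x * y ≡ x * z -> y ≡ z
  *-cancelˡ{x}{y}{z}p e = trans(lemma y)(trans(cong(x ⁻¹ *_)e)(sym(lemma z)))
   where
   lemma : ∀ w -> w ≡ x ⁻¹ *(x * w)
   lemma w = trans(sym(*-identityˡ w))(trans(cong(_* w)(sym(inverseˡ p)))(*-assoc _ _ _))

  ⁻¹-involutive : ∀ x -> x ⁻¹ ⁻¹ ≡ x
  ⁻¹-involutive x with x ≟ 0#
  ... | yes refl = trans(cong _⁻¹ 0⁻¹)0⁻¹
  ... | no p = *-cancelˡ(⁻¹-nonzero p)(trans(inverseʳ(⁻¹-nonzero p))(sym(inverseˡ p)))

  ⁻¹-* : ∀ x y ->(x * y)⁻¹ ≡ x ⁻¹ * y ⁻¹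
  ⁻¹-* x y with x ≟ 0# | y ≟ 0#
  ... | yes refl | _ = trans(cong _⁻¹(zeroˡ y))(trans 0⁻¹(trans(sym(zeroˡ _))(cong(_* y ⁻¹)(sym 0⁻¹))))
  ... | no _ | yes refl = trans(cong _⁻¹(zeroʳ x))(trans 0⁻¹(trans(sym(zeroʳ _))(cong(x ⁻¹ *_)(sym 0⁻¹))))
  ... | no p | no q = *-cancelˡ(*-nonzero p q)(trans(inverseʳ(*-nonzero p q))(sym(begin
   _ ≡⟨ solve 4(\x y i j -> x :* y :*(i :* j):=(x :* i):*(y :* j))refl x y(x ⁻¹)(y ⁻¹)⟩
   _ ≡⟨ cong₂ _*_(inverseʳ p)(inverseʳ q)⟩
   1# * 1# ≡⟨ *-identityˡ 1# ⟩
   1# ∎)))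
   where open ≡-Reasoning

  x-y≡0⇒x≡y : ∀{x y}-> x - y ≡ 0# -> x ≡ y
  x-y≡0⇒x≡y{x}{y}p = trans(solve 2(\x y -> x :=(x :- y):+ y)refl x y)(trans(cong(_+ y)p)(+-identityˡ y))

  x≢y⇒x-y≢0 : ∀{x y}-> x ≢ y -> x - y ≢ 0#
  x≢y⇒x-y≢0 p e = p(x-y≡0⇒x≡y e)

  record Bijection : Set where
   field
    to from : Carrier -> Carrier
    to∘from : ∀ x -> to(from x)≡ x
    from∘to : ∀ x -> from(to x)≡ x

   map-↭ : map to elems ↭ elems
   map-↭ = unique-↭(Unique.map⁺ inj unique)unique(\_ -> complete _)
        (\{x}_ -> subst(_∈ map to elems)(to∘from x)(∈-map⁺ to(complete(from x))))
    where
    inj : ∀{x y}-> to x ≡ to y -> x ≡ y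
    inj{x}{y}e = trans(sym(from∘to x))(trans(cong from e)(from∘to y))
  open Bijection public

  module Reindex (S : CommutativeRing 0ℓ 0ℓ) where
   open CommutativeRing S using (_≈_) renaming (Carrier to C; sym to ≈-sym; trans to ≈-trans)
   open RingKit S using (Ʃ; Ʃ-map; Ʃ-↭)
   Ʃ-reindex :(σ : Bijection)(f : Carrier -> C)-> Ʃ elems(\x -> f(to σ x))≈ Ʃ elems f
   Ʃ-reindex σ f = ≈-trans(≈-sym(Ʃ-map(to σ)elems f))(Ʃ-↭(map-↭ σ)f)

  shift-bij : Carrier -> Bijection
  shift-bij a = record
   {to = \x -> x + a ; from = \x -> x - a
   ; to∘from = \x -> solve 2(\x a -> x :- a :+ a := x)refl x a
   ; from∘to = \x -> solve 2(\x a -> x :+ a :- a := x)refl x a}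

  scale-bij : ∀ a -> a ≢ 0# -> Bijection
  scale-bij a a≢0 = record
   {to = \x -> a * x ; from = \x -> a ⁻¹ * x
   ; to∘from = \x -> trans(sym(*-assoc _ _ _))(trans(cong(_* x)(inverseʳ a≢0))(*-identityˡ x))
   ; from∘to = \x -> trans(sym(*-assoc _ _ _))(trans(cong(_* x)(inverseˡ a≢0))(*-identityˡ x))}

  inv-bij : Bijection
  inv-bij = record{to = _⁻¹ ; from = _⁻¹ ; to∘from = ⁻¹-involutive ; from∘to = ⁻¹-involutive}

  reflect-bij : Carrier -> Bijection
  reflect-bij a = record{to = \x -> a - x ; from = \x -> a - x ; to∘from = inv ; from∘to = inv}
   where
   inv : ∀ x -> a -(a - x)≡ x
   inv x = solve 2(\a x -> a :-(a :- x):= x)refl a x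

  nz : List Carrier
  nz = filter(\x -> ¬?(x ≟ 0#))elems

  ∈-nz⁻ : ∀{x}-> x ∈ nz -> x ≢ 0#
  ∈-nz⁻ p = proj₂(∈-filter⁻(\x -> ¬?(x ≟ 0#)){xs = elems}p)

  ∈-nz⁺ : ∀{x}-> x ≢ 0# -> x ∈ nz
  ∈-nz⁺{x}p = ∈-filter⁺(\x -> ¬?(x ≟ 0#))(complete x)p

  nz-unique : Unique nz
  nz-unique = Unique.filter⁺(\x -> ¬?(x ≟ 0#))unique

  elems-↭ : elems ↭ 0# ∷ nz
  elems-↭ = unique-↭ unique(All.tabulate(\p e -> ∈-nz⁻ p(sym e))∷ nz-unique)f(\_ -> complete _)
   where
   f : ∀{x}-> x ∈ elems -> x ∈ 0# ∷ nz
   f{x}_ with x ≟ 0#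
   ... | yes p = here p
   ... | no p = there(∈-nz⁺ p)

  size-nz : size ≡ suc(length nz)
  size-nz = ↭-length elems-↭

  private
   ∏ : List Carrier -> Carrier
   ∏ = foldr _*_ 1#

   ∏-↭ : ∀{xs ys}-> xs ↭ ys -> ∏ xs ≡ ∏ ys
   ∏-↭(_↭_.refl)= refl
   ∏-↭(_↭_.prep x p)= cong(x *_)(∏-↭ p)
   ∏-↭(_↭_.swap{xs}{ys}x y p)= trans(cong(\z -> x *(y * z))(∏-↭ p))
    (solve 3(\x y z -> x :*(y :* z):= y :*(x :* z))refl x y(∏ ys))
   ∏-↭(_↭_.trans p p')= trans(∏-↭ p)(∏-↭ p')

   ∏-scale : ∀ a xs -> ∏(map(a *_)xs)≡ a ^ length xs * ∏ xs
   ∏-scale a [] = sym(*-identityˡ 1#)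
   ∏-scale a(x ∷ xs)= trans(cong(a * x *_)(∏-scale a xs))
    (solve 4(\a x y z -> a :* x :*(y :* z):=(a :* y):*(x :* z))refl a x(a ^ length xs)(∏ xs))

   ∏-nonzero : ∀ xs ->(∀{x}-> x ∈ xs -> x ≢ 0#)-> ∏ xs ≢ 0#
   ∏-nonzero [] h = 1≢0
   ∏-nonzero(x ∷ xs)h = *-nonzero(h(here refl))(∏-nonzero xs(h ∘ there))

  fermat : ∀{x}-> x ≢ 0# -> x ^ length nz ≡ 1#
  fermat{x}p = *-cancelˡ(∏-nonzero nz ∈-nz⁻)(begin
   _ ≡⟨ *-comm _ _ ⟩
   _ ≡⟨ sym(∏-scale x nz)⟩
   _ ≡⟨ ∏-↭(unique-↭(Unique.map⁺(*-cancelˡ p)nz-unique)nz-unique f g)⟩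
   ∏ nz ≡⟨ sym(*-identityʳ _)⟩
   _ ∎)
   where
   open ≡-Reasoning
   f : ∀{y}-> y ∈ map(x *_)nz -> y ∈ nz
   f q with ∈-map⁻(x *_)q
   ... | z , z∈ , refl = ∈-nz⁺(*-nonzero p(∈-nz⁻ z∈))
   g : ∀{y}-> y ∈ nz -> y ∈ map(x *_)nz
   g{y}q = subst(_∈ map(x *_)nz)(to∘from(scale-bij x p)y)
         (∈-map⁺(x *_)(∈-nz⁺(*-nonzero(⁻¹-nonzero p)(∈-nz⁻ q))))

  fermat' : ∀ x -> x ^ size ≡ x
  fermat' x with x ≟ 0#
  ... | yes refl = trans(cong(0# ^_)size-nz)(zeroˡ _)
  ... | no p = trans(cong(x ^_)size-nz)(trans(cong(x *_)(fermat p))(*-identityʳ x))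

  δ : Carrier -> Carrier -> ℕ
  δ x y = if does(x ≟ y)then 1 else 0

  δ-≡ : ∀{x y}-> x ≡ y -> δ x y ≡ 1
  δ-≡{x}{y}p with x ≟ y
  ... | yes _ = refl
  ... | no q = contradiction p q

  δ-≢ : ∀{x y}-> x ≢ y -> δ x y ≡ 0
  δ-≢{x}{y}p with x ≟ y
  ... | yes q = contradiction q p
  ... | no _ = refl

  module _ (S : CommutativeRing 0ℓ 0ℓ) where
   private
    module S = CommutativeRing S
    module T = RingKit S
   Ʃ-δ : ∀ y(f : Carrier -> S.Carrier)-> T.Ʃ elems(\x -> T.⟨ δ x y ⟩ S.* f x)S.≈ f y
   Ʃ-δ y f = go elems unique(complete y)
    where
    none : ∀ xs -> All(y ≢_)xs -> T.Ʃ xs(\x -> T.⟨ δ x y ⟩ S.* f x)S.≈ S.0#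
    none xs h = T.Ʃ-≈0 xs \{x}p -> S.trans(S.*-congʳ(S.reflexive(cong T.⟨_⟩(δ-≢(\e -> All.lookup h p(sym e))))))(S.zeroˡ _)
    go : ∀ xs -> Unique xs -> y ∈ xs -> T.Ʃ xs(\x -> T.⟨ δ x y ⟩ S.* f x)S.≈ f y
    go(x ∷ xs)(x∉ ∷ u)(here refl)= S.trans(S.+-cong
     (S.trans(S.*-congʳ(S.trans(S.reflexive(cong T.⟨_⟩(δ-≡{y}refl)))T.⟨1⟩))(S.*-identityˡ _))(none xs x∉))(S.+-identityʳ _)
    go(x ∷ xs)(x∉ ∷ u)(there p)= S.trans(S.+-cong
     (S.trans(S.*-congʳ(S.reflexive(cong T.⟨_⟩(δ-≢(All.lookup x∉ p)))))(S.zeroˡ _))(go xs u p))(S.+-identityˡ _)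

  private module ΣN = Sums +-*-commutativeSemiring

  Ʃ-δℕ : ∀ y -> ΣN.Ʃ elems(\x -> δ x y)≡ 1
  Ʃ-δℕ y = go elems unique(complete y)
   where
   none : ∀ xs -> All(y ≢_)xs -> ΣN.Ʃ xs(\x -> δ x y)≡ 0
   none xs h = ΣN.Ʃ-≈0 xs \{x}p -> δ-≢(\e -> All.lookup h p(sym e))
   go : ∀ xs -> Unique xs -> y ∈ xs -> ΣN.Ʃ xs(\x -> δ x y)≡ 1
   go(x ∷ xs)(x∉ ∷ u)(here refl)= cong₂ N._+_(δ-≡{y}refl)(none xs x∉)
   go(x ∷ xs)(x∉ ∷ u)(there p)= cong₂ N._+_(δ-≢(All.lookup x∉ p))(go xs u p)

module Quad where
 open import Data.List.Membership.Propositional using (find)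
 open import Data.List.Membership.Propositional.Properties using (∈-cartesianProduct⁺)
 open import Data.List.Relation.Unary.Any using (any?)
 open import Data.List.Relation.Unary.All.Properties using (¬Any⇒All¬; ¬All⇒Any¬)
 open import Data.Product.Properties using (≡-dec)
 open E
 open Alg
 open Field

 private module ΣN = NatSums

 module OddField (F : FiniteField) where
  open FieldKit F

  Odd : Set
  Odd = 1# ≢ - 1#

  Square : Carrier -> Set
  Square s = ∃ \r -> r * r ≡ s

  square? : ∀ s -> Dec(Square s)
  square? s with any?(\r ->(r * r)≟ s)elems
  ... | yes p = let r , _ , e = find p in yes(r , e)
  ... | no ¬p = no \(r , e)-> All.lookup(¬Any⇒All¬ elems ¬p)(complete r)e

  roots-± : ∀{r s}-> r * r ≡ s * s -> r ≡ s ⊎ r ≡ - s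
  roots-±{r}{s}e with *-zero{r - s}{r + s}(trans
    (solve 2(\r s ->(r :- s):*(r :+ s):= r :* r :- s :* s)refl r s)(trans(cong(_- s * s)e)(-‿inverseʳ _)))
  ... | inj₁ p = inj₁(x-y≡0⇒x≡y p)
  ... | inj₂ p = inj₂(x-y≡0⇒x≡y(trans(solve 2(\r s -> r :-(:- s):= r :+ s)refl r s)p))

  module Nonsquare (odd : Odd) where
   2≢0 : 1# + 1# ≢ 0#
   2≢0 e = odd(x-y≡0⇒x≡y(trans(solve 1(\a -> a :-(:- a):= a :+ a)refl 1#)e))

   nonsquare : ∃ \s -> ¬ Square s
   nonsquare with All.all? square? elems
   ... | no ¬p = let s , _ , h = find(¬All⇒Any¬ square? elems ¬p)in s , h
   ... | yes p = contradiction(subst(2 N.≤_)n≡1 n≥2)\{(s≤s ())}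
    where
    n : Carrier -> ℕ
    n s = ΣN.Ʃ elems(\r -> δ(r * r)s)
    total : ΣN.Ʃ elems n ≡ size
    total = trans(ΣN.Ʃ-swap elems elems(\s r -> δ(r * r)s))
     (trans(ΣN.Ʃ-cong elems \r -> trans(ΣN.Ʃ-cong elems(\s -> flip(r * r)s))(Ʃ-δℕ(r * r)))(trans(ΣN.Ʃ-const elems 1)(N.*-identityʳ size)))
     where
     flip : ∀ x y -> δ x y ≡ δ y x
     flip x y with x ≟ y
     ... | yes refl = sym(δ-≡{x}refl)
     ... | no q = sym(δ-≢(q ∘ sym))
    1≤n : ∀ s -> 1 ≤ n s
    1≤n s = let r , e = All.lookup p(complete s)in
     subst(N._≤ n s)(δ-≡ e)(ΣN.∈⇒≤Ʃ(\r -> δ(r * r)s)(complete r))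
    n≡1 : n 1# ≡ 1
    n≡1 = sym(ΣN.Ʃ-squeeze elems 1≤n(≡⇒≤(trans total(sym(trans(ΣN.Ʃ-const elems 1)(N.*-identityʳ size)))))(complete 1#))
    pick : Carrier -> ℕ
    pick r = δ r 1# N.+ δ r(- 1#)
    pick≤ : ∀ r -> pick r ≤ δ(r * r)1#
    pick≤ r with r ≟ 1# | r ≟(- 1#)
    ... | yes refl | yes e = contradiction e odd
    ... | yes refl | no _ = ≡⇒≤(sym(δ-≡(*-identityˡ 1#)))
    ... | no _ | yes refl = ≡⇒≤(sym(δ-≡(trans(solve 1(\a ->(:- a):*(:- a):= a :* a)refl 1#)(*-identityˡ 1#))))
    ... | no _ | no _ = z≤n
    n≥2 : 2 ≤ n 1#
    n≥2 = subst(N._≤ n 1#)(trans(ΣN.Ʃ-+ elems _ _)(cong₂ N._+_(Ʃ-δℕ 1#)(Ʃ-δℕ(- 1#))))(ΣN.Ʃ-mono-≤ elems{pick}\{r}_ -> pick≤ r)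

  module Squares (δ₀ : Carrier) (ns : ¬ Square δ₀) where

   δ₀≢0 : δ₀ ≢ 0#
   δ₀≢0 e = ns(0# , trans(zeroˡ 0#)(sym e))

   private
    n m : Carrier -> ℕ
    n s = ΣN.Ʃ elems(\r -> δ(r * r)s)
    m s = ΣN.Ʃ elems(\r -> δ(δ₀ *(r * r))s)

    bound : ∀{f : Carrier -> ℕ}a b ->(∀ r -> f r ≤ δ r a N.+ δ r b)-> ΣN.Ʃ elems f ≤ 2
    bound a b h = subst(ΣN.Ʃ elems _ N.≤_)(trans(ΣN.Ʃ-+ elems _ _)(cong₂ N._+_(Ʃ-δℕ a)(Ʃ-δℕ b)))(ΣN.Ʃ-mono-≤ elems \{r}_ -> h r)

    δ-≤± : ∀{x s}c -> c ≢ 0# -> ∀ r -> c *(x * x)≡ s -> δ(c *(r * r))s ≤ δ r x N.+ δ r(- x)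
    δ-≤±{x}{s}c c≢0 r e with(c *(r * r))≟ s
    ... | no _ = z≤n
    ... | yes e' with roots-±(*-cancelˡ c≢0(trans e'(sym e)))
    ... | inj₁ refl = ≤-trans(≡⇒≤(sym(δ-≡{r}refl)))(m≤m+n _ _)
    ... | inj₂ refl = ≤-trans(≡⇒≤(sym(δ-≡{ - x}refl)))(m≤n+m _(δ(- x)x))

    vanish : ∀{f : Carrier -> ℕ}->(∀ r -> f r ≡ 0)-> ΣN.Ʃ elems f ≡ 0
    vanish h = ΣN.Ʃ-≈0 elems(\{r}_ -> h r)

    n+m≤2 : ∀ s -> n s N.+ m s ≤ 2
    n+m≤2 s with square? s
    ... | no ¬sq with any?(\r ->(δ₀ *(r * r))≟ s)elems
    ... | yes p = let x , _ , e = find p in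
        subst(N._≤ 2)(sym(cong(N._+ m s)(vanish \r -> δ-≢(\e -> ¬sq(r , e)))))(bound x(- x)(\r -> δ-≤± δ₀ δ₀≢0 r e))
    ... | no ¬p = subst(N._≤ 2)(sym(cong₂ N._+_(vanish \r -> δ-≢(\e -> ¬sq(r , e)))
             (vanish \r -> δ-≢(All.lookup(¬Any⇒All¬ elems ¬p)(complete r)))))z≤n
    n+m≤2 s | yes(x , e)with s ≟ 0#
    ... | yes refl = +-mono-≤(lemma(\r -> r * r)(\r e -> [r]² r e))(lemma(\r -> δ₀ *(r * r))(\r e -> [r]² r(help r e)))
     where
     [r]² : ∀ r -> r * r ≡ 0# -> r ≡ 0#
     [r]² r e with *-zero e
     ... | inj₁ p = p
     ... | inj₂ p = p
     help : ∀ r -> δ₀ *(r * r)≡ 0# -> r * r ≡ 0#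
     help r e with *-zero e
     ... | inj₁ p = contradiction p δ₀≢0
     ... | inj₂ p = p
     lemma : ∀(f : Carrier -> Carrier)->(∀ r -> f r ≡ 0# -> r ≡ 0#)-> ΣN.Ʃ elems(\r -> δ(f r)0#)≤ 1
     lemma f h = subst(ΣN.Ʃ elems(\r -> δ(f r)0#)N.≤_)(Ʃ-δℕ 0#)(ΣN.Ʃ-mono-≤ elems{\r -> δ(f r)0#}\{r}_ -> pt r)
      where
      pt : ∀ r -> δ(f r)0# ≤ δ r 0#
      pt r with f r ≟ 0#
      ... | no _ = z≤n
      ... | yes p = ≡⇒≤(sym(δ-≡(h r p)))
    ... | no s≢0 = subst(N._≤ 2)(sym(trans(cong(n s N.+_)(vanish \r -> δ-≢(nope r)))(N.+-identityʳ _)))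
         (bound x(- x)\r -> subst(\z -> δ z s ≤ δ r x N.+ δ r(- x))(*-identityˡ _)(δ-≤± 1# 1≢0 r(trans(*-identityˡ _)e)))
     where
     nope : ∀ r -> δ₀ *(r * r)≢ s
     nope r e' = ns(x * r ⁻¹ ,(begin
      _ ≡⟨ solve 2(\x i -> x :* i :*(x :* i):=(x :* x):*(i :* i))refl x(r ⁻¹)⟩
      _ ≡⟨ cong(_*(r ⁻¹ * r ⁻¹))(trans e(sym e'))⟩
      _ ≡⟨ solve 3(\d r i -> d :*(r :* r):*(i :* i):= d :*((r :* i):*(r :* i)))refl δ₀ r(r ⁻¹)⟩
      _ ≡⟨ cong(\z -> δ₀ *(z * z))(inverseʳ r≢0)⟩
      _ ≡⟨ trans(cong(δ₀ *_)(*-identityˡ 1#))(*-identityʳ δ₀)⟩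
      δ₀ ∎))
      where
      open ≡-Reasoning
      r≢0 : r ≢ 0#
      r≢0 refl = s≢0(trans(sym e')(trans(cong(δ₀ *_)(zeroˡ 0#))(zeroʳ δ₀)))

    flip : ∀ x y -> δ x y ≡ δ y x
    flip x y with x ≟ y
    ... | yes refl = sym(δ-≡{x}refl)
    ... | no q = sym(δ-≢(q ∘ sym))

    total :(g : Carrier -> Carrier)-> ΣN.Ʃ elems(\s -> ΣN.Ʃ elems(\r -> δ(g r)s))≡ size
    total g = trans(ΣN.Ʃ-swap elems elems(\s r -> δ(g r)s))
     (trans(ΣN.Ʃ-cong elems \r -> trans(ΣN.Ʃ-cong elems(\s -> flip(g r)s))(Ʃ-δℕ(g r)))(trans(ΣN.Ʃ-const elems 1)(N.*-identityʳ size)))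

    n+m≡2 : ∀ s -> n s N.+ m s ≡ 2
    n+m≡2 s = ΣN.Ʃ-squeeze elems n+m≤2(≡⇒≤(trans(ΣN.Ʃ-const elems 2)
     (trans(trans(*-suc size 1)(cong(size N.+_)(N.*-identityʳ size)))(sym(trans(ΣN.Ʃ-+ elems n m)(cong₂ N._+_(total _)(total _)))))))(complete s)

   nonsquare-form : ∀ s -> ¬ Square s -> ∃ \r -> δ₀ *(r * r)≡ s
   nonsquare-form s ¬sq with any?(\r ->(δ₀ *(r * r))≟ s)elems
   ... | yes p = let r , _ , e = find p in r , e
   ... | no ¬p = contradiction(trans(sym(n+m≡2 s))(cong₂ N._+_(vanish \r -> δ-≢(\e -> ¬sq(r , e)))
           (vanish \r -> δ-≢(All.lookup(¬Any⇒All¬ elems ¬p)(complete r)))))\ ()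

   module _ (S : CommutativeRing 0ℓ 0ℓ) where
    private
     module S = CommutativeRing S
     module T = RingKit S
    open import Relation.Binary.Reasoning.Setoid S.setoid

    private
     push :(g : Carrier -> Carrier)(φ : Carrier -> S.Carrier)->
         T.Ʃ elems(\r -> φ(g r))S.≈ T.Ʃ elems(\s -> T.⟨ ΣN.Ʃ elems(\r -> δ(g r)s)⟩ S.* φ s)
     push g φ = begin
      T.Ʃ elems(\r -> φ(g r))
       ≈⟨ T.Ʃ-cong elems(\r -> S.sym(Ʃ-δ S(g r)φ))⟩
      T.Ʃ elems(\r -> T.Ʃ elems(\s -> T.⟨ δ s(g r)⟩ S.* φ s))
       ≈⟨ T.Ʃ-swap elems elems _ ⟩
      T.Ʃ elems(\s -> T.Ʃ elems(\r -> T.⟨ δ s(g r)⟩ S.* φ s))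
       ≈⟨ T.Ʃ-cong elems(\s -> S.trans(T.Ʃ-*ʳ elems(φ s)_)(S.*-congʳ(S.trans(T.Ʃ-⟨⟩ elems _)
          (S.reflexive(cong T.⟨_⟩(ΣN.Ʃ-cong elems(\r -> flip s(g r))))))))⟩
      T.Ʃ elems(\s -> T.⟨ ΣN.Ʃ elems(\r -> δ(g r)s)⟩ S.* φ s)∎

    Ʃ-squares :(φ : Carrier -> S.Carrier)->
     T.Ʃ elems(\r -> φ(r * r))S.+ T.Ʃ elems(\r -> φ(δ₀ *(r * r)))S.≈ T.⟨ 2 ⟩ S.* T.Ʃ elems φ
    Ʃ-squares φ = begin
     T.Ʃ elems(\r -> φ(r * r))S.+ T.Ʃ elems(\r -> φ(δ₀ *(r * r)))
      ≈⟨ S.+-cong(push _ φ)(push _ φ)⟩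
     T.Ʃ elems(\s -> T.⟨ n s ⟩ S.* φ s)S.+ T.Ʃ elems(\s -> T.⟨ m s ⟩ S.* φ s)
      ≈⟨ S.sym(T.Ʃ-+ elems _ _)⟩
     T.Ʃ elems(\s -> T.⟨ n s ⟩ S.* φ s S.+ T.⟨ m s ⟩ S.* φ s)
      ≈⟨ T.Ʃ-cong elems(\s -> S.trans(S.sym(S.distribʳ _ _ _))(S.*-congʳ(S.trans(S.sym(T.⟨⟩-+(n s)(m s)))(S.reflexive(cong T.⟨_⟩(n+m≡2 s))))))⟩
     T.Ʃ elems(\s -> T.⟨ 2 ⟩ S.* φ s)
      ≈⟨ T.Ʃ-*ˡ elems _ φ ⟩
     T.⟨ 2 ⟩ S.* T.Ʃ elems φ ∎

   open FiniteField using () renaming (Carrier to C)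

   -- F(√δ₀), with (x , y) standing for x + y √δ₀
   private
    _⊕_ _⊗_ : Carrier × Carrier -> Carrier × Carrier -> Carrier × Carrier
    (a , b)⊕(c , d)= a + c , b + d
    (a , b)⊗(c , d)= a * c + δ₀ *(b * d), a * d + b * c
    ⊖_ : Carrier × Carrier -> Carrier × Carrier
    ⊖(a , b)= - a , - b

   norm : Carrier × Carrier -> Carrier
   norm(a , b)= a * a - δ₀ *(b * b)

   norm≡0 : ∀ z -> norm z ≡ 0# -> z ≡(0# , 0#)
   norm≡0(a , b)e with b ≟ 0#
   ... | yes refl = cong(_, 0#)(a≡0(*-zero(trans(solve 2(\a d -> a :* a := a :* a :- d :*(con 0 :* con 0))refl a δ₀)e)))
    where
    a≡0 : a ≡ 0# ⊎ a ≡ 0# -> a ≡ 0#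
    a≡0(inj₁ p)= p
    a≡0(inj₂ p)= p
   ... | no b≢0 = contradiction(a * b ⁻¹ ,(begin
    _ ≡⟨ solve 2(\x i -> x :* i :*(x :* i):=(x :* x):*(i :* i))refl a(b ⁻¹)⟩
    _ ≡⟨ cong(_*(b ⁻¹ * b ⁻¹))(x-y≡0⇒x≡y e)⟩
    _ ≡⟨ solve 3(\d r i -> d :*(r :* r):*(i :* i):= d :*((r :* i):*(r :* i)))refl δ₀ b(b ⁻¹)⟩
    _ ≡⟨ cong(\z -> δ₀ *(z * z))(inverseʳ b≢0)⟩
    _ ≡⟨ trans(cong(δ₀ *_)(*-identityˡ 1#))(*-identityʳ δ₀)⟩
    δ₀ ∎))ns
    where open ≡-Reasoning

   norm-* : ∀ z w -> norm(z ⊗ w)≡ norm z * norm w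
   norm-*(a , b)(c , d)= solve 5(\e a b c d ->
    (a :* c :+ e :*(b :* d)):*(a :* c :+ e :*(b :* d)):- e :*((a :* d :+ b :* c):*(a :* d :+ b :* c)):=
    (a :* a :- e :*(b :* b)):*(c :* c :- e :*(d :* d)))refl δ₀ a b c d

   quadratic : FiniteField
   quadratic = record
    {Carrier = Carrier × Carrier
    ; _+_ = _⊕_ ; _*_ = _⊗_ ; -_ = ⊖_ ; 0# = 0# , 0# ; 1# = 1# , 0#
    ; isCommutativeRing = record
     {isRing = record
      {+-isAbelianGroup = record
       {isGroup = record
        {isMonoid = record
         {isSemigroup = record
          {isMagma = record{isEquivalence = isEquivalence ; ∙-cong = cong₂ _⊕_}
          ; assoc = \(a , b)(c , d)(e , f)-> cong₂ _,_(+-assoc a c e)(+-assoc b d f)}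
         ; identity =(\(a , b)-> cong₂ _,_(+-identityˡ a)(+-identityˡ b)),(\(a , b)-> cong₂ _,_(+-identityʳ a)(+-identityʳ b))}
        ; inverse =(\(a , b)-> cong₂ _,_(-‿inverseˡ a)(-‿inverseˡ b)),(\(a , b)-> cong₂ _,_(-‿inverseʳ a)(-‿inverseʳ b))
        ; ⁻¹-cong = cong ⊖_}
       ; comm = \(a , b)(c , d)-> cong₂ _,_(+-comm a c)(+-comm b d)}
      ; *-cong = cong₂ _⊗_
      ; *-assoc = \(a , b)(c , d)(e , f)-> cong₂ _,_
        (solve 7(\t a b c d e f ->(a :* c :+ t :*(b :* d)):* e :+ t :*((a :* d :+ b :* c):* f):=
          a :*(c :* e :+ t :*(d :* f)):+ t :*(b :*(c :* f :+ d :* e)))refl δ₀ a b c d e f)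
        (solve 7(\t a b c d e f ->(a :* c :+ t :*(b :* d)):* f :+(a :* d :+ b :* c):* e :=
          a :*(c :* f :+ d :* e):+ b :*(c :* e :+ t :*(d :* f)))refl δ₀ a b c d e f)
      ; *-identity = idˡ ,(\z -> trans(comm z _)(idˡ z))
      ; distrib = dˡ ,(\x y z -> trans(comm _ x)(trans(dˡ x y z)(cong₂ _⊕_(comm x y)(comm x z))))}
     ; *-comm = comm}
    ; _⁻¹ = inv
    ; inverseʳ = \{z}-> invʳ z
    ; 0⁻¹ = cong₂ _,_(zeroˡ _)(trans(solve 1(\i ->(:- con 0):* i := con 0)refl(norm(0# , 0#)⁻¹))refl)
    ; 1≢0 = 1≢0 ∘ cong proj₁
    ; _≟_ = ≡-dec _≟_ _≟_
    ; elems = cartesianProduct elems elems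
    ; complete = \(a , b)-> ∈-cartesianProduct⁺(complete a)(complete b)
    ; unique = Unique.cartesianProduct⁺ unique unique}
    where
    comm : ∀ z w -> z ⊗ w ≡ w ⊗ z
    comm(a , b)(c , d)= cong₂ _,_(cong₂ _+_(*-comm a c)(cong(δ₀ *_)(*-comm b d)))
     (trans(+-comm _ _)(cong₂ _+_(*-comm b c)(*-comm a d)))
    idˡ : ∀ z ->(1# , 0#)⊗ z ≡ z
    idˡ(a , b)= cong₂ _,_
     (trans(cong₂ _+_(*-identityˡ a)(trans(cong(δ₀ *_)(zeroˡ b))(zeroʳ δ₀)))(+-identityʳ a))
     (trans(cong₂ _+_(*-identityˡ b)(zeroˡ a))(+-identityʳ b))
    dˡ : ∀ x y z -> x ⊗(y ⊕ z)≡(x ⊗ y)⊕(x ⊗ z)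
    dˡ(a , b)(c , d)(e , f)= cong₂ _,_
     (solve 7(\t a b c d e f -> a :*(c :+ e):+ t :*(b :*(d :+ f)):=(a :* c :+ t :*(b :* d)):+(a :* e :+ t :*(b :* f)))refl δ₀ a b c d e f)
     (solve 6(\a b c d e f -> a :*(d :+ f):+ b :*(c :+ e):=(a :* d :+ b :* c):+(a :* f :+ b :* e))refl a b c d e f)
    inv : Carrier × Carrier -> Carrier × Carrier
    inv(a , b)= a * norm(a , b)⁻¹ ,(- b)* norm(a , b)⁻¹
    invʳ : ∀ z -> z ≢(0# , 0#)-> z ⊗ inv z ≡(1# , 0#)
    invʳ(a , b)p = cong₂ _,_
     (trans(solve 4(\t a b i -> a :*(a :* i):+ t :*(b :*((:- b):* i)):=(a :* a :- t :*(b :* b)):* i)refl δ₀ a b(norm(a , b)⁻¹))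
         (inverseʳ(p ∘ norm≡0(a , b))))
     (solve 3(\a b i -> a :*((:- b):* i):+ b :*(a :* i):= con 0)refl a b(norm(a , b)⁻¹))

module Frob where
 open import Data.Nat.Combinatorics using (_C_; nCn≡1; nCk+nC[k+1]≡[n+1]C[k+1])
 open import Data.Nat.Combinatorics.Specification using (k>n⇒nCk≡0)
 open import Data.Nat.Divisibility using (n∣m*n; m∣m*n)
 open import Data.Nat.Primality using (euclidsLemma)
 open import Data.Nat.Solver using (module +-*-Solver)
 open import Data.Fin as Fin using (Fin; zero; suc; toℕ; inject₁; fromℕ)
 open import Data.Vec.Functional using (init; last)
 open E using (_≡_)

 absorption : ∀ n k -> suc k N.*(suc n C suc k)≡ suc n N.*(n C k)
 absorption zero zero = E.refl
 absorption zero(suc k)= E.trans(cong(suc(suc k)N.*_)(k>n⇒nCk≡0{1}{suc(suc k)}(s≤s(s≤s z≤n))))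
  (E.trans(N.*-zeroʳ(suc(suc k)))(E.sym(cong(1 N.*_)(k>n⇒nCk≡0{0}{suc k}(s≤s z≤n)))))
 absorption(suc n)zero = begin
  _ ≡⟨ cong(1 N.*_)(E.sym(nCk+nC[k+1]≡[n+1]C[k+1](suc n)0))⟩
  _ ≡⟨ N.*-distribˡ-+ 1(suc n C 0)_ ⟩
  _ ≡⟨ cong(1 N.+_)(absorption n 0)⟩
  _ ∎
  where open E.≡-Reasoning
 absorption(suc n)(suc k)= begin
  _ ≡⟨ cong(suc(suc k)N.*_)(E.sym(nCk+nC[k+1]≡[n+1]C[k+1](suc n)(suc k)))⟩
  _ ≡⟨ solve 3(\k a b ->(con 2 :+ k):*(a :+ b):= a :+(con 1 :+ k):* a :+(con 2 :+ k):* b)E.refl k A B ⟩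
  _ ≡⟨ cong₂(\x y -> A N.+ x N.+ y)(absorption n k)(absorption n(suc k))⟩
  _ ≡⟨ solve 4(\a n x y -> a :+(con 1 :+ n):* x :+(con 1 :+ n):* y := a :+(con 1 :+ n):*(x :+ y))E.refl A n(n C k)(n C suc k)⟩
  _ ≡⟨ cong(\z -> A N.+ suc n N.* z)(nCk+nC[k+1]≡[n+1]C[k+1] n k)⟩
  _ ∎
  where
  open E.≡-Reasoning
  open +-*-Solver
  A = suc n C suc k
  B = suc n C suc(suc k)

 prime∣binomial : ∀{p}-> Prime(suc p)-> ∀ k -> suc k < suc p -> suc p ∣(suc p C suc k)
 prime∣binomial{p}pr k k<p with euclidsLemma(suc k)(suc p C suc k)pr(subst(suc p ∣_)(E.sym(absorption p k))(m∣m*n(p C k)))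
 ... | inj₁ d = contradiction(∣⇒≤ d)(<⇒≱ k<p)
 ... | inj₂ d = d

 module Frobenius (S : CommutativeSemiring 0ℓ 0ℓ) where
  open CommutativeSemiring S hiding (zero)
  open import Algebra.Properties.Semiring.Exp semiring
  open import Algebra.Properties.Semiring.Mult semiring renaming (_×_ to _×'_)
  open import Algebra.Properties.Semiring.Sum semiring using (sum; sum-init-last; sum-cong-≋; sum-replicate-zero)
  open import Algebra.Properties.CommutativeSemiring.Binomial S using (theorem; binomialTerm)
  open import Relation.Binary.Reasoning.Setoid setoid

  module _{p : ℕ}(pr : Prime p) (char : ∀ x -> p ×' x ≈ 0#) where
   frobenius : ∀ x y ->(x + y)^ p ≈ x ^ p + y ^ p
   frobenius x y = go p pr char
    where
    go : ∀ p -> Prime p ->(∀ x -> p ×' x ≈ 0#)->(x + y)^ p ≈ x ^ p + y ^ p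
    go(suc p)pr char = begin
     _ ≈⟨ theorem(suc p)x y ⟩
     _ ≈⟨ +-cong first(sum-init-last(\i -> t(suc i)))⟩
     _ ≈⟨ +-congˡ(+-cong(trans(sum-cong-≋ middle)(sum-replicate-zero p))final)⟩
     _ ≈⟨ trans(+-congˡ(+-identityˡ _))(+-comm _ _)⟩
     _ ∎
     where
     t = binomialTerm x y(suc p)
     first : t zero ≈ y ^ suc p
     first = trans(×-homo-1 _)(*-identityˡ _)
     kill : ∀{m}-> suc p ∣ m -> ∀ z -> m ×' z ≈ 0#
     kill(divides m E.refl)z = trans(×-congˡ{z}(N.*-comm m(suc p)))(trans(sym(×-assocˡ z(suc p)m))(char _))
     middle : ∀ i -> t(suc(inject₁ i))≈ 0#
     middle i = kill(prime∣binomial pr(toℕ(inject₁ i))(s≤s(subst(N._< p)(E.sym(Fin.toℕ-inject₁ i))(Fin.toℕ<n i))))_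
     final : t(suc(fromℕ p))≈ x ^ suc p
     final = begin
      _ ≡⟨ cong(\z ->(suc p C suc z)×'(x ^ suc z * y ^(p N.∸ z)))(Fin.toℕ-fromℕ p)⟩
      _ ≡⟨ cong₂(\c e -> c ×'(x ^ suc p * y ^ e))(nCn≡1(suc p))(N.n∸n≡0 p)⟩
      _ ≈⟨ trans(×-homo-1 _)(*-identityʳ _)⟩
      _ ∎

   frobenius-^ : ∀ h x y ->(x + y)^(p N.^ h)≈ x ^(p N.^ h)+ y ^(p N.^ h)
   frobenius-^ zero x y = trans(*-identityʳ _)(sym(+-cong(*-identityʳ _)(*-identityʳ _)))
   frobenius-^(suc h)x y = begin
    _ ≈⟨ sym(^-assocʳ _ p(p N.^ h))⟩
    _ ≈⟨ ^-congˡ(p N.^ h)(frobenius x y)⟩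
    _ ≈⟨ frobenius-^ h _ _ ⟩
    _ ≈⟨ +-cong(^-assocʳ x p _)(^-assocʳ y p _)⟩
    _ ∎

module Polys where
 open import Algebra.Structures using (IsCommutativeRing)
 open Alg
 open Field

 module Polynomials (F : FiniteField) where
  open FieldKit F
  open E.≡-Reasoning

  Series : Set
  Series = ℕ -> Carrier

  tail : Series -> Series
  tail f n = f(suc n)

  mul : Series -> Series -> Series
  mul f g zero = f 0 * g 0
  mul f g(suc n)= f 0 * g(suc n)+ mul(tail f)g n

  mul-cong : ∀{f f' g g'}->(∀ n -> f n ≡ f' n)->(∀ n -> g n ≡ g' n)-> ∀ n -> mul f g n ≡ mul f' g' n
  mul-cong p q zero = cong₂ _*_(p 0)(q 0)
  mul-cong p q(suc n)= cong₂ _+_(cong₂ _*_(p 0)(q(suc n)))(mul-cong(\n -> p(suc n))q n)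

  mul-distribʳ : ∀ f g h n -> mul(\i -> f i + g i)h n ≡ mul f h n + mul g h n
  mul-distribʳ f g h zero = distribʳ _ _ _
  mul-distribʳ f g h(suc n)= E.trans(cong(\t ->(f 0 + g 0)* h(suc n)+ t)(mul-distribʳ(tail f)(tail g)h n))
   (solve 5(\a b c x y ->(a :+ b):* c :+(x :+ y):=(a :* c :+ x):+(b :* c :+ y))E.refl(f 0)(g 0)(h(suc n))_ _)

  mul-scale : ∀ c f g n -> mul(\i -> c * f i)g n ≡ c * mul f g n
  mul-scale c f g zero = *-assoc _ _ _
  mul-scale c f g(suc n)= E.trans(cong(\t -> c * f 0 * g(suc n)+ t)(mul-scale c(tail f)g n))
   (solve 4(\c a b x -> c :* a :* b :+ c :* x := c :*(a :* b :+ x))E.refl c(f 0)(g(suc n))_)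

  mul-zero : ∀{f}g n ->(∀ i -> f i ≡ 0#)-> mul f g n ≡ 0#
  mul-zero g zero p = E.trans(cong(_* g 0)(p 0))(zeroˡ _)
  mul-zero g(suc n)p = E.trans(cong₂ _+_(E.trans(cong(_* g(suc n))(p 0))(zeroˡ _))(mul-zero g n(\i -> p(suc i))))(+-identityˡ 0#)

  mul-sucʳ : ∀ f g n -> mul f g(suc n)≡ f(suc n)* g 0 + mul f(tail g)n
  mul-sucʳ f g zero = +-comm _ _
  mul-sucʳ f g(suc n)= E.trans(cong(\t -> f 0 * g(suc(suc n))+ t)(mul-sucʳ(tail f)g n))
   (solve 3(\a b c -> a :+(b :+ c):= b :+(a :+ c))E.refl(f 0 * g(suc(suc n)))(f(suc(suc n))* g 0)(mul(tail f)(tail g)n))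

  mul-comm : ∀ f g n -> mul f g n ≡ mul g f n
  mul-comm f g zero = *-comm _ _
  mul-comm f g(suc n)= E.trans(cong₂ _+_(*-comm _ _)(mul-comm(tail f)g n))(E.sym(mul-sucʳ g f n))

  mul-assoc : ∀ f g h n -> mul(mul f g)h n ≡ mul f(mul g h)n
  mul-assoc f g h zero = *-assoc _ _ _
  mul-assoc f g h(suc n)= begin
   _ ≡⟨ cong(\t -> f 0 * g 0 * h(suc n)+ t)(E.trans(mul-distribʳ(\i -> f 0 * tail g i)(mul(tail f)g)h n)
       (cong₂ _+_(mul-scale(f 0)(tail g)h n)(mul-assoc(tail f)g h n)))⟩
   _ ≡⟨ solve 5(\a b c x y -> a :* b :* c :+(a :* x :+ y):= a :*(b :* c :+ x):+ y)E.refl(f 0)(g 0)(h(suc n))_ _ ⟩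
   _ ∎

  Supp : ℕ -> Series -> Set
  Supp d f = ∀ n -> d ≤ n -> f n ≡ 0#

  supp-≤ : ∀{d e f}-> d ≤ e -> Supp d f -> Supp e f
  supp-≤ p s n q = s n(≤-trans p q)

  supp-+ : ∀{d f g}-> Supp d f -> Supp d g -> Supp d(\n -> f n + g n)
  supp-+ s t n p = E.trans(cong₂ _+_(s n p)(t n p))(+-identityˡ 0#)

  -- Supp (suc a) means degree at most a, and degrees add.
  supp-mul : ∀ a b f g -> Supp(suc a)f -> Supp(suc b)g -> Supp(suc(a N.+ b))(mul f g)
  supp-mul zero b f g s t(suc n)p = E.trans(cong₂ _+_(E.trans(cong(\t -> f 0 * t)(t(suc n)p))(zeroʳ _))
   (mul-zero g n(\i -> s(suc i)(s≤s z≤n))))(+-identityˡ 0#)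
  supp-mul(suc a)b f g s t(suc n)(s≤s p)= E.trans(cong₂ _+_(E.trans(cong(\t -> f 0 * t)(t(suc n)(s≤s(≤-trans(m≤n+m b a)(<⇒≤ p)))))(zeroʳ _))
   (supp-mul a b(tail f)g(\i q -> s(suc i)(s≤s q))t n p))(+-identityˡ 0#)

  record Poly : Set where
   constructor poly
   field
    coeff : Series
    bound : ℕ
    supp : Supp bound coeff
  open Poly public

  infix 4 _≋_
  record _≋_(p q : Poly): Set where
   constructor mk
   field at : ∀ n -> coeff p n ≡ coeff q n
  open _≋_ public

  C : Carrier -> Poly
  C c = poly f 1 \{(suc n)_ -> E.refl}
   where
   f : Series
   f zero = c
   f(suc n)= 0#

  X : Poly
  X = poly f 2 \{(suc(suc n))_ -> E.refl ;(suc zero)(s≤s ())}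
   where
   f : Series
   f zero = 0#
   f(suc zero)= 1#
   f(suc(suc n))= 0#

  private
   neg0 : - 0# ≡ 0#
   neg0 = solve 0(:- con 0 := con 0)E.refl

  abstract
   addP mulP : Poly -> Poly -> Poly
   addP(poly f a s)(poly g b t)= poly(\n -> f n + g n)(a N.+ b)(supp-+(supp-≤(m≤m+n a b)s)(supp-≤(m≤n+m b a)t))
   mulP(poly f a s)(poly g b t)= poly(mul f g)(suc(a N.+ b))(supp-mul a b f g(supp-≤(n≤1+n a)s)(supp-≤(n≤1+n b)t))
   negP : Poly -> Poly
   negP(poly f a s)= poly(\n -> - f n)a(\n p -> E.trans(cong -_(s n p))neg0)
   zeroP oneP : Poly
   zeroP = poly(\_ -> 0#)0(\_ _ -> E.refl)
   oneP = C 1#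

   coeff-+ : ∀ p q n -> coeff(addP p q)n ≡ coeff p n + coeff q n
   coeff-+ p q n = E.refl
   coeff-* : ∀ p q n -> coeff(mulP p q)n ≡ mul(coeff p)(coeff q)n
   coeff-* p q n = E.refl
   coeff-neg : ∀ p n -> coeff(negP p)n ≡ - coeff p n
   coeff-neg p n = E.refl
   coeff-0 : ∀ n -> coeff zeroP n ≡ 0#
   coeff-0 n = E.refl
   C-1 : oneP ≡ C 1#
   C-1 = E.refl

   private
    identˡ : ∀ g n -> mul(coeff oneP)g n ≡ g n
    identˡ g zero = *-identityˡ _
    identˡ g(suc n)= E.trans(cong₂ _+_(*-identityˡ _)(mul-zero g n(\_ -> E.refl)))(+-identityʳ _)

    distrˡ : ∀ f g h n -> mul f(\i -> g i + h i)n ≡ mul f g n + mul f h n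
    distrˡ f g h n = E.trans(mul-comm f _ n)(E.trans(mul-distribʳ g h f n)(cong₂ _+_(mul-comm g f n)(mul-comm h f n)))

   isPolyRing : IsCommutativeRing _≋_ addP mulP negP zeroP oneP
   isPolyRing = record
    {isRing = record
     {+-isAbelianGroup = record
      {isGroup = record
       {isMonoid = record
        {isSemigroup = record
         {isMagma = record
          {isEquivalence = record{refl = mk \_ -> E.refl ; sym = \p -> mk \n -> E.sym(at p n); trans = \p q -> mk \n -> E.trans(at p n)(at q n)}
          ; ∙-cong = \p q -> mk \n -> cong₂ _+_(at p n)(at q n)}
         ; assoc = \p q r -> mk \n -> +-assoc _ _ _}
        ; identity =(\p -> mk \n -> +-identityˡ _),(\p -> mk \n -> +-identityʳ _)}
       ; inverse =(\p -> mk \n -> -‿inverseˡ _),(\p -> mk \n -> -‿inverseʳ _)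
       ; ⁻¹-cong = \p -> mk \n -> cong -_(at p n)}
      ; comm = \p q -> mk \n -> +-comm _ _}
     ; *-cong = \p q -> mk(mul-cong(at p)(at q))
     ; *-assoc = \p q r -> mk(mul-assoc(coeff p)(coeff q)(coeff r))
     ; *-identity =(\p -> mk(identˡ(coeff p))),(\p -> mk \n -> E.trans(mul-comm(coeff p)_ n)(identˡ(coeff p)n))
     ; distrib =(\p q r -> mk(distrˡ(coeff p)(coeff q)(coeff r))),(\p q r -> mk(mul-distribʳ(coeff q)(coeff r)(coeff p)))}
    ; *-comm = \p q -> mk(mul-comm(coeff p)(coeff q))}

  polyRing : CommutativeRing 0ℓ 0ℓ
  polyRing = record{isCommutativeRing = isPolyRing}

  module P = CommutativeRing polyRing
  module PK = RingKit polyRing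
  open import Algebra.Properties.Semiring.Exp P.semiring public using () renaming (_^_ to _^ᴾ_; ^-homo-* to ^ᴾ-homo-*; ^-assocʳ to ^ᴾ-assocʳ; ^-congˡ to ^ᴾ-congˡ)

  mul-C : ∀ c p n -> coeff(C c P.* p)n ≡ c * coeff p n
  mul-C c p n = E.trans(coeff-*(C c)p n)(lemma n)
   where
   lemma : ∀ n -> mul(coeff(C c))(coeff p)n ≡ c * coeff p n
   lemma zero = E.refl
   lemma(suc n)= E.trans(cong(\t -> c * coeff p(suc n)+ t)(mul-zero(coeff p)n(\_ -> E.refl)))(+-identityʳ _)

  C-+ : ∀ a b -> C(a + b)≋ C a P.+ C b
  C-+ a b = mk \{zero -> E.sym(coeff-+(C a)(C b)0);(suc n)-> E.sym(E.trans(coeff-+(C a)(C b)(suc n))(+-identityˡ 0#))}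

  C-* : ∀ a b -> C(a * b)≋ C a P.* C b
  C-* a b = mk \n -> E.sym(E.trans(mul-C a(C b)n)(lemma n))
   where
   lemma : ∀ n -> a * coeff(C b)n ≡ coeff(C(a * b))n
   lemma zero = E.refl
   lemma(suc n)= zeroʳ a

  C-neg : ∀ a -> C(- a)≋ P.- C a
  C-neg a = mk \{zero -> E.sym(coeff-neg(C a)0);(suc n)-> E.sym(E.trans(coeff-neg(C a)(suc n))neg0)}

  C-0 : C 0# ≋ P.0#
  C-0 = mk \{zero -> E.sym(coeff-0 0);(suc n)-> E.sym(coeff-0(suc n))}

  C-cong : ∀{a b}-> a ≡ b -> C a ≋ C b
  C-cong E.refl = P.refl

  C-1# : C 1# ≋ P.1#
  C-1# = P.reflexive(E.sym C-1)

  C-^ : ∀ a n -> C(a ^ n)≋ C a ^ᴾ n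
  C-^ a zero = C-1#
  C-^ a(suc n)= P.trans(C-* a(a ^ n))(P.*-congˡ(C-^ a n))

  mul-X-0 : ∀ p -> coeff(X P.* p)0 ≡ 0#
  mul-X-0 p = E.trans(coeff-* X p 0)(zeroˡ _)

  mul-X-suc : ∀ p n -> coeff(X P.* p)(suc n)≡ coeff p n
  mul-X-suc p n = E.trans(coeff-* X p(suc n))(E.trans(cong₂ _+_(zeroˡ _)(E.trans
   (mul-cong{f' = coeff(C 1#)}{g' = coeff p}(\{zero -> E.refl ;(suc i)-> E.refl})(\_ -> E.refl)n)
   (E.trans(E.sym(coeff-*(C 1#)p n))(E.trans(mul-C 1# p n)(*-identityˡ _)))))(+-identityˡ _))

  coeff-− : ∀ p q n -> coeff(p P.- q)n ≡ coeff p n - coeff q n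
  coeff-− p q n = E.trans(coeff-+ p(P.- q)n)(cong(\t -> coeff p n + t)(coeff-neg q n))

  X-_ : Carrier -> Poly
  X- z = X P.- C z

  coeff-X- : ∀ z h n -> coeff((X- z)P.* h)(suc n)≡ coeff h n - z * coeff h(suc n)
  coeff-X- z h n = E.trans(at(PK.solve 3(\x c h ->(x PK.:- c)PK.:* h PK.:= x PK.:* h PK.:- c PK.:* h)P.refl X(C z)h)(suc n))
   (E.trans(coeff-−(X P.* h)(C z P.* h)(suc n))(cong₂ _-_(mul-X-suc h n)(mul-C z h(suc n))))

  private
   descend : ∀ z(h : Series)d ->(∀ n -> d ≤ suc n -> h n ≡ z * h(suc n))-> ∀ k n -> d ≤ suc n -> h(k N.+ n)≡ 0# -> h n ≡ 0#
   descend z h d e zero n p q = q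
   descend z h d e(suc k)n p q = begin
    h n ≡⟨ e n p ⟩
    _ ≡⟨ cong(\t -> z * t)(descend z h d e k(suc n)(N.m≤n⇒m≤1+n p)(subst(\i -> h i ≡ 0#)(E.sym(+-suc k n))q))⟩
    z * 0# ≡⟨ zeroʳ z ⟩
    0# ∎

  supp-divide : ∀ z h d -> Supp d(coeff((X- z)P.* h))-> Supp(d N.∸ 1)(coeff h)
  supp-divide z h d s n p = descend z(coeff h)d step(bound h)n(low d p)(supp h _(m≤m+n(bound h)n))
   where
   low : ∀ d -> d N.∸ 1 ≤ n -> d ≤ suc n
   low zero _ = z≤n
   low(suc d)q = s≤s q
   step : ∀ n -> d ≤ suc n -> coeff h n ≡ z * coeff h(suc n)
   step n q = x-y≡0⇒x≡y(E.trans(E.sym(coeff-X- z h n))(s(suc n)q))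

  cancel-X- : ∀ z f g ->(X- z)P.* f ≋(X- z)P.* g -> f ≋ g
  cancel-X- z f g e = mk \n -> x-y≡0⇒x≡y(E.trans(E.sym(coeff-− f g n))(supp-divide z(f P.- g)0(\i _ -> E.trans
   (at(PK.solve 3(\v f g -> v PK.:*(f PK.:- g)PK.:= v PK.:* f PK.:- v PK.:* g)P.refl(X- z)f g)i)
   (E.trans(coeff-− _ _ i)(E.trans(cong(_- coeff((X- z)P.* g)i)(at e i))(-‿inverseʳ _))))n z≤n))

  _∣ᴾ_ : Poly -> Poly -> Set
  d ∣ᴾ f = ∃ \h -> f ≋ d P.* h

  swap-factor : ∀{z w}-> z ≢ w -> ∀ j{b}->((X- w)^ᴾ j)∣ᴾ((X- z)P.* b)->((X- w)^ᴾ j)∣ᴾ b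
  swap-factor z≢w zero{b}_ = b , P.sym(P.*-identityˡ b)
  swap-factor{z}{w}z≢w(suc j){b}(a , e)= proj₁ ih , P.trans b≋(P.trans(P.*-congˡ(proj₂ ih))(P.sym(P.*-assoc(X- w)_ _)))
   where
   A =(X- w)^ᴾ j P.* a
   c =(z - w)⁻¹
   b₁ = C c P.*(b P.- A)
   inverse : C c P.* C(z - w)≋ P.1#
   inverse = P.trans(P.sym(C-* c(z - w)))(P.trans(C-cong(inverseˡ(x≢y⇒x-y≢0 z≢w)))C-1#)
   Cz-w : C(z - w)≋ C z P.- C w
   Cz-w = P.trans(C-+ z(- w))(P.+-congˡ(C-neg w))
   -- (X - z)(b - A) = (X - w) A - (X - z) A = (z - w) A
   A≋ : A ≋(X- z)P.* b₁
   A≋ = P.trans(P.sym(P.*-identityˡ A))(P.trans(P.*-congʳ(P.sym inverse))(P.trans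
    (P.*-assoc(C c)(C(z - w))A)(P.trans(P.*-congˡ lemma)
    (PK.solve 3(\c v d -> c PK.:*(v PK.:* d)PK.:= v PK.:*(c PK.:* d))P.refl(C c)(X- z)(b P.- A)))))
    where
    lemma : C(z - w)P.* A ≋(X- z)P.*(b P.- A)
    lemma = P.trans(P.*-congʳ Cz-w)(P.trans
     (PK.solve 4(\x z w A ->(z PK.:- w)PK.:* A PK.:=(x PK.:- w)PK.:* A PK.:-(x PK.:- z)PK.:* A)P.refl X(C z)(C w)A)
     (P.trans(P.+-congʳ(P.sym(P.trans e(P.*-assoc(X- w)_ a))))
     (PK.solve 3(\v b A -> v PK.:* b PK.:- v PK.:* A PK.:= v PK.:*(b PK.:- A))P.refl(X- z)b A)))
   b≋ : b ≋(X- w)P.* b₁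
   b≋ = cancel-X- z b((X- w)P.* b₁)(P.trans e(P.trans(P.*-assoc(X- w)_ a)(P.trans(P.*-congˡ A≋)
    (PK.solve 3(\w z b -> w PK.:*(z PK.:* b)PK.:= z PK.:*(w PK.:* b))P.refl(X- w)(X- z)b₁))))
   ih = swap-factor z≢w j{b₁}(a , P.sym A≋)

  swap-power : ∀{z w}-> z ≢ w -> ∀ j i{b}->((X- w)^ᴾ j)∣ᴾ((X- z)^ᴾ i P.* b)->((X- w)^ᴾ j)∣ᴾ b
  swap-power z≢w j zero{b}(a , e)= a , P.trans(P.sym(P.*-identityˡ b))e
  swap-power{z}z≢w j(suc i){b}(a , e)= swap-power z≢w j i(swap-factor z≢w j(a , P.trans(P.sym(P.*-assoc(X- z)_ b))e))

  supp-≋ : ∀{d p q}-> p ≋ q -> Supp d(coeff p)-> Supp d(coeff q)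
  supp-≋ e s n l = E.trans(E.sym(at e n))(s n l)

  supp-power : ∀ z K h d -> Supp d(coeff((X- z)^ᴾ K P.* h))-> Supp(d N.∸ K)(coeff h)
  supp-power z zero h d s = supp-≋(P.*-identityˡ h)s
  supp-power z(suc K)h d s = subst(\e -> Supp e(coeff h))(N.∸-+-assoc d 1 K)
   (supp-power z K h(d N.∸ 1)(supp-divide z((X- z)^ᴾ K P.* h)d(supp-≋(P.*-assoc(X- z)_ h)s)))

  multiple-roots : ∀ K{zs}-> Unique zs -> ∀ f d -> Supp d(coeff f)-> All(\z ->((X- z)^ᴾ K)∣ᴾ f)zs ->
           d ≤ length zs N.* K -> f ≋ P.0#
  multiple-roots K [] f d s _ p = mk \n -> E.trans(s n(≤-trans p z≤n))(E.sym(coeff-0 n))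
  multiple-roots K{z ∷ zs}(z∉ ∷ u)f d s((h , e)∷ div)p = P.trans e(P.trans(P.*-congˡ h≋0)(P.zeroʳ _))
   where
   h≋0 : h ≋ P.0#
   h≋0 = multiple-roots K u h(d N.∸ K)(supp-power z K h d(supp-≋ e s))
    (All.zipWith(\{(z≢w ,(a , e'))-> swap-power z≢w K K(a , P.trans(P.sym e)e')})(z∉ , div))
    (≤-trans(N.∸-monoˡ-≤ K p)(≡⇒≤(N.m+n∸m≡n K _)))

  X-divides-^ : ∀ z n ->(X- z)∣ᴾ(X ^ᴾ n P.- C(z ^ n))
  X-divides-^ z zero = P.0# , P.trans(P.trans(P.+-congˡ(P.-‿cong C-1#))(P.-‿inverseʳ _))(P.sym(P.zeroʳ(X- z)))
  X-divides-^ z(suc n)with X-divides-^ z n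
  ... | h , e = X P.* h P.+ C(z ^ n), P.trans(P.+-congˡ(P.-‿cong(C-* z(z ^ n))))(P.trans
   (PK.solve 4(\x a z c -> x PK.:* a PK.:- z PK.:* c PK.:= x PK.:*(a PK.:- c)PK.:+(x PK.:- z)PK.:* c)P.refl X(X ^ᴾ n)(C z)(C(z ^ n)))
   (P.trans(P.+-congʳ(P.*-congˡ e))
   (PK.solve 4(\x v h c -> x PK.:*(v PK.:* h)PK.:+ v PK.:* c PK.:= v PK.:*(x PK.:* h PK.:+ c))P.refl X(X- z)h(C(z ^ n)))))

  coeff-X^-< : ∀ n h i -> i < n -> coeff(X ^ᴾ n P.* h)i ≡ 0#
  coeff-X^-<(suc n)h zero p = E.trans(at(P.*-assoc X(X ^ᴾ n)h)0)(mul-X-0 _)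
  coeff-X^-<(suc n)h(suc i)(s≤s p)= E.trans(at(P.*-assoc X(X ^ᴾ n)h)(suc i))(E.trans(mul-X-suc _ i)(coeff-X^-< n h i p))

  coeff-X^-+ : ∀ n h i -> coeff(X ^ᴾ n P.* h)(n N.+ i)≡ coeff h i
  coeff-X^-+ zero h i = at(P.*-identityˡ h)i
  coeff-X^-+(suc n)h i = E.trans(at(P.*-assoc X(X ^ᴾ n)h)(suc(n N.+ i)))(E.trans(mul-X-suc _ _)(coeff-X^-+ n h i))

  supp-C : ∀ c -> Supp 1(coeff(C c))
  supp-C c(suc n)_ = E.refl

  supp-X : Supp 2(coeff X)
  supp-X(suc(suc n))_ = E.refl
  supp-X(suc zero)(s≤s ())

  supp-addᴾ : ∀{d p q}-> Supp d(coeff p)-> Supp d(coeff q)-> Supp d(coeff(p P.+ q))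
  supp-addᴾ{p = p}{q}s t n l = E.trans(coeff-+ p q n)(supp-+ s t n l)

  supp-mulᴾ : ∀{a b p q}-> Supp(suc a)(coeff p)-> Supp(suc b)(coeff q)-> Supp(suc(a N.+ b))(coeff(p P.* q))
  supp-mulᴾ{a}{b}{p}{q}s t n l = E.trans(coeff-* p q n)(supp-mul a b(coeff p)(coeff q)s t n l)

  supp-0 : ∀{d}-> Supp d(coeff P.0#)
  supp-0 n _ = coeff-0 n

  supp-^ : ∀{a p}n -> Supp(suc a)(coeff p)-> Supp(suc(n N.* a))(coeff(p ^ᴾ n))
  supp-^ zero s = subst(\p -> Supp 1(coeff p))(E.sym C-1)(supp-C 1#)
  supp-^(suc n)s = supp-mulᴾ s(supp-^ n s)

  supp-X^ : ∀ n -> Supp(suc n)(coeff(X ^ᴾ n))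
  supp-X^ n = subst(\m -> Supp(suc m)(coeff(X ^ᴾ n)))(N.*-identityʳ n)(supp-^ n supp-X)

  roots-of-unity : ∀ n{zs}-> Unique zs -> All(\z -> z ^ suc n ≡ 1#)zs -> length zs ≤ suc n
  roots-of-unity n{zs}u h with suc(suc n)N.≤? length zs
  ... | no p = ≤-pred(≰⇒> p)
  ... | yes p = contradiction(E.trans(E.sym lead)(E.trans(at(multiple-roots 1 u f(suc(suc n))s(All.map div h)
          (subst(suc(suc n)N.≤_)(E.sym(N.*-identityʳ _))p))(suc n))(coeff-0 _)))1≢0
   where
   f = X ^ᴾ suc n P.- C 1#
   div : ∀{z}-> z ^ suc n ≡ 1# ->((X- z)^ᴾ 1)∣ᴾ f
   div{z}e = q , P.trans{f}{X ^ᴾ suc n P.- C(z ^ suc n)}step(P.trans{j =(X- z)P.* q}(proj₂ d)(P.*-congʳ{q}{X- z}{(X- z)^ᴾ 1}(P.sym(P.*-identityʳ(X- z)))))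
    where
    d = X-divides-^ z(suc n)
    q = proj₁ d
    step : f ≋ X ^ᴾ suc n P.- C(z ^ suc n)
    step = P.+-congˡ{X ^ᴾ suc n}(P.-‿cong{C 1#}(C-cong{1#}{z ^ suc n}(E.sym e)))
   f-at : ∀ i -> coeff f(suc i)≡ coeff(X ^ᴾ suc n)(suc i)
   f-at i = E.trans(coeff-− _ _(suc i))(E.trans(cong(\t -> coeff(X ^ᴾ suc n)(suc i)+ t)neg0)(+-identityʳ _))
   s : Supp(suc(suc n))(coeff f)
   s(suc i)p = E.trans(f-at i)(supp-X^(suc n)(suc i)p)
   lead : coeff f(suc n)≡ 1#
   lead = E.trans(f-at n)(E.trans(at(P.sym(P.*-identityʳ(X ^ᴾ suc n)))(suc n))
    (E.trans(cong(coeff(X ^ᴾ suc n P.* P.1#))(E.sym(N.+-identityʳ(suc n))))(E.trans(coeff-X^-+(suc n)P.1# 0)(at(P.sym C-1#)0))))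

module Kernel where
 open import Data.Fin as Fin using (Fin; toℕ; fromℕ<; funToFin; finToFun)
 open import Data.List.Relation.Unary.Any using (index)
 open import Data.List.Relation.Unary.Any.Properties using (lookup-index)
 open import Data.List.Membership.Propositional.Properties using (∈-lookup)
 open E
 open Field

 lookup-injective :{A : Set}{xs : List A}-> Unique xs -> ∀ i j -> lookup xs i ≡ lookup xs j -> i ≡ j
 lookup-injective(_ ∷ u)Fin.zero Fin.zero e = refl
 lookup-injective(n ∷ u)Fin.zero(Fin.suc j)e = contradiction e(All.lookup n(∈-lookup j))
 lookup-injective(n ∷ u)(Fin.suc i)Fin.zero e = contradiction(sym e)(All.lookup n(∈-lookup i))
 lookup-injective(_ ∷ u)(Fin.suc i)(Fin.suc j)e = cong Fin.suc(lookup-injective u i j e)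

 module LinearKernel (F : FiniteField) where
  open FieldKit F

  private
   idx : Carrier -> Fin size
   idx x = index(complete x)

   lookup-idx : ∀ x -> lookup elems(idx x)≡ x
   lookup-idx x = sym(lookup-index(complete x))

   ext : ∀{n}->(Fin n -> Fin size)-> ℕ -> Carrier
   ext{n}v i with i N.<? n
   ... | yes p = lookup elems(v(fromℕ< p))
   ... | no _ = 0#

   ext-< : ∀{n}(v : Fin n -> Fin size)i -> ext v(toℕ i)≡ lookup elems(v i)
   ext-<{n}v i with toℕ i N.<? n
   ... | yes p = cong(\j -> lookup elems(v j))(Fin.fromℕ<-toℕ i p)
   ... | no ¬p = contradiction(Fin.toℕ<n i)¬p

   1<size : 1 < size
   1<size = two elems(complete 0#)(complete 1#)
    where
    two : ∀ xs -> 0# ∈ xs -> 1# ∈ xs -> 1 < length xs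
    two(x ∷ [])(here p)(here q)= contradiction(trans q(sym p))1≢0
    two(x ∷ y ∷ xs)_ _ = s≤s(s≤s z≤n)

   funToFin-cong : ∀{m n}{f g : Fin m -> Fin n}->(∀ i -> f i ≡ g i)-> funToFin f ≡ funToFin g
   funToFin-cong{zero}h = refl
   funToFin-cong{suc m}h = cong₂ Fin.combine(h Fin.zero)(funToFin-cong(\i -> h(Fin.suc i)))

  kernel : ∀ n m -> m < n ->(Λ :(ℕ -> Carrier)-> ℕ -> Carrier)->
       (∀ f g c -> Λ(\i -> f i - g i)c ≡ Λ f c - Λ g c)->
       ∃ \α ->(∃ \i -> i < n × α i ≢ 0#)×(∀ c -> c < m -> Λ α c ≡ 0#)
  kernel n m m<n Λ Λ-− = α , nonzero , vanish
   where
   vec : Fin(size N.^ n)-> Fin n -> Fin size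
   vec = finToFun{size}{n}
   f : Fin(size N.^ n)-> Fin(size N.^ m)
   f k = funToFin{m}(\c -> idx(Λ(ext(vec k))(toℕ c)))
   hole = Fin.pigeonhole(N.^-monoʳ-< size 1<size m<n)f
   i = proj₁ hole
   j = proj₁(proj₂ hole)
   i<j = proj₁(proj₂(proj₂ hole))
   fi≡fj = proj₂(proj₂(proj₂ hole))
   α : ℕ -> Carrier
   α t = ext(vec i)t - ext(vec j)t
   nonzero : ∃ \t -> t < n × α t ≢ 0#
   nonzero with Fin.all?(\t -> vec i t Fin.≟ vec j t)
   ... | yes p = contradiction(trans(sym(Fin.funToFin-finToFin{n}{size}i))(trans(funToFin-cong p)(Fin.funToFin-finToFin{n}{size}j)))(Fin.<⇒≢ i<j)
   ... | no ¬p with Fin.¬∀⟶∃¬ n _(\t -> vec i t Fin.≟ vec j t)¬p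
   ... | t , ne = toℕ t , Fin.toℕ<n t , \e -> ne(lookup-injective unique _ _
        (trans(sym(ext-<(vec i)t))(trans(x-y≡0⇒x≡y e)(ext-<(vec j)t))))
   vanish : ∀ c -> c < m -> Λ α c ≡ 0#
   vanish c c<m = begin
    Λ α c ≡⟨ Λ-−(ext(vec i))(ext(vec j))c ⟩
    _ ≡⟨ cong(_- Λ(ext(vec j))c)same ⟩
    _ ≡⟨ -‿inverseʳ _ ⟩
    0# ∎
    where
    open ≡-Reasoning
    c' = fromℕ< c<m
    out : Fin(size N.^ n)-> Carrier
    out k = Λ(ext(vec k))(toℕ c')
    val : ∀ k -> lookup elems(finToFun{size}{m}(f k)c')≡ out k
    val k = trans(cong(lookup elems)(Fin.finToFun-funToFin{m}(\c -> idx(Λ(ext(vec k))(toℕ c)))c'))(lookup-idx(out k))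
    same : Λ(ext(vec i))c ≡ Λ(ext(vec j))c
    same = subst(\z -> Λ(ext(vec i))z ≡ Λ(ext(vec j))z)(Fin.toℕ-fromℕ< c<m)
     (trans(sym(val i))(trans(cong(\w -> lookup elems(finToFun{size}{m}w c'))fi≡fj)(val j)))

module Stepanov where
 open import Data.Nat using (_/_; _%_)
 import Data.Nat.DivMod as N
 import Data.Nat.Divisibility as N using (n∣m*n)
 import Data.Nat.Induction as ℕI
 open import Relation.Binary.Definitions using (tri<; tri≈; tri>)
 open import Data.Nat.Solver using (module +-*-Solver)
 open import Data.Empty using (⊥)
 open Alg
 open Field
 open Frob
 open Polys
 open Kernel

 module Multiples (R : CommutativeRing 0ℓ 0ℓ) where
  open CommutativeRing R
  open RingKit R
  open import Algebra.Properties.Semiring.Mult semiring using () renaming (_×_ to _×'_)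

  ×≈⟨⟩* : ∀ n x -> n ×' x ≈ ⟨ n ⟩ * x
  ×≈⟨⟩* zero x = sym(zeroˡ x)
  ×≈⟨⟩*(suc n)x = trans(+-cong(sym(*-identityˡ x))(×≈⟨⟩* n x))(sym(distribʳ x _ _))

 module Congruence (F : FiniteField) (V : Polynomials.Poly F) where
  open Polynomials F
  infix 4 _~_
  _~_ : Poly -> Poly -> Set
  f ~ g = V ∣ᴾ(f P.- g)

  ≋⇒~ : ∀{f g}-> f ≋ g -> f ~ g
  ≋⇒~{f}{g}e = P.0# , P.trans(P.trans(P.+-congʳ e)(P.-‿inverseʳ g))(P.sym(P.zeroʳ V))

  ~-refl : ∀{f}-> f ~ f
  ~-refl = ≋⇒~ P.refl

  ~-sym : ∀{f g}-> f ~ g -> g ~ f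
  ~-sym{f}{g}(a , p)= P.- a , P.trans(PK.solve 2(\f g -> g PK.:- f PK.:= PK.:-(f PK.:- g))P.refl f g)
   (P.trans(P.-‿cong p)(PK.solve 2(\v a -> PK.:-(v PK.:* a)PK.:= v PK.:*(PK.:- a))P.refl V a))

  ~-trans : ∀{f g h}-> f ~ g -> g ~ h -> f ~ h
  ~-trans{f}{g}{h}(a , p)(b , q)= a P.+ b , P.trans
   (PK.solve 3(\f g h -> f PK.:- h PK.:=(f PK.:- g)PK.:+(g PK.:- h))P.refl f g h)
   (P.trans(P.+-cong p q)(P.sym(P.distribˡ V a b)))

  ~-+ : ∀{f f' g g'}-> f ~ f' -> g ~ g' -> f P.+ g ~ f' P.+ g'
  ~-+{f}{f'}{g}{g'}(a , p)(b , q)= a P.+ b , P.trans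
   (PK.solve 4(\f f' g g' ->(f PK.:+ g)PK.:-(f' PK.:+ g')PK.:=(f PK.:- f')PK.:+(g PK.:- g'))P.refl f f' g g')
   (P.trans(P.+-cong p q)(P.sym(P.distribˡ V a b)))

  ~-* : ∀{f f' g g'}-> f ~ f' -> g ~ g' -> f P.* g ~ f' P.* g'
  ~-*{f}{f'}{g}{g'}(a , p)(b , q)= a P.* g P.+ f' P.* b , P.trans
   (PK.solve 4(\f f' g g' -> f PK.:* g PK.:- f' PK.:* g' PK.:=(f PK.:- f')PK.:* g PK.:+ f' PK.:*(g PK.:- g'))P.refl f f' g g')
   (P.trans(P.+-cong(P.*-congʳ p)(P.*-congˡ q))
   (PK.solve 5(\v a g f b ->(v PK.:* a)PK.:* g PK.:+ f PK.:*(v PK.:* b)PK.:= v PK.:*(a PK.:* g PK.:+ f PK.:* b))P.refl V a g f' b))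

  ~-^ : ∀{f g}n -> f ~ g -> f ^ᴾ n ~ g ^ᴾ n
  ~-^ zero e = ~-refl
  ~-^(suc n)e = ~-* e(~-^ n e)

  ~-Ʃ :{J : Set}(xs : List J){f g : J -> Poly}->(∀ x -> f x ~ g x)-> PK.Ʃ xs f ~ PK.Ʃ xs g
  ~-Ʃ [] h = ~-refl
  ~-Ʃ(x ∷ xs)h = ~-+(h x)(~-Ʃ xs h)

 module StepanovBound (F : FiniteField) (I' h m : ℕ) (κ g : FiniteField.Carrier F) where
  open FieldKit F
  open Polynomials F

  I r M J L Q Δ : ℕ
  I = suc I'
  r = suc I N.^ h
  M = m N.+ r N.* m
  J = m N.+ 10
  L = J N.* I
  Q = r N.* r
  Δ = M N.+ J N.+ 4 N.* r

  jj ii i* E : ℕ -> ℕ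
  jj ℓ = ℓ / I
  ii ℓ = ℓ % I
  i* ℓ = I' N.∸ ii ℓ
  E ℓ = M N.* ℓ N.+ jj ℓ

  u : Poly
  u =(X P.+ C 1#)P.*(X P.+ C κ)

  uz : Carrier -> Carrier
  uz z =(z + 1#)*(z + κ)

  -- the unknown polynomial of index ℓ, with the M unknown coefficients α (e + ℓ M), e < M
  a :(ℕ -> Carrier)-> ℕ -> Poly
  a α ℓ = poly f M s
   where
   f : ℕ -> Carrier
   f e with e N.<? M
   ... | yes _ = α(e N.+ ℓ N.* M)
   ... | no _ = 0#
   s : Supp M f
   s e p with e N.<? M
   ... | yes q = contradiction q(N.≤⇒≯ p)
   ... | no _ = E.refl

  a-< : ∀ α ℓ{e}-> e < M -> coeff(a α ℓ)e ≡ α(e N.+ ℓ N.* M)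
  a-< α ℓ{e}p with e N.<? M
  ... | yes _ = E.refl
  ... | no ¬p = contradiction p ¬p

  T :(ℕ -> Carrier)-> ℕ -> Poly
  T α ℓ = a α ℓ P.*(X ^ᴾ E ℓ P.* u ^ᴾ(M N.* i* ℓ))

  Ψ :(ℕ -> Carrier)-> Poly
  Ψ α = PK.Ʃ(rng L)(T α)

  b :(ℕ -> Carrier)-> ℕ -> Poly
  b α ℓ = a α ℓ P.*(X ^ᴾ(m N.* ii ℓ)P.* u ^ᴾ(m N.* i* ℓ))

  -- t f ρ is the coefficient of U^ρ in (X + U)^f, and τ its value at z.
  t : ℕ -> ℕ -> Poly
  t zero zero = C 1#
  t zero(suc ρ)= C 0#
  t(suc f)zero = X P.* t f zero
  t(suc f)(suc ρ)= X P.* t f(suc ρ)P.+ t f ρ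

  τ : Carrier -> ℕ -> ℕ -> Carrier
  τ z zero zero = 1#
  τ z zero(suc ρ)= 0#
  τ z(suc f)zero = z * τ z f zero
  τ z(suc f)(suc ρ)= z * τ z f(suc ρ)+ τ z f ρ

  Bd : ℕ
  Bd = M N.+ 2 N.* r

  w : ℕ -> Poly
  w ℓ = C(g ^ i* ℓ)P.*(X ^ᴾ(jj ℓ N.+ m N.* i* ℓ)P.* u ^ᴾ(m N.* ii ℓ))

  Ep :(ℕ -> Carrier)-> ℕ -> Poly
  Ep α ρ = PK.Ʃ(rng L)(\ ℓ -> w ℓ P.* PK.Ʃ(rng Bd)(\f -> C(coeff(b α ℓ)f)P.* t f ρ))

  supp-u : Supp 3(coeff u)
  supp-u = supp-mulᴾ{1}{1}(supp-addᴾ supp-X(supp-≤(s≤s z≤n)(supp-C 1#)))(supp-addᴾ supp-X(supp-≤(s≤s z≤n)(supp-C κ)))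

  coeff-Ʃ :{A : Set}(xs : List A)(f : A -> Poly)-> ∀ n -> coeff(PK.Ʃ xs f)n ≡ K.Ʃ xs(\x -> coeff(f x)n)
  coeff-Ʃ [] f n = coeff-0 n
  coeff-Ʃ(x ∷ xs)f n = E.trans(coeff-+(f x)(PK.Ʃ xs f)n)(cong(\z -> coeff(f x)n + z)(coeff-Ʃ xs f n))

  supp-Ʃ : ∀{d}{A : Set}(xs : List A){f : A -> Poly}->(∀{x}-> x ∈ xs -> Supp d(coeff(f x)))-> Supp d(coeff(PK.Ʃ xs f))
  supp-Ʃ [] h = supp-0
  supp-Ʃ(x ∷ xs)h = supp-addᴾ(h(here E.refl))(supp-Ʃ xs(h ∘ there))

  C-Ʃ :{A : Set}(xs : List A)(f : A -> Carrier)-> C(K.Ʃ xs f)≋ PK.Ʃ xs(\x -> C(f x))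
  C-Ʃ [] f = C-0
  C-Ʃ(x ∷ xs)f = P.trans(C-+ _ _)(P.+-congˡ(C-Ʃ xs f))

  expand : ∀ d p -> Supp d(coeff p)-> p ≋ PK.Ʃ(rng d)(\f -> C(coeff p f)P.* X ^ᴾ f)
  expand d p s = mk \n -> go n
   where
   S : ℕ -> Poly
   S d = PK.Ʃ(rng d)(\f -> C(coeff p f)P.* X ^ᴾ f)
   top : ∀ d -> coeff(X ^ᴾ d)d ≡ 1#
   top d = E.trans(at(P.sym(P.*-identityʳ(X ^ᴾ d)))d)(E.trans(cong(coeff(X ^ᴾ d P.* P.1#))(E.sym(N.+-identityʳ d)))
    (E.trans(coeff-X^-+ d P.1# 0)(at(P.sym C-1#)0)))
   low : ∀ d n -> n < d -> coeff(X ^ᴾ d)n ≡ 0#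
   low d n q = E.trans(at(P.sym(P.*-identityʳ(X ^ᴾ d)))n)(coeff-X^-< d P.1# n q)
   step : ∀ d n -> coeff(S(suc d))n ≡ coeff p d * coeff(X ^ᴾ d)n + coeff(S d)n
   step d n = E.trans(coeff-+ _ _ n)(cong(_+ coeff(S d)n)(mul-C _ _ n))
   above : ∀ d n -> d ≤ n -> coeff(S d)n ≡ 0#
   above zero n q = coeff-0 n
   above(suc d)n q = E.trans(step d n)(E.trans(cong₂ _+_(E.trans(cong(coeff p d *_)(supp-X^ d n q))(zeroʳ _))(above d n(<⇒≤ q)))(+-identityʳ 0#))
   below : ∀ d n -> n < d -> coeff(S d)n ≡ coeff p n
   below(suc d)n q with n N.≟ d
   ... | yes E.refl = E.trans(step d d)(E.trans(cong₂ _+_(E.trans(cong(coeff p d *_)(top d))(*-identityʳ _))(above d d ≤-refl))(+-identityʳ _))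
   ... | no ne = E.trans(step d n)(E.trans(cong₂ _+_(E.trans(cong(coeff p d *_)(low d n n<d))(zeroʳ _))(below d n n<d))(+-identityˡ _))
    where n<d = ≤∧≢⇒<(≤-pred q)ne
   go : ∀ n -> coeff p n ≡ coeff(S d)n
   go n with n N.<? d
   ... | yes q = E.sym(below d n q)
   ... | no q = E.trans(s n(≮⇒≥ q))(E.sym(above d n(≮⇒≥ q)))

  module AtPoint (z : Carrier) where
   V : Poly
   V = X- z

   module A = Congruence F V
   module B = Congruence F (V ^ᴾ r)

   const-zero : ∀{c}-> C c A.~ P.0# -> c ≡ 0#
   const-zero{c}(q , e)= E.trans(at e' 0)(E.trans(at(P.*-congˡ{V}q≋0)0)(E.trans(at(P.zeroʳ V)0)(coeff-0 0)))
    where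
    e' : C c ≋ V P.* q
    e' = P.trans(PK.solve 1(\c -> c PK.:= c PK.:- PK.con 0)P.refl(C c))e
    q≋0 : q ≋ P.0#
    q≋0 = mk \n -> E.trans(supp-divide z q 1(supp-≋ e'(supp-C c))n z≤n)(E.sym(coeff-0 n))

   X~z : X A.~ C z
   X~z = P.1# , P.sym(P.*-identityʳ V)

   u~uz : u A.~ C(uz z)
   u~uz = A.~-trans(A.~-*(A.~-+ X~z A.~-refl)(A.~-+ X~z A.~-refl))
    (A.≋⇒~(P.sym(P.trans(C-* _ _)(P.*-cong(C-+ z 1#)(C-+ z κ)))))

   C-C* : ∀{f f' c c'}-> f A.~ C c -> f' A.~ C c' -> f P.* f' A.~ C(c * c')
   C-C* p q = A.~-trans(A.~-* p q)(A.≋⇒~(P.sym(C-* _ _)))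

   C-^~ : ∀{f c}n -> f A.~ C c -> f ^ᴾ n A.~ C(c ^ n)
   C-^~ n p = A.~-trans(A.~-^ n p)(A.≋⇒~(P.sym(C-^ _ n)))

   t~τ : ∀ f ρ -> t f ρ A.~ C(τ z f ρ)
   t~τ zero zero = A.~-refl
   t~τ zero(suc ρ)= A.~-refl
   t~τ(suc f)zero = C-C* X~z(t~τ f zero)
   t~τ(suc f)(suc ρ)= A.~-trans(A.~-+(C-C* X~z(t~τ f(suc ρ)))(t~τ f ρ))(A.≋⇒~(P.sym(C-+ _ _)))

   wz : ℕ -> Carrier
   wz ℓ = g ^ i* ℓ *(z ^(jj ℓ N.+ m N.* i* ℓ)* uz z ^(m N.* ii ℓ))

   w~wz : ∀ ℓ -> w ℓ A.~ C(wz ℓ)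
   w~wz ℓ = C-C* A.~-refl(C-C*(C-^~(jj ℓ N.+ m N.* i* ℓ)X~z)(C-^~(m N.* ii ℓ)u~uz))

   e :(ℕ -> Carrier)-> ℕ -> Carrier
   e α ρ = K.Ʃ(rng L)(\ ℓ -> wz ℓ * K.Ʃ(rng Bd)(\f -> coeff(b α ℓ)f * τ z f ρ))

   Ep~e : ∀ α ρ -> Ep α ρ A.~ C(e α ρ)
   Ep~e α ρ = A.~-trans(A.~-Ʃ(rng L)\ ℓ -> C-C*(w~wz ℓ)(A.~-trans(A.~-Ʃ(rng Bd)\f -> C-C* A.~-refl(t~τ f ρ))
    (A.≋⇒~(P.sym(C-Ʃ(rng Bd)_)))))(A.≋⇒~(P.sym(C-Ʃ(rng L)_)))

   e≡0 : ∀ α ρ -> Ep α ρ ≋ P.0# -> e α ρ ≡ 0#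
   e≡0 α ρ p = const-zero(A.~-trans(A.~-sym(Ep~e α ρ))(A.≋⇒~ p))

   S : ℕ -> ℕ -> Poly
   S n f = PK.Ʃ(rng n)(\ρ -> C(τ z f ρ)P.* V ^ᴾ ρ)

   over : ℕ -> ℕ -> Poly
   over f zero = P.0#
   over f(suc n)= C(τ z f n)P.* V ^ᴾ suc n

   S-step : ∀ f n -> X P.* S n f ≋ S n(suc f)P.+ over f n
   S-step f zero = P.trans(P.zeroʳ X)(P.sym(P.+-identityʳ P.0#))
   S-step f(suc n)= P.trans(P.distribˡ X _ _)(P.trans(P.+-congˡ(S-step f n))(last n))
    where
    last : ∀ n -> X P.*(C(τ z f n)P.* V ^ᴾ n)P.+(S n(suc f)P.+ over f n)≋ S(suc n)(suc f)P.+ over f(suc n)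
    last zero = P.trans
     (PK.solve 5(\x c d v s -> x PK.:*(d PK.:* v)PK.:+(s PK.:+ PK.con 0)PK.:=
       ((c PK.:* d)PK.:* v PK.:+ s)PK.:+ d PK.:*((x PK.:- c)PK.:* v))P.refl X(C z)(C(τ z f 0))(V ^ᴾ 0)(S 0(suc f)))
     (P.+-congʳ(P.+-congʳ(P.*-congʳ(P.sym(C-* z(τ z f 0))))))
    last(suc n)= P.trans
     (PK.solve 6(\x c d v s e -> x PK.:*(d PK.:* v)PK.:+(s PK.:+ e PK.:* v)PK.:=
       ((c PK.:* d PK.:+ e)PK.:* v PK.:+ s)PK.:+ d PK.:*((x PK.:- c)PK.:* v))P.refl X(C z)(C(τ z f(suc n)))(V ^ᴾ suc n)(S(suc n)(suc f))(C(τ z f n)))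
     (P.+-congʳ(P.+-congʳ(P.*-congʳ(P.sym(P.trans(C-+ _ _)(P.+-congʳ(C-* z(τ z f(suc n)))))))))

   over~0 : ∀ f n ->(V ^ᴾ n)∣ᴾ over f n
   over~0 f zero = P.0# , P.sym(P.zeroʳ _)
   over~0 f(suc n)= C(τ z f n), P.*-comm _ _

   S-0 : ∀ n -> S(suc n)0 ≋ P.1#
   S-0 zero = P.trans(P.+-identityʳ _)(P.trans(P.*-identityʳ _)C-1#)
   S-0(suc n)= P.trans(P.+-cong(P.trans(P.*-congʳ C-0)(P.zeroˡ _))(S-0 n))(P.+-identityˡ _)

   X^~S : ∀{n}-> r ≡ suc n -> ∀ f -> X ^ᴾ f B.~ S r f
   X^~S{n}r≡ zero = B.≋⇒~(P.sym(subst(\k -> S k 0 ≋ P.1#)(E.sym r≡)(S-0 n)))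
   X^~S{n}r≡(suc f)= B.~-trans(B.~-*(B.~-refl{X})(X^~S r≡ f))(B.~-trans(B.≋⇒~(S-step f r))
    (B.~-trans(B.~-+(B.~-refl{S r(suc f)})(proj₁(over~0 f r), P.trans(PK.solve 1(\a -> a PK.:- PK.con 0 PK.:= a)P.refl(over f r))(proj₂(over~0 f r))))
    (B.≋⇒~(P.+-identityʳ _))))

  supp-t : ∀ f ρ -> Supp(suc f)(coeff(t f ρ))
  supp-t zero zero = supp-C 1#
  supp-t zero(suc ρ)= supp-C 0#
  supp-t(suc f)zero = supp-mulᴾ supp-X(supp-t f zero)
  supp-t(suc f)(suc ρ)= supp-addᴾ(supp-mulᴾ supp-X(supp-t f(suc ρ)))(supp-≤(n≤1+n _)(supp-t f ρ))

  module _ (r≡ : r ≡ suc (I N.* m)) (1≤m : 1 ≤ m) (1≤I' : 1 ≤ I') where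
   ii≤I' : ∀ ℓ -> ii ℓ ≤ I'
   ii≤I' ℓ = ≤-pred(N.m%n<n ℓ I)

   ii+i* : ∀ ℓ -> ii ℓ N.+ i* ℓ ≡ I'
   ii+i* ℓ = m+[n∸m]≡n(ii≤I' ℓ)

   ℓ≡ : ∀ ℓ -> ℓ ≡ ii ℓ N.+ jj ℓ N.* I
   ℓ≡ ℓ = N.m≡m%n+[m/n]*n ℓ I

   jj<J : ∀{ℓ}-> ℓ < L -> jj ℓ < J
   jj<J p = N.m<n*o⇒m/o<n p

   open +-*-Solver using () renaming (solve to solveℕ; _:=_ to _:≡_; _:+_ to _⊞_; _:*_ to _⊠_; con to conℕ)

   MI≡ : suc(M N.* I)≡ Q
   MI≡ = begin
    _ ≡⟨ solveℕ 3(\m r i -> conℕ 1 ⊞(m ⊞ r ⊠ m)⊠ i :≡ conℕ 1 ⊞ i ⊠ m ⊞ r ⊠(i ⊠ m))E.refl m r I ⟩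
    _ ≡⟨ cong(N._+ r N.*(I N.* m))(E.sym r≡)⟩
    _ ≡⟨ E.sym(*-suc r(I N.* m))⟩
    _ ≡⟨ cong(r N.*_)(E.sym r≡)⟩
    _ ∎
    where open E.≡-Reasoning

   E≡ : ∀ ℓ -> E ℓ ≡ Q N.* jj ℓ N.+ M N.* ii ℓ
   E≡ ℓ = begin
    _ ≡⟨ cong(\x -> M N.* x N.+ jj ℓ)(ℓ≡ ℓ)⟩
    _ ≡⟨ solveℕ 4(\M i j k -> M ⊠(i ⊞ j ⊠ k)⊞ j :≡(conℕ 1 ⊞ M ⊠ k)⊠ j ⊞ M ⊠ i)E.refl M(ii ℓ)(jj ℓ)I ⟩
    _ ≡⟨ cong(\x -> x N.* jj ℓ N.+ M N.* ii ℓ)MI≡ ⟩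
    _ ∎
    where open E.≡-Reasoning

   open N.≤-Reasoning

   Im≤r : I N.* m ≤ r
   Im≤r = ≤-trans(n≤1+n _)(≡⇒≤(E.sym r≡))

   1+2m≤r : suc(2 N.* m)≤ r
   1+2m≤r = begin _ ≤⟨ s≤s(*-monoˡ-≤ m(s≤s 1≤I'))⟩ _ ≡⟨ E.sym r≡ ⟩ r ∎

   3≤r : 3 ≤ r
   3≤r = ≤-trans(s≤s(*-monoʳ-≤ 2 1≤m))1+2m≤r

   1≤M : 1 ≤ M
   1≤M = ≤-trans 1≤m(m≤m+n m _)

   -- deg contributions of the two factors with exponents n·ii and n·i*
   two-powers : ∀ n ℓ -> n N.* ii ℓ N.+ n N.* i* ℓ N.* 2 ≤ 2 N.*(I' N.* n)
   two-powers n ℓ = begin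
    _ ≤⟨ +-monoˡ-≤ _(m≤m+n(n N.* ii ℓ)_)⟩
    _ ≡⟨ solveℕ 3(\n i k -> n ⊠ i ⊞ n ⊠ i ⊞ n ⊠ k ⊠ conℕ 2 :≡ conℕ 2 ⊠((i ⊞ k)⊠ n))E.refl n(ii ℓ)(i* ℓ)⟩
    _ ≡⟨ cong(\x -> 2 N.*(x N.* n))(ii+i* ℓ)⟩
    _ ∎

   I'm≤r : I' N.* m ≤ r
   I'm≤r = ≤-trans(*-monoˡ-≤ m(n≤1+n I'))Im≤r

   supp-a : ∀ α ℓ -> Supp(suc(N.pred M))(coeff(a α ℓ))
   supp-a α ℓ = subst(\d -> Supp d(coeff(a α ℓ)))(E.sym(suc-pred M{{N.>-nonZero 1≤M}}))(supp(a α ℓ))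

   supp-term : ∀ α ℓ n k -> Supp(M N.+(k N.+ n N.* 2))(coeff(a α ℓ P.*(X ^ᴾ k P.* u ^ᴾ n)))
   supp-term α ℓ n k = subst(\d -> Supp(d N.+(k N.+ n N.* 2))(coeff(a α ℓ P.*(X ^ᴾ k P.* u ^ᴾ n))))(suc-pred M{{N.>-nonZero 1≤M}})
    (supp-mulᴾ(supp-a α ℓ)(supp-mulᴾ(supp-X^ k)(supp-^ n supp-u)))

   supp-b : ∀ α ℓ -> Supp Bd(coeff(b α ℓ))
   supp-b α ℓ = supp-≤(+-monoʳ-≤ M(≤-trans(two-powers m ℓ)(*-monoʳ-≤ 2 I'm≤r)))(supp-term α ℓ(m N.* i* ℓ)(m N.* ii ℓ))

   supp-Ep : ∀ α ρ -> Supp Δ(coeff(Ep α ρ))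
   supp-Ep α ρ = supp-Ʃ(rng L)\{ℓ}ℓ∈ -> supp-≤(deg≤ ℓ(jj<J(∈-rng⁻ ℓ∈)))
    (supp-mulᴾ{b = N.pred Bd}(supp-mulᴾ(supp-C _)(supp-mulᴾ(supp-X^(jj ℓ N.+ m N.* i* ℓ))(supp-^(m N.* ii ℓ)supp-u)))
     (subst(\d -> Supp d(coeff(inner ℓ)))(E.sym Bd≡)(supp-Ʃ(rng Bd)\{f}f∈ -> supp-≤(∈-rng⁻ f∈)(supp-mulᴾ(supp-C _)(supp-t f ρ)))))
    where
    inner : ℕ -> Poly
    inner ℓ = PK.Ʃ(rng Bd)(\f -> C(coeff(b α ℓ)f)P.* t f ρ)
    Bd≡ : suc(N.pred Bd)≡ Bd
    Bd≡ = suc-pred Bd{{N.>-nonZero(≤-trans 1≤M(m≤m+n M _))}}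
    deg≤ : ∀ ℓ -> jj ℓ < J -> suc((jj ℓ N.+ m N.* i* ℓ N.+ m N.* ii ℓ N.* 2)N.+ N.pred Bd)≤ Δ
    deg≤ ℓ p = begin
     _ ≡⟨ E.trans(E.sym(+-suc _ _))(cong(jj ℓ N.+ m N.* i* ℓ N.+ m N.* ii ℓ N.* 2 N.+_)Bd≡)⟩
     _ ≤⟨ +-monoˡ-≤ Bd(+-monoˡ-≤(m N.* ii ℓ N.* 2)(+-mono-≤(<⇒≤ p)(m≤m+n _(m N.* i* ℓ))))⟩
     _ ≡⟨ solveℕ 6(\J m k i M r ->(J ⊞(m ⊠ k ⊞ m ⊠ k)⊞ m ⊠ i ⊠ conℕ 2)⊞(M ⊞ conℕ 2 ⊠ r):≡ M ⊞ J ⊞(conℕ 2 ⊠((i ⊞ k)⊠ m)⊞ conℕ 2 ⊠ r))E.refl J m(i* ℓ)(ii ℓ)M r ⟩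
     _ ≤⟨ +-monoʳ-≤(M N.+ J)(+-monoˡ-≤(2 N.* r)(*-monoʳ-≤ 2(subst(\x -> x N.* m ≤ r)(E.sym(ii+i* ℓ))I'm≤r)))⟩
     _ ≡⟨ solveℕ 2(\a r -> a ⊞(conℕ 2 ⊠ r ⊞ conℕ 2 ⊠ r):≡ a ⊞ conℕ 4 ⊠ r)E.refl(M N.+ J)r ⟩
     Δ ∎

   supp-Ψ : ∀ α -> Supp(Q N.* suc J)(coeff(Ψ α))
   supp-Ψ α = supp-Ʃ(rng L)\{ℓ}ℓ∈ -> supp-≤(deg≤ ℓ(jj<J(∈-rng⁻ ℓ∈)))(supp-term α ℓ(M N.* i* ℓ)(E ℓ))
    where
    deg≤ : ∀ ℓ -> jj ℓ < J -> M N.+(E ℓ N.+ M N.* i* ℓ N.* 2)≤ Q N.* suc J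
    deg≤ ℓ p = begin
     _ ≡⟨ cong(\x -> M N.+(x N.+ M N.* i* ℓ N.* 2))(E≡ ℓ)⟩
     _ ≡⟨ solveℕ 4(\M x y z -> M ⊞(x ⊞ y ⊞ z):≡ x ⊞(M ⊞(y ⊞ z)))E.refl M(Q N.* jj ℓ)(M N.* ii ℓ)(M N.* i* ℓ N.* 2)⟩
     _ ≤⟨ +-monoʳ-≤(Q N.* jj ℓ)(+-mono-≤(m≤m+n M(M N.+ 0))(two-powers M ℓ))⟩
     _ ≡⟨ solveℕ 3(\x M i -> x ⊞(conℕ 2 ⊠ M ⊞ conℕ 2 ⊠(i ⊠ M)):≡ x ⊞ conℕ 2 ⊠(M ⊠(conℕ 1 ⊞ i)))E.refl(Q N.* jj ℓ)M I' ⟩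
     _ ≤⟨ +-monoʳ-≤(Q N.* jj ℓ)(*-monoʳ-≤ 2(≤-trans(n≤1+n _)(≡⇒≤ MI≡)))⟩
     _ ≡⟨ solveℕ 2(\q j -> q ⊠ j ⊞ conℕ 2 ⊠ q :≡ q ⊠(conℕ 2 ⊞ j))E.refl Q(jj ℓ)⟩
     _ ≤⟨ *-monoʳ-≤ Q(s≤s p)⟩
     _ ∎

   count : r N.* Δ < L N.* M
   count = N.+-cancelʳ-< J(r N.* Δ)(L N.* M)(begin-strict
    _ ≡⟨ solveℕ 2(\m r -> r ⊠((m ⊞ r ⊠ m)⊞(m ⊞ conℕ 10)⊞ conℕ 4 ⊠ r)⊞(m ⊞ conℕ 10):≡
        m ⊠(r ⊠ r)⊞(conℕ 2 ⊠ m ⊠ r ⊞ m ⊞ conℕ 10 ⊠ r ⊞ conℕ 10 ⊞ conℕ 4 ⊠(r ⊠ r)))E.refl m r ⟩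
    _ <⟨ N.+-monoʳ-<(m N.* Q)(+-monoˡ-<(4 N.* Q)small)⟩
    _ ≡⟨ solveℕ 2(\m q -> m ⊠ q ⊞(conℕ 6 ⊠ q ⊞ conℕ 4 ⊠ q):≡(m ⊞ conℕ 10)⊠ q)E.refl m Q ⟩
    _ ≡⟨ cong(J N.*_)(E.sym MI≡)⟩
    _ ≡⟨ solveℕ 3(\J M I -> J ⊠(conℕ 1 ⊞ M ⊠ I):≡ J ⊠ I ⊠ M ⊞ J)E.refl J M I ⟩
    _ ∎)
    where
    m≤r : m ≤ r
    m≤r = ≤-trans(N.m≤n*m m I)Im≤r
    tail-bound : 10 N.* r N.+ 11 ≤ 5 N.* Q
    tail-bound with r | 3≤r
    ... | suc(suc(suc k))| _ = begin
     _ ≤⟨ m≤m+n _(4 N.+ 20 N.* k N.+ 5 N.*(k N.* k))⟩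
     _ ≡⟨ solveℕ 1(\k -> conℕ 10 ⊠(conℕ 3 ⊞ k)⊞ conℕ 11 ⊞(conℕ 4 ⊞ conℕ 20 ⊠ k ⊞ conℕ 5 ⊠(k ⊠ k)):≡ conℕ 5 ⊠((conℕ 3 ⊞ k)⊠(conℕ 3 ⊞ k)))E.refl k ⟩
     _ ∎
    tail-bound | suc zero | s≤s ()
    tail-bound | suc(suc zero)| s≤s(s≤s ())
    small : 2 N.* m N.* r N.+ m N.+ 10 N.* r N.+ 10 < 6 N.* Q
    small = begin-strict
     _ ≤⟨ +-monoˡ-≤ 10(+-monoˡ-≤(10 N.* r)(+-monoʳ-≤(2 N.* m N.* r)m≤r))⟩
     _ ≡⟨ solveℕ 2(\m r -> conℕ 2 ⊠ m ⊠ r ⊞ r ⊞ conℕ 10 ⊠ r ⊞ conℕ 10 :≡(conℕ 1 ⊞ conℕ 2 ⊠ m)⊠ r ⊞(conℕ 10 ⊠ r ⊞ conℕ 10))E.refl m r ⟩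
     _ <⟨ N.+-mono-≤-<(*-monoˡ-≤ r 1+2m≤r)(≤-trans(≡⇒≤(E.sym(+-suc(10 N.* r)10)))tail-bound)⟩
     _ ∎

   E-gap : ∀{ℓ ℓ'}-> ℓ < ℓ' -> M N.+ E ℓ ≤ E ℓ'
   E-gap{ℓ}{ℓ'}p = begin
    _ ≡⟨ solveℕ 3(\M l j -> M ⊞(M ⊠ l ⊞ j):≡ M ⊠(conℕ 1 ⊞ l)⊞ j)E.refl M ℓ(jj ℓ)⟩
    _ ≤⟨ +-mono-≤(*-monoʳ-≤ M p)(N./-monoˡ-≤ I(<⇒≤ p))⟩
    _ ∎

   Ʃ-single : ∀ n(f : ℕ -> Carrier){ℓ}-> ℓ < n ->(∀ ℓ' -> ℓ' < n -> ℓ' ≢ ℓ -> f ℓ' ≡ 0#)-> K.Ʃ(rng n)f ≡ f ℓ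
   Ʃ-single(suc n)f{ℓ}p h with n N.≟ ℓ
   ... | yes E.refl = E.trans(cong(\x -> f n + x)(K.Ʃ-≈0(rng n)\{x}x∈ -> h x(m<n⇒m<1+n(∈-rng⁻ x∈))(<⇒≢(∈-rng⁻ x∈))))(+-identityʳ _)
   ... | no ne = E.trans(cong₂ _+_(h n ≤-refl ne)(Ʃ-single n f(≤∧≢⇒<(≤-pred p)(ne ∘ E.sym))\ ℓ' q -> h ℓ'(m<n⇒m<1+n q)))(+-identityˡ _)

   mul-first : ∀ f c n ->(∀ i -> i < n -> f i ≡ 0#)-> mul f c n ≡ f n * c 0
   mul-first f c zero h = E.refl
   mul-first f c(suc n)h = E.trans(cong₂ _+_(E.trans(cong(_* c(suc n))(h 0(s≤s z≤n)))(zeroˡ _))(mul-first(tail f)c n(\i p -> h(suc i)(s≤s p))))(+-identityˡ _)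

   module Nonvanishing (κ≢0 : κ ≢ 0#) (α : ℕ -> Carrier) (Ψ≋0 : Ψ α ≋ P.0#) where
    c : ℕ -> Poly
    c ℓ = u ^ᴾ(M N.* i* ℓ)

    c0≢0 : ∀ n -> coeff(u ^ᴾ n)0 ≢ 0#
    c0≢0 zero = subst(_≢ 0#)(at C-1# 0)1≢0
    c0≢0(suc n)= subst(_≢ 0#)(E.sym(coeff-* u(u ^ᴾ n)0))(*-nonzero(subst(_≢ 0#)(E.sym u0)(*-nonzero 1≢0 κ≢0))(c0≢0 n))
     where
     u0 : coeff u 0 ≡ 1# * κ
     u0 = E.trans(coeff-* _ _ 0)(cong₂ _*_(E.trans(coeff-+ X(C 1#)0)(+-identityˡ _))(E.trans(coeff-+ X(C κ)0)(+-identityˡ _)))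

    T≋ : ∀ ℓ -> T α ℓ ≋ X ^ᴾ E ℓ P.*(a α ℓ P.* c ℓ)
    T≋ ℓ = PK.solve 3(\a x c -> a PK.:*(x PK.:* c)PK.:= x PK.:*(a PK.:* c))P.refl(a α ℓ)(X ^ᴾ E ℓ)(c ℓ)

    low : ∀ ℓ ->(∀ e -> e < M -> coeff(a α ℓ P.* c ℓ)e ≡ 0#)-> ∀ e -> e < M -> coeff(a α ℓ)e ≡ 0#
    low ℓ h e = ℕI.<-rec(\e -> e < M -> coeff(a α ℓ)e ≡ 0#)step e
     where
     step : ∀ e ->(∀{i}-> i < e -> i < M -> coeff(a α ℓ)i ≡ 0#)-> e < M -> coeff(a α ℓ)e ≡ 0#
     step e ih p with *-zero(E.trans(E.sym(E.trans(coeff-*(a α ℓ)(c ℓ)e)(mul-first _(coeff(c ℓ))e(\i q -> ih q(<-trans q p)))))(h e p))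
     ... | inj₁ q = q
     ... | inj₂ q = contradiction q(c0≢0(M N.* i* ℓ))

    vanish : ∀ ℓ -> ℓ < L -> ∀ e -> e < M -> coeff(a α ℓ)e ≡ 0#
    vanish ℓ = ℕI.<-rec(\ ℓ -> ℓ < L -> ∀ e -> e < M -> coeff(a α ℓ)e ≡ 0#)step ℓ
     where
     step : ∀ ℓ ->(∀{i}-> i < ℓ -> i < L -> ∀ e -> e < M -> coeff(a α i)e ≡ 0#)-> ℓ < L -> ∀ e -> e < M -> coeff(a α ℓ)e ≡ 0#
     step ℓ ih ℓ<L = low ℓ \e e<M -> E.trans(E.sym(coeff-X^-+(E ℓ)(a α ℓ P.* c ℓ)e))(E.trans(E.sym(at(T≋ ℓ)(E ℓ N.+ e)))
       (E.trans(E.sym(E.trans(coeff-Ʃ(rng L)(T α)(E ℓ N.+ e))(Ʃ-single L _ ℓ<L(other e e<M))))(E.trans(at Ψ≋0 _)(coeff-0 _))))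
      where
      other : ∀ e -> e < M -> ∀ ℓ' -> ℓ' < L -> ℓ' ≢ ℓ -> coeff(T α ℓ')(E ℓ N.+ e)≡ 0#
      other e e<M ℓ' ℓ'<L ne with N.<-cmp ℓ' ℓ
      ... | tri≈ _ q _ = contradiction q ne
      ... | tri> _ _ q = E.trans(at(T≋ ℓ')_)(coeff-X^-<(E ℓ')_ _(<-≤-trans(N.+-monoʳ-<(E ℓ)e<M)(≤-trans(≡⇒≤(N.+-comm(E ℓ)M))(E-gap q))))
      ... | tri< q _ _ = E.trans(at(P.*-congʳ{X ^ᴾ E ℓ' P.* c ℓ'}a≋0)_)(E.trans(at(P.zeroˡ _)_)(coeff-0 _))
       where
       a≋0 : a α ℓ' ≋ P.0#
       a≋0 = mk \n -> E.trans(value n)(E.sym(coeff-0 n))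
        where
        value : ∀ n -> coeff(a α ℓ')n ≡ 0#
        value n with n N.<? M
        ... | yes p = E.trans(E.sym(a-< α ℓ' p))(ih q ℓ'<L n p)
        ... | no p = E.refl

    α≡0 : ∀ i -> i < L N.* M -> α i ≡ 0#
    α≡0 i p = E.trans(cong α(N.m≡m%n+[m/n]*n i M))(E.trans(E.sym(a-< α(i / M)(N.m%n<n i M)))(vanish(i / M)(N.m<n*o⇒m/o<n p)(i % M)(N.m%n<n i M)))
     where instance _ = N.>-nonZero 1≤M

   module Vanishing (r^ : size ≡ Q) (prime : Prime (suc I)) (char : K.⟨ suc I ⟩ ≡ 0#) (z : Carrier) (z≢0 : z ≢ 0#) (uz≢0 : uz z ≢ 0#) (curve : uz z ^ M ≡ g * z ^ M) where
    open AtPoint z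
    module PM = Multiples polyRing
    open Frobenius P.commutativeSemiring
    import Algebra.Properties.CommutativeSemiring.Exp P.commutativeSemiring as PE

    ⟨⟩-C : ∀ n -> PK.⟨ n ⟩ ≋ C K.⟨ n ⟩
    ⟨⟩-C zero = P.sym C-0
    ⟨⟩-C(suc n)= P.trans(P.+-cong(P.sym C-1#)(⟨⟩-C n))(P.sym(C-+ _ _))

    frob : ∀ f g ->(f P.+ g)^ᴾ r ≋ f ^ᴾ r P.+ g ^ᴾ r
    frob = frobenius-^ prime(\x -> P.trans(PM.×≈⟨⟩*(suc I)x)(P.trans(P.*-congʳ(P.trans(⟨⟩-C(suc I))(P.trans(C-cong char)C-0)))(P.zeroˡ x)))h

    zr ur : Carrier
    zr = z ^ r
    ur = uz z ^ r

    X^r~ : X ^ᴾ r B.~ C zr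
    X^r~ = P.1# , P.trans(P.+-cong(P.trans(^ᴾ-congˡ r(PK.solve 2(\x c -> x PK.:=(x PK.:- c)PK.:+ c)P.refl X(C z)))(frob V(C z)))(P.-‿cong(C-^ z r)))
     (PK.solve 2(\v c ->(v PK.:+ c)PK.:- c PK.:= v)P.refl(V ^ᴾ r)(C z ^ᴾ r)⟪ P.sym(P.*-identityʳ _))
     where
     _⟪_ : ∀{a b c}-> a ≋ b -> b ≋ c -> a ≋ c
     _⟪_ = P.trans

    u^r~ : u ^ᴾ r B.~ C ur
    u^r~ = W ^ᴾ r , P.trans(P.+-cong(P.trans(^ᴾ-congˡ r u≋)(frob(V P.* W)(C(uz z))))(P.-‿cong(C-^(uz z)r)))
     (P.trans(PK.solve 2(\v c ->(v PK.:+ c)PK.:- c PK.:= v)P.refl((V P.* W)^ᴾ r)(C(uz z)^ᴾ r))(PE.^-distrib-* V W r))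
     where
     W = X P.+ C z P.+ C 1# P.+ C κ
     u≋ : u ≋ V P.* W P.+ C(uz z)
     u≋ = P.trans(PK.solve 4(\x z o k ->(x PK.:+ o)PK.:*(x PK.:+ k)PK.:=(x PK.:- z)PK.:*(x PK.:+ z PK.:+ o PK.:+ k)PK.:+(z PK.:+ o)PK.:*(z PK.:+ k))P.refl X(C z)(C 1#)(C κ))
      (P.+-congˡ(P.sym(P.trans(C-* _ _)(P.*-cong(C-+ z 1#)(C-+ z κ)))))

    C^~ : ∀{f c}n -> f B.~ C c -> f ^ᴾ n B.~ C(c ^ n)
    C^~ n p = B.~-trans(B.~-^ n p)(B.≋⇒~(P.sym(C-^ _ n)))

    split : ∀ f i -> f ^ᴾ(M N.* i)≋(f ^ᴾ r)^ᴾ(m N.* i)P.* f ^ᴾ(m N.* i)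
    split f i = P.trans(P.reflexive(cong(f ^ᴾ_)(solveℕ 3(\m r i ->(m ⊞ r ⊠ m)⊠ i :≡ r ⊠(m ⊠ i)⊞ m ⊠ i)E.refl m r i)))
     (P.trans(^ᴾ-homo-* f(r N.*(m N.* i))(m N.* i))(P.*-congʳ(P.sym(^ᴾ-assocʳ f r(m N.* i)))))

    X^Q~ : X ^ᴾ Q B.~ C z
    X^Q~ = B.~-trans(B.≋⇒~(P.sym(^ᴾ-assocʳ X r r)))(B.~-trans(C^~ r X^r~)(B.≋⇒~(C-cong(E.trans(^-assocʳ z r r)(E.trans(cong(z ^_)(E.sym r^))(fermat' z))))))

    w₀ w₁ : Carrier
    w₀ = z ^(m N.* I')* uz z ^(m N.* I')
    w₁ = z ^(M N.* I')

    ^-nonzero : ∀{x}n -> x ≢ 0# -> x ^ n ≢ 0#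
    ^-nonzero zero p = 1≢0
    ^-nonzero(suc n)p = *-nonzero p(^-nonzero n p)

    scalar : ℕ -> Carrier
    scalar ℓ = z ^ jj ℓ *(zr ^(m N.* ii ℓ)* ur ^(m N.* i* ℓ))

    T~ : ∀ α ℓ -> T α ℓ B.~ C(scalar ℓ)P.* b α ℓ
    T~ α ℓ = B.~-trans(B.~-*(B.~-refl{a α ℓ})(B.~-* X-part U-part))(B.≋⇒~ collect)
     where
     X-part : X ^ᴾ E ℓ B.~ C(z ^ jj ℓ)P.*(C(zr ^(m N.* ii ℓ))P.* X ^ᴾ(m N.* ii ℓ))
     X-part = B.~-trans(B.≋⇒~(P.trans(P.reflexive(cong(X ^ᴾ_)(E≡ ℓ)))(P.trans(^ᴾ-homo-* X(Q N.* jj ℓ)(M N.* ii ℓ))(P.*-cong(P.sym(^ᴾ-assocʳ X Q(jj ℓ)))(split X(ii ℓ))))))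
      (B.~-*(C^~(jj ℓ)X^Q~)(B.~-*(C^~(m N.* ii ℓ)X^r~)(B.~-refl{X ^ᴾ(m N.* ii ℓ)})))
     U-part : u ^ᴾ(M N.* i* ℓ)B.~ C(ur ^(m N.* i* ℓ))P.* u ^ᴾ(m N.* i* ℓ)
     U-part = B.~-trans(B.≋⇒~(split u(i* ℓ)))(B.~-*(C^~(m N.* i* ℓ)u^r~)(B.~-refl{u ^ᴾ(m N.* i* ℓ)}))
     collect : a α ℓ P.*((C(z ^ jj ℓ)P.*(C(zr ^(m N.* ii ℓ))P.* X ^ᴾ(m N.* ii ℓ)))P.*(C(ur ^(m N.* i* ℓ))P.* u ^ᴾ(m N.* i* ℓ)))≋ C(scalar ℓ)P.* b α ℓ
     collect = P.trans(PK.solve 6(\a j k x l y -> a PK.:*((j PK.:*(k PK.:* x))PK.:*(l PK.:* y))PK.:=(j PK.:*(k PK.:* l))PK.:*(a PK.:*(x PK.:* y)))P.refl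
       (a α ℓ)(C(z ^ jj ℓ))(C(zr ^(m N.* ii ℓ)))(X ^ᴾ(m N.* ii ℓ))(C(ur ^(m N.* i* ℓ)))(u ^ᴾ(m N.* i* ℓ)))
      (P.*-congʳ(P.sym(P.trans(C-* _ _)(P.*-congˡ(C-* _ _)))))

    splitᶜ : ∀ x i -> x ^(M N.* i)≡(x ^ r)^(m N.* i)* x ^(m N.* i)
    splitᶜ x i = E.trans(cong(x ^_)(solveℕ 3(\m r i ->(m ⊞ r ⊠ m)⊠ i :≡ r ⊠(m ⊠ i)⊞ m ⊠ i)E.refl m r i))
     (E.trans(^-homo-* x(r N.*(m N.* i))(m N.* i))(cong(_* x ^(m N.* i))(E.sym(^-assocʳ x r(m N.* i)))))

    scalar≡ : ∀ ℓ -> w₀ * scalar ℓ ≡ w₁ * wz ℓ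
    scalar≡ ℓ = eqs
     where
     A = m N.* ii ℓ
     Bx = m N.* i* ℓ
     mI' : m N.* I' ≡ A N.+ Bx
     mI' = E.trans(cong(m N.*_)(E.sym(ii+i* ℓ)))(N.*-distribˡ-+ m(ii ℓ)(i* ℓ))
     key : ur ^ Bx * uz z ^ Bx ≡ g ^ i* ℓ *(zr ^ Bx * z ^ Bx)
     key = E.trans(E.sym(splitᶜ(uz z)(i* ℓ)))(E.trans(E.sym(^-assocʳ(uz z)M(i* ℓ)))(E.trans(cong(_^ i* ℓ)curve)
      (E.trans(^-distrib-* g(z ^ M)(i* ℓ))(cong(\x -> g ^ i* ℓ * x)(E.trans(^-assocʳ z M(i* ℓ))(splitᶜ z(i* ℓ)))))))
     pw : ∀ x -> x ^(m N.* I')≡ x ^ A * x ^ Bx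
     pw x = E.trans(cong(x ^_)mI')(^-homo-* x A Bx)
     w₁≡ : w₁ ≡(zr ^ A * zr ^ Bx)*(z ^ A * z ^ Bx)
     w₁≡ = E.trans(splitᶜ z I')(cong₂ _*_(pw zr)(pw z))
     eqs : w₀ * scalar ℓ ≡ w₁ * wz ℓ
     eqs = E.trans(cong(_* scalar ℓ)(cong₂ _*_(pw z)(pw(uz z))))
      (E.trans(solve 8(\za zb ua ub j ra rb lb ->((za :* zb):*(ua :* ub)):*(j :*(ra :* lb)):=(lb :* ub):*(za :* zb :* ua :* j :* ra))E.refl
        (z ^ A)(z ^ Bx)(uz z ^ A)(uz z ^ Bx)(z ^ jj ℓ)(zr ^ A)(zr ^ Bx)(ur ^ Bx))
      (E.trans(cong(_*(z ^ A * z ^ Bx * uz z ^ A * z ^ jj ℓ * zr ^ A))key)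
      (E.trans(solve 7(\za zb ua j ra rb G ->(G :*(rb :* zb)):*(za :* zb :* ua :* j :* ra):=((ra :* rb):*(za :* zb)):*(G :*((j :* zb):* ua)))E.refl
        (z ^ A)(z ^ Bx)(uz z ^ A)(z ^ jj ℓ)(zr ^ A)(zr ^ Bx)(g ^ i* ℓ))
      (E.sym(cong₂ _*_ w₁≡(cong(\x -> g ^ i* ℓ *(x * uz z ^ A))(^-homo-* z(jj ℓ)Bx)))))))

    b~ : ∀ α ℓ -> b α ℓ B.~ PK.Ʃ(rng Bd)(\f -> C(coeff(b α ℓ)f)P.* S r f)
    b~ α ℓ = B.~-trans(B.≋⇒~(expand Bd(b α ℓ)(supp-b α ℓ)))(B.~-Ʃ(rng Bd)\f -> B.~-*(B.~-refl{C(coeff(b α ℓ)f)})(X^~S r≡ f))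

    regroup : ∀ α -> PK.Ʃ(rng L)(\ ℓ -> C(wz ℓ)P.* PK.Ʃ(rng Bd)(\f -> C(coeff(b α ℓ)f)P.* S r f))≋ PK.Ʃ(rng r)(\ρ -> C(e α ρ)P.* V ^ᴾ ρ)
    regroup α = P.sym(P.trans(PK.Ʃ-cong(rng r)\ρ -> P.trans(P.*-congʳ(P.trans(C-Ʃ(rng L)_)(PK.Ʃ-cong(rng L)\ ℓ -> P.trans(C-* _ _)(P.*-congˡ(P.trans(C-Ʃ(rng Bd)_)(PK.Ʃ-cong(rng Bd)\f -> C-* _ _))))))
       (P.sym(PK.Ʃ-*ʳ(rng L)(V ^ᴾ ρ)_)))
      (P.trans(PK.Ʃ-swap(rng r)(rng L)_)(PK.Ʃ-cong(rng L)\ ℓ ->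
       P.trans(PK.Ʃ-cong(rng r)\ρ -> P.*-assoc _ _ _)(P.trans(PK.Ʃ-*ˡ(rng r)(C(wz ℓ))_)(P.*-congˡ
        (P.trans(PK.Ʃ-cong(rng r)\ρ -> P.sym(PK.Ʃ-*ʳ(rng Bd)(V ^ᴾ ρ)_))
        (P.trans(PK.Ʃ-swap(rng r)(rng Bd)_)(PK.Ʃ-cong(rng Bd)\f -> P.trans(PK.Ʃ-cong(rng r)\ρ -> P.*-assoc _ _ _)(PK.Ʃ-*ˡ(rng r)_ _)))))))))

    divides-Ψ : ∀ α ->(∀ ρ -> ρ < r -> Ep α ρ ≋ P.0#)->(V ^ᴾ r)∣ᴾ Ψ α
    divides-Ψ α hyp = C(w₀ ⁻¹)P.* proj₁ main , P.trans Ψ≋(PK.solve 3(\c v q -> c PK.:*(v PK.:* q)PK.:= v PK.:*(c PK.:* q))P.refl(C(w₀ ⁻¹))(V ^ᴾ r)(proj₁ main))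
     where
     w₀≢0 : w₀ ≢ 0#
     w₀≢0 = *-nonzero(^-nonzero(m N.* I')z≢0)(^-nonzero(m N.* I')uz≢0)
     zero-sum : PK.Ʃ(rng r)(\ρ -> C(e α ρ)P.* V ^ᴾ ρ)≋ P.0#
     zero-sum = PK.Ʃ-≈0(rng r)\{ρ}ρ∈ -> P.trans(P.*-congʳ(P.trans(C-cong(e≡0 α ρ(hyp ρ(∈-rng⁻ ρ∈))))C-0))(P.zeroˡ _)
     chain : C w₀ P.* Ψ α B.~ P.0#
     chain = B.~-trans(B.~-*(B.~-refl{C w₀})(B.~-Ʃ(rng L)(T~ α)))(B.~-trans
      (B.≋⇒~(P.trans(P.sym(PK.Ʃ-*ˡ(rng L)(C w₀)_))(P.trans(PK.Ʃ-cong(rng L)\ ℓ -> P.trans(P.sym(P.*-assoc _ _ _))(P.trans(P.*-congʳ(P.trans(P.sym(C-* _ _))(P.trans(C-cong(scalar≡ ℓ))(C-* _ _))))(P.*-assoc _ _ _)))(PK.Ʃ-*ˡ(rng L)(C w₁)_))))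
      (B.~-trans(B.~-*(B.~-refl{C w₁})(B.~-Ʃ(rng L)\ ℓ -> B.~-*(B.~-refl{C(wz ℓ)})(b~ α ℓ)))
      (B.≋⇒~(P.trans(P.*-congˡ(P.trans(regroup α)zero-sum))(P.zeroʳ _)))))
     main :(V ^ᴾ r)∣ᴾ(C w₀ P.* Ψ α)
     main = proj₁ chain , P.trans(PK.solve 1(\a -> a PK.:= a PK.:- PK.con 0)P.refl(C w₀ P.* Ψ α))(proj₂ chain)
     Ψ≋ : Ψ α ≋ C(w₀ ⁻¹)P.*((V ^ᴾ r)P.* proj₁ main)
     Ψ≋ = P.trans(P.sym(P.*-identityˡ _))(P.trans(P.*-congʳ(P.sym(P.trans(P.sym(C-* _ _))(P.trans(C-cong(inverseˡ w₀≢0))C-1#))))(P.trans(P.*-assoc _ _ _)(P.*-congˡ(proj₂ main))))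

   module Solve where
    instance
     Δ-nonZero : NonZero Δ
     Δ-nonZero = N.>-nonZero(≤-trans 1≤M(≤-trans(m≤m+n M J)(m≤m+n(M N.+ J)_)))

    Λ :(ℕ -> Carrier)-> ℕ -> Carrier
    Λ α c = coeff(Ep α(c / Δ))(c % Δ)

    a-− : ∀ α β ℓ -> a(\i -> α i - β i)ℓ ≋ a α ℓ P.- a β ℓ
    a-− α β ℓ = mk \n -> E.trans(value n)(E.sym(coeff-−(a α ℓ)(a β ℓ)n))
     where
     value : ∀ n -> coeff(a(\i -> α i - β i)ℓ)n ≡ coeff(a α ℓ)n - coeff(a β ℓ)n
     value n with n N.<? M
     ... | yes _ = E.refl
     ... | no _ = E.sym(-‿inverseʳ 0#)

    module _ (α β : ℕ -> Carrier) where
     b-− : ∀ ℓ -> b(\i -> α i - β i)ℓ ≋ b α ℓ P.- b β ℓ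
     b-− ℓ = P.trans(P.*-congʳ(a-− α β ℓ))(PK.solve 3(\x y c ->(x PK.:- y)PK.:* c PK.:= x PK.:* c PK.:- y PK.:* c)P.refl
      (a α ℓ)(a β ℓ)(X ^ᴾ(m N.* ii ℓ)P.* u ^ᴾ(m N.* i* ℓ)))

     private
      inner :(ℕ -> Carrier)-> ℕ -> ℕ -> ℕ -> Poly
      inner γ ρ ℓ f = C(coeff(b γ ℓ)f)P.* t f ρ

     inner-− : ∀ ρ ℓ f -> inner(\i -> α i - β i)ρ ℓ f ≋ inner α ρ ℓ f P.- inner β ρ ℓ f
     inner-− ρ ℓ f = P.trans(P.*-congʳ{t f ρ}(P.trans(C-cong(E.trans(at(b-− ℓ)f)(coeff-−(b α ℓ)(b β ℓ)f)))
       (P.trans(C-+(coeff(b α ℓ)f)(- coeff(b β ℓ)f))(P.+-congˡ(C-neg(coeff(b β ℓ)f))))))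
      (PK.solve 3(\x y t ->(x PK.:- y)PK.:* t PK.:= x PK.:* t PK.:- y PK.:* t)P.refl(C(coeff(b α ℓ)f))(C(coeff(b β ℓ)f))(t f ρ))

     Ep-− : ∀ ρ -> Ep(\i -> α i - β i)ρ ≋ Ep α ρ P.- Ep β ρ
     Ep-− ρ = P.trans(PK.Ʃ-cong(rng L)step)(PK.Ʃ-−(rng L)(\ ℓ -> w ℓ P.* PK.Ʃ(rng Bd)(inner α ρ ℓ))(\ ℓ -> w ℓ P.* PK.Ʃ(rng Bd)(inner β ρ ℓ)))
      where
      step : ∀ ℓ -> w ℓ P.* PK.Ʃ(rng Bd)(inner(\i -> α i - β i)ρ ℓ)≋ w ℓ P.* PK.Ʃ(rng Bd)(inner α ρ ℓ)P.- w ℓ P.* PK.Ʃ(rng Bd)(inner β ρ ℓ)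
      step ℓ = P.trans(P.*-congˡ{w ℓ}(P.trans(PK.Ʃ-cong(rng Bd)(inner-− ρ ℓ))(PK.Ʃ-−(rng Bd)(inner α ρ ℓ)(inner β ρ ℓ))))
       (PK.solve 3(\w x y -> w PK.:*(x PK.:- y)PK.:= w PK.:* x PK.:- w PK.:* y)P.refl(w ℓ)(PK.Ʃ(rng Bd)(inner α ρ ℓ))(PK.Ʃ(rng Bd)(inner β ρ ℓ)))

    Λ-− : ∀ α β c -> Λ(\i -> α i - β i)c ≡ Λ α c - Λ β c
    Λ-− α β c = E.trans(at(Ep-− α β(c / Δ))(c % Δ))(coeff-−(Ep α(c / Δ))(Ep β(c / Δ))(c % Δ))

    solution : ∃ \α ->(∃ \i -> i < L N.* M × α i ≢ 0#)×(∀ c -> c < r N.* Δ -> Λ α c ≡ 0#)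
    solution = LinearKernel.kernel F(L N.* M)(r N.* Δ)count Λ Λ-−

    Ep≋0 : ∀ α ->(∀ c -> c < r N.* Δ -> Λ α c ≡ 0#)-> ∀ ρ -> ρ < r -> Ep α ρ ≋ P.0#
    Ep≋0 α Λ≡0 ρ ρ<r = mk \n -> E.trans(value n(n N.<? Δ))(E.sym(coeff-0 n))
     where
     value : ∀ n -> Dec(n < Δ)-> coeff(Ep α ρ)n ≡ 0#
     value n(no q)= supp-Ep α ρ n(≮⇒≥ q)
     value n(yes q)= E.subst₂(\x y -> coeff(Ep α x)y ≡ 0#)quot rem(Λ≡0(n N.+ ρ N.* Δ)c<)
      where
      rem :(n N.+ ρ N.* Δ)% Δ ≡ n
      rem = E.trans(N.[m+kn]%n≡m%n n ρ Δ)(N.m<n⇒m%n≡m q)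
      quot :(n N.+ ρ N.* Δ)/ Δ ≡ ρ
      quot = E.trans(N.+-distrib-/-∣ʳ n(N.n∣m*n ρ))(cong₂ N._+_(N.m<n⇒m/n≡0 q)(N.m*n/n≡m ρ Δ))
      c< : n N.+ ρ N.* Δ < r N.* Δ
      c< = <-≤-trans(+-monoˡ-<(ρ N.* Δ)q)(*-monoˡ-≤ Δ ρ<r)

    OnCurve : Carrier -> Set
    OnCurve z = z ≢ 0# × uz z ≢ 0# × uz z ^ M ≡ g * z ^ M

    -- Stepanov: the curve (z + 1)^M (z + κ)^M = g z^M has few points.
    stepanov : κ ≢ 0# -> size ≡ Q -> Prime(suc I)-> K.⟨ suc I ⟩ ≡ 0# -> ∀{zs}-> Unique zs ->
          All OnCurve zs -> length zs < r N.* suc J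
    stepanov κ≢0 size≡ pr char{zs}uniq pts = ≰⇒> \p -> αi≢0(Nonvanishing.α≡0 κ≢0 α(Ψ≋0 p)(proj₁(proj₁(proj₂ solution)))(proj₁(proj₂(proj₁(proj₂ solution)))))
     where
     α = proj₁ solution
     αi≢0 = proj₂(proj₂(proj₁(proj₂ solution)))
     div : ∀{z}-> OnCurve z ->((X- z)^ᴾ r)∣ᴾ Ψ α
     div{z}(z≢0 , uz≢0 , curve)= Vanishing.divides-Ψ size≡ pr char z z≢0 uz≢0 curve α(Ep≋0 α(proj₂(proj₂ solution)))
     Ψ≋0 : r N.* suc J ≤ length zs -> Ψ α ≋ P.0#
     Ψ≋0 p = multiple-roots r uniq(Ψ α)(Q N.* suc J)(supp-Ψ α)(All.map div pts)
      (subst(N._≤ length zs N.* r)(solveℕ 2(\r j ->(r ⊠ j)⊠ r :≡(r ⊠ r)⊠ j)E.refl r(suc J))(*-monoˡ-≤ r p))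

module Char where
 open Alg
 open Cone
 open Field
 open Quad

 module Characters (S : StarRing) (Φ : FiniteField) where
  open Positivity S
  module F = FieldKit Φ
  open F using (elems; size; nz) renaming (Carrier to K)
  open F.Reindex cring

  Ʃ-nz : ∀(f : K -> Carrier)-> Ʃ elems f ≈ f F.0# + Ʃ nz f
  Ʃ-nz f = Ʃ-↭ F.elems-↭ f

  Ʃ-except-0 : ∀{f g : K -> Carrier}->(∀{x}-> x ≢ F.0# -> f x ≈ g x)-> Ʃ elems f ≈ Ʃ elems g +(f F.0# - g F.0#)
  Ʃ-except-0{f}{g}h = begin
   _ ≈⟨ Ʃ-nz f ⟩
   _ ≈⟨ +-congˡ(Ʃ-cong-∈ nz(\p -> h(F.∈-nz⁻ p)))⟩
   _ ≈⟨ solve 3(\a b s -> a :+ s :=(b :+ s):+(a :- b))refl(f F.0#)(g F.0#)(Ʃ nz g)⟩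
   _ ≈⟨ +-congʳ(sym(Ʃ-nz g))⟩
   _ ∎

  record Multiplicative(ψ : K -> Carrier): Set where
   field
    ψ-* : ∀ x y -> ψ(x F.* y)≈ ψ x * ψ y
    ψ-0 : ψ F.0# ≈ 0#
    ψ-1 : ψ F.1# ≈ 1#
    ψ-N : ∀{x}-> x ≢ F.0# -> N(ψ x)≈ 1#

   ψ-cong : ∀{x y}-> x ≡ y -> ψ x ≈ ψ y
   ψ-cong E.refl = refl

   N-ψ≲1 : ∀ x -> N(ψ x)≲ 1#
   N-ψ≲1 x with x F.≟ F.0#
   ... | yes E.refl = ≲-respˡ(sym(trans(*-congʳ ψ-0)(zeroˡ _)))(pos⇒≲ pos-1)
   ... | no p = ≈⇒≲(ψ-N p)

   ψ-⁻¹ : ∀{x}-> x ≢ F.0# -> ψ x * ψ(x F.⁻¹)≈ 1#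
   ψ-⁻¹{x}p = trans(sym(ψ-* x(x F.⁻¹)))(trans(ψ-cong(F.inverseʳ p))ψ-1)

   ψ-⋆ : ∀ x -> ψ x ⋆ ≈ ψ(x F.⁻¹)
   ψ-⋆ x with x F.≟ F.0#
   ... | yes E.refl = trans(⋆-cong ψ-0)(trans 0⋆(sym(trans(ψ-cong F.0⁻¹)ψ-0)))
   ... | no p = begin
    ψ x ⋆ ≈⟨ sym(*-identityʳ _)⟩
    _ ≈⟨ *-congˡ(sym(ψ-⁻¹ p))⟩
    _ ≈⟨ solve 3(\a b c -> a :*(b :* c):=(b :* a):* c)refl(ψ x ⋆)(ψ x)_ ⟩
    _ ≈⟨ *-congʳ(ψ-N p)⟩
    _ ≈⟨ *-identityˡ _ ⟩
    _ ∎

   ƩN≲size : Ʃ elems(\x -> N(ψ x))≲ ⟨ size ⟩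
   ƩN≲size = ≲-respʳ(trans(Ʃ-const elems 1#)(*-identityʳ _))(Ʃ-mono elems(\{x}_ -> N-ψ≲1 x))

   ƩN-nz : Ʃ elems(\x -> N(ψ x))≈ ⟨ length nz ⟩
   ƩN-nz = trans(Ʃ-nz _)(trans(+-cong(trans(*-congʳ ψ-0)(zeroˡ _))(trans(Ʃ-cong-∈ nz(\p -> ψ-N(F.∈-nz⁻ p)))(trans(Ʃ-const nz 1#)(*-identityʳ _))))(+-identityˡ _))

   conjugate : Multiplicative(\x -> ψ x ⋆)
   conjugate = record
    {ψ-* = \x y -> trans(⋆-cong(ψ-* x y))(⋆-* _ _)
    ; ψ-0 = trans(⋆-cong ψ-0)0⋆
    ; ψ-1 = trans(⋆-cong ψ-1)1⋆
    ; ψ-N = \p -> trans(N-⋆ _)(ψ-N p)}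

   square : Multiplicative(\x -> ψ x * ψ x)
   square = record
    {ψ-* = \x y -> trans(*-cong(ψ-* x y)(ψ-* x y))(solve 2(\a b ->(a :* b):*(a :* b):=(a :* a):*(b :* b))refl(ψ x)(ψ y))
    ; ψ-0 = trans(*-congʳ ψ-0)(zeroˡ _)
    ; ψ-1 = trans(*-cong ψ-1 ψ-1)(*-identityˡ 1#)
    ; ψ-N = \p -> trans(N-* _ _)(trans(*-cong(ψ-N p)(ψ-N p))(*-identityˡ 1#))}

  record Character(ψ : K -> Carrier): Set where
   field
    multiplicative : Multiplicative ψ
    ψ-Ʃ : Ʃ elems ψ ≈ 0#
   open Multiplicative multiplicative public

   conjugateᶜ : Character(\x -> ψ x ⋆)
   conjugateᶜ = record{multiplicative = conjugate ; ψ-Ʃ = trans(sym(⋆-Ʃ elems ψ))(trans(⋆-cong ψ-Ʃ)0⋆)}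

  module Orthogonality{ψ : K -> Carrier}(χ : Character ψ) where
   open Character χ

   orthogonal : ∀{w w'}-> w ≢ w' -> Ʃ elems(\v -> ψ(v F.- w)* ψ(v F.- w')⋆)≈ - 1#
   orthogonal{w}{w'}w≢w' = begin
    _ ≈⟨ sym(Ʃ-reindex(F.shift-bij w')_)⟩
    _ ≈⟨ Ʃ-cong elems(\v -> *-cong(ψ-cong(F.solve 3(\v w' w ->(v F.:+ w')F.:- w F.:= v F.:+(w' F.:- w))E.refl v w' w))
        (trans(⋆-cong(ψ-cong(F.solve 2(\v w ->(v F.:+ w)F.:- w F.:= v)E.refl v w')))(ψ-⋆ v)))⟩
    _ ≈⟨ Ʃ-except-0{_}{\v -> ψ(F.1# F.+ c F.* v F.⁻¹)}(\{v}p -> trans(sym(ψ-* _ _))(ψ-cong(E.trans(F.distribʳ _ v c)(cong(\t -> t F.+ c F.* v F.⁻¹)(F.inverseʳ p)))))⟩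
    _ ≈⟨ +-cong(trans(Ʃ-reindex F.inv-bij(\v -> ψ(F.1# F.+ c F.* v)))(trans(Ʃ-cong elems(\v -> ψ-cong(F.+-comm _ _)))
        (trans(Ʃ-reindex(F.scale-bij c c≢0)(\v -> ψ(v F.+ F.1#)))(trans(Ʃ-reindex(F.shift-bij F.1#)ψ)ψ-Ʃ))))
        (+-cong(trans(*-congˡ(trans(ψ-cong F.0⁻¹)ψ-0))(zeroʳ _))
         (-‿cong(trans(ψ-cong(E.trans(cong(\t -> F.1# F.+ c F.* t)F.0⁻¹)(E.trans(cong(\t -> F.1# F.+ t)(F.zeroʳ c))(F.+-identityʳ _))))ψ-1)))⟩
    _ ≈⟨ trans(+-identityˡ _)(+-identityˡ _)⟩
    - 1# ∎
    where
    c = w' F.- w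
    c≢0 : c ≢ F.0#
    c≢0 = F.x≢y⇒x-y≢0(w≢w' ∘ E.sym)

   gram : ∀ w w' -> Ʃ elems(\v -> ψ(v F.- w)* ψ(v F.- w')⋆)≈ ⟨ F.δ w w' ⟩ * ⟨ size ⟩ - 1#
   gram w w' with w F.≟ w'
   ... | no p = trans(orthogonal p)(solve 2(\o s -> :- o := con 0 :* s :- o)refl 1# ⟨ size ⟩)
   ... | yes E.refl = begin
    _ ≈⟨ Ʃ-reindex(F.shift-bij(F.- w))(\v -> N(ψ v))⟩
    _ ≈⟨ ƩN-nz ⟩
    _ ≈⟨ solve 2(\o l -> l :=(o :+ l):- o)refl 1# ⟨ length nz ⟩ ⟩
    _ ≈⟨ +-congʳ(trans(reflexive(cong ⟨_⟩(E.sym F.size-nz)))(trans(sym(*-identityˡ _))(*-congʳ(sym ⟨1⟩))))⟩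
    _ ∎

   plancherel : ∀(f : K -> Carrier)-> Ʃ elems(\v -> N(Ʃ elems(\w -> f w * ψ(v F.- w))))≲ ⟨ size ⟩ * Ʃ elems(\w -> N(f w))
   plancherel f = by(resp(sym(trans(+-congˡ(-‿cong eq))(solve 2(\a b -> a :-(a :- b):= b)refl _ _)))(sq(Ʃ elems f)))
    where
    swap₃ :(G : K -> K -> K -> Carrier)-> Ʃ elems(\v -> Ʃ elems(\w -> Ʃ elems(\w' -> G v w w')))≈ Ʃ elems(\w -> Ʃ elems(\w' -> Ʃ elems(\v -> G v w w')))
    swap₃ G = trans(Ʃ-swap elems elems _)(Ʃ-cong elems(\w -> Ʃ-swap elems elems _))
    eq : Ʃ elems(\v -> N(Ʃ elems(\w -> f w * ψ(v F.- w))))≈ ⟨ size ⟩ * Ʃ elems(\w -> N(f w))- N(Ʃ elems f)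
    eq = begin
     _ ≈⟨ Ʃ-cong elems(\v -> trans(*-congˡ(⋆-Ʃ elems _))(Ʃ-*Ʃ elems elems _ _))⟩
     _ ≈⟨ swap₃ _ ⟩
     _ ≈⟨ Ʃ-cong elems(\w -> Ʃ-cong elems(\w' -> trans(Ʃ-cong elems(\v -> trans(*-congˡ(⋆-* _ _))
         (solve 4(\a b c d ->(a :* b):*(c :* d):=(a :* c):*(b :* d))refl(f w)(ψ(v F.- w))(f w' ⋆)(ψ(v F.- w')⋆))))
         (trans(Ʃ-*ˡ elems(f w * f w' ⋆)_)(*-congˡ(gram w w')))))⟩
     _ ≈⟨ Ʃ-cong elems(\w -> trans(Ʃ-cong elems(\w' -> solve 5(\a b d q o ->(a :* b):*(d :* q :- o):=(d :*(q :*(a :* b))):-((a :* b):* o))refl(f w)(f w' ⋆)⟨ F.δ w w' ⟩ ⟨ size ⟩ 1#))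
         (Ʃ-− elems _ _))⟩
     _ ≈⟨ Ʃ-− elems _ _ ⟩
     _ ≈⟨ +-cong(trans(Ʃ-swap elems elems _)(trans(Ʃ-cong elems(\w' -> F.Ʃ-δ cring w'(\w -> ⟨ size ⟩ *(f w * f w' ⋆))))(Ʃ-*ˡ elems _ _)))
         (-‿cong(trans(Ʃ-cong elems(\w -> Ʃ-cong elems(\w' -> *-identityʳ _)))(trans(sym(Ʃ-*Ʃ elems elems _ _))(*-congˡ(sym(⋆-Ʃ elems f))))))⟩
     _ ∎

   -- For v ≠ 0 the sum of α(w) ψ(v - w) over w is α(v) ψ(v) J, so Plancherel bounds J.
   jacobi : ∀{α}-> Multiplicative α -> N(Ʃ elems(\w -> α w * ψ(F.1# F.- w)))≲ ⟨ size ⟩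
   jacobi{α}mα = go(length nz)(E.refl)
    where
    module α = Multiplicative mα
    J = Ʃ elems(\w -> α w * ψ(F.1# F.- w))
    Sv : K -> Carrier
    Sv v = Ʃ elems(\w -> α w * ψ(v F.- w))
    Sv≈ : ∀{v}-> v ≢ F.0# -> Sv v ≈(α v * ψ v)* J
    Sv≈{v}p = trans(sym(Ʃ-reindex(F.scale-bij v p)_))(trans(Ʃ-cong elems(\w -> trans(*-cong(α.ψ-* v w)
      (trans(ψ-cong(E.trans(cong(\t -> t F.- v F.* w)(E.sym(F.*-identityʳ v)))(F.solve 3(\v o w -> v F.:* o F.:- v F.:* w F.:= v F.:*(o F.:- w))E.refl v F.1# w)))(ψ-* v(F.1# F.- w))))
     (solve 4(\a b c d ->(a :* b):*(c :* d):=(a :* c):*(b :* d))refl(α v)(α w)(ψ v)_)))(Ʃ-*ˡ elems _ _))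
    N-Sv : ∀{v}-> v ≢ F.0# -> N(Sv v)≈ N J
    N-Sv p = trans(N-cong(Sv≈ p))(trans(N-* _ _)(trans(*-congʳ(trans(N-* _ _)(trans(*-cong(α.ψ-N p)(ψ-N p))(*-identityˡ 1#))))(*-identityˡ _)))
    bound : ⟨ length nz ⟩ * N J ≲ ⟨ length nz ⟩ * ⟨ size ⟩
    bound = ≲-trans(≲-respˡ(trans(Ʃ-cong-∈ nz(\p -> N-Sv(F.∈-nz⁻ p)))(Ʃ-const nz _))(≲-respʳ(sym(Ʃ-nz _))(≲-+ˡ(sq(Sv F.0#)))))
     (≲-respʳ(trans(*-congˡ α.ƩN-nz)(*-comm _ _))(plancherel α))
    nz-pos : ∀{n}-> length nz ≡ n -> n ≢ 0
    nz-pos e E.refl with nz | F.∈-nz⁺ F.1≢0 | e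
    ... | _ ∷ _ | _ | ()
    go : ∀ n -> length nz ≡ n -> N J ≲ ⟨ size ⟩
    go zero e = contradiction E.refl(nz-pos e)
    go(suc n)e = ≲-div n(subst(\k -> ⟨ k ⟩ * N J ≲ ⟨ k ⟩ * ⟨ size ⟩)e bound)

  module FourPoint{ψ : K -> Carrier}(χ : Character ψ) where
   open Character χ
   open Orthogonality χ

   W : K -> Carrier
   W κ = Ʃ elems(\s -> ψ(s F.+ F.1#)* ψ(s F.+ κ)* ψ s ⋆)

   conductor : K -> Carrier
   conductor κ = Ʃ elems(\π -> Ʃ elems(\p -> ψ p * ψ(κ F.* p F.+((F.1# F.- κ)F.* π F.- κ F.*(F.1# F.- κ)))* ψ π ⋆))

   private
    E₀ J₁ J₂ C₀ : Carrier
    E₀ = Ʃ elems(\p -> ψ p * ψ p)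
    J₁ = Ʃ elems(\p -> ψ p * ψ(p F.- F.1#))
    J₂ = Ʃ elems(\w -> ψ w * ψ w * ψ(F.1# F.- w)⋆)
    C₀ = Ʃ elems(\π -> Ʃ elems(\p -> ψ p * ψ(p F.-(F.1# F.- π))* ψ π ⋆))

    N-E₀ : N E₀ ≲ ⟨ size ⟩ * ⟨ size ⟩
    N-E₀ = ≲-trans(N-Ʃ elems _)(*-monoˡ(pos-⟨⟩ size)(Multiplicative.ƩN≲size square))

    -1≢0 : F.- F.1# ≢ F.0#
    -1≢0 e = F.1≢0(E.trans(F.solve 1(\a -> a F.:= F.:-(F.:- a))E.refl F.1#)(E.trans(cong F.-_ e)(F.solve 0(F.:- F.con 0 F.:= F.con 0)E.refl)))

    N-J₁ : N J₁ ≲ ⟨ size ⟩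
    N-J₁ = ≲-respˡ(sym(trans(N-cong J₁≈)(trans(N-* u J)(trans(*-congʳ(ψ-N -1≢0))(*-identityˡ _)))))(jacobi multiplicative)
     where
     u = ψ(F.- F.1#)
     J = Ʃ elems(\w -> ψ w * ψ(F.1# F.- w))
     J₁≈ : J₁ ≈ u * J
     J₁≈ = trans(Ʃ-cong elems(\w -> trans(*-congˡ(trans(ψ-cong(E.trans(E.sym(F.*-identityˡ _))(F.solve 2(\w o -> o F.:*(w F.:- o)F.:=(F.:- o)F.:*(o F.:- w))E.refl w F.1#)))(ψ-* _ _)))
      (solve 3(\a b c -> a :*(b :* c):= b :*(a :* c))refl(ψ w)u(ψ(F.1# F.- w)))))(Ʃ-*ˡ elems u _)

    N-J₂ : N J₂ ≲ ⟨ size ⟩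
    N-J₂ = Orthogonality.jacobi conjugateᶜ square

    C₀≈ : C₀ ≈ J₂ * J₁ + E₀
    C₀≈ = begin
     _ ≈⟨ sym(Ʃ-reindex(F.reflect-bij F.1#)_)⟩
     _ ≈⟨ Ʃ-cong elems(\w -> trans(Ʃ-cong elems(\p -> *-congʳ(*-congˡ(ψ-cong(F.solve 3(\p o w -> p F.:-(o F.:-(o F.:- w))F.:= p F.:- w)E.refl p F.1# w)))))(Ʃ-*ʳ elems _ _))⟩
     _ ≈⟨ Ʃ-except-0{_}{\w ->(ψ w * ψ w * ψ(F.1# F.- w)⋆)* J₁}(\{w}w≢0 -> trans(*-congʳ(inner w≢0))(solve 3(\a j b ->(a :* j):* b :=(a :* b):* j)refl(ψ w * ψ w)J₁ _))⟩
     _ ≈⟨ +-cong(Ʃ-*ʳ elems J₁ _)(+-cong at0(-‿cong(trans(*-congʳ(trans(*-congʳ(trans(*-congʳ ψ-0)(zeroˡ _)))(zeroˡ _)))(zeroˡ _))))⟩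
     _ ≈⟨ +-congˡ(solve 1(\a -> a :- con 0 := a)refl E₀)⟩
     _ ∎
     where
     inner : ∀{w}-> w ≢ F.0# -> Ʃ elems(\p -> ψ p * ψ(p F.- w))≈(ψ w * ψ w)* J₁
     inner{w}p = trans(sym(Ʃ-reindex(F.scale-bij w p)_))(trans(Ʃ-cong elems(\x -> trans(*-cong(ψ-* w x)(trans(ψ-cong
       (E.trans(cong(\t -> w F.* x F.- t)(E.sym(F.*-identityʳ w)))(F.solve 3(\w x o -> w F.:* x F.:- w F.:* o F.:= w F.:*(x F.:- o))E.refl w x F.1#)))(ψ-* w _)))
      (solve 4(\a b c d ->(a :* b):*(c :* d):=(a :* c):*(b :* d))refl(ψ w)(ψ x)(ψ w)_)))(Ʃ-*ˡ elems _ _))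
     minus-0 : ∀ p -> p F.- F.0# ≡ p
     minus-0 p = F.solve 1(\p -> p F.:- F.con 0 F.:= p)E.refl p
     at0 : Ʃ elems(\p -> ψ p * ψ(p F.- F.0#))* ψ(F.1# F.- F.0#)⋆ ≈ E₀
     at0 = trans(*-cong(Ʃ-cong elems(\p -> *-congˡ(ψ-cong(minus-0 p))))(trans(⋆-cong(trans(ψ-cong(minus-0 F.1#))ψ-1))1⋆))(*-identityʳ _)

    N-C₀ : N C₀ ≲ ⟨ 4 ⟩ *(⟨ size ⟩ * ⟨ size ⟩)
    N-C₀ = ≲-respˡ(sym(N-cong C₀≈))(≲-trans(N-+ _ _)(≲-respʳ(solve 1(\q -> con 2 :* q :+ con 2 :* q := con 4 :* q)refl(⟨ size ⟩ * ⟨ size ⟩))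
     (+-mono(*-monoˡ(pos-⟨⟩ 2)(≲-respˡ(sym(N-* J₂ J₁))(*-mono(sq J₂)(pos-⟨⟩ size)N-J₂ N-J₁)))(*-monoˡ(pos-⟨⟩ 2)N-E₀))))

   N-conductor : ∀{κ}-> κ ≢ F.0# -> N(conductor κ)≲ ⟨ 4 ⟩ *(⟨ size ⟩ * ⟨ size ⟩)
   N-conductor{κ}κ≢0 = by-cases(κ F.≟ F.1#)
    where
    by-cases : Dec(κ ≡ F.1#)-> N(conductor κ)≲ ⟨ 4 ⟩ *(⟨ size ⟩ * ⟨ size ⟩)
    by-cases(yes E.refl)= ≲-respˡ(sym(trans(N-cong zero-sum)(zeroˡ _)))(pos⇒≲(pos-*(pos-⟨⟩ 4)(pos-*(pos-⟨⟩ size)(pos-⟨⟩ size))))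
     where
     simp : ∀ p π -> F.1# F.* p F.+((F.1# F.- F.1#)F.* π F.- F.1# F.*(F.1# F.- F.1#))≡ p
     simp p π = E.trans(F.solve 3(\o p π -> o F.:* p F.:+((o F.:- o)F.:* π F.:- o F.:*(o F.:- o))F.:= o F.:* p)E.refl F.1# p π)(F.*-identityˡ p)
     zero-sum : conductor F.1# ≈ 0#
     zero-sum = trans(Ʃ-cong elems(\π -> trans(Ʃ-cong elems(\p -> *-congʳ(*-congˡ(ψ-cong(simp p π)))))(Ʃ-*ʳ elems(ψ π ⋆)_)))
      (trans(Ʃ-*ˡ elems E₀ _)(trans(*-congˡ(Character.ψ-Ʃ conjugateᶜ))(zeroʳ _)))
    by-cases(no κ≢1)= ≲-respˡ(sym(trans(N-cong scaled)(trans(N-* _ _)(trans(*-congʳ unit)(*-identityˡ _)))))N-C₀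
     where
     λ' = F.1# F.- κ
     λ≢0 : λ' ≢ F.0#
     λ≢0 = F.x≢y⇒x-y≢0(κ≢1 ∘ E.sym)
     v = ψ λ' * ψ(κ F.* λ')* ψ κ ⋆
     unit : N v ≈ 1#
     unit = trans(N-* _ _)(trans(*-cong(trans(N-* _ _)(trans(*-cong(ψ-N λ≢0)(ψ-N(F.*-nonzero κ≢0 λ≢0)))(*-identityˡ 1#)))(trans(N-⋆ _)(ψ-N κ≢0)))(*-identityˡ 1#))
     arg : ∀ p π -> κ F.*(λ' F.* p)F.+(λ' F.*(κ F.* π)F.- κ F.* λ')≡ κ F.* λ' F.*(p F.-(F.1# F.- π))
     arg p π = E.trans(cong(\t -> κ F.*(λ' F.* p)F.+(λ' F.*(κ F.* π)F.- t))(E.sym(F.*-identityʳ _)))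
      (F.solve 5(\k l p π o -> k F.:*(l F.:* p)F.:+(l F.:*(k F.:* π)F.:- k F.:* l F.:* o)F.:= k F.:* l F.:*(p F.:-(o F.:- π)))E.refl κ λ' p π F.1#)
     scaled : conductor κ ≈ v * C₀
     scaled = trans(sym(Ʃ-reindex(F.scale-bij κ κ≢0)_))(trans(Ʃ-cong elems(\π -> trans(sym(Ʃ-reindex(F.scale-bij λ' λ≢0)_))
       (trans(Ʃ-cong elems(\p -> trans(*-cong(*-cong(ψ-* λ' p)(trans(ψ-cong(arg p π))(ψ-* _ _)))(trans(⋆-cong(ψ-* κ π))(⋆-* _ _)))
        (solve 6(\a b c d e f ->((a :* b):*(c :* d)):*(e :* f):=(a :* c :* e):*(b :* d :* f))refl(ψ λ')(ψ p)(ψ(κ F.* λ'))(ψ(p F.-(F.1# F.- π)))(ψ κ ⋆)(ψ π ⋆))))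
       (Ʃ-*ˡ elems v _))))(Ʃ-*ˡ elems v _))

 module Doubling (S : StarRing) (Φ : FiniteField) (odd : OddField.Odd Φ) (δ₀ : FiniteField.Carrier Φ) (ns : ¬ OddField.Square Φ δ₀) where
  open Positivity S
  module F = FieldKit Φ
  open F using (elems) renaming (Carrier to K)
  open F.Reindex cring
  module O = OddField Φ
  module Sq = O.Squares δ₀ ns
  private
   2# ½ : K
   2# = F.1# F.+ F.1#
   ½ = 2# F.⁻¹

   2≢0 : 2# ≢ F.0#
   2≢0 = O.Nonsquare.2≢0 odd

   ½≢0 : ½ ≢ F.0#
   ½≢0 = F.⁻¹-nonzero 2≢0

   2½ : 2# F.* ½ ≡ F.1#
   2½ = F.inverseʳ 2≢0

  -- Summing over z of trace σ and norm π, and over pairs (x , y) of sum σ and product π,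
  -- covers each quadratic polynomial T² - σT + π exactly twice.
  quadratics :(G : K -> K -> Carrier)->
   Ʃ elems(\x -> Ʃ elems(\y -> G(x F.+ x)(x F.* x F.- δ₀ F.*(y F.* y))))+ Ʃ elems(\x -> Ʃ elems(\y -> G(x F.+ y)(x F.* y)))
   ≈ ⟨ 2 ⟩ * Ʃ elems(\σ -> Ʃ elems(G σ))
  quadratics G = begin
   _ ≈⟨ +-cong nonsplit split ⟩
   _ ≈⟨ trans(+-comm _ _)(sym(Ʃ-+ elems _ _))⟩
   _ ≈⟨ Ʃ-cong elems(\σ -> trans(Sq.Ʃ-squares cring(φ σ))(*-congˡ(all σ)))⟩
   _ ≈⟨ Ʃ-*ˡ elems _ _ ⟩
   _ ∎
   where
   φ : K -> K -> Carrier
   φ σ s = G σ(½ F.* ½ F.*(σ F.* σ F.- s))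
   G-cong : ∀{a b c d}-> a ≡ b -> c ≡ d -> G a c ≈ G b d
   G-cong E.refl E.refl = refl
   halves : ∀ σ -> ½ F.* σ F.+ ½ F.* σ ≡ σ
   halves σ = E.trans(cong₂ F._+_(E.sym(F.*-identityˡ _))(E.sym(F.*-identityˡ _)))
    (E.trans(F.solve 3(\o h s -> o F.:*(h F.:* s)F.:+ o F.:*(h F.:* s)F.:=((o F.:+ o)F.:* h)F.:* s)E.refl F.1# ½ σ)(E.trans(cong(F._* σ)2½)(F.*-identityˡ σ)))
   nonsplit : Ʃ elems(\x -> Ʃ elems(\y -> G(x F.+ x)(x F.* x F.- δ₀ F.*(y F.* y))))≈ Ʃ elems(\σ -> Ʃ elems(\r -> φ σ(δ₀ F.*(r F.* r))))
   nonsplit = trans(sym(Ʃ-reindex(F.scale-bij ½ ½≢0)_))(Ʃ-cong elems(\σ -> trans(sym(Ʃ-reindex(F.scale-bij ½ ½≢0)_))(Ʃ-cong elems(\r ->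
    G-cong(halves σ)(F.solve 4(\h s d r -> h F.:* s F.:*(h F.:* s)F.:- d F.:*(h F.:* r F.:*(h F.:* r))F.:= h F.:* h F.:*(s F.:* s F.:- d F.:*(r F.:* r)))E.refl ½ σ δ₀ r)))))
   minus-plus : ∀ x y -> x F.+(y F.+ F.- x)≡ y
   minus-plus x y = F.solve 2(\x y -> x F.:+(y F.:+ F.:- x)F.:= y)E.refl x y
   split : Ʃ elems(\x -> Ʃ elems(\y -> G(x F.+ y)(x F.* y)))≈ Ʃ elems(\σ -> Ʃ elems(\r -> φ σ(r F.* r)))
   split = trans(Ʃ-cong elems(\x -> trans(sym(Ʃ-reindex(F.shift-bij(F.- x))_))(Ʃ-cong elems(\σ -> G-cong(minus-plus x σ)E.refl))))
    (trans(Ʃ-swap elems elems _)(Ʃ-cong elems(\σ -> trans(sym(Ʃ-reindex(F.scale-bij ½ ½≢0)_))(trans(sym(Ʃ-reindex(F.shift-bij σ)_))(Ʃ-cong elems(\r ->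
     G-cong E.refl(E.trans(cong(\t -> ½ F.*(r F.+ σ)F.*(t F.+ F.-(½ F.*(r F.+ σ))))(E.sym(halves σ)))
      (F.solve 3(\h r s -> h F.:*(r F.:+ s)F.:*((h F.:* s F.:+ h F.:* s)F.:+ F.:-(h F.:*(r F.:+ s)))F.:= h F.:* h F.:*(s F.:* s F.:- r F.:* r))E.refl ½ r σ))))))))
   all : ∀ σ -> Ʃ elems(φ σ)≈ Ʃ elems(G σ)
   all σ = trans(Ʃ-reindex(F.reflect-bij(σ F.* σ))(\s -> G σ(½ F.* ½ F.* s)))(Ʃ-reindex(F.scale-bij(½ F.* ½)(F.*-nonzero ½≢0 ½≢0))(G σ))

  Φ₂ : FiniteField
  Φ₂ = Sq.quadratic
  module F₂ = FieldKit Φ₂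
  module C₁ = Characters S Φ
  module C₂ = Characters S Φ₂

  Ʃ-quadratic :(f : K × K -> Carrier)-> Ʃ F₂.elems f ≈ Ʃ elems(\x -> Ʃ elems(\y -> f(x , y)))
  Ʃ-quadratic f = go elems
   where
   go : ∀ xs -> Ʃ(cartesianProduct xs elems)f ≈ Ʃ xs(\x -> Ʃ elems(\y -> f(x , y)))
   go [] = refl
   go(x ∷ xs)= trans(Ʃ-++(map(x ,_)elems)(cartesianProduct xs elems)f)(+-cong(Ʃ-map(x ,_)elems f)(go xs))

  module _{ψ : K -> Carrier}(χ : C₁.Character ψ) where
   open C₁.Character χ
   open C₁.FourPoint χ

   lift : C₂.Character(\z -> ψ(Sq.norm z))
   lift = record
    {multiplicative = record
     {ψ-* = \z w -> trans(ψ-cong(Sq.norm-* z w))(ψ-* _ _)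
     ; ψ-0 = trans(ψ-cong(F.solve 1(\d -> F.con 0 F.:* F.con 0 F.:- d F.:*(F.con 0 F.:* F.con 0)F.:= F.con 0)E.refl δ₀))ψ-0
     ; ψ-1 = trans(ψ-cong(E.trans(F.solve 2(\o d -> o F.:* o F.:- d F.:*(F.con 0 F.:* F.con 0)F.:= o F.:* o)E.refl F.1# δ₀)(F.*-identityˡ _)))ψ-1
     ; ψ-N = \{z}p -> ψ-N(p ∘ Sq.norm≡0 z)}
    ; ψ-Ʃ = begin
      _ ≈⟨ Ʃ-quadratic _ ⟩
      A ≈⟨ solve 2(\a b -> a :=(a :+ b):- b)refl A B ⟩
      _ ≈⟨ +-cong(trans(quadratics(\_ π -> ψ π))(*-congˡ(Ʃ-≈0 elems(\_ -> ψ-Ʃ))))(-‿cong B≈0)⟩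
      _ ≈⟨ solve 0(con 2 :* con 0 :- con 0 := con 0)refl ⟩
      0# ∎}
    where
    A = Ʃ elems(\x -> Ʃ elems(\y -> ψ(x F.* x F.- δ₀ F.*(y F.* y))))
    B = Ʃ elems(\x -> Ʃ elems(\y -> ψ(x F.* y)))
    B≈0 : B ≈ 0#
    B≈0 = Ʃ-≈0 elems(\{x}_ -> trans(Ʃ-cong elems(ψ-* x))(trans(Ʃ-*ˡ elems _ _)(trans(*-congˡ ψ-Ʃ)(zeroʳ _))))

   doubling : ∀ κ -> C₂.FourPoint.W lift(κ , F.0#)+ W κ * W κ ≈ ⟨ 2 ⟩ * conductor κ
   doubling κ = trans(+-cong(trans(Ʃ-quadratic _)(Ʃ-cong elems(\x -> Ʃ-cong elems(\y -> nonsplit x y))))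
     (trans(Ʃ-*Ʃ elems elems _ _)(Ʃ-cong elems(\x -> Ʃ-cong elems(\y -> split x y)))))(trans(quadratics G)(*-congˡ(trans(Ʃ-swap elems elems _)(Ʃ-cong elems shear))))
    where
    G : K -> K -> Carrier
    G σ π = ψ(F.1# F.+ σ F.+ π)* ψ(κ F.* κ F.+ κ F.* σ F.+ π)* ψ π ⋆
    nonsplit : ∀ x y -> ψ(Sq.norm(x F.+ F.1# , y F.+ F.0#))* ψ(Sq.norm(x F.+ κ , y F.+ F.0#))* ψ(Sq.norm(x , y))⋆ ≈ G(x F.+ x)(x F.* x F.- δ₀ F.*(y F.* y))
    nonsplit x y = *-congʳ(*-cong
     (ψ-cong(E.trans(F.solve 4(\x y o d ->(x F.:+ o)F.:*(x F.:+ o)F.:- d F.:*((y F.:+ F.con 0)F.:*(y F.:+ F.con 0))F.:= o F.:* o F.:+ o F.:*(x F.:+ x)F.:+(x F.:* x F.:- d F.:*(y F.:* y)))E.refl x y F.1# δ₀)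
      (cong₂(\s t -> s F.+ t F.+(x F.* x F.- δ₀ F.*(y F.* y)))(F.*-identityˡ F.1#)(F.*-identityˡ _))))
     (ψ-cong(F.solve 4(\x y k d ->(x F.:+ k)F.:*(x F.:+ k)F.:- d F.:*((y F.:+ F.con 0)F.:*(y F.:+ F.con 0))F.:= k F.:* k F.:+ k F.:*(x F.:+ x)F.:+(x F.:* x F.:- d F.:*(y F.:* y)))E.refl x y κ δ₀)))
    split : ∀ x y ->(ψ(x F.+ F.1#)* ψ(x F.+ κ)* ψ x ⋆)*(ψ(y F.+ F.1#)* ψ(y F.+ κ)* ψ y ⋆)≈ G(x F.+ y)(x F.* y)
    split x y = trans(solve 6(\a b c d e f ->(a :* b :* c):*(d :* e :* f):=(a :* d):*(b :* e):*(c :* f))refl(ψ(x F.+ F.1#))(ψ(x F.+ κ))(ψ x ⋆)(ψ(y F.+ F.1#))(ψ(y F.+ κ))(ψ y ⋆))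
     (*-cong(*-cong
      (trans(sym(ψ-* _ _))(ψ-cong(E.trans(F.solve 3(\x y o ->(x F.:+ o)F.:*(y F.:+ o)F.:= o F.:* o F.:+ o F.:*(x F.:+ y)F.:+ x F.:* y)E.refl x y F.1#)(cong₂(\s t -> s F.+ t F.+ x F.* y)(F.*-identityˡ F.1#)(F.*-identityˡ _)))))
      (trans(sym(ψ-* _ _))(ψ-cong(F.solve 3(\x y k ->(x F.:+ k)F.:*(y F.:+ k)F.:= k F.:* k F.:+ k F.:*(x F.:+ y)F.:+ x F.:* y)E.refl x y κ))))
      (trans(sym(⋆-* _ _))(⋆-cong(sym(ψ-* x y)))))
    shear : ∀ π -> Ʃ elems(\σ -> G σ π)≈ Ʃ elems(\p -> ψ p * ψ(κ F.* p F.+((F.1# F.- κ)F.* π F.- κ F.*(F.1# F.- κ)))* ψ π ⋆)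
    shear π = trans(sym(Ʃ-reindex(F.shift-bij(F.-(F.1# F.+ π)))_))(Ʃ-cong elems(\p -> *-congʳ(*-cong
     (ψ-cong(F.solve 3(\p o π -> o F.:+(p F.:+ F.:-(o F.:+ π))F.:+ π F.:= p)E.refl p F.1# π))
     (ψ-cong(E.trans(cong₂(\s t -> s F.+ κ F.*(p F.+ F.-(F.1# F.+ π))F.+ t)(E.refl{x = κ F.* κ})(E.sym(F.*-identityˡ π)))
      (F.solve 4(\p o π k -> k F.:* k F.:+ k F.:*(p F.:+ F.:-(o F.:+ π))F.:+ o F.:* π F.:= k F.:* p F.:+((o F.:- k)F.:* π F.:- k F.:*(o F.:- k)))E.refl p F.1# π κ))))))

module Tower where
 open import Data.Nat.Solver using (module +-*-Solver)
 open Alg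
 open Cone
 open Field
 open Quad
 open Frob
 open Polys
 open Stepanov
 open Char

 module FieldMap (A B : FiniteField) where
  private
   module A = FieldKit A
   module B = FieldKit B

  map-⟨⟩ :(f : A.Carrier -> B.Carrier)-> f A.0# ≡ B.0# -> f A.1# ≡ B.1# ->(∀ x y -> f(x A.+ y)≡ f x B.+ f y)->
       ∀ n -> B.K.⟨ n ⟩ ≡ f A.K.⟨ n ⟩
  map-⟨⟩ f f0 f1 f+ zero = E.sym f0
  map-⟨⟩ f f0 f1 f+(suc n)= E.trans(cong₂ B._+_(E.sym f1)(map-⟨⟩ f f0 f1 f+ n))(E.sym(f+ A.1# A.K.⟨ n ⟩))

 module FrobeniusField (G : FiniteField){p : ℕ}(pr : Prime p) where
  open FieldKit G

  field-frobenius : K.⟨ p ⟩ ≡ 0# -> ∀ h z w ->(z + w)^(p N.^ h)≡ z ^(p N.^ h)+ w ^(p N.^ h)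
  field-frobenius char h = Frobenius.frobenius-^ commutativeSemiring pr
   (\x -> E.trans(Multiples.×≈⟨⟩* ring p x)(E.trans(cong(_* x)char)(zeroˡ x)))h

 -- A finite extension of F₀, with the norm Φ to F₀ given as z ↦ z ^ M.
 record Extension(F₀ : FiniteField)(I' : ℕ): Set₁ where
  module F₀ = FieldKit F₀
  field
   F : FiniteField
  module F = FieldKit F
  field
   ι : F₀.Carrier -> F.Carrier
   ι-* : ∀ x y -> ι(x F₀.* y)≡ ι x F.* ι y
   ι-0 : ι F₀.0# ≡ F.0#
   ι-inj : ∀{x y}-> ι x ≡ ι y -> x ≡ y
   Φ : F.Carrier -> F₀.Carrier
   M h : ℕ
   ι-Φ : ∀ z -> ι(Φ z)≡ z F.^ M
   size≡ : F.size ≡ suc(suc I')N.^ h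
   size-M : F.size ≡ suc(suc I' N.* M)
   odd : OddField.Odd F
   char : F.K.⟨ suc(suc I')⟩ ≡ F.0#

 module QuadraticStep{F₀ : FiniteField}{I' : ℕ}(E : Extension F₀ I') (pr : Prime (suc (suc I')))
            (c : ℕ)(even : suc I' ≡ 2 N.* c)(1≤c : 1 ≤ c)where
  open Extension E
  private module O = OddField F
  open O.Nonsquare odd using (nonsquare)
  δ₀ : F.Carrier
  δ₀ = proj₁ nonsquare
  module Sq = O.Squares δ₀ (proj₂ nonsquare)
  F₂ : FiniteField
  F₂ = Sq.quadratic
  module F₂ = FieldKit F₂
  private module P = Polynomials F

  private
   half : ℕ
   half = c N.* M

   nz≡ : length F.nz ≡ half N.+ half
   nz≡ = suc-injective(E.trans(E.sym F.size-nz)(E.trans size-M(cong suc(E.trans(cong(N._* M)even)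
    (solve 2(\c m -> con 2 :* c :* m := c :* m :+ c :* m)E.refl c M)))))
    where open +-*-Solver

   1^ : ∀ n -> F.1# F.^ n ≡ F.1#
   1^ zero = E.refl
   1^(suc n)= E.trans(F.*-identityˡ _)(1^ n)

   sq^half : ∀{r}-> r ≢ F.0# ->(r F.* r)F.^ half ≡ F.1#
   sq^half{r}p = E.trans(F.^-distrib-* r r half)(E.trans(E.sym(F.^-homo-* r half half))(E.trans(cong(r F.^_)(E.sym nz≡))(F.fermat p)))

  1≤half : 1 ≤ half
  1≤half = positive half nz≡
   where
   positive : ∀ n -> length F.nz ≡ n N.+ n -> 1 ≤ n
   positive(suc n)_ = s≤s z≤n
   positive zero e = contradiction(F.∈-nz⁺ F.1≢0)(empty F.nz e)
    where
    empty : ∀ xs -> length xs ≡ 0 -> ¬ F.1# ∈ xs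
    empty [] _ ()

  private
   -- Otherwise every nonzero element would be a root of x ^ half - 1.
   euler-≢1 : δ₀ F.^ half ≢ F.1#
   euler-≢1 e = <⇒≱(N.m<m+n half 1≤half)(subst(N._≤ half)nz≡(bound half 1≤half roots))
    where
    root : ∀{x}-> x ≢ F.0# -> Dec(O.Square x)-> x F.^ half ≡ F.1#
    root p(yes(r , E.refl))= sq^half(\{E.refl -> p(F.zeroˡ _)})
    root{x}p(no ¬sq)with Sq.nonsquare-form x ¬sq
    ... | r , E.refl = E.trans(F.^-distrib-* δ₀(r F.* r)half)(E.trans(cong₂ F._*_ e(sq^half(\{E.refl -> p(E.trans(cong(δ₀ F.*_)(F.zeroˡ _))(F.zeroʳ _))})))(F.*-identityˡ _))
    roots : All(\x -> x F.^ half ≡ F.1#)F.nz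
    roots = All.tabulate(\{x}p -> root(F.∈-nz⁻ p)(O.square? x))
    bound : ∀ n -> 1 ≤ n -> All(\x -> x F.^ n ≡ F.1#)F.nz -> length F.nz ≤ n
    bound(suc n)_ h = P.roots-of-unity n F.nz-unique h

   euler : δ₀ F.^ half ≡ F.- F.1#
   euler = pick(O.roots-±{δ₀ F.^ half}{F.1#}(E.trans(E.sym(F.^-distrib-* δ₀ δ₀ half))(E.trans(sq^half Sq.δ₀≢0)(E.sym(F.*-identityˡ _)))))
    where
    pick : _ -> δ₀ F.^ half ≡ F.- F.1#
    pick(inj₁ e)= contradiction e euler-≢1
    pick(inj₂ e)= e

  emb : F.Carrier -> F₂.Carrier
  emb x = x , F.0#

  emb-* : ∀ x y -> emb(x F.* y)≡ emb x F₂.* emb y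
  emb-* x y = cong₂ _,_(F.solve 3(\x y d -> x F.:* y F.:= x F.:* y F.:+ d F.:*(F.con 0 F.:* F.con 0))E.refl x y δ₀)
   (F.solve 2(\x y -> F.con 0 F.:= x F.:* F.con 0 F.:+ F.con 0 F.:* y)E.refl x y)

  emb-^ : ∀ x n -> emb(x F.^ n)≡ emb x F₂.^ n
  emb-^ x zero = E.refl
  emb-^ x(suc n)= E.trans(emb-* x(x F.^ n))(cong(emb x F₂.*_)(emb-^ x n))

  private
   ω : F₂.Carrier
   ω = F.0# , F.1#

   bar : F₂.Carrier -> F₂.Carrier
   bar(x , y)= x , F.- y

   decompose : ∀ x y ->(x , y)≡ emb x F₂.+ emb y F₂.* ω
   decompose x y = cong₂ _,_
    (F.solve 4(\x y d o -> x F.:= x F.:+(y F.:* F.con 0 F.:+ d F.:*(F.con 0 F.:* o)))E.refl x y δ₀ F.1#)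
    (E.trans(E.sym(F.*-identityʳ y))(F.solve 2(\y o -> y F.:* o F.:= F.con 0 F.:+(y F.:* o F.:+ F.con 0 F.:* F.con 0))E.refl y F.1#))

   ω² : ω F₂.* ω ≡ emb δ₀
   ω² = cong₂ _,_(E.trans(F.solve 2(\d o -> F.con 0 F.:* F.con 0 F.:+ d F.:*(o F.:* o)F.:= d F.:*(o F.:* o))E.refl δ₀ F.1#)(E.trans(cong(δ₀ F.*_)(F.*-identityˡ _))(F.*-identityʳ _)))
    (F.solve 1(\o -> F.con 0 F.:* o F.:+ o F.:* F.con 0 F.:= F.con 0)E.refl F.1#)

   size-half : F.size ≡ suc(half N.+ half)
   size-half = E.trans F.size-nz(cong suc nz≡)

   ω^ : ω F₂.^ F.size ≡ emb(F.- F.1#)F₂.* ω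
   ω^ = E.trans(cong(ω F₂.^_)size-half)(E.trans(cong(ω F₂.*_)(E.trans(F₂.^-homo-* ω half half)(E.trans(E.sym(F₂.^-distrib-* ω ω half))
    (E.trans(cong(F₂._^ half)ω²)(E.trans(E.sym(emb-^ δ₀ half))(cong emb euler))))))(F₂.*-comm ω _))

  char₂ : F₂.K.⟨ suc(suc I')⟩ ≡ F₂.0#
  char₂ = E.trans(FieldMap.map-⟨⟩ F F₂ emb E.refl E.refl(\x y -> cong(x F.+ y ,_)(E.sym(F.+-identityˡ F.0#)))(suc(suc I')))(cong emb char)

  private
   frob : ∀ z w ->(z F₂.+ w)F₂.^ F.size ≡ z F₂.^ F.size F₂.+ w F₂.^ F.size
   frob z w = subst(\n ->(z F₂.+ w)F₂.^ n ≡ z F₂.^ n F₂.+ w F₂.^ n)(E.sym size≡)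
    (FrobeniusField.field-frobenius F₂ pr char₂ h z w)

   bar-^ : ∀ z -> z F₂.^ F.size ≡ bar z
   bar-^(x , y)= E.trans(cong(F₂._^ F.size)(decompose x y))(E.trans(frob(emb x)(emb y F₂.* ω))(E.trans
    (cong₂ F₂._+_(fix x)(E.trans(F₂.^-distrib-*(emb y)ω F.size)(cong₂ F₂._*_(fix y)ω^)))
    (E.trans(cong(emb x F₂.+_)(E.trans(E.sym(F₂.*-assoc(emb y)(emb(F.- F.1#))ω))(cong(F₂._* ω)(E.trans(E.sym(emb-* y(F.- F.1#)))
     (cong emb(E.trans(F.solve 2(\y o -> y F.:*(F.:- o)F.:= F.:-(y F.:* o))E.refl y F.1#)(cong F.-_(F.*-identityʳ y))))))))(E.sym(decompose x(F.- y))))))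
    where
    fix : ∀ x -> emb x F₂.^ F.size ≡ emb x
    fix x = E.trans(E.sym(emb-^ x F.size))(cong emb(F.fermat' x))

  norm-^ : ∀ z -> emb(Sq.norm z)≡ z F₂.^ suc F.size
  norm-^ z = E.sym(E.trans(cong(z F₂.*_)(bar-^ z))(prod z))
   where
   prod : ∀ z -> z F₂.* bar z ≡ emb(Sq.norm z)
   prod(x , y)= cong₂ _,_(F.solve 3(\x y d -> x F.:* x F.:+ d F.:*(y F.:*(F.:- y))F.:= x F.:* x F.:- d F.:*(y F.:* y))E.refl x y δ₀)
    (F.solve 2(\x y -> x F.:*(F.:- y)F.:+ y F.:* x F.:= F.con 0)E.refl x y)

  size₂ : F₂.size ≡ F.size N.* F.size
  size₂ = len F.elems
   where
   len : ∀ xs -> length(cartesianProduct xs F.elems)≡ length xs N.* F.size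
   len [] = E.refl
   len(x ∷ xs)= E.trans(List.length-++(map(x ,_)F.elems))(cong₂ N._+_(List.length-map(x ,_)F.elems)(len xs))

  next : Extension F₀ I'
  next = record
   {F = F₂ ; ι = emb ∘ ι ; ι-* = \x y -> E.trans(cong emb(ι-* x y))(emb-*(ι x)(ι y)); ι-0 = cong emb ι-0 ; ι-inj = ι-inj ∘ cong proj₁
   ; Φ = Φ ∘ Sq.norm ; M = suc F.size N.* M ; h = h N.+ h
   ; ι-Φ = \z -> E.trans(cong emb(ι-Φ(Sq.norm z)))(E.trans(emb-^(Sq.norm z)M)(E.trans(cong(F₂._^ M)(norm-^ z))(F₂.^-assocʳ z(suc F.size)M)))
   ; size≡ = E.trans size₂(E.trans(cong₂ N._*_ size≡ size≡)(E.sym(^-distribˡ-+-*(suc(suc I'))h h)))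
   ; size-M = E.trans size₂(sizes F.size size-M)
   ; odd = odd ∘ cong proj₁
   ; char = char₂}
   where
   sizes : ∀ q -> q ≡ suc(suc I' N.* M)-> q N.* q ≡ suc(suc I' N.*(suc q N.* M))
   sizes q e = E.trans(cong(N._* q)e)(E.trans(solve 3(\i m q ->(con 1 :+ i :* m):* q := q :+(i :* m):* q)E.refl(suc I')M q)
    (E.trans(cong(N._+ suc I' N.* M N.* q)e)(solve 3(\i m q -> con 1 :+ i :* m :+ i :* m :* q := con 1 :+ i :*((con 1 :+ q):* m))E.refl(suc I')M q)))
    where open +-*-Solver

module Weil where
 open import Data.Nat using (_∸_)
 open import Data.Nat.Solver using (module +-*-Solver)
 open Alg
 open Cone
 open Field
 open Quad
 open Stepanov
 open Char
 open Tower

 private module ΣN = NatSums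

 fibre-total : ∀ i m r z -> r ≡ suc(suc i N.* m)-> 3 ≤ r -> z ≤ 3 ->
        suc i N.*(r N.*(m N.+ 11))N.+ z ≤ r N.* r N.+ 11 N.* suc(suc i)N.* r
 fibre-total i m r z r≡ 3≤r z≤3 = begin
  _ ≤⟨ +-monoʳ-≤(suc i N.*(r N.*(m N.+ 11)))(≤-trans z≤3 3≤r)⟩
  _ ≡⟨ solve 3(\i r m -> i :*(r :*(m :+ con 11)):+ r := r :*(con 1 :+ i :* m):+ con 11 :* i :* r)E.refl(suc i)r m ⟩
  _ ≤⟨ +-mono-≤(≡⇒≤(cong(r N.*_)(E.sym r≡)))(*-monoˡ-≤ r(*-monoʳ-≤ 11(n≤1+n(suc i))))⟩
  _ ∎
  where
  open N.≤-Reasoning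
  open +-*-Solver

 numeric : ∀ T q -> 1 ≤ T -> 2 N.*(16 N.*(q N.* q))N.+ 2 N.*(121 N.*(T N.* T)N.*(q N.* q))≤(121 N.* T N.* q)N.*(121 N.* T N.* q)
 numeric T q 1≤T = begin
  _ ≡⟨ solve 2(\x y -> con 2 :*(con 16 :* y):+ con 2 :*(con 121 :* x :* y):= con 32 :*(con 1 :* y):+ con 242 :*(x :* y))E.refl X Y ⟩
  _ ≤⟨ +-monoˡ-≤(242 N.*(X N.* Y))(*-monoʳ-≤ 32(*-monoˡ-≤ Y(*-mono-≤ 1≤T 1≤T)))⟩
  _ ≤⟨ m≤m+n _(14367 N.*(X N.* Y))⟩
  _ ≡⟨ solve 2(\t q -> let z =(t :* t):*(q :* q)in con 32 :* z :+ con 242 :* z :+ con 14367 :* z :=(con 121 :* t :* q):*(con 121 :* t :* q))E.refl T q ⟩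
  _ ∎
  where
  open N.≤-Reasoning
  open +-*-Solver
  X = T N.* T
  Y = q N.* q

 module UnitSums (S : StarRing) where
  open Positivity S

  N-units :{I : Set}(xs : List I)(a : I -> ℕ)(y : I -> Carrier)->(∀{x}-> x ∈ xs -> N(y x)≲ 1#)->
       N(Ʃ xs(\x -> ⟨ a x ⟩ * y x))≲ ⟨ ΣN.Ʃ xs a N.* ΣN.Ʃ xs a ⟩
  N-units{I}xs a y h = ≲-div 1(≲-resp left right(Ʃ-mono xs{\x -> Ʃ xs(A x)}{\x -> Ʃ xs(B x)}\{x}x∈ -> Ʃ-mono xs{A x}{B x}\{x'}x'∈ ->
    *-monoˡ(pos-*(pos-⟨⟩(a x))(pos-⟨⟩(a x')))(≲-trans(cross(y x)(y x'))(+-mono(h x∈)(h x'∈)))))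
   where
   A B : I -> I -> Carrier
   A x x' =(⟨ a x ⟩ * ⟨ a x' ⟩)*(y x * y x' ⋆ + y x ⋆ * y x')
   B x x' =(⟨ a x ⟩ * ⟨ a x' ⟩)*(1# + 1#)
   F = \x -> ⟨ a x ⟩ * y x
   N≈ : N(Ʃ xs F)≈ Ʃ xs(\x -> Ʃ xs(\x' ->(⟨ a x ⟩ * ⟨ a x' ⟩)*(y x * y x' ⋆)))
   N≈ = trans(*-congˡ(⋆-Ʃ xs F))(trans(Ʃ-*Ʃ xs xs _ _)(Ʃ-cong xs \x -> Ʃ-cong xs \x' -> trans(*-congˡ(trans(⋆-* _ _)(*-congʳ(self-⟨⟩(a x')))))
    (solve 4(\a b c d ->(a :* b):*(c :* d):=(a :* c):*(b :* d))refl ⟨ a x ⟩(y x)⟨ a x' ⟩(y x' ⋆))))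
   N≈' : N(Ʃ xs F)≈ Ʃ xs(\x -> Ʃ xs(\x' ->(⟨ a x ⟩ * ⟨ a x' ⟩)*(y x ⋆ * y x')))
   N≈' = trans N≈(trans(Ʃ-swap xs xs _)(Ʃ-cong xs \x -> Ʃ-cong xs \x' ->
    solve 4(\a b c d ->(a :* b):*(c :* d):=(b :* a):*(d :* c))refl ⟨ a x' ⟩ ⟨ a x ⟩(y x')(y x ⋆)))
   left : Ʃ xs(\x -> Ʃ xs(A x))≈ ⟨ 2 ⟩ * N(Ʃ xs F)
   left = trans(Ʃ-cong xs \x -> trans(Ʃ-cong xs \x' -> distribˡ _ _ _)(Ʃ-+ xs _ _))(trans(Ʃ-+ xs _ _)(trans(+-cong(sym N≈)(sym N≈'))
    (solve 1(\a -> a :+ a := con 2 :* a)refl(N(Ʃ xs F)))))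
   s = ΣN.Ʃ xs a
   right : Ʃ xs(\x -> Ʃ xs(B x))≈ ⟨ 2 ⟩ * ⟨ s N.* s ⟩
   right = trans(Ʃ-cong xs \x -> Ʃ-*ʳ xs _ _)(trans(Ʃ-*ʳ xs _ _)(trans(*-congʳ(trans(sym(Ʃ-*Ʃ xs xs _ _))(trans(*-cong(Ʃ-⟨⟩ xs a)(Ʃ-⟨⟩ xs a))(sym(⟨⟩-* s s)))))
    (trans(*-comm _ _)(*-congʳ(+-congˡ(sym(+-identityʳ 1#)))))))

 module ValueDistribution (S : StarRing) (F₀ : FiniteField){χ : FiniteField.Carrier F₀ -> CommutativeRing.Carrier (StarRing.cring S)}
              (isχ : Characters.Character S F₀ χ){Ix : Set}(xs : List Ix)(θ : Ix -> FiniteField.Carrier F₀)where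
  open Positivity S
  private module F₀ = FieldKit F₀
  open Characters.Character isχ

  fibre : F₀.Carrier -> List Ix
  fibre g = filter(\s -> θ s F₀.≟ g)xs

  count : ∀ ys g -> ΣN.Ʃ ys(\s -> F₀.δ(θ s)g)≡ length(filter(\s -> θ s F₀.≟ g)ys)
  count [] g = E.refl
  count(y ∷ ys)g with does(θ y F₀.≟ g)
  ... | true = cong suc(count ys g)
  ... | false = count ys g

  δ-sym : ∀ x y -> F₀.δ x y ≡ F₀.δ y x
  δ-sym x y with x F₀.≟ y
  ... | yes E.refl = E.sym(F₀.δ-≡{x}E.refl)
  ... | no q = E.sym(F₀.δ-≢(q ∘ E.sym))

  total : ΣN.Ʃ F₀.elems(length ∘ fibre)≡ length xs
  total = E.trans(ΣN.Ʃ-cong F₀.elems(\g -> E.sym(count xs g)))(E.trans(ΣN.Ʃ-swap F₀.elems xs(\g s -> F₀.δ(θ s)g))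
   (E.trans(ΣN.Ʃ-cong xs(\s -> E.trans(ΣN.Ʃ-cong F₀.elems(\g -> δ-sym(θ s)g))(F₀.Ʃ-δℕ(θ s))))(E.trans(ΣN.Ʃ-const xs 1)(N.*-identityʳ _))))

  by-value : Ʃ xs(\s -> χ(θ s))≈ Ʃ F₀.elems(\g -> ⟨ length(fibre g)⟩ * χ g)
  by-value = trans(Ʃ-cong xs(\s -> sym(F₀.Ʃ-δ cring(θ s)χ)))(trans(Ʃ-swap xs F₀.elems _)
   (Ʃ-cong F₀.elems(\g -> trans(Ʃ-*ʳ xs(χ g)_)(*-congʳ(trans(Ʃ-⟨⟩ xs _)(reflexive(cong ⟨_⟩(E.trans(ΣN.Ʃ-cong xs(\s -> δ-sym g(θ s)))(count xs g)))))))))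

  deviation : ∀ U ->(∀{g}-> g ≢ F₀.0# -> length(fibre g)≤ U)->
   let D = length F₀.nz N.* U N.+ length(fibre F₀.0#)∸ length xs in N(Ʃ xs(\s -> χ(θ s)))≲ ⟨ D N.* D ⟩
  deviation U h = ≲-trans(≲-respˡ N-eq(UnitSums.N-units S F₀.nz gap χ(\{x}_ -> N-ψ≲1 x)))(⟨⟩-mono(*-mono-≤ total-gap total-gap))
   where
   cnt = length ∘ fibre
   gap : F₀.Carrier -> ℕ
   gap g = U ∸ cnt g
   split : ∀{g}-> g ∈ F₀.nz -> ⟨ U ⟩ * χ g ≈ ⟨ cnt g ⟩ * χ g + ⟨ gap g ⟩ * χ g
   split{g}p = trans(*-congʳ(trans(reflexive(cong ⟨_⟩(E.sym(m+[n∸m]≡n(h(F₀.∈-nz⁻ p))))))(⟨⟩-+(cnt g)(gap g))))(distribʳ _ _ _)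
   nz-sum : Ʃ F₀.nz χ ≈ 0#
   nz-sum = trans(sym(+-identityˡ _))(trans(+-congʳ(sym ψ-0))(trans(sym(Characters.Ʃ-nz S F₀ χ))ψ-Ʃ))
   A = Ʃ F₀.nz(\g -> ⟨ cnt g ⟩ * χ g)
   B = Ʃ F₀.nz(\g -> ⟨ gap g ⟩ * χ g)
   A+B : A + B ≈ 0#
   A+B = trans(sym(Ʃ-+ F₀.nz _ _))(trans(Ʃ-cong-∈ F₀.nz(\p -> sym(split p)))(trans(Ʃ-*ˡ F₀.nz _ _)(trans(*-congˡ nz-sum)(zeroʳ _))))
   A≈ : Ʃ xs(\s -> χ(θ s))≈ A
   A≈ = trans by-value(trans(Characters.Ʃ-nz S F₀ _)(trans(+-congʳ(trans(*-congˡ ψ-0)(zeroʳ _)))(+-identityˡ _)))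
   N-eq : N B ≈ N(Ʃ xs(\s -> χ(θ s)))
   N-eq = trans(sym(trans(*-congˡ(⋆-neg B))(solve 2(\a b ->(:- a):*(:- b):= a :* b)refl B(B ⋆))))(N-cong(sym(trans A≈
    (trans(solve 2(\a b -> a :=(a :+ b):- b)refl A B)(trans(+-congʳ A+B)(+-identityˡ _))))))
   sums : ΣN.Ʃ F₀.nz gap N.+ ΣN.Ʃ F₀.nz cnt ≡ length F₀.nz N.* U
   sums = E.trans(E.sym(ΣN.Ʃ-+ F₀.nz gap cnt))(E.trans(ΣN.Ʃ-cong-∈ F₀.nz(\p -> m∸n+n≡m(h(F₀.∈-nz⁻ p))))(ΣN.Ʃ-const F₀.nz U))
   all-sum : length xs ≡ cnt F₀.0# N.+ ΣN.Ʃ F₀.nz cnt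
   all-sum = E.trans(E.sym total)(ΣN.Ʃ-↭ F₀.elems-↭ cnt)
   total-gap : ΣN.Ʃ F₀.nz gap ≤ length F₀.nz N.* U N.+ cnt F₀.0# ∸ length xs
   total-gap = ≡⇒≤(E.sym(E.trans(cong₂ _∸_(cong(N._+ cnt F₀.0#)(E.sym sums))all-sum)
    (E.trans(cong(_∸(cnt F₀.0# N.+ ΣN.Ʃ F₀.nz cnt))(E.trans(N.+-assoc(ΣN.Ʃ F₀.nz gap)_ _)(cong(ΣN.Ʃ F₀.nz gap N.+_)(N.+-comm(ΣN.Ʃ F₀.nz cnt)_))))(N.m+n∸n≡m _(cnt F₀.0# N.+ ΣN.Ʃ F₀.nz cnt)))))

 record TopField(F₀ : FiniteField)(I' : ℕ): Set₁ where
  module F₀ = FieldKit F₀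
  field
   G : FiniteField
  module G = FieldKit G
  field
   ι : F₀.Carrier -> G.Carrier
   ι-* : ∀ x y -> ι(x F₀.* y)≡ ι x G.* ι y
   ι-0 : ι F₀.0# ≡ G.0#
   ι-inj : ∀{x y}-> ι x ≡ ι y -> x ≡ y
   Φ : G.Carrier -> F₀.Carrier
   M h : ℕ
   ι-Φ : ∀ z -> ι(Φ z)≡ z G.^(M N.+ suc(suc I')N.^ h N.* M)
   1≤M : 1 ≤ M
   size≡ : G.size ≡ suc(suc I')N.^ h N.* suc(suc I')N.^ h
   r≡ : suc(suc I')N.^ h ≡ suc(suc I' N.* M)
   char : G.K.⟨ suc(suc I')⟩ ≡ G.0#

 module TopBound (S : StarRing) (F₀ : FiniteField) (I' : ℕ) (pr : Prime (suc (suc I'))) (1≤I' : 1 ≤ I')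
         (size₀ : FieldKit.size F₀ ≡ suc(suc I')){χ : FiniteField.Carrier F₀ -> CommutativeRing.Carrier(StarRing.cring S)}
         (isχ : Characters.Character S F₀ χ)(E : TopField F₀ I')(κ : FiniteField.Carrier(TopField.G E))(κ≢0 : κ ≢ FiniteField.0#(TopField.G E))where
  open Positivity S
  open TopField E
  private
   p = suc(suc I')
   module X = Characters.Character isχ
   M₂ = M N.+ p N.^ h N.* M

  Wκ : Carrier
  Wκ = Ʃ G.elems(\s -> χ(Φ(s G.+ G.1#))* χ(Φ(s G.+ κ))* χ(Φ s)⋆)

  θ : G.Carrier -> F₀.Carrier
  θ s = Φ(s G.+ G.1#)F₀.* Φ(s G.+ κ)F₀.* Φ s F₀.⁻¹

  W≈ : Wκ ≈ Ʃ G.elems(\s -> χ(θ s))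
  W≈ = Ʃ-cong G.elems(\s -> trans(*-congˡ(X.ψ-⋆(Φ s)))(trans(*-congʳ(sym(X.ψ-* _ _)))(sym(X.ψ-* _ _))))

  open ValueDistribution S F₀ isχ G.elems θ

  private
   r = p N.^ h

   U : ℕ
   U = r N.*(M N.+ 11)

   Φ-zero : ∀{z}-> Φ z ≡ F₀.0# -> z ≡ G.0#
   Φ-zero{z}e = power-zero M₂(E.trans(E.sym(ι-Φ z))(E.trans(cong ι e)ι-0))
    where
    power-zero : ∀ n -> z G.^ n ≡ G.0# -> z ≡ G.0#
    power-zero zero e = contradiction e G.1≢0
    power-zero(suc n)e with G.*-zero e
    ... | inj₁ q = q
    ... | inj₂ q = power-zero n q

  module SB (g : F₀.Carrier) = StepanovBound G I' h M κ (ι g)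

  private
   fibre-curve : ∀{g}-> g ≢ F₀.0# -> ∀{s}-> s ∈ fibre g -> SB.Solve.OnCurve g r≡ 1≤M 1≤I' s
   fibre-curve{g}g≢0{s}s∈ = s≢0 , uz≢0 , curve
    where
    θ≡g : θ s ≡ g
    θ≡g = proj₂(∈-filter⁻(\s -> θ s F₀.≟ g){xs = G.elems}s∈)
    a = Φ(s G.+ G.1#)
    b = Φ(s G.+ κ)
    d = Φ s
    ab≢0 : a F₀.* b ≢ F₀.0#
    ab≢0 e = g≢0(E.trans(E.sym θ≡g)(E.trans(cong(F₀._* d F₀.⁻¹)e)(F₀.zeroˡ _)))
    d≢0 : d ≢ F₀.0#
    d≢0 e = g≢0(E.trans(E.sym θ≡g)(E.trans(cong(\x -> a F₀.* b F₀.* x)(E.trans(cong F₀._⁻¹ e)F₀.0⁻¹))(F₀.zeroʳ _)))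
    Φ0 : Φ G.0# ≡ F₀.0#
    Φ0 = ι-inj(E.trans(ι-Φ G.0#)(E.trans(zero-power M₂ 1≤M₂)(E.sym ι-0)))
     where
     1≤M₂ : 1 ≤ M₂
     1≤M₂ = ≤-trans 1≤M(m≤m+n M _)
     zero-power : ∀ n -> 1 ≤ n -> G.0# G.^ n ≡ G.0#
     zero-power(suc n)_ = G.zeroˡ _
    s≢0 : s ≢ G.0#
    s≢0 e = d≢0(E.trans(cong Φ e)Φ0)
    uz≢0 :(s G.+ G.1#)G.*(s G.+ κ)≢ G.0#
    uz≢0 e with G.*-zero e
    ... | inj₁ q = ab≢0(E.trans(cong(F₀._* b)(E.trans(cong Φ q)Φ0))(F₀.zeroˡ _))
    ... | inj₂ q = ab≢0(E.trans(cong(a F₀.*_)(E.trans(cong Φ q)Φ0))(F₀.zeroʳ _))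
    ab≡gd : a F₀.* b ≡ g F₀.* d
    ab≡gd = E.trans(E.sym(F₀.*-identityʳ _))(E.trans(cong(a F₀.* b F₀.*_)(E.sym(F₀.inverseˡ d≢0)))(E.trans(E.sym(F₀.*-assoc _ _ _))(cong(F₀._* d)θ≡g)))
    curve :((s G.+ G.1#)G.*(s G.+ κ))G.^ M₂ ≡ ι g G.* s G.^ M₂
    curve = E.trans(G.^-distrib-*(s G.+ G.1#)(s G.+ κ)M₂)(E.trans(cong₂ G._*_(E.sym(ι-Φ _))(E.sym(ι-Φ _)))
     (E.trans(E.sym(ι-* a b))(E.trans(cong ι ab≡gd)(E.trans(ι-* g d)(cong(ι g G.*_)(ι-Φ s))))))

   fibre-bound : ∀{g}-> g ≢ F₀.0# -> length(fibre g)≤ U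
   fibre-bound{g}g≢0 = <⇒≤(subst(\n -> length(fibre g)< n)U≡
    (SB.Solve.stepanov g r≡ 1≤M 1≤I' κ≢0 size≡ pr char
     (Unique.filter⁺(\s -> θ s F₀.≟ g)G.unique)(All.tabulate(fibre-curve g≢0))))
    where
    U≡ : p N.^ h N.* suc(M N.+ 10)≡ U
    U≡ = cong(r N.*_)(E.sym(+-suc M 10))

   zero-fibre : length(fibre F₀.0#)≤ 3
   zero-fibre = E.subst₂ N._≤_(count G.elems F₀.0#)three(ΣN.Ʃ-mono-≤ G.elems{\s -> F₀.δ(θ s)F₀.0#}\{s}_ -> pointwise s)
    where
    a₁ a₂ : G.Carrier
    a₁ = G.- G.1#
    a₂ = G.- κ
    three : ΣN.Ʃ G.elems(\s -> G.δ s a₁ N.+ G.δ s a₂ N.+ G.δ s G.0#)≡ 3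
    three = E.trans(ΣN.Ʃ-+ G.elems _ _)(cong₂ N._+_(E.trans(ΣN.Ʃ-+ G.elems _ _)(cong₂ N._+_(G.Ʃ-δℕ a₁)(G.Ʃ-δℕ a₂)))(G.Ʃ-δℕ G.0#))
    root : ∀{x y}-> x G.+ y ≡ G.0# -> x ≡ G.- y
    root{x}{y}e = G.x-y≡0⇒x≡y(E.trans(G.solve 2(\x y -> x G.:-(G.:- y)G.:= x G.:+ y)E.refl x y)e)
    inv-zero : ∀{x}-> x F₀.⁻¹ ≡ F₀.0# -> x ≡ F₀.0#
    inv-zero{x}e = E.trans(E.sym(F₀.⁻¹-involutive x))(E.trans(cong F₀._⁻¹ e)F₀.0⁻¹)
    cases : ∀ s -> θ s ≡ F₀.0# -> 1 ≤ G.δ s a₁ N.+ G.δ s a₂ N.+ G.δ s G.0#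
    cases s e with F₀.*-zero e
    ... | inj₂ q = ≤-trans(≡⇒≤(E.sym(G.δ-≡(Φ-zero(inv-zero q)))))(m≤n+m _ _)
    ... | inj₁ q with F₀.*-zero q
    ... | inj₁ q' = ≤-trans(≡⇒≤(E.sym(G.δ-≡(root(Φ-zero q')))))(≤-trans(m≤m+n _ _)(m≤m+n _ _))
    ... | inj₂ q' = ≤-trans(≡⇒≤(E.sym(G.δ-≡(root(Φ-zero q')))))(≤-trans(m≤n+m(G.δ s a₂)(G.δ s a₁))(m≤m+n _ _))
    pointwise : ∀ s -> F₀.δ(θ s)F₀.0# ≤ G.δ s a₁ N.+ G.δ s a₂ N.+ G.δ s G.0#
    pointwise s = go(θ s F₀.≟ F₀.0#)
     where
     go : Dec(θ s ≡ F₀.0#)-> _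
     go(yes e)= ≤-trans(≡⇒≤(F₀.δ-≡ e))(cases s e)
     go(no ne)= ≤-trans(≡⇒≤(F₀.δ-≢ ne))z≤n

   D≤ : length F₀.nz N.* U N.+ length(fibre F₀.0#)∸ length G.elems ≤ 11 N.* p N.* r
   D≤ = m≤n+o⇒m∸n≤o(length F₀.nz N.* U N.+ length(fibre F₀.0#))(length G.elems)(E.subst₂(\x y -> x N.* U N.+ length(fibre F₀.0#)≤ y N.+ 11 N.* p N.* r)(E.sym nz≡)(E.sym size≡)
    (fibre-total I' M r(length(fibre F₀.0#))r≡ 3≤r zero-fibre))
    where
    nz≡ : length F₀.nz ≡ suc I'
    nz≡ = suc-injective(E.trans(E.sym F₀.size-nz)size₀)
    3≤r : 3 ≤ r
    3≤r = subst(3 N.≤_)(E.sym r≡)(s≤s(*-mono-≤(s≤s 1≤I')1≤M))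

  top : N(Wκ)≲ ⟨(11 N.* p N.* r)N.*(11 N.* p N.* r)⟩
  top = ≲-trans(≲-respˡ(N-cong(sym W≈))(deviation U fibre-bound))(⟨⟩-mono(*-mono-≤ D≤ D≤))

 -- The square root in |W|² ≤ 2|c| + |W₂| turns the bound 121 T² over the quadratic extension into 121 T.
 module WeilStep (S : StarRing) where
  open Positivity S

  descend : ∀ T q{w w₂ d}-> 1 ≤ T -> 1 ≤ q -> w₂ + w * w ≈ ⟨ 2 ⟩ * d -> N d ≲ ⟨ 4 ⟩ *(⟨ q ⟩ * ⟨ q ⟩)->
       N w₂ ≲ ⟨ 121 N.*(T N.* T)N.*(q N.* q)⟩ -> N w ≲ ⟨ 121 N.* T N.* q ⟩
  descend T q{w}{w₂}{d}1≤T 1≤q eq Nd Nw₂ = root(121 N.* T N.* q)(*-mono-≤{1}{121 N.* T}(*-mono-≤{1}{121}(s≤s z≤n)1≤T)1≤q)(≲-trans(≲-respˡ Nww(N-+(⟨ 2 ⟩ * d)(- w₂)))(≲-trans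
    (+-mono(*-monoˡ(pos-⟨⟩ 2)N2d)(*-monoˡ(pos-⟨⟩ 2)(≲-respˡ(sym N-neg)Nw₂)))(≲-resp collect(⟨⟩-*(121 N.* T N.* q)(121 N.* T N.* q))(⟨⟩-mono bound))))
   where
   X = T N.* T
   Y = q N.* q
   N-neg : N(- w₂)≈ N w₂
   N-neg = trans(*-congˡ(⋆-neg w₂))(solve 2(\a b ->(:- a):*(:- b):= a :* b)refl w₂(w₂ ⋆))
   Nww : N(⟨ 2 ⟩ * d + - w₂)≈ N w * N w
   Nww = trans(N-cong(trans(+-congʳ(sym eq))(solve 2(\a b ->(a :+ b):- a := b)refl w₂(w * w))))(N-* w w)
   N2d : N(⟨ 2 ⟩ * d)≲ ⟨ 16 N.* Y ⟩
   N2d = ≲-resp(sym(trans(N-* _ _)(*-congʳ(*-congˡ(self-⟨⟩ 2)))))(trans(solve 2(\a y ->(con 2 :* con 2):*(con 4 :* y):= con 16 :* y)refl 0#(⟨ q ⟩ * ⟨ q ⟩))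
    (trans(*-congˡ(sym(⟨⟩-* q q)))(sym(⟨⟩-* 16 Y))))(*-monoˡ(pos-*(pos-⟨⟩ 2)(pos-⟨⟩ 2))Nd)
   collect : ⟨ 2 N.*(16 N.* Y)N.+ 2 N.*(121 N.* X N.* Y)⟩ ≈ ⟨ 2 ⟩ * ⟨ 16 N.* Y ⟩ + ⟨ 2 ⟩ * ⟨ 121 N.* X N.* Y ⟩
   collect = trans(⟨⟩-+(2 N.*(16 N.* Y))(2 N.*(121 N.* X N.* Y)))(+-cong(⟨⟩-* 2(16 N.* Y))(⟨⟩-* 2(121 N.* X N.* Y)))
   bound : 2 N.*(16 N.* Y)N.+ 2 N.*(121 N.* X N.* Y)≤(121 N.* T N.* q)N.*(121 N.* T N.* q)
   bound = numeric T q 1≤T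
   root : ∀ K -> 1 ≤ K -> N w * N w ≲ ⟨ K ⟩ * ⟨ K ⟩ -> N w ≲ ⟨ K ⟩
   root(suc K)_ h = sq-≲⇒≲ K(sq w)h

 module WeilBound (S : StarRing) (F₀ : FiniteField) (I' : ℕ) (pr : Prime (suc (suc I'))) (c : ℕ) (even : suc I' ≡ 2 N.* c) (1≤c : 1 ≤ c)
          (size₀ : FieldKit.size F₀ ≡ suc(suc I')){χ : FiniteField.Carrier F₀ -> CommutativeRing.Carrier(StarRing.cring S)}
          (isχ : Characters.Character S F₀ χ)where
  open Positivity S
  private
   p = suc(suc I')
   1≤I' : 1 ≤ I'
   1≤I' = ≤-pred(subst(2 N.≤_)(E.sym even)(*-monoʳ-≤ 2 1≤c))

  W :(E : Extension F₀ I')-> FiniteField.Carrier(Extension.F E)-> Carrier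
  W E κ = Ʃ F.elems(\s -> χ(Φ(s F.+ F.1#))* χ(Φ(s F.+ κ))* χ(Φ s)⋆)
   where open Extension E

  IsChar : Extension F₀ I' -> Set
  IsChar E = Characters.Character S(Extension.F E)(χ ∘ Extension.Φ E)

  module Next (E : Extension F₀ I') (isψ : IsChar E) where
   open Extension E
   module QS = QuadraticStep E pr c even 1≤c
   module D = Doubling S F odd QS.δ₀ (proj₂ (OddField.Nonsquare.nonsquare F odd))
   module W₁ = Characters.FourPoint S F isψ

   next : Extension F₀ I'
   next = QS.next

   isψ₂ : IsChar next
   isψ₂ = D.lift isψ

   emb≢0 : ∀{κ}-> κ ≢ F.0# -> QS.emb κ ≢ FiniteField.0# QS.F₂
   emb≢0 p e = p(cong proj₁ e)

   size₂ : FieldKit.size QS.F₂ ≡ F.size N.* F.size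
   size₂ = QS.size₂

   1≤M : 1 ≤ M
   1≤M = n≢0⇒n>0(\e -> <⇒≱ QS.1≤half(≡⇒≤(E.trans(cong(c N.*_)e)(N.*-zeroʳ c))))

   1≤size : 1 ≤ F.size
   1≤size = subst(1 N.≤_)(E.sym size-M)(s≤s z≤n)

   topField : TopField F₀ I'
   topField = record
    {G = QS.F₂ ; ι = Extension.ι next ; ι-* = Extension.ι-* next ; ι-0 = Extension.ι-0 next ; ι-inj = Extension.ι-inj next
    ; Φ = Extension.Φ next ; M = M ; h = h ; 1≤M = 1≤M
    ; ι-Φ = \z -> E.trans(Extension.ι-Φ next z)(cong(\n -> FieldKit._^_ QS.F₂ z(M N.+ n N.* M))size≡)
    ; size≡ = E.trans size₂(cong₂ N._*_ size≡ size≡); r≡ = E.trans(E.sym size≡)size-M ; char = Extension.char next}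

   top : ∀{κ}-> κ ≢ F.0# -> N(W next(QS.emb κ))≲ ⟨(11 N.* p N.* p N.^ h)N.*(11 N.* p N.* p N.^ h)⟩
   top{κ}κ≢0 = TopBound.top S F₀ I' pr 1≤I' size₀ isχ topField(QS.emb κ)(emb≢0 κ≢0)

   down : ∀ T{κ}-> 1 ≤ T -> κ ≢ F.0# -> N(W next(QS.emb κ))≲ ⟨ 121 N.*(T N.* T)N.*(F.size N.* F.size)⟩ -> N(W E κ)≲ ⟨ 121 N.* T N.* F.size ⟩
   down T{κ}1≤T κ≢0 h = WeilStep.descend S T F.size 1≤T 1≤size(D.doubling isψ κ)(W₁.N-conductor κ≢0)h

  weil : ∀ n T -> 1 ≤ T -> p ≤ T N.^(2 N.^ n)->(E : Extension F₀ I')-> IsChar E -> ∀{κ}-> κ ≢ FiniteField.0#(Extension.F E)->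
      N(W E κ)≲ ⟨ 121 N.* T N.* FieldKit.size(Extension.F E)⟩
  weil zero T 1≤T p≤T E isψ κ≢0 = down T 1≤T κ≢0(≲-trans(top κ≢0)(⟨⟩-mono(subst(\r ->(11 N.* p N.* r)N.*(11 N.* p N.* r)≤ 121 N.*(T N.* T)N.*(F.size N.* F.size))size≡(bound p T F.size p≤T'))))
   where
   open Next E isψ
   open Extension E
   p≤T' : p ≤ T
   p≤T' = subst(p N.≤_)(N.*-identityʳ T)p≤T
   bound : ∀ p T r -> p ≤ T ->(11 N.* p N.* r)N.*(11 N.* p N.* r)≤ 121 N.*(T N.* T)N.*(r N.* r)
   bound p T r h = ≤-trans(≡⇒≤(solveℕ 2(\p r ->(conℕ 11 ⊠ p ⊠ r)⊠(conℕ 11 ⊠ p ⊠ r):≡ conℕ 121 ⊠(p ⊠ p)⊠(r ⊠ r))E.refl p r))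
    (*-monoˡ-≤(r N.* r)(*-monoʳ-≤ 121(*-mono-≤ h h)))
    where open +-*-Solver using () renaming (solve to solveℕ; _:=_ to _:≡_; _:*_ to _⊠_; con to conℕ)
  weil(suc n)T 1≤T p≤T E isψ{κ}κ≢0 = down T 1≤T κ≢0(subst(\s -> N(W next(QS.emb κ))≲ ⟨ 121 N.*(T N.* T)N.* s ⟩)size₂
    (weil n(T N.* T)(*-mono-≤ 1≤T 1≤T)(subst(p N.≤_)powers p≤T)next isψ₂(emb≢0 κ≢0)))
   where
   open Next E isψ
   powers : T N.^(2 N.^ suc n)≡(T N.* T)N.^(2 N.^ n)
   powers = E.trans(E.sym(^-*-assoc T 2(2 N.^ n)))(cong(\x ->(T N.* x)N.^(2 N.^ n))(N.*-identityʳ T))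

module Moment where
 open Alg
 open Cone
 open Field
 open Char

 private module ΣN = NatSums

 module FourthMoment (S : StarRing) (Φ : FiniteField){χ : FiniteField.Carrier Φ -> CommutativeRing.Carrier (StarRing.cring S)}
           (isχ : Characters.Character S Φ χ)where
  open Positivity S
  open Characters S Φ using (module F; module Character; module Orthogonality; Ʃ-except-0)
  open F using (elems; size) renaming (Carrier to K)
  open F.Reindex cring
  open Characters.Character isχ
  open Characters.Orthogonality S Φ isχ using (orthogonal)

  V : K -> Carrier
  V κ = Ʃ elems(\s -> χ(s F.+ F.1#)* χ(s F.+ κ)* χ s ⋆)

  W : K -> K -> K -> K -> Carrier
  W a b c d = Ʃ elems(\x ->(χ(x F.+ a)* χ(x F.+ b))*(χ(x F.+ c)⋆ * χ(x F.+ d)⋆))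

  private
   N-unit-* : ∀{u v}-> N u ≈ 1# -> N(u * v)≈ N v
   N-unit-* p = trans(N-* _ _)(trans(*-congʳ p)(*-identityˡ _))

   N-mul≲1 : ∀{u v}-> N u ≲ 1# -> N v ≲ 1# -> N(u * v)≲ 1#
   N-mul≲1{u}{v}p q = ≲-resp(sym(N-* u v))(*-identityˡ 1#)(*-mono(sq u)pos-1 p q)

   W-term : ∀ a b c d x -> N((χ(x F.+ a)* χ(x F.+ b))*(χ(x F.+ c)⋆ * χ(x F.+ d)⋆))≲ 1#
   W-term a b c d x = N-mul≲1(N-mul≲1(N-ψ≲1 _)(N-ψ≲1 _))(N-mul≲1(≲-respˡ(sym(N-⋆ _))(N-ψ≲1 _))(≲-respˡ(sym(N-⋆ _))(N-ψ≲1 _)))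

  W-trivial : ∀ a b c d -> W a b c d + W a b c d ⋆ ≲ ⟨ 2 ⟩ * ⟨ size ⟩
  W-trivial a b c d = ≲-resp(trans(Ʃ-+ elems _ _)(+-congˡ(sym(⋆-Ʃ elems _))))(trans(Ʃ-const elems ⟨ 2 ⟩)(*-comm _ _))
   (Ʃ-mono elems{\x -> t x + t x ⋆}\{x}_ -> ≲-resp(+-cong(trans(*-congˡ 1⋆)(*-identityʳ _))(*-identityʳ _))(+-congˡ(sym ⟨1⟩))
    (≲-trans(cross(t x)1#)(+-mono(W-term a b c d x)(≈⇒≲(trans(*-congˡ 1⋆)(*-identityˡ 1#))))))
   where
   t : K -> Carrier
   t x =(χ(x F.+ a)* χ(x F.+ b))*(χ(x F.+ c)⋆ * χ(x F.+ d)⋆)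

  private
   two-terms : ∀{u}-> N u ≲ 1# -> N(- 1# - u)≲ ⟨ 4 ⟩
   two-terms{u}h = ≲-trans(N-+(- 1#)(- u))(≲-respʳ(solve 0(con 2 :* con 1 :+ con 2 :* con 1 := con 4)refl)
    (+-mono(*-monoˡ(pos-⟨⟩ 2)(≈⇒≲(trans(neg 1#)(trans(*-congˡ 1⋆)(trans(*-identityˡ 1#)(sym ⟨1⟩))))))(*-monoˡ(pos-⟨⟩ 2)(≲-resp(sym(neg u))(sym ⟨1⟩)h))))
    where
    neg : ∀ x -> N(- x)≈ N x
    neg x = trans(*-congˡ(⋆-neg x))(solve 2(\a b ->(:- a):*(:- b):= a :* b)refl x(x ⋆))

   -- A repeated factor only removes one term from the orthogonality relation.
   pair-sum : ∀ a{b c}-> b ≢ c -> N(Ʃ elems(\x -> N(χ(x F.+ a))*(χ(x F.+ b)* χ(x F.+ c)⋆)))≲ ⟨ 4 ⟩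
   pair-sum a{b}{c}b≢c = ≲-respˡ(sym(N-cong eq))(two-terms{χ(b F.- a)* χ(c F.- a)⋆}(N-mul≲1(N-ψ≲1 _)(≲-respˡ(sym(N-⋆ _))(N-ψ≲1 _))))
    where
    f : K -> Carrier
    f x = N(χ(x F.+ a))*(χ(x F.+ b)* χ(x F.+ c)⋆)
    g : K -> Carrier
    g y = χ(y F.+(b F.- a))* χ(y F.+(c F.- a))⋆
    shift : ∀(y w : K)->(y F.+ F.- a)F.+ w ≡ y F.+(w F.- a)
    shift y w = F.solve 3(\y a w ->(y F.:+ F.:- a)F.:+ w F.:= y F.:+(w F.:- a))E.refl y a w
    minus : ∀ v w -> v F.+ w ≡ v F.-(F.- w)
    minus v w = F.solve 2(\v w -> v F.:+ w F.:= v F.:-(F.:- w))E.refl v w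
    neg-inj : ∀{x y}-> F.- x ≡ F.- y -> x ≡ y
    neg-inj{x}{y}e = E.trans(F.solve 1(\x -> x F.:= F.:-(F.:- x))E.refl x)(E.trans(cong F.-_ e)(F.solve 1(\y -> F.:-(F.:- y)F.:= y)E.refl y))
    apart : F.-(b F.- a)≢ F.-(c F.- a)
    apart e = b≢c(E.trans(F.solve 2(\b a -> b F.:=(b F.:- a)F.:+ a)E.refl b a)(E.trans(cong(\t -> t F.+ a)(neg-inj e))(F.solve 2(\c a ->(c F.:- a)F.:+ a F.:= c)E.refl c a)))
    g-sum : Ʃ elems g ≈ - 1#
    g-sum = trans(Ʃ-cong elems(\y -> *-cong(ψ-cong(minus y(b F.- a)))(⋆-cong(ψ-cong(minus y(c F.- a))))))(orthogonal apart)
    0+ : ∀ x -> F.0# F.+ x ≡ x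
    0+ = F.+-identityˡ
    eq : Ʃ elems f ≈ - 1# - χ(b F.- a)* χ(c F.- a)⋆
    eq = begin
     _ ≈⟨ sym(Ʃ-reindex(F.shift-bij(F.- a))f)⟩
     _ ≈⟨ Ʃ-cong elems(\y -> *-cong(N-cong(ψ-cong(F.solve 2(\y a ->(y F.:+ F.:- a)F.:+ a F.:= y)E.refl y a)))(*-cong(ψ-cong(shift y b))(⋆-cong(ψ-cong(shift y c)))))⟩
     _ ≈⟨ Ʃ-except-0(\{y}p -> trans(*-congʳ(ψ-N p))(*-identityˡ(g y)))⟩
     _ ≈⟨ +-cong g-sum(+-cong(trans(*-congʳ(trans(*-congʳ ψ-0)(zeroˡ _)))(zeroˡ _))(-‿cong(*-cong(ψ-cong(0+ _))(⋆-cong(ψ-cong(0+ _))))))⟩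
     _ ≈⟨ +-congˡ(+-identityˡ _)⟩
     _ ∎

   -- The substitution x = 1/y moves the point d (here 0) to infinity.
   inversion : ∀{a b c}-> a ≢ F.0# -> b ≢ F.0# -> c ≢ F.0# -> a ≢ c -> b ≢ c -> ∀ B ->
         (∀{κ}-> κ ≢ F.0# -> N(V κ)≲ B)-> N(W a b c F.0#)≲ ⟨ 2 ⟩ * B + ⟨ 2 ⟩
   inversion{a}{b}{c}a≢0 b≢0 c≢0 a≢c b≢c B h = ≲-respˡ(sym(N-cong W≈))(≲-trans(N-+ _(- 1#))
     (+-mono(*-monoˡ(pos-⟨⟩ 2)(≲-respˡ(sym(trans(N-cong Y≈)(N-unit-* unit)))(h κ≢0)))(≈⇒≲(trans(*-congˡ(trans(*-congˡ(⋆-neg 1#))(trans(solve 2(\o p ->(:- o):*(:- p):= o :* p)refl 1#(1# ⋆))(trans(*-congˡ 1⋆)(*-identityˡ 1#)))))(*-identityʳ _)))))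
    where
    lin : K -> K -> Carrier
    lin e y = χ(F.1# F.+ e F.* y)
    Y : Carrier
    Y = Ʃ elems(\y -> lin a y * lin b y * lin c y ⋆)
    flip : ∀{y}e -> y ≢ F.0# -> χ(y F.⁻¹ F.+ e)≈ χ(y F.⁻¹)* lin e y
    flip{y}e p = trans(ψ-cong(E.trans(cong(\t -> y F.⁻¹ F.+ t)(E.trans(E.sym(F.*-identityʳ e))(cong(\t -> e F.* t)(E.sym(F.inverseˡ p)))))
     (E.trans(cong(\t -> t F.+ e F.*(y F.⁻¹ F.* y))(E.sym(F.*-identityʳ _)))(F.solve 4(\i o e y -> i F.:* o F.:+ e F.:*(i F.:* y)F.:= i F.:*(o F.:+ e F.:* y))E.refl(y F.⁻¹)F.1# e y))))(ψ-* _ _)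
    W≈ : W a b c F.0# ≈ Y + - 1#
    W≈ = begin
     _ ≈⟨ sym(Ʃ-reindex F.inv-bij _)⟩
     _ ≈⟨ Ʃ-except-0{_}{\y -> lin a y * lin b y * lin c y ⋆}nonzero ⟩
     _ ≈⟨ +-congˡ(+-cong(trans(*-congˡ(trans(*-congˡ(trans(⋆-cong(trans(ψ-cong(E.trans(F.+-identityʳ _)F.0⁻¹))ψ-0))0⋆))(zeroʳ _)))(zeroʳ _))
         (-‿cong(trans(*-cong(trans(*-cong(at0 a)(at0 b))(*-identityˡ 1#))(trans(⋆-cong(at0 c))1⋆))(*-identityˡ 1#))))⟩
     _ ≈⟨ +-congˡ(+-identityˡ _)⟩
     Y + - 1# ∎
     where
     at0 : ∀ e -> lin e F.0# ≈ 1#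
     at0 e = trans(ψ-cong(E.trans(cong(\t -> F.1# F.+ t)(F.zeroʳ e))(F.+-identityʳ _)))ψ-1
     nonzero : ∀{y}-> y ≢ F.0# ->(χ(y F.⁻¹ F.+ a)* χ(y F.⁻¹ F.+ b))*(χ(y F.⁻¹ F.+ c)⋆ * χ(y F.⁻¹ F.+ F.0#)⋆)≈ lin a y * lin b y * lin c y ⋆
     nonzero{y}p = trans(*-cong(*-cong(flip a p)(flip b p))(*-cong(trans(⋆-cong(flip c p))(⋆-* _ _))(⋆-cong(ψ-cong(F.+-identityʳ _)))))
      (trans(solve 5(\i j x y z ->((i :* x):*(i :* y)):*((j :* z):* j):=((i :* j):*(i :* j)):*(x :* y :* z))refl(χ(y F.⁻¹))(χ(y F.⁻¹)⋆)(lin a y)(lin b y)(lin c y ⋆))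
      (trans(*-congʳ(trans(*-cong(ψ-N(F.⁻¹-nonzero p))(ψ-N(F.⁻¹-nonzero p)))(*-identityˡ 1#)))(*-identityˡ _)))
    α β e₁ e₂ κ : K
    α = a F.* c F.⁻¹
    β = b F.* c F.⁻¹
    e₁ = c F.* a F.⁻¹ F.- F.1#
    e₂ = c F.* b F.⁻¹ F.- F.1#
    κ = e₂ F.* e₁ F.⁻¹
    e≢0 : ∀{x}-> x ≢ F.0# -> x ≢ c -> c F.* x F.⁻¹ F.- F.1# ≢ F.0#
    e≢0{x}x≢0 x≢c p = x≢c(E.trans(E.sym(F.*-identityˡ x))(E.trans(cong(\t -> t F.* x)(E.sym(F.x-y≡0⇒x≡y p)))(E.trans(F.*-assoc c _ x)(E.trans(cong(\t -> c F.* t)(F.inverseˡ x≢0))(F.*-identityʳ c)))))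
    e₁≢0 = e≢0 a≢0 a≢c
    e₂≢0 = e≢0 b≢0 b≢c
    κ≢0 : κ ≢ F.0#
    κ≢0 = F.*-nonzero e₂≢0(F.⁻¹-nonzero e₁≢0)
    u : Carrier
    u =(χ α * χ β)*(χ e₁ * χ e₁ * χ e₁ ⋆)
    unit : N u ≈ 1#
    unit = one(one(ψ-N(F.*-nonzero a≢0(F.⁻¹-nonzero c≢0)))(ψ-N(F.*-nonzero b≢0(F.⁻¹-nonzero c≢0))))(one(one(ψ-N e₁≢0)(ψ-N e₁≢0))(trans(N-⋆ _)(ψ-N e₁≢0)))
     where
     one : ∀{x y}-> N x ≈ 1# -> N y ≈ 1# -> N(x * y)≈ 1#
     one p q = trans(N-* _ _)(trans(*-cong p q)(*-identityˡ 1#))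
    -- y = c⁻¹(s - 1) followed by s = e₁ s′
    lin-e : ∀{x}-> x ≢ F.0# -> ∀ s -> F.1# F.+ x F.*(c F.⁻¹ F.*(s F.+ F.- F.1#))≡(x F.* c F.⁻¹)F.*(s F.+(c F.* x F.⁻¹ F.- F.1#))
    lin-e{x}x≢0 s = E.sym(E.trans(F.solve 6(\x i c j s o ->(x F.:* i)F.:*(s F.:+(c F.:* j F.:- o))F.:=(x F.:* j)F.:*(c F.:* i)F.:+ x F.:*(i F.:*(s F.:+ F.:- o)))E.refl x(c F.⁻¹)c(x F.⁻¹)s F.1#)
     (cong(\t -> t F.+ x F.*(c F.⁻¹ F.*(s F.+ F.- F.1#)))(E.trans(cong₂ F._*_(F.inverseʳ x≢0)(F.inverseʳ c≢0))(F.*-identityˡ _))))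
    lin-c : ∀ s -> F.1# F.+ c F.*(c F.⁻¹ F.*(s F.+ F.- F.1#))≡ s
    lin-c s = E.trans(cong(\t -> F.1# F.+ t)(E.trans(E.sym(F.*-assoc c _ _))(E.trans(cong(\t -> t F.*(s F.+ F.- F.1#))(F.inverseʳ c≢0))(F.*-identityˡ _))))(F.solve 2(\o s -> o F.:+(s F.:+ F.:- o)F.:= s)E.refl F.1# s)
    Y≈ : Y ≈ u * V κ
    Y≈ = trans(sym(Ʃ-reindex(F.scale-bij(c F.⁻¹)(F.⁻¹-nonzero c≢0))_))(trans(sym(Ʃ-reindex(F.shift-bij(F.- F.1#))_))
     (trans(Ʃ-cong elems(\s -> *-cong(*-cong(trans(ψ-cong(lin-e a≢0 s))(ψ-* _ _))(trans(ψ-cong(lin-e b≢0 s))(ψ-* _ _)))(⋆-cong(ψ-cong(lin-c s)))))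
     (trans(sym(Ʃ-reindex(F.scale-bij e₁ e₁≢0)_))(trans(Ʃ-cong elems step)(Ʃ-*ˡ elems u _)))))
     where
     step : ∀ s ->(χ α * χ(e₁ F.* s F.+ e₁))*(χ β * χ(e₁ F.* s F.+ e₂))* χ(e₁ F.* s)⋆ ≈ u *(χ(s F.+ F.1#)* χ(s F.+ κ)* χ s ⋆)
     step s = trans(*-cong(*-cong(*-congˡ(trans(ψ-cong(E.trans(cong(\t -> e₁ F.* s F.+ t)(E.sym(F.*-identityʳ e₁)))(E.sym(F.distribˡ e₁ s F.1#))))(ψ-* _ _)))
       (*-congˡ(trans(ψ-cong(E.trans(cong(\t -> e₁ F.* s F.+ t)(E.sym(E.trans(F.solve 3(\e k i -> e F.:*(k F.:* i)F.:= k F.:*(e F.:* i))E.refl e₁ e₂(e₁ F.⁻¹))(E.trans(cong(\t -> e₂ F.* t)(F.inverseʳ e₁≢0))(F.*-identityʳ e₂)))))(E.sym(F.distribˡ e₁ s κ))))(ψ-* _ _))))(trans(⋆-cong(ψ-* e₁ s))(⋆-* _ _)))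
      (solve 7(\α β e j x y z ->(α :*(e :* x)):*(β :*(e :* y)):*(j :* z):=((α :* β):*(e :* e :* j)):*(x :* y :* z))refl(χ α)(χ β)(χ e₁)(χ e₁ ⋆)(χ(s F.+ F.1#))(χ(s F.+ κ))(χ s ⋆))

   separated : ∀{a b c d}-> a ≢ c -> a ≢ d -> b ≢ c -> b ≢ d -> c ≢ d -> ∀ B ->(∀{κ}-> κ ≢ F.0# -> N(V κ)≲ B)-> N(W a b c d)≲ ⟨ 2 ⟩ * B + ⟨ 2 ⟩
   separated{a}{b}{c}{d}ac ad bc bd cd B h = ≲-respˡ(N-cong shifted)(inversion(F.x≢y⇒x-y≢0 ad)(F.x≢y⇒x-y≢0 bd)(F.x≢y⇒x-y≢0 cd)(ac ∘ cancel)(bc ∘ cancel)B h)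
    where
    cancel : ∀{x y}-> x F.- d ≡ y F.- d -> x ≡ y
    cancel{x}{y}e = E.trans(F.solve 2(\x d -> x F.:=(x F.:- d)F.:+ d)E.refl x d)(E.trans(cong(\t -> t F.+ d)e)(F.solve 2(\y d ->(y F.:- d)F.:+ d F.:= y)E.refl y d))
    move : ∀ x w ->(x F.+ F.- d)F.+ w ≡ x F.+(w F.- d)
    move x w = F.solve 3(\x d w ->(x F.:+ F.:- d)F.:+ w F.:= x F.:+(w F.:- d))E.refl x d w
    shifted : W(a F.- d)(b F.- d)(c F.- d)F.0# ≈ W a b c d
    shifted = trans(Ʃ-cong elems(\x -> *-cong(*-cong(ψ-cong(E.sym(move x a)))(ψ-cong(E.sym(move x b))))(*-cong(⋆-cong(ψ-cong(E.sym(move x c))))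
     (⋆-cong(ψ-cong(E.trans(cong(\t -> x F.+ t)(E.sym(F.-‿inverseʳ d)))(E.sym(move x d))))))))(Ʃ-reindex(F.shift-bij(F.- d))_)

   W-⋆ : ∀ a b c d -> W c d a b ≈ W a b c d ⋆
   W-⋆ a b c d = sym(trans(⋆-Ʃ elems _)(Ʃ-cong elems \x -> trans(⋆-* _ _)(trans(*-cong(⋆-* _ _)(trans(⋆-* _ _)(*-cong(⋆-involutive _)(⋆-involutive _))))(*-comm _ _))))

   pairing : ∀{a b c d}x y ->(∀ t ->(χ(t F.+ a)* χ(t F.+ b))*(χ(t F.+ c)⋆ * χ(t F.+ d)⋆)≈ N(χ(t F.+ y))*(χ(t F.+ proj₁ x)* χ(t F.+ proj₂ x)⋆))->
        proj₁ x ≢ proj₂ x -> N(W a b c d)≲ ⟨ 4 ⟩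
   pairing x y e ne = ≲-respˡ(N-cong(sym(Ʃ-cong elems e)))(pair-sum y ne)

  W-bound : ∀{a b c d}-> ¬(a ≡ c × b ≡ d)-> ¬(a ≡ d × b ≡ c)-> ¬(a ≡ b × c ≡ d)-> ∀ B -> ⟨ 1 ⟩ ≲ B ->
       (∀{κ}-> κ ≢ F.0# -> N(V κ)≲ B)-> N(W a b c d)≲ ⟨ 2 ⟩ * B + ⟨ 2 ⟩
  W-bound{a}{b}{c}{d}n₁ n₂ n₃ B 1≲B h = go(a F.≟ c)(a F.≟ d)(b F.≟ c)(b F.≟ d)(c F.≟ d)
   where
   four : ⟨ 4 ⟩ ≲ ⟨ 2 ⟩ * B + ⟨ 2 ⟩
   four = ≲-respˡ(solve 0(con 2 :* con 1 :+ con 2 := con 4)refl)(+-mono(*-monoˡ(pos-⟨⟩ 2)1≲B)≲-refl)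
   go : Dec(a ≡ c)-> Dec(a ≡ d)-> Dec(b ≡ c)-> Dec(b ≡ d)-> Dec(c ≡ d)-> N(W a b c d)≲ ⟨ 2 ⟩ * B + ⟨ 2 ⟩
   go(yes E.refl)_ _ _ _ = ≲-trans(pairing(b , d)a(\t -> solve 4(\x y z w ->(x :* y):*(z :* w):=(x :* z):*(y :* w))refl(χ(t F.+ a))(χ(t F.+ b))(χ(t F.+ a)⋆)(χ(t F.+ d)⋆))(\e -> n₁(E.refl , e)))four
   go(no _)(yes E.refl)_ _ _ = ≲-trans(pairing(b , c)a(\t -> solve 4(\x y z w ->(x :* y):*(z :* w):=(x :* w):*(y :* z))refl(χ(t F.+ a))(χ(t F.+ b))(χ(t F.+ c)⋆)(χ(t F.+ a)⋆))(\e -> n₂(E.refl , e)))four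
   go(no ac)(no ad)(yes E.refl)_ _ = ≲-trans(pairing(a , d)b(\t -> solve 4(\x y z w ->(x :* y):*(z :* w):=(y :* z):*(x :* w))refl(χ(t F.+ a))(χ(t F.+ b))(χ(t F.+ b)⋆)(χ(t F.+ d)⋆))ad)four
   go(no ac)(no ad)(no bc)(yes E.refl)_ = ≲-trans(pairing(a , c)b(\t -> solve 4(\x y z w ->(x :* y):*(z :* w):=(y :* w):*(x :* z))refl(χ(t F.+ a))(χ(t F.+ b))(χ(t F.+ c)⋆)(χ(t F.+ b)⋆))ac)four
   go(no ac)(no ad)(no bc)(no bd)(no cd)= separated ac ad bc bd cd B h
   go(no ac)(no ad)(no bc)(no bd)(yes E.refl)= ≲-respˡ(trans(N-cong(W-⋆ a b c c))(N-⋆ _))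
    (separated(ac ∘ E.sym)(bc ∘ E.sym)(ac ∘ E.sym)(bc ∘ E.sym)(\e -> n₃(e , E.refl))B h)

module Moment2 where
 open Alg
 open Cone
 open Field
 open Char
 open Moment

 private module ΣN = NatSums

 thrice : ∀ n -> n N.+(n N.+ n)≡ 3 N.* n
 thrice = solve-∀

 module ShiftMoments (S : StarRing) (Φ : FiniteField){χ : FiniteField.Carrier Φ -> CommutativeRing.Carrier (StarRing.cring S)}
           (isχ : Characters.Character S Φ χ)
           (θ : ℕ -> FiniteField.Carrier Φ)(d : ℕ)
           (θ-inj : ∀{i j}-> i < d -> j < d -> θ i ≡ θ j -> i ≡ j)where
  open Positivity S
  open Characters S Φ using (module F)
  open F using (elems; size; δ) renaming (Carrier to K)
  open Characters.Character isχ
  open Characters.Orthogonality S Φ isχ using (gram)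
  open FourthMoment S Φ isχ using (W; V; W-trivial; W-bound)

  P : K -> Carrier
  P x = Ʃ(rng d)(\i -> χ(x F.+ θ i))

  private
   δ≢ : ∀{i j}-> i < d -> j < d -> i ≢ j -> δ(θ i)(θ j)≡ 0
   δ≢ p q n = F.δ-≢(n ∘ θ-inj p q)

   δ-zero : ∀ a n -> n ≤ a -> a < d -> ΣN.Ʃ(rng n)(\i -> δ(θ a)(θ i))≡ 0
   δ-zero a n n≤a a<d = ΣN.Ʃ-≈0(rng n)(\{i}p -> let i<a = <-≤-trans(∈-rng⁻ p)n≤a in
    δ≢ a<d(<-trans i<a a<d)(\e -> <-irrefl(E.sym e)i<a))

   Ʃ-δ-rng : ∀ a n -> a < d -> n ≤ d -> ΣN.Ʃ(rng n)(\i -> δ(θ a)(θ i))≤ 1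
   Ʃ-δ-rng a zero a<d n≤d = z≤n
   Ʃ-δ-rng a(suc n)a<d n<d = go(a N.≟ n)
    where
    go : Dec(a ≡ n)-> ΣN.Ʃ(rng(suc n))(\i -> δ(θ a)(θ i))≤ 1
    go(yes E.refl)= ≡⇒≤(cong₂ N._+_(F.δ-≡{θ a}E.refl)(δ-zero a a ≤-refl a<d))
    go(no p)= ≤-trans(≡⇒≤(cong(N._+ ΣN.Ʃ(rng n)(\i -> δ(θ a)(θ i)))(δ≢ a<d n<d p)))(Ʃ-δ-rng a n a<d(<⇒≤ n<d))

   ƩƩ-δ : ΣN.Ʃ(rng d)(\a -> ΣN.Ʃ(rng d)(\b -> δ(θ a)(θ b)))≤ d
   ƩƩ-δ = ≤-trans(ΣN.Ʃ-≤-const(rng d)1(\p -> Ʃ-δ-rng _ d(∈-rng⁻ p)≤-refl))(≡⇒≤(E.trans(N.*-identityʳ _)(length-rng d)))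

   swap₂ :{A : Set}(xs : List A)(f : A -> ℕ -> ℕ -> Carrier)->
       Ʃ xs(\x -> Ʃ(rng d)(\a -> Ʃ(rng d)(f x a)))≈ Ʃ(rng d)(\a -> Ʃ(rng d)(\b -> Ʃ xs(\x -> f x a b)))
   swap₂ xs f = trans(Ʃ-swap xs(rng d)_)(Ʃ-cong(rng d)(\a -> Ʃ-swap xs(rng d)(\x -> f x a)))

   N-P : ∀ x -> N(P x)≈ Ʃ(rng d)(\a -> Ʃ(rng d)(\b -> χ(x F.+ θ a)* χ(x F.+ θ b)⋆))
   N-P x = trans(*-congˡ(⋆-Ʃ(rng d)_))(Ʃ-*Ʃ(rng d)(rng d)_ _)

   correlation : ∀ a b -> Ʃ elems(\x -> χ(x F.+ θ a)* χ(x F.+ θ b)⋆)≲ ⟨ δ(θ a)(θ b)⟩ * ⟨ size ⟩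
   correlation a b = by(resp(trans(solve 2(\g o -> o := g :-(g :- o))refl(⟨ δ(θ a)(θ b)⟩ * ⟨ size ⟩)1#)(+-congˡ(-‿cong eq)))pos-1)
    where
    neg-δ : ∀ s t -> δ(F.- s)(F.- t)≡ δ s t
    neg-δ s t = go(s F.≟ t)
     where
     go : Dec(s ≡ t)-> δ(F.- s)(F.- t)≡ δ s t
     go(yes E.refl)= E.trans(F.δ-≡{F.- s}E.refl)(E.sym(F.δ-≡{s}E.refl))
     go(no p)= E.trans(F.δ-≢(\e -> p(E.trans(F.solve 1(\s -> s F.:= F.:-(F.:- s))E.refl s)(E.trans(cong F.-_ e)(F.solve 1(\t -> F.:-(F.:- t)F.:= t)E.refl t)))))(E.sym(F.δ-≢ p))
    shift : ∀(x t : K)-> x F.-(F.- t)≡ x F.+ t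
    shift x t = F.solve 2(\x t -> x F.:-(F.:- t)F.:= x F.:+ t)E.refl x t
    eq : ⟨ δ(θ a)(θ b)⟩ * ⟨ size ⟩ - 1# ≈ Ʃ elems(\x -> χ(x F.+ θ a)* χ(x F.+ θ b)⋆)
    eq = trans(+-congʳ(*-congʳ(reflexive(cong ⟨_⟩(E.sym(neg-δ(θ a)(θ b)))))))(trans(sym(gram(F.- θ a)(F.- θ b)))
     (Ʃ-cong elems(\x -> *-cong(ψ-cong(shift x(θ a)))(⋆-cong(ψ-cong(shift x(θ b)))))))

  second-moment : Ʃ elems(\x -> N(P x))≲ ⟨ d N.* size ⟩
  second-moment = ≲-trans(≲-resp(sym(trans(Ʃ-cong elems N-P)(swap₂ elems _)))
    (trans(Ʃ-cong(rng d)(\a -> trans(Ʃ-*ʳ(rng d)⟨ size ⟩ _)(*-congʳ(Ʃ-⟨⟩(rng d)(\b -> δ(θ a)(θ b))))))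
     (trans(Ʃ-*ʳ(rng d)⟨ size ⟩ _)(trans(*-congʳ(Ʃ-⟨⟩(rng d)(\a -> ΣN.Ʃ(rng d)(\b -> δ(θ a)(θ b)))))(sym(⟨⟩-*(ΣN.Ʃ(rng d)(\a -> ΣN.Ʃ(rng d)(\b -> δ(θ a)(θ b))))size)))))
    (Ʃ-mono(rng d){\a -> Ʃ(rng d)(\b -> Ʃ elems(\x -> χ(x F.+ θ a)* χ(x F.+ θ b)⋆))}{\a -> Ʃ(rng d)(\b -> ⟨ δ(θ a)(θ b)⟩ * ⟨ size ⟩)}
     (\{a}_ -> Ʃ-mono(rng d)(\{b}_ -> correlation a b))))
   (⟨⟩-mono(*-monoˡ-≤ size ƩƩ-δ))

  private
   deg : ℕ -> ℕ -> ℕ -> ℕ -> ℕ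
   deg a b c e = δ(θ a)(θ c)N.* δ(θ b)(θ e)N.+(δ(θ a)(θ e)N.* δ(θ b)(θ c)N.+ δ(θ a)(θ b)N.* δ(θ c)(θ e))

   ƩƩ :(ℕ -> ℕ -> ℕ)-> ℕ
   ƩƩ f = ΣN.Ʃ(rng d)(\a -> ΣN.Ʃ(rng d)(f a))

   rectangle :(f g : ℕ -> ℕ -> ℕ)-> ƩƩ(\a b -> ƩƩ(\c e -> f a c N.* g b e))≡ ƩƩ f N.* ƩƩ g
   rectangle f g = E.sym(E.trans(ΣN.Ʃ-*Ʃ(rng d)(rng d)_ _)(ΣN.Ʃ-cong(rng d)(\a -> ΣN.Ʃ-cong(rng d)(\b -> ΣN.Ʃ-*Ʃ(rng d)(rng d)(f a)(g b)))))

   ƩƩ-cong : ∀{f g : ℕ -> ℕ -> ℕ}->(∀ a b -> f a b ≡ g a b)-> ƩƩ f ≡ ƩƩ g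
   ƩƩ-cong h = ΣN.Ʃ-cong(rng d)(\a -> ΣN.Ʃ-cong(rng d)(h a))

   ƩƩ-+ : ∀(f g : ℕ -> ℕ -> ℕ)-> ƩƩ(\a b -> f a b N.+ g a b)≡ ƩƩ f N.+ ƩƩ g
   ƩƩ-+ f g = E.trans(ΣN.Ʃ-cong(rng d)(\a -> ΣN.Ʃ-+(rng d)(f a)(g a)))(ΣN.Ʃ-+(rng d)_ _)

   ƩƩƩƩ-+ : ∀(f g : ℕ -> ℕ -> ℕ -> ℕ -> ℕ)-> ƩƩ(\a b -> ƩƩ(\c e -> f a b c e N.+ g a b c e))≡ ƩƩ(\a b -> ƩƩ(f a b))N.+ ƩƩ(\a b -> ƩƩ(g a b))
   ƩƩƩƩ-+ f g = E.trans(ƩƩ-cong(\a b -> ƩƩ-+(f a b)(g a b)))(ƩƩ-+(\a b -> ƩƩ(f a b))(\a b -> ƩƩ(g a b)))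

   δδ : ℕ -> ℕ -> ℕ
   δδ a b = δ(θ a)(θ b)

   deg-total : ƩƩ(\a b -> ƩƩ(\c e -> deg a b c e))≤ 3 N.*(d N.* d)
   deg-total = ≤-trans(≡⇒≤(E.trans(ƩƩƩƩ-+ _ _)(cong₂ N._+_(rectangle δδ δδ)(E.trans(ƩƩƩƩ-+ _ _)(cong₂ N._+_
     (E.trans(ƩƩ-cong(\a b -> ΣN.Ʃ-swap(rng d)(rng d)(\c e -> δδ a e N.* δδ b c)))(rectangle δδ δδ))
     (E.trans(ƩƩ-cong(\a b -> E.trans(ΣN.Ʃ-cong(rng d)(\c -> ΣN.Ʃ-*ˡ(rng d)(δδ a b)(δδ c)))(ΣN.Ʃ-*ˡ(rng d)(δδ a b)_)))
      (E.trans(ΣN.Ʃ-cong(rng d)(\a -> ΣN.Ʃ-*ʳ(rng d)(ƩƩ δδ)(δδ a)))(ΣN.Ʃ-*ʳ(rng d)(ƩƩ δδ)_))))))))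
    (≤-trans(≡⇒≤(thrice(ƩƩ δδ N.* ƩƩ δδ)))(*-monoʳ-≤ 3(*-mono-≤ ƩƩ-δ ƩƩ-δ)))

   total : ∀ s -> ƩƩ(\a b -> ƩƩ(\c e -> size N.* deg a b c e N.+ s))≤ size N.*(3 N.*(d N.* d))N.+(d N.* d)N.*(d N.* d)N.* s
   total s = ≤-trans(≡⇒≤(E.trans(ƩƩƩƩ-+ _ _)(cong₂ N._+_
     (E.trans(ƩƩ-cong(\a b -> pull(deg a b)))(pull(\a b -> ƩƩ(deg a b))))
     (E.trans(ƩƩ-cong(\a b -> const s))(E.trans(const((d N.* d)N.* s))(E.sym(N.*-assoc(d N.* d)_ s)))))))
    (+-monoˡ-≤ _(*-monoʳ-≤ size deg-total))
    where
    pull : ∀(f : ℕ -> ℕ -> ℕ)-> ƩƩ(\a b -> size N.* f a b)≡ size N.* ƩƩ f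
    pull f = E.trans(ΣN.Ʃ-cong(rng d)(\a -> ΣN.Ʃ-*ˡ(rng d)size(f a)))(ΣN.Ʃ-*ˡ(rng d)size _)
    const : ∀ t -> ƩƩ(\_ _ -> t)≡(d N.* d)N.* t
    const t = E.trans(ΣN.Ʃ-cong(rng d)(\_ -> ΣN.Ʃ-const(rng d)t))(E.trans(ΣN.Ʃ-const(rng d)_)
     (E.trans(cong(\l -> l N.*(l N.* t))(length-rng d))(E.sym(N.*-assoc d d t))))

   Z : Carrier
   Z = Ʃ elems(\x -> N(P x)* N(P x))

   I :(ℕ -> ℕ -> Carrier)-> Carrier
   I f = Ʃ(rng d)(\a -> Ʃ(rng d)(f a))

   I-cong : ∀{f g : ℕ -> ℕ -> Carrier}->(∀ a b -> f a b ≈ g a b)-> I f ≈ I g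
   I-cong h = Ʃ-cong(rng d)(\a -> Ʃ-cong(rng d)(h a))

   I-+ : ∀(f g : ℕ -> ℕ -> Carrier)-> I(\a b -> f a b + g a b)≈ I f + I g
   I-+ f g = trans(Ʃ-cong(rng d)(\a -> Ʃ-+(rng d)(f a)(g a)))(Ʃ-+(rng d)_ _)

   I-*ˡ : ∀ c(f : ℕ -> ℕ -> Carrier)-> I(\a b -> c * f a b)≈ c * I f
   I-*ˡ c f = trans(Ʃ-cong(rng d)(\a -> Ʃ-*ˡ(rng d)c(f a)))(Ʃ-*ˡ(rng d)c _)

   I-⋆ : ∀(f : ℕ -> ℕ -> Carrier)-> I(\a b -> f a b ⋆)≈(I f)⋆
   I-⋆ f = sym(trans(⋆-Ʃ(rng d)_)(Ʃ-cong(rng d)(\a -> ⋆-Ʃ(rng d)_)))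

   I-mono : ∀{f g : ℕ -> ℕ -> Carrier}->(∀{a b}-> a < d -> b < d -> f a b ≲ g a b)-> I f ≲ I g
   I-mono{f}{g}h = Ʃ-mono(rng d){\a -> Ʃ(rng d)(f a)}{\a -> Ʃ(rng d)(g a)}(\{a}p -> Ʃ-mono(rng d){f a}{g a}(\q -> h(∈-rng⁻ p)(∈-rng⁻ q)))

   I-⟨⟩ : ∀(f : ℕ -> ℕ -> ℕ)-> I(\a b -> ⟨ f a b ⟩)≈ ⟨ ƩƩ f ⟩
   I-⟨⟩ f = trans(Ʃ-cong(rng d)(\a -> Ʃ-⟨⟩(rng d)(f a)))(Ʃ-⟨⟩(rng d)_)

   WW : ℕ -> ℕ -> ℕ -> ℕ -> Carrier
   WW a b c e = W(θ a)(θ b)(θ c)(θ e)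

   Z≈ : Z ≈ I(\a b -> I(\c e -> WW a b c e))
   Z≈ = trans(Ʃ-cong elems expand)(trans(swap₂ elems _)(I-cong(\a b -> swap₂ elems _)))
    where
    expand : ∀ x -> N(P x)* N(P x)≈ I(\a b -> I(\c e ->(χ(x F.+ θ a)* χ(x F.+ θ b))*(χ(x F.+ θ c)⋆ * χ(x F.+ θ e)⋆)))
    expand x = trans(solve 2(\p q ->(p :* q):*(p :* q):=(p :* p):*(q :* q))refl(P x)(P x ⋆))
     (trans(*-cong(Ʃ-*Ʃ(rng d)(rng d)_ _)(trans(*-cong(⋆-Ʃ(rng d)_)(⋆-Ʃ(rng d)_))(Ʃ-*Ʃ(rng d)(rng d)_ _)))
      (trans(sym(Ʃ-*ʳ(rng d)_ _))(Ʃ-cong(rng d)(\a -> trans(sym(Ʃ-*ʳ(rng d)_ _))(Ʃ-cong(rng d)(\b -> sym(I-*ˡ _ _)))))))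

   two-Z : ⟨ 2 ⟩ * Z ≈ I(\a b -> I(\c e -> WW a b c e + WW a b c e ⋆))
   two-Z = trans(solve 1(\z -> con 2 :* z := z :+ z)refl Z)(trans(+-cong Z≈(trans(sym self-Z)(trans(⋆-cong Z≈)(trans(sym(I-⋆ _))(I-cong(\a b -> sym(I-⋆ _)))))))
    (trans(sym(I-+ _ _))(I-cong(\a b -> sym(I-+ _ _)))))
    where
    self-Z : Self Z
    self-Z = self-Ʃ elems(\x -> self-*(self-N(P x))(self-N(P x)))

  fourth-moment : ∀ B s -> ⟨ 1 ⟩ ≲ B ->(∀{κ}-> κ ≢ F.0# -> N(V κ)≲ B)-> ⟨ 2 ⟩ * B + ⟨ 2 ⟩ ≲ ⟨ suc s N.* suc s ⟩ ->
          Ʃ elems(\x -> N(P x)* N(P x))≲ ⟨ size N.*(3 N.*(d N.* d))N.+(d N.* d)N.*(d N.* d)N.* suc s ⟩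
  fourth-moment B s 1≲B h hs = ≲-div 1(≲-respˡ(sym two-Z)(≲-trans(I-mono{\a b -> I(\c e -> WW a b c e + WW a b c e ⋆)}{\a b -> I(\c e -> ⟨ 2 ⟩ * ⟨ size N.* deg a b c e N.+ suc s ⟩)}
    (\{a}{b}a< b< -> I-mono{\c e -> WW a b c e + WW a b c e ⋆}{\c e -> ⟨ 2 ⟩ * ⟨ size N.* deg a b c e N.+ suc s ⟩}(\{c}{e}c< e< -> pointwise a b c e)))
   (≲-respˡ(sym(trans(I-cong(\a b -> I-*ˡ ⟨ 2 ⟩ _))(trans(I-*ˡ ⟨ 2 ⟩ _)(*-congˡ(trans(I-cong(\a b -> I-⟨⟩(\c e -> size N.* deg a b c e N.+ suc s)))(I-⟨⟩ _))))))
    (*-monoˡ(pos-⟨⟩ 2)(⟨⟩-mono(total(suc s)))))))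
   where
   t = suc s
   small : ∀ w -> N w ≲ ⟨ 2 ⟩ * B + ⟨ 2 ⟩ -> w + w ⋆ ≲ ⟨ 2 ⟩ * ⟨ t ⟩
   small w p = ≲-div s(≲-trans(≲-resp(trans(+-cong(*-congˡ(self-⟨⟩ t))(*-comm _ _))(trans(+-congʳ(*-comm _ _))(sym(distribˡ _ _ _))))(+-congˡ(*-congˡ(self-⟨⟩ t)))(cross w ⟨ t ⟩))
    (≲-respʳ(trans(+-congʳ(⟨⟩-* t t))(solve 1(\t -> t :* t :+ t :* t := t :*(con 2 :* t))refl ⟨ t ⟩))
     (+-mono(≲-trans p hs)(≲-refl{⟨ t ⟩ * ⟨ t ⟩}))))
   big : ∀{n}-> 1 ≤ n -> size ≤ size N.* n N.+ t
   big{n}1≤n = ≤-trans(≤-trans(≡⇒≤(E.sym(N.*-identityʳ size)))(*-monoʳ-≤ size 1≤n))(m≤m+n(size N.* n)t)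
   prod0 : ∀{x y}-> x N.+ y ≡ 0 -> x ≡ 0 × y ≡ 0
   prod0{x}e = N.m+n≡0⇒m≡0 x e , N.m+n≡0⇒n≡0 x e
   both : ∀{a b c e}-> δ a b N.* δ c e ≡ 0 -> ¬(a ≡ b × c ≡ e)
   both{a}{_}{c}z(E.refl , E.refl)= contradiction(E.trans(E.sym(cong₂ N._*_(F.δ-≡{a}E.refl)(F.δ-≡{c}E.refl)))z)\ ()
   pointwise : ∀ a b c e -> WW a b c e + WW a b c e ⋆ ≲ ⟨ 2 ⟩ * ⟨ size N.* deg a b c e N.+ t ⟩
   pointwise a b c e = go(deg a b c e)E.refl
    where
    go : ∀ n -> deg a b c e ≡ n -> WW a b c e + WW a b c e ⋆ ≲ ⟨ 2 ⟩ * ⟨ size N.* n N.+ t ⟩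
    go zero p = let p₁ , p₂ = prod0{δ(θ a)(θ c)N.* δ(θ b)(θ e)}p ; p₃ , p₄ = prod0{δ(θ a)(θ e)N.* δ(θ b)(θ c)}p₂ in
     ≲-trans(small(WW a b c e)(W-bound(both p₁)(both p₃)(both p₄)B 1≲B h))(*-monoˡ(pos-⟨⟩ 2)(⟨⟩-mono(m≤n+m t(size N.* 0))))
    go(suc n)p = ≲-trans(W-trivial(θ a)(θ b)(θ c)(θ e))(*-monoˡ(pos-⟨⟩ 2)(⟨⟩-mono(big(s≤s z≤n))))

module Burgess where
 open Alg
 open Cone
 open Field
 open Char

 private module ΣN = NatSums

 module Prefixes (S : StarRing) where
  open Positivity S

  -- The sum of the squares of all dyadic blocks of f on [0, 2^κ).
  Q : ℕ ->(ℕ -> Carrier)-> Carrier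
  Q zero f = N(f 0)
  Q(suc κ)f = N(Ʃ(rng(2 N.^ suc κ))f)+(Q κ f + Q κ(\b -> f(b N.+ 2 N.^ κ)))

  pos-Q : ∀ κ f -> Pos(Q κ f)
  pos-Q zero f = sq(f 0)
  pos-Q(suc κ)f = add(sq _)(add(pos-Q κ f)(pos-Q κ _))

  block≲Q : ∀ κ f -> N(Ʃ(rng(2 N.^ κ))f)≲ Q κ f
  block≲Q zero f = ≈⇒≲(N-cong(+-identityʳ _))
  block≲Q(suc κ)f = ≲-+ʳ(add(pos-Q κ f)(pos-Q κ _))

  prefix : ∀ κ f j -> j ≤ 2 N.^ κ -> N(Ʃ(rng j)f)≲ ⟨ suc κ ⟩ * Q κ f
  prefix zero f zero _ = ≲-respˡ(sym(zeroˡ _))(pos⇒≲(pos-*(pos-⟨⟩ 1)(sq(f 0))))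
  prefix zero f(suc zero)_ = ≈⇒≲(trans(N-cong(+-identityʳ(f 0)))(sym(trans(*-congʳ ⟨1⟩)(*-identityˡ _))))
  prefix zero f(suc(suc j))(s≤s ())
  prefix(suc κ)f j j≤ = go(j N.≤? 2 N.^ κ)
   where
   n = suc κ
   f' : ℕ -> Carrier
   f' b = f(b N.+ 2 N.^ κ)
   top : Q κ f + Q κ f' ≲ Q(suc κ)f
   top = ≲-+ˡ(sq _)
   go : Dec(j ≤ 2 N.^ κ)-> N(Ʃ(rng j)f)≲ ⟨ suc n ⟩ * Q(suc κ)f
   go(yes p)= ≲-trans(prefix κ f j p)(*-mono(pos-⟨⟩ n)(pos-Q(suc κ)f)(⟨⟩-mono(n≤1+n n))(≲-trans(≲-+ʳ(pos-Q κ f'))top))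
   go(no ¬p)= ≲-trans(≲-respˡ(N-cong(sym split))(≲-div κ(≲-trans(N-weighted n u v)(≲-respʳ alg(+-mono(*-monoˡ(pos-⟨⟩ n)(*-monoˡ(pos-⟨⟩(suc n))(block≲Q κ f)))(*-monoˡ(pos-⟨⟩(suc n))(prefix κ f' i i≤)))))))
           (*-monoˡ(pos-⟨⟩(suc n))top)
    where
    i = j N.∸ 2 N.^ κ
    j≡ : i N.+ 2 N.^ κ ≡ j
    j≡ = m∸n+n≡m(<⇒≤(≰⇒> ¬p))
    i≤ : i ≤ 2 N.^ κ
    i≤ = m≤n+o⇒m∸n≤o j(2 N.^ κ)(≤-trans j≤(≡⇒≤(cong(2 N.^ κ N.+_)(N.+-identityʳ _))))
    u v : Carrier
    u = Ʃ(rng(2 N.^ κ))f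
    v = Ʃ(rng i)f'
    split : Ʃ(rng j)f ≈ u + v
    split = trans(reflexive(cong(\k -> Ʃ(rng k)f)(E.sym j≡)))(Ʃ-rng-+(2 N.^ κ)i f)
    alg : ⟨ n ⟩ *(⟨ suc n ⟩ * Q κ f)+ ⟨ suc n ⟩ *(⟨ n ⟩ * Q κ f')≈ ⟨ n ⟩ *(⟨ suc n ⟩ *(Q κ f + Q κ f'))
    alg = solve 4(\n m a b -> n :*(m :* a):+ m :*(n :* b):= n :*(m :*(a :+ b)))refl ⟨ n ⟩ ⟨ suc n ⟩(Q κ f)(Q κ f')

  module Averages{X : Set}(xs : List X) (M : ℕ) (F : X -> ℕ -> Carrier) where
   sh : ℕ -> X -> ℕ -> Carrier
   sh c x b = F x(b N.+ c)

   private
    resh : ∀ κ c x -> Q κ(\b -> sh c x(b N.+ 2 N.^ κ))≈ Q κ(sh(2 N.^ κ N.+ c)x)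
    resh κ c x = go κ(\b -> cong(F x)(N.+-assoc b(2 N.^ κ)c))
     where
     go : ∀ κ{f g : ℕ -> Carrier}->(∀ b -> f b ≡ g b)-> Q κ f ≈ Q κ g
     go zero h = N-cong(reflexive(h 0))
     go(suc κ)h = +-cong(N-cong(Ʃ-cong(rng(2 N.^ suc κ))(\b -> reflexive(h b))))(+-cong(go κ h)(go κ(\b -> h(b N.+ 2 N.^ κ))))

    double : ∀ κ -> 2 N.^ suc κ ≡ 2 N.^ κ N.+ 2 N.^ κ
    double κ = cong(2 N.^ κ N.+_)(N.+-identityʳ _)

    left≤ : ∀ κ c -> 2 N.^ suc κ N.+ c ≤ M -> 2 N.^ κ N.+ c ≤ M
    left≤ κ c h = ≤-trans(+-monoˡ-≤ c(m≤m+n(2 N.^ κ)_))h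

    right≤ : ∀ κ c -> 2 N.^ suc κ N.+ c ≤ M -> 2 N.^ κ N.+(2 N.^ κ N.+ c)≤ M
    right≤ κ c h = ≤-trans(≡⇒≤(E.trans(E.sym(N.+-assoc(2 N.^ κ)_ c))(cong(N._+ c)(E.sym(double κ)))))h

   first-average : ∀ U ->(∀ i c -> 2 N.^ i N.+ c ≤ M -> Ʃ xs(\x -> N(Ʃ(rng(2 N.^ i))(sh c x)))≲ ⟨ 2 N.^ i ⟩ * ⟨ U ⟩)->
    ∀ κ c -> 2 N.^ κ N.+ c ≤ M -> Ʃ xs(\x -> Q κ(sh c x))≲ ⟨ suc κ ⟩ *(⟨ 2 N.^ κ ⟩ * ⟨ U ⟩)
   first-average U h zero c le = ≲-resp(Ʃ-cong xs(\x -> N-cong(+-identityʳ _)))(sym(trans(*-congʳ ⟨1⟩)(*-identityˡ _)))(h 0 c le)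
   first-average U h(suc κ)c le = ≲-resp(sym(trans(Ʃ-+ xs _ _)(+-congˡ(trans(Ʃ-+ xs _ _)(+-congˡ(Ʃ-cong xs(resh κ c)))))))alg
     (+-mono(h(suc κ)c le)(+-mono(first-average U h κ c(left≤ κ c le))(first-average U h κ(2 N.^ κ N.+ c)(right≤ κ c le))))
    where
    b = ⟨ 2 N.^ κ ⟩
    two : ⟨ 2 N.^ suc κ ⟩ ≈ ⟨ 2 ⟩ * b
    two = ⟨⟩-* 2(2 N.^ κ)
    alg : ⟨ 2 N.^ suc κ ⟩ * ⟨ U ⟩ +(⟨ suc κ ⟩ *(b * ⟨ U ⟩)+ ⟨ suc κ ⟩ *(b * ⟨ U ⟩))≈ ⟨ suc(suc κ)⟩ *(⟨ 2 N.^ suc κ ⟩ * ⟨ U ⟩)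
    alg = trans(+-congʳ(*-congʳ two))(trans(solve 4(\o k b u -> con 2 :* b :* u :+(k :*(b :* u):+ k :*(b :* u)):=(con 1 :+ k):*(con 2 :* b :* u))refl 1# ⟨ suc κ ⟩ b ⟨ U ⟩)
     (*-cong(+-congʳ ⟨1⟩)(*-congʳ(sym two))))

   second-average : ∀ U κ₀ ->(∀ i c -> i ≤ κ₀ -> 2 N.^ i N.+ c ≤ M ->
     Ʃ xs(\x -> N(Ʃ(rng(2 N.^ i))(sh c x))* N(Ʃ(rng(2 N.^ i))(sh c x)))≲ ⟨ 2 N.^ i ⟩ * ⟨ 2 N.^ i ⟩ * ⟨ U ⟩)->
    ∀ κ c -> κ ≤ κ₀ -> 2 N.^ κ N.+ c ≤ M -> Ʃ xs(\x -> Q κ(sh c x)* Q κ(sh c x))≲ ⟨ suc κ ⟩ * ⟨ suc κ ⟩ *(⟨ 2 N.^ κ ⟩ * ⟨ 2 N.^ κ ⟩ * ⟨ U ⟩)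
   second-average U κ₀ h zero c k≤ le = ≲-resp(Ʃ-cong xs(\x -> *-cong(N-cong(+-identityʳ _))(N-cong(+-identityʳ _))))
    (sym(trans(*-congʳ(trans(*-cong ⟨1⟩ ⟨1⟩)(*-identityˡ 1#)))(*-identityˡ _)))(h 0 c k≤ le)
   second-average U κ₀ h(suc κ)c k≤ le = ≲-div κ(≲-trans(≲-respˡ(trans(Ʃ-*ˡ xs ⟨ n ⟩ _)refl)(Ʃ-mono xs(\{x}_ -> pointwise x)))
     (≲-resp(sym total)alg(+-mono(*-monoˡ(pos-*(pos-⟨⟩ n)(pos-⟨⟩(suc n)))(h(suc κ)c k≤ le))(*-monoˡ(pos-*(pos-⟨⟩ 2)(pos-⟨⟩(suc n)))
      (+-mono(second-average U κ₀ h κ c k≤'(left≤ κ c le))(second-average U κ₀ h κ(2 N.^ κ N.+ c)k≤'(right≤ κ c le)))))))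
    where
    n = suc κ
    k≤' = ≤-trans(n≤1+n κ)k≤
    b = ⟨ 2 N.^ κ ⟩
    two : ⟨ 2 N.^ suc κ ⟩ ≈ ⟨ 2 ⟩ * b
    two = ⟨⟩-* 2(2 N.^ κ)
    Z q₁ q₂ : X -> Carrier
    Z x = N(Ʃ(rng(2 N.^ suc κ))(sh c x))
    q₁ x = Q κ(sh c x)
    q₂ x = Q κ(\b -> sh c x(b N.+ 2 N.^ κ))
    N-self : ∀{a}-> Pos a -> N a ≈ a * a
    N-self p = *-congˡ(pos-self p)
    pointwise : ∀ x -> ⟨ n ⟩ *(Q(suc κ)(sh c x)* Q(suc κ)(sh c x))≲(⟨ n ⟩ * ⟨ suc n ⟩)*(Z x * Z x)+(⟨ 2 ⟩ * ⟨ suc n ⟩)*(q₁ x * q₁ x + q₂ x * q₂ x)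
    pointwise x = ≲-respˡ(*-congˡ(N-self(pos-Q(suc κ)(sh c x))))(≲-trans(N-weighted n(Z x)(q₁ x + q₂ x))
     (≲-respʳ(solve 5(\n m z a b -> n :*(m :* z):+ m :*(con 2 :* a :+ con 2 :* b):=(n :* m):* z :+(con 2 :* m):*(a :+ b))refl ⟨ n ⟩ ⟨ suc n ⟩(Z x * Z x)(q₁ x * q₁ x)(q₂ x * q₂ x))
      (+-mono(≈⇒≲(*-congˡ(*-congˡ(N-self(sq _)))))(*-monoˡ(pos-⟨⟩(suc n))(≲-respʳ(+-cong(*-congˡ(N-self(pos-Q κ _)))(*-congˡ(N-self(pos-Q κ _))))(N-+(q₁ x)(q₂ x)))))))
    total : Ʃ xs(\x ->(⟨ n ⟩ * ⟨ suc n ⟩)*(Z x * Z x)+(⟨ 2 ⟩ * ⟨ suc n ⟩)*(q₁ x * q₁ x + q₂ x * q₂ x))≈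
     (⟨ n ⟩ * ⟨ suc n ⟩)* Ʃ xs(\x -> Z x * Z x)+(⟨ 2 ⟩ * ⟨ suc n ⟩)*(Ʃ xs(\x -> q₁ x * q₁ x)+ Ʃ xs(\x -> Q κ(sh(2 N.^ κ N.+ c)x)* Q κ(sh(2 N.^ κ N.+ c)x)))
    total = trans(Ʃ-+ xs _ _)(+-cong(Ʃ-*ˡ xs _ _)(trans(Ʃ-*ˡ xs _ _)(*-congˡ(trans(Ʃ-+ xs _ _)(+-congˡ(Ʃ-cong xs(\x -> *-cong(resh κ c x)(resh κ c x))))))))
    alg :(⟨ n ⟩ * ⟨ suc n ⟩)*(⟨ 2 N.^ suc κ ⟩ * ⟨ 2 N.^ suc κ ⟩ * ⟨ U ⟩)+(⟨ 2 ⟩ * ⟨ suc n ⟩)*(⟨ n ⟩ * ⟨ n ⟩ *(b * b * ⟨ U ⟩)+ ⟨ n ⟩ * ⟨ n ⟩ *(b * b * ⟨ U ⟩))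
     ≈ ⟨ n ⟩ *(⟨ suc n ⟩ * ⟨ suc n ⟩ *(⟨ 2 N.^ suc κ ⟩ * ⟨ 2 N.^ suc κ ⟩ * ⟨ U ⟩))
    alg = trans(+-congʳ(*-congˡ(*-congʳ(*-cong two two))))(trans(trans(+-cong(*-congʳ(*-congˡ suc≈))(*-congʳ(*-congˡ suc≈)))
     (solve 3(\n b u ->(n :*(con 1 :+ n)):*((con 2 :* b):*(con 2 :* b):* u):+(con 2 :*(con 1 :+ n)):*(n :* n :*(b :* b :* u):+ n :* n :*(b :* b :* u))
      := n :*((con 1 :+ n):*(con 1 :+ n):*((con 2 :* b):*(con 2 :* b):* u)))refl ⟨ n ⟩ b ⟨ U ⟩))
     (*-congˡ(*-cong(*-cong(sym suc≈)(sym suc≈))(*-congʳ(*-cong(sym two)(sym two))))))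
     where
     suc≈ : ⟨ suc n ⟩ ≈ ⟨ 1 ⟩ + ⟨ n ⟩
     suc≈ = +-congʳ(sym ⟨1⟩)

module Shift where
 open Alg
 open Cone
 open Field
 open Char
 open Burgess

 private module ΣN = NatSums

 module ShiftTrick (S : StarRing) (Φ : FiniteField){χ : FiniteField.Carrier Φ -> CommutativeRing.Carrier (StarRing.cring S)}
          (isχ : Characters.Character S Φ χ)where
  open Positivity S
  open Prefixes S
  open Characters S Φ using (module F)
  open F using (elems) renaming (Carrier to K)
  open Characters.Character isχ

  ι : ℕ -> K
  ι = F.K.⟨_⟩

  S[_] : ℕ -> Carrier
  S[ n ] = Ʃ(rng n)(\i -> χ(ι(suc i)))

  cut : ∀{P : Set}-> Dec P -> Carrier -> Carrier
  cut(yes _)x = x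
  cut(no _)x = 0#

  cut-yes : ∀{P : Set}(d : Dec P){x}-> P -> cut d x ≈ x
  cut-yes(yes _)_ = refl
  cut-yes(no ¬p)p = contradiction p ¬p

  cut-no : ∀{P : Set}(d : Dec P){x}-> ¬ P -> cut d x ≈ 0#
  cut-no(yes p)¬p = contradiction p ¬p
  cut-no(no _)_ = refl

  -- The terms with m b ≤ X form an initial segment.
  initial : ∀(m : ℕ -> ℕ)->(∀{b c}-> b ≤ c -> m b ≤ m c)-> ∀ X(g : ℕ -> Carrier)B ->
       ∃ \j -> j ≤ B × Ʃ(rng B)(\b -> cut(m b N.≤? X)(g b))≈ Ʃ(rng j)g
  initial m mono X g zero = 0 , z≤n , refl
  initial m mono X g(suc B)= go(m B N.≤? X)(initial m mono X g B)
   where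
   go : Dec(m B ≤ X)->(∃ \j -> j ≤ B × Ʃ(rng B)(\b -> cut(m b N.≤? X)(g b))≈ Ʃ(rng j)g)->
      ∃ \j -> j ≤ suc B × Ʃ(rng(suc B))(\b -> cut(m b N.≤? X)(g b))≈ Ʃ(rng j)g
   go(yes p)_ = suc B , ≤-refl , Ʃ-cong-∈(rng(suc B))(\{b}b∈ -> cut-yes(m b N.≤? X)(≤-trans(mono(≤-pred(∈-rng⁻ b∈)))p))
   go(no ¬p)(j , j≤ , e)= j , ≤-trans j≤(n≤1+n B), trans(+-congʳ(cut-no(m B N.≤? X)¬p))(trans(+-identityˡ _)e)

  module _ (n H : ℕ) where
   h : ℕ -> Carrier
   h m = cut(m N.≤? n N.+ H)(χ(ι m F.- ι H))- cut(m N.≤? H)(χ(ι m F.- ι H))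

   private
    h-low : ∀{m}-> m ≤ H -> h m ≈ 0#
    h-low{m}p = x≈y⇒x-y≈0(trans(cut-yes(m N.≤? n N.+ H)(≤-trans p(m≤n+m H n)))(sym(cut-yes(m N.≤? H)p)))

    h-high : ∀{m}-> n N.+ H < m -> h m ≈ 0#
    h-high{m}p = x≈y⇒x-y≈0(trans(cut-no(m N.≤? n N.+ H)(<⇒≱ p))(sym(cut-no(m N.≤? H)(<⇒≱(≤-<-trans(m≤n+m H n)p)))))

    h-mid : ∀{i}-> i < n -> h(suc(i N.+ H))≈ χ(ι(suc i))
    h-mid{i}p = trans(+-cong(cut-yes(suc(i N.+ H)N.≤? n N.+ H)(+-monoˡ-≤ H p))(-‿cong(cut-no(suc(i N.+ H)N.≤? H)(<⇒≱(s≤s(m≤n+m H i))))))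
     (trans(solve 1(\a -> a :- con 0 := a)refl _)(ψ-cong(E.trans(cong(\t -> t F.- ι H)(F.K.⟨⟩-+(suc i)H))(F.solve 2(\a b ->(a F.:+ b)F.:- b F.:= a)E.refl(ι(suc i))(ι H)))))

   shifted : ∀ s -> s ≤ H -> Ʃ(rng(n N.+ H))(\i -> h(suc(i N.+ s)))≈ S[ n ]
   shifted s s≤H = begin
    _ ≈⟨ trans(sym(+-identityˡ _))(+-congʳ(sym(Ʃ-≈0(rng s)(\p -> h-low(≤-trans(∈-rng⁻ p)s≤H)))))⟩
    _ ≈⟨ sym(Ʃ-rng-+ s(n N.+ H)f)⟩
    _ ≈⟨ reflexive(cong(\t -> Ʃ(rng t)f)(N.+-comm(n N.+ H)s))⟩
    _ ≈⟨ Ʃ-rng-+(n N.+ H)s f ⟩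
    _ ≈⟨ +-cong(Ʃ-rng-+ H n f)(Ʃ-≈0(rng s)(\{i}_ -> h-high(s≤s(m≤n+m(n N.+ H)i))))⟩
    _ ≈⟨ trans(+-identityʳ _)(trans(+-congʳ(Ʃ-≈0(rng H)(\p -> h-low(∈-rng⁻ p))))(+-identityˡ _))⟩
    _ ≈⟨ Ʃ-cong-∈(rng n)(\p -> h-mid(∈-rng⁻ p))⟩
    S[ n ] ∎
    where
    f : ℕ -> Carrier
    f i = h(suc i)

  y : ℕ -> ℕ -> ℕ -> K
  y H i a =(ι(suc i)F.- ι H)F.* ι(suc a)F.⁻¹

  tail : K -> ℕ -> Carrier
  tail x b = χ(x F.+ ι b)

  module _ (n A κ : ℕ) (units : ∀{a}-> a < A -> ι (suc a) ≢ F.0#) where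
   private
    B = 2 N.^ κ
    H = A N.* B

    inner : ℕ -> ℕ -> Carrier
    inner i a = Ʃ(rng B)(\b -> h n H(suc(i N.+ suc a N.* b)))

    term : ∀{a}-> a < A -> ∀ i b -> χ(ι(suc(i N.+ suc a N.* b))F.- ι H)≈ χ(ι(suc a))* tail(y H i a)b
    term{a}a<A i b = trans(ψ-cong(E.trans(cong(\t -> t F.- ι H)(E.trans(F.K.⟨⟩-+(suc i)(suc a N.* b))(cong(\t -> ι(suc i)F.+ t)(F.K.⟨⟩-*(suc a)b))))
      (E.trans(F.solve 4(\x h a b ->(x F.:+ a F.:* b)F.:- h F.:=(x F.:- h)F.:+ a F.:* b)E.refl(ι(suc i))(ι H)(ι(suc a))(ι b))
      (E.trans(cong(\t -> t F.+ ι(suc a)F.* ι b)(E.trans(E.sym(F.*-identityʳ _))(cong(\t ->(ι(suc i)F.- ι H)F.* t)(E.sym(F.inverseˡ(units a<A))))))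
       (F.solve 4(\d a j b -> d F.:*(j F.:* a)F.:+ a F.:* b F.:= a F.:*(d F.:* j F.:+ b))E.refl(ι(suc i)F.- ι H)(ι(suc a))(ι(suc a)F.⁻¹)(ι b))))))(ψ-* _ _)

    N-neg : ∀ x -> N(- x)≈ N x
    N-neg x = trans(*-congˡ(⋆-neg x))(solve 2(\a b ->(:- a):*(:- b):= a :* b)refl x(x ⋆))

    N-inner : ∀{a}-> a < A -> ∀ i -> N(inner i a)≲ ⟨ 4 N.* suc κ ⟩ * Q κ(tail(y H i a))
    N-inner{a}a<A i = let(j₁ , j₁≤ , e₁)= initial m mono(n N.+ H)g B ;(j₂ , j₂≤ , e₂)= initial m mono H g B in go j₁ j₂ j₁≤ j₂≤ e₁ e₂
     where
     m : ℕ -> ℕ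
     m b = suc(i N.+ suc a N.* b)
     mono : ∀{b c}-> b ≤ c -> m b ≤ m c
     mono p = s≤s(+-monoʳ-≤ i(*-monoʳ-≤(suc a)p))
     g : ℕ -> Carrier
     g b = χ(ι(m b)F.- ι H)
     t = tail(y H i a)
     q = Q κ t
     scaled : ∀ j -> Ʃ(rng j)g ≈ χ(ι(suc a))* Ʃ(rng j)t
     scaled j = trans(Ʃ-cong(rng j)(term a<A i))(Ʃ-*ˡ(rng j)_ _)
     go : ∀ j₁ j₂ -> j₁ ≤ B -> j₂ ≤ B -> Ʃ(rng B)(\b -> cut(m b N.≤? n N.+ H)(g b))≈ Ʃ(rng j₁)g ->
        Ʃ(rng B)(\b -> cut(m b N.≤? H)(g b))≈ Ʃ(rng j₂)g -> N(inner i a)≲ ⟨ 4 N.* suc κ ⟩ * q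
     go j₁ j₂ p₁ p₂ e₁ e₂ = ≲-respˡ(sym(trans(N-cong eq)(N-*(χ(ι(suc a)))w)))(≲-trans(*-monoʳ(sq w)(N-ψ≲1(ι(suc a))))(≲-respˡ(sym(*-identityˡ _))
       (≲-trans(N-+(Ʃ(rng j₁)t)(- Ʃ(rng j₂)t))(≲-respʳ alg(+-mono(*-monoˡ(pos-⟨⟩ 2)(prefix κ t j₁ p₁))(*-monoˡ(pos-⟨⟩ 2)(≲-respˡ(sym(N-neg _))(prefix κ t j₂ p₂))))))))
      where
      w = Ʃ(rng j₁)t - Ʃ(rng j₂)t
      eq : inner i a ≈ χ(ι(suc a))* w
      eq = trans(Ʃ-−(rng B)_ _)(trans(+-cong(trans e₁(scaled j₁))(-‿cong(trans e₂(scaled j₂))))(solve 3(\c x y -> c :* x :- c :* y := c :*(x :- y))refl(χ(ι(suc a)))_ _))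
      alg : ⟨ 2 ⟩ *(⟨ suc κ ⟩ * q)+ ⟨ 2 ⟩ *(⟨ suc κ ⟩ * q)≈ ⟨ 4 N.* suc κ ⟩ * q
      alg = trans(solve 2(\k q -> con 2 :*(k :* q):+ con 2 :*(k :* q):=(con 4 :* k):* q)refl ⟨ suc κ ⟩ q)(*-congʳ(sym(⟨⟩-* 4(suc κ))))

    H-sum : ⟨ H ⟩ * S[ n ] ≈ Ʃ(rng(n N.+ H))(\i -> Ʃ(rng A)(inner i))
    H-sum = begin
     _ ≈⟨ trans(*-congʳ(trans(⟨⟩-* A B)(*-cong(reflexive(cong ⟨_⟩(E.sym(length-rng A))))(reflexive(cong ⟨_⟩(E.sym(length-rng B)))))))(*-assoc _ _ _)⟩
     _ ≈⟨ sym(trans(Ʃ-cong(rng A)(\_ -> Ʃ-const(rng B)_))(Ʃ-const(rng A)_))⟩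
     _ ≈⟨ Ʃ-cong-∈(rng A)(\{a}a∈ -> Ʃ-cong-∈(rng B)(\{b}b∈ -> sym(shifted n H(suc a N.* b)(*-mono-≤(∈-rng⁻ a∈)(<⇒≤(∈-rng⁻ b∈))))))⟩
     _ ≈⟨ Ʃ-cong(rng A)(\a -> Ʃ-swap(rng B)(rng(n N.+ H))_)⟩
     _ ≈⟨ Ʃ-swap(rng A)(rng(n N.+ H))_ ⟩
     _ ∎

   averaging : N(⟨ H ⟩ * S[ n ])≲ ⟨(n N.+ H)N.* A N.*(4 N.* suc κ)⟩ * Ʃ(rng(n N.+ H))(\i -> Ʃ(rng A)(\a -> Q κ(tail(y H i a))))
   averaging = ≲-respˡ(N-cong(sym H-sum))(≲-trans(N-Ʃ(rng(n N.+ H))(\i -> Ʃ(rng A)(inner i)))(≲-resp(*-congʳ(reflexive(cong ⟨_⟩(E.sym(length-rng(n N.+ H))))))alg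
     (*-monoˡ(pos-⟨⟩(n N.+ H))(Ʃ-mono(rng(n N.+ H)){\i -> N(Ʃ(rng A)(inner i))}{\i -> ⟨ A ⟩ *(⟨ 4 N.* suc κ ⟩ * R i)}(\{i}_ -> row i)))))
    where
    R : ℕ -> Carrier
    R i = Ʃ(rng A)(\a -> Q κ(tail(y H i a)))
    row : ∀ i -> N(Ʃ(rng A)(inner i))≲ ⟨ A ⟩ *(⟨ 4 N.* suc κ ⟩ * R i)
    row i = ≲-trans(N-Ʃ(rng A)(inner i))(≲-resp(*-congʳ(reflexive(cong ⟨_⟩(E.sym(length-rng A)))))(*-congˡ(Ʃ-*ˡ(rng A)_ _))
     (*-monoˡ(pos-⟨⟩ A)(Ʃ-mono(rng A){\a -> N(inner i a)}{\a -> ⟨ 4 N.* suc κ ⟩ * Q κ(tail(y H i a))}(\a∈ -> N-inner(∈-rng⁻ a∈)i))))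
    alg : ⟨ n N.+ H ⟩ * Ʃ(rng(n N.+ H))(\i -> ⟨ A ⟩ *(⟨ 4 N.* suc κ ⟩ * R i))≈ ⟨(n N.+ H)N.* A N.*(4 N.* suc κ)⟩ * Ʃ(rng(n N.+ H))R
    alg = trans(*-congˡ(trans(Ʃ-*ˡ(rng(n N.+ H))_ _)(*-congˡ(Ʃ-*ˡ(rng(n N.+ H))_ _))))
     (trans(solve 4(\a b c d -> a :*(b :*(c :* d)):=((a :* b):* c):* d)refl ⟨ n N.+ H ⟩ ⟨ A ⟩ ⟨ 4 N.* suc κ ⟩ _)
      (*-congʳ(sym(trans(⟨⟩-*((n N.+ H)N.* A)(4 N.* suc κ))(*-congʳ(⟨⟩-*(n N.+ H)A))))))

module Count where
 open import Data.Nat using (_+_; _*_; ∣_-_∣)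
 open import Data.Bool using (if_then_else_)
 open E hiding ([_])
 open Alg
 open NatSums

 [_] :{P : Set}-> Dec P -> ℕ
 [ d ] = if does d then 1 else 0

 [yes] :{P : Set}(d : Dec P)-> P -> [ d ] ≡ 1
 [yes](yes _)_ = refl
 [yes](no ¬p)p = contradiction p ¬p

 [no] :{P : Set}(d : Dec P)-> ¬ P -> [ d ] ≡ 0
 [no](yes p)¬p = contradiction p ¬p
 [no](no _)_ = refl

 []-mono :{P R : Set}(d : Dec P)(e : Dec R)->(P -> R)-> [ d ] ≤ [ e ]
 []-mono(yes p)e f = ≡⇒≤(sym([yes] e(f p)))
 []-mono(no _)e f = z≤n

 []≤1 :{P : Set}(d : Dec P)-> [ d ] ≤ 1
 []≤1(yes _)= s≤s z≤n
 []≤1(no _)= z≤n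

 module _{A : Set}where
  Ʃ-[] :{P : A -> Set}(P? : ∀ x -> Dec(P x))(xs : List A)-> Ʃ xs(\x -> [ P? x ])≡ length(filter P? xs)
  Ʃ-[] P? [] = refl
  Ʃ-[] P?(x ∷ xs)with does(P? x)
  ... | true = cong suc(Ʃ-[] P? xs)
  ... | false = Ʃ-[] P? xs

  count-≤ :{P : A -> Set}(P? : ∀ x -> Dec(P x))(xs : List A)-> Unique xs -> ∀ D ->
       (∀ ys -> Unique ys ->(∀{y}-> y ∈ ys -> P y)-> length ys ≤ D)-> Ʃ xs(\x -> [ P? x ])≤ D
  count-≤ P? xs u D h = ≤-trans(≡⇒≤(Ʃ-[] P? xs))(h _(Unique.filter⁺ P? u)(\{y}y∈ -> proj₂(∈-filter⁻ P?{xs = xs}y∈)))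

  at-most-one :{P : A -> Set}(P? : ∀ x -> Dec(P x))(xs : List A)-> Unique xs ->(∀{x y}-> P x -> P y -> x ≡ y)-> Ʃ xs(\x -> [ P? x ])≤ 1
  at-most-one{P}P? xs u h = count-≤ P? xs u 1 bound
   where
   bound : ∀ ys -> Unique ys ->(∀{y}-> y ∈ ys -> P y)-> length ys ≤ 1
   bound [] _ _ = z≤n
   bound(y ∷ [])_ _ = s≤s z≤n
   bound(y ∷ z ∷ ys)((p ∷ _)∷ _)q = contradiction(h(q(here refl))(q(there(here refl))))p
    where open import Data.List.Relation.Unary.Any using (here; there)

 rng-unique : ∀ n -> Unique(rng n)
 rng-unique zero = []
 rng-unique(suc n)= All.tabulate(\p e -> <-irrefl(sym e)(∈-rng⁻ p))∷ rng-unique n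

 DivBound : ℕ -> ℕ -> Set
 DivBound D z = ∀ ys -> Unique ys ->(∀{y}-> y ∈ ys -> y ∣ z)-> length ys ≤ D

 divisor-count : ∀{D z}-> DivBound D z -> ∀ A -> Ʃ(rng A)(\a -> [ suc a ∣? z ])≤ D
 divisor-count{D}h A = count-≤(\a -> suc a ∣? _)(rng A)(rng-unique A)D
  (\ys u q -> ≤-trans(≡⇒≤(sym(length-map suc ys)))(h(map suc ys)(Unique.map⁺ suc-injective u)
   (\{d}d∈ -> let z , z∈ , e = ∈-map⁻ suc d∈ in subst(_∣ _)(sym e)(q z∈))))
  where open import Data.List.Properties using (length-map)

 ∣-∣-cross : ∀ a b c d -> a + b ≡ c + d -> ∣ a - d ∣ ≡ ∣ c - b ∣
 ∣-∣-cross a b c d e = begin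
  _ ≡⟨ sym(N.∣m+n-m+o∣≡∣n-o∣ b a d)⟩
  _ ≡⟨ cong(\t -> ∣ t - b + d ∣)(trans(N.+-comm b a)(trans e(N.+-comm c d)))⟩
  _ ≡⟨ cong(\t -> ∣ d + c - t ∣)(N.+-comm b d)⟩
  _ ≡⟨ N.∣m+n-m+o∣≡∣n-o∣ d c b ⟩
  _ ∎
  where open ≡-Reasoning

 -- The number of solutions of (i - H) a′ = (i′ - H) a with given i and a′, written without subtraction.
 Equation : ℕ -> ℕ -> ℕ -> ℕ -> ℕ -> Set
 Equation H i a i' a' = suc i * suc a' + H * suc a ≡ suc i' * suc a + H * suc a'

 equation? : ∀ H i a i' a' -> Dec(Equation H i a i' a')
 equation? H i a i' a' =(suc i * suc a' + H * suc a)N.≟(suc i' * suc a + H * suc a')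

 module Equations (H L A D : ℕ) (L≤ : ∀{z}-> 1 ≤ z -> z ≤ L * A -> DivBound D z) (H≤L : H ≤ L) where
  private
   unique-i' : ∀{i a a' x y}-> Equation H i a x a' -> Equation H i a y a' -> x ≡ y
   unique-i'{i}{a}{a'}{x}{y}e f = suc-injective(N.*-cancelʳ-≡(suc x)(suc y)(suc a)(+-cancelʳ-≡(H * suc a')(suc x * suc a)(suc y * suc a)(trans(sym e)f)))

   divides-it : ∀{i a i' a'}-> Equation H i a i' a' -> suc a ∣ ∣ suc i - H ∣ * suc a'
   divides-it{i}{a}{i'}{a'}e = divides ∣ suc i' - H ∣(trans(N.*-distribʳ-∣-∣(suc a')(suc i)H)
    (trans(∣-∣-cross(suc i * suc a')(H * suc a)(suc i' * suc a)(H * suc a')e)(sym(N.*-distribʳ-∣-∣(suc a)(suc i')H))))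

   inner : ∀ i a a' -> Ʃ(rng L)(\i' -> [ equation? H i a i' a' ])≤ [ suc a ∣? ∣ suc i - H ∣ * suc a' ]
   inner i a a' = go(suc a ∣? ∣ suc i - H ∣ * suc a')
    where
    go :(d : Dec(suc a ∣ ∣ suc i - H ∣ * suc a'))-> Ʃ(rng L)(\i' -> [ equation? H i a i' a' ])≤ [ d ]
    go(yes p)= at-most-one(\i' -> equation? H i a i' a')(rng L)(rng-unique L)(unique-i'{i}{a}{a'})
    go(no ¬p)= ≡⇒≤(Ʃ-≈0(rng L)(\{i'}_ -> [no](equation? H i a i' a')(¬p ∘ divides-it{i}{a}{i'}{a'})))

   row : ∀ i a' -> i < L -> a' < A -> Ʃ(rng A)(\a -> Ʃ(rng L)(\i' -> [ equation? H i a i' a' ]))≤ D + [ suc i N.≟ H ] * A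
   row i a' i<L a'<A = go(suc i N.≟ H)
    where
    go :(d : Dec(suc i ≡ H))-> Ʃ(rng A)(\a -> Ʃ(rng L)(\i' -> [ equation? H i a i' a' ]))≤ D + [ d ] * A
    go(yes _)= ≤-trans(≤-trans(Ʃ-≤-const(rng A)1(\{a}_ -> at-most-one(\i' -> equation? H i a i' a')(rng L)(rng-unique L)(unique-i'{i}{a}{a'})))
            (≡⇒≤(trans(N.*-identityʳ _)(trans(length-rng A)(sym(N.+-identityʳ A))))))(m≤n+m(A + 0)D)
    go(no ¬p)= ≤-trans(≤-trans(Ʃ-mono-≤(rng A)(\{a}_ -> inner i a a'))(divisor-count(L≤ z≥1 z≤)A))(m≤m+n D 0)
     where
     z≥1 : 1 ≤ ∣ suc i - H ∣ * suc a'
     z≥1 = *-mono-≤{1}{∣ suc i - H ∣}{1}(n≢0⇒n>0(¬p ∘ N.∣m-n∣≡0⇒m≡n))(s≤s z≤n)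
     z≤ : ∣ suc i - H ∣ * suc a' ≤ L * A
     z≤ = *-mono-≤(≤-trans(N.∣m-n∣≤m⊔n(suc i)H)(N.⊔-lub i<L H≤L))a'<A

  total : Ʃ(rng L)(\i -> Ʃ(rng A)(\a -> Ʃ(rng L)(\i' -> Ʃ(rng A)(\a' -> [ equation? H i a i' a' ]))))≤ L * A * D + A * A
  total = begin
   _ ≡⟨ Ʃ-cong(rng L)(\i -> trans(Ʃ-cong(rng A)(\a -> Ʃ-swap(rng L)(rng A)(\i' a' -> [ equation? H i a i' a' ])))(Ʃ-swap(rng A)(rng A)(\a a' -> Ʃ(rng L)(\i' -> [ equation? H i a i' a' ]))))⟩
   _ ≤⟨ Ʃ-mono-≤(rng L)(\{i}i∈ -> Ʃ-≤-const(rng A)(D + [ suc i N.≟ H ] * A)(\{a'}a'∈ -> row i a'(∈-rng⁻ i∈)(∈-rng⁻ a'∈)))⟩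
   _ ≡⟨ trans(Ʃ-*ˡ(rng L)(length(rng A))_)(cong₂ _*_(length-rng A)(trans(Ʃ-+(rng L)(\_ -> D)(\i -> [ suc i N.≟ H ] * A))(cong₂ _+_(trans(Ʃ-const(rng L)D)(cong(_* D)(length-rng L)))(Ʃ-*ʳ(rng L)A(\i -> [ suc i N.≟ H ])))))⟩
   _ ≤⟨ *-monoʳ-≤ A(+-monoʳ-≤(L * D)(*-monoˡ-≤ A(at-most-one(\i -> suc i N.≟ H)(rng L)(rng-unique L)(\e f -> suc-injective(trans e(sym f))))))⟩
   _ ≡⟨ alg A L D ⟩
   _ ∎
   where
   open N.≤-Reasoning
   open import Data.Nat.Tactic.RingSolver using (solve-∀)
   alg : ∀ a l d -> a *(l * d + 1 * a)≡ l * a * d + a * a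
   alg = solve-∀

module Burgess2 where
 open import Data.List.Relation.Binary.Permutation.Propositional.Properties using (↭-length)
 open Alg
 open Cone
 open Field
 open Char
 open Moment
 open Moment2
 open Burgess
 open Shift
 open Count

 private module ΣN = NatSums

 record PrimeField(p : ℕ): Set₁ where
  field
   Φ : FiniteField
  module F = FieldKit Φ
  field
   enumerated : F.elems ↭ map F.K.⟨_⟩(rng p)
   ⟨⟩-inj : ∀{i j}-> i < p -> j < p -> F.K.⟨ i ⟩ ≡ F.K.⟨ j ⟩ -> i ≡ j
   ⟨p⟩≡0 : F.K.⟨ p ⟩ ≡ F.0#

  size≡p : F.size ≡ p
  size≡p = E.trans(↭-length enumerated)(E.trans(List.length-map F.K.⟨_⟩(rng p))(length-rng p))

 pv-numeric : ∀ b k p ->(2 N.* b N.+ b)N.* 1 N.*(4 N.* k)N.*(2 N.*(k N.*(b N.* p)))≡ b N.* b N.*(24 N.*(k N.* k)N.* p)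
 pv-numeric = solve-∀

 moment-numeric : ∀ p b B s -> b ≤ B -> p N.*(3 N.*(b N.* b))N.+(b N.* b)N.*(b N.* b)N.* s ≤ b N.* b N.*(3 N.* p N.+ B N.* B N.* s)
 moment-numeric p b B s h = ≤-trans(≡⇒≤(eq p(b N.* b)s))(*-monoʳ-≤(b N.* b)(+-monoʳ-≤(3 N.* p)(*-monoˡ-≤ s(*-mono-≤ h h))))
  where
  eq : ∀ p b s -> p N.*(3 N.* b)N.+ b N.* b N.* s ≡ b N.*(3 N.* p N.+ b N.* s)
  eq = solve-∀

 module ShortSums (S : StarRing){p : ℕ}(PF : PrimeField p)
          {χ : FiniteField.Carrier(PrimeField.Φ PF)-> CommutativeRing.Carrier(StarRing.cring S)}
          (isχ : Characters.Character S(PrimeField.Φ PF)χ)where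
  open Positivity S
  open PrimeField PF using (Φ; enumerated; ⟨⟩-inj; ⟨p⟩≡0; size≡p)
  open Prefixes S
  open ShiftTrick S Φ isχ
  open Characters S Φ using (module F)
  open F using (elems; δ) renaming (Carrier to K)
  open F.Reindex cring
  open Characters.Character isχ
  open FourthMoment S Φ isχ using (V)

  unit : ∀{a}-> suc a < p -> ι(suc a)≢ F.0#
  unit{a}a<p e with ()← ⟨⟩-inj a<p(≤-<-trans z≤n a<p)e

  private
   window-inj : ∀{d c i j}-> d N.+ c ≤ p -> i < d -> j < d -> ι(i N.+ c)≡ ι(j N.+ c)-> i ≡ j
   window-inj{d}{c}{i}{j}le i<d j<d e = +-cancelʳ-≡ c i j(⟨⟩-inj(<-≤-trans(+-monoˡ-< c i<d)le)(<-≤-trans(+-monoˡ-< c j<d)le)e)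

   module Avg = Averages elems p tail

   ⟨⟩-cong : ∀{m n}-> m ≡ n -> ⟨ m ⟩ ≈ ⟨ n ⟩
   ⟨⟩-cong e = reflexive(cong ⟨_⟩ e)

   Q-cong : ∀ κ{f g : ℕ -> Carrier}->(∀ b -> f b ≈ g b)-> Q κ f ≈ Q κ g
   Q-cong zero h = N-cong(h 0)
   Q-cong(suc κ)h = +-cong(N-cong(Ʃ-cong(rng(2 N.^ suc κ))h))(+-cong(Q-cong κ h)(Q-cong κ(\b -> h(b N.+ 2 N.^ κ))))

   unshift : ∀ κ x -> Q κ(Avg.sh 0 x)≈ Q κ(tail x)
   unshift κ x = Q-cong κ(\b -> reflexive(cong(tail x)(N.+-identityʳ b)))

   mean-Q : ∀ κ -> 2 N.^ κ ≤ p -> Ʃ elems(\x -> Q κ(tail x))≲ ⟨ suc κ ⟩ *(⟨ 2 N.^ κ ⟩ * ⟨ p ⟩)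
   mean-Q κ le = ≲-respˡ(Ʃ-cong elems(unshift κ))(Avg.first-average p(\i c le -> ≲-respʳ(trans(⟨⟩-*(2 N.^ i)F.size)(*-congˡ(⟨⟩-cong size≡p)))
    (ShiftMoments.second-moment S Φ isχ(\b -> ι(b N.+ c))(2 N.^ i)(window-inj le)))κ 0(≤-trans(≡⇒≤(N.+-identityʳ _))le))

   over-field : ∀(f : K -> Carrier)-> Ʃ(rng p)(\i -> f(ι i))≈ Ʃ elems f
   over-field f = sym(trans(Ʃ-↭ enumerated f)(Ʃ-map ι(rng p)f))

   once : ∀(f : K -> Carrier)H -> Ʃ(rng p)(\i -> f(y H i 0))≈ Ʃ elems f
   once f H = trans(Ʃ-cong(rng p)(\i -> reflexive(cong f(affine i))))(trans(over-field(\x -> f(ι 1 F.⁻¹ F.*(x F.+(F.1# F.- ι H)))))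
     (trans(Ʃ-reindex(F.shift-bij(F.1# F.- ι H))(\x -> f(ι 1 F.⁻¹ F.* x)))(Ʃ-reindex(F.scale-bij(ι 1 F.⁻¹)(F.⁻¹-nonzero ι1≢0))f)))
    where
    ι1≢0 : ι 1 ≢ F.0#
    ι1≢0 e = F.1≢0(E.trans(E.sym(F.+-identityʳ F.1#))e)
    affine : ∀ i -> y H i 0 ≡ ι 1 F.⁻¹ F.*(ι i F.+(F.1# F.- ι H))
    affine i = F.solve 4(\o x h j ->((o F.:+ x)F.:- h)F.:* j F.:= j F.:*(x F.:+(o F.:- h)))E.refl F.1#(ι i)(ι H)(ι 1 F.⁻¹)

   twice : ∀(f : K -> Carrier)->(∀ x -> Pos(f x))-> ∀ H m -> m ≤ p N.+ p -> Ʃ(rng m)(\i -> f(y H i 0))≲ ⟨ 2 ⟩ * Ʃ elems f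
   twice f pf H m m≤ = ≲-trans(≲-respʳ(reflexive(cong(\t -> Ʃ(rng t)g)(m∸n+n≡m m≤)))(≲-respʳ(sym(Ʃ-rng-+ m(p N.+ p N.∸ m)g))(≲-+ʳ(pos-Ʃ(rng(p N.+ p N.∸ m))(\_ -> pf _)))))
     (≈⇒≲(trans(Ʃ-rng-+ p p g)(trans(+-cong(once f H)(trans(Ʃ-cong(rng p)(\i -> reflexive(cong f(wrap i))))(once f H)))(solve 1(\a -> a :+ a := con 2 :* a)refl(Ʃ elems f)))))
    where
    g : ℕ -> Carrier
    g i = f(y H i 0)
    wrap : ∀ i -> y H(i N.+ p)0 ≡ y H i 0
    wrap i = cong(\t ->(t F.- ι H)F.* ι 1 F.⁻¹)(E.trans(F.K.⟨⟩-+(suc i)p)(E.trans(cong(\t -> ι(suc i)F.+ t)⟨p⟩≡0)(F.+-identityʳ _)))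

   square-H : ∀ H X -> N(⟨ H ⟩ * X)≈ ⟨ H N.* H ⟩ * N X
   square-H H X = trans(N-* ⟨ H ⟩ X)(*-congʳ(trans(*-congˡ(self-⟨⟩ H))(sym(⟨⟩-* H H))))

  polya-vinogradov : ∀ n κ -> n < p -> 2 N.^ κ ≤ n -> n ≤ 2 N.* 2 N.^ κ -> N S[ n ] ≲ ⟨ 24 N.*(suc κ N.* suc κ)N.* p ⟩
  polya-vinogradov n κ n<p B≤n n≤2B = cancel(m^n>0 2 κ)(≲-trans(≲-respˡ(square-H H S[ n ])(averaging n 1 κ(\a<1 -> unit(≤-trans(s≤s(≤-trans a<1(≤-trans(m^n>0 2 κ)B≤n)))n<p))))
    (≲-trans(*-monoˡ(pos-⟨⟩ lhs)(≲-trans(≈⇒≲(Ʃ-cong(rng(n N.+ H))(\i -> +-identityʳ _)))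
     (≲-trans(twice(\x -> Q κ(tail x))(\x -> pos-Q κ _)H(n N.+ H)(+-mono-≤(<⇒≤ n<p)(≤-trans(≡⇒≤ H≡B)B≤p)))(*-monoˡ(pos-⟨⟩ 2)(mean-Q κ B≤p)))))
    (≲-respˡ merge(⟨⟩-mono numeric))))
   where
   B = 2 N.^ κ
   H = 1 N.* B
   H≡B : H ≡ B
   H≡B = N.*-identityˡ B
   B≤p : B ≤ p
   B≤p = ≤-trans B≤n(<⇒≤ n<p)
   C = 24 N.*(suc κ N.* suc κ)N.* p
   lhs =(n N.+ H)N.* 1 N.*(4 N.* suc κ)
   merge : ⟨ lhs N.*(2 N.*(suc κ N.*(B N.* p)))⟩ ≈ ⟨ lhs ⟩ *(⟨ 2 ⟩ *(⟨ suc κ ⟩ *(⟨ B ⟩ * ⟨ p ⟩)))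
   merge = trans(⟨⟩-* lhs(2 N.*(suc κ N.*(B N.* p))))(*-congˡ(trans(⟨⟩-* 2(suc κ N.*(B N.* p)))(*-congˡ(trans(⟨⟩-*(suc κ)(B N.* p))(*-congˡ(⟨⟩-* B p))))))
   numeric : lhs N.*(2 N.*(suc κ N.*(B N.* p)))≤ H N.* H N.* C
   numeric = ≤-trans(*-monoˡ-≤(2 N.*(suc κ N.*(B N.* p)))(*-monoˡ-≤(4 N.* suc κ)(*-monoˡ-≤ 1(+-mono-≤ n≤2B(≡⇒≤ H≡B)))))
    (≡⇒≤(E.trans(pv-numeric B(suc κ)p)(cong(\t -> t N.* t N.* C)(E.sym H≡B))))
   cancel : 1 ≤ B -> ⟨ H N.* H ⟩ * N S[ n ] ≲ ⟨ H N.* H N.* C ⟩ -> N S[ n ] ≲ ⟨ C ⟩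
   cancel 1≤B le = go(H N.* H)(*-mono-≤{1}{H}{1}{H}1≤H 1≤H)le
    where
    1≤H : 1 ≤ H
    1≤H = ≤-trans 1≤B(≡⇒≤(E.sym H≡B))
    go : ∀ m -> 1 ≤ m -> ⟨ m ⟩ * N S[ n ] ≲ ⟨ m N.* C ⟩ -> N S[ n ] ≲ ⟨ C ⟩
    go(suc m)_ le = ≲-div m(≲-respʳ(⟨⟩-*(suc m)C)le)

  module _ (n A κ D : ℕ) (A≥1 : 1 ≤ A) (H≤n : A N.* 2 N.^ κ ≤ n) (small : (n N.+ n) N.* A N.+ n N.* A < p)
       (divisors : ∀{z}-> 1 ≤ z -> z < p -> DivBound D z)where
   private
    B = 2 N.^ κ
    H = A N.* B
    L = n N.+ H

    L≤ : L ≤ n N.+ n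
    L≤ = +-monoʳ-≤ n H≤n

    units : ∀{a}-> a < A -> suc a < p
    units{a}a<A = ≤-<-trans a<A(≤-<-trans(≤-trans(≤-trans(≡⇒≤(E.sym(N.*-identityˡ A)))(*-monoˡ-≤ A 1≤n))(m≤n+m(n N.* A)((n N.+ n)N.* A)))small)
     where
     1≤n : 1 ≤ n
     1≤n = ≤-trans(*-mono-≤ A≥1(m^n>0 2 κ))H≤n

    ν : K -> ℕ
    ν x = ΣN.Ʃ(rng L)(\i -> ΣN.Ʃ(rng A)(\a -> δ x(y H i a)))

    grouped : ∀(f : K -> Carrier)-> Ʃ(rng L)(\i -> Ʃ(rng A)(\a -> f(y H i a)))≈ Ʃ elems(\x -> ⟨ ν x ⟩ * f x)
    grouped f = trans(Ʃ-cong(rng L)(\i -> trans(Ʃ-cong(rng A)(\a -> sym(F.Ʃ-δ cring(y H i a)f)))(Ʃ-swap(rng A)elems _)))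
     (trans(Ʃ-swap(rng L)elems _)(Ʃ-cong elems(\x -> trans(Ʃ-cong(rng L)(\i -> trans(Ʃ-*ʳ(rng A)(f x)_)(*-congʳ(Ʃ-⟨⟩(rng A)(\a -> δ x(y H i a))))))
      (trans(Ʃ-*ʳ(rng L)(f x)_)(*-congʳ(Ʃ-⟨⟩(rng L)(\i -> ΣN.Ʃ(rng A)(\a -> δ x(y H i a)))))))))

    coincidence : ∀{i a i' a'}-> i < L -> a < A -> i' < L -> a' < A -> δ(y H i a)(y H i' a')≤ [ equation? H i a i' a' ]
    coincidence{i}{a}{i'}{a'}i< a< i'< a'< = go(y H i a F.≟ y H i' a')
     where
     go : Dec(y H i a ≡ y H i' a')-> δ(y H i a)(y H i' a')≤ [ equation? H i a i' a' ]
     go(no ne)= ≤-trans(≡⇒≤(F.δ-≢ ne))z≤n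
     go(yes e)= ≤-trans(≡⇒≤(F.δ-≡ e))(≡⇒≤(E.sym([yes](equation? H i a i' a')(⟨⟩-inj(small' i< a'< a<)(small' i'< a< a'<)field-eq))))
      where
      small' : ∀{i a a'}-> i < L -> a < A -> a' < A -> suc i N.* suc a N.+ H N.* suc a' < p
      small' p₁ p₂ p₃ = ≤-<-trans(+-mono-≤(*-mono-≤(≤-trans p₁ L≤)p₂)(*-mono-≤ H≤n p₃))small
      s = ι(suc a)
      s' = ι(suc a')
      d = ι(suc i)F.- ι H
      d' = ι(suc i')F.- ι H
      clear : ∀{s s' d}-> s ≢ F.0# ->(d F.* s F.⁻¹)F.*(s F.* s')≡ d F.* s'
      clear{s}{s'}{d}s≢0 = E.trans(F.solve 4(\d j s t ->(d F.:* j)F.:*(s F.:* t)F.:= d F.:* t F.:*(j F.:* s))E.refl d(s F.⁻¹)s s')(E.trans(cong(\t -> d F.* s' F.* t)(F.inverseˡ s≢0))(F.*-identityʳ _))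
      crossed : d F.* s' ≡ d' F.* s
      crossed = E.trans(E.sym(clear(unit(units a<))))(E.trans(cong₂ F._*_ e(F.*-comm s s'))(clear(unit(units a'<))))
      image : ∀ i a a' -> ι(suc i N.* suc a N.+ H N.* suc a')≡(ι(suc i)F.- ι H)F.* ι(suc a)F.+ ι H F.*(ι(suc a)F.+ ι(suc a'))
      image i a a' = E.trans(F.K.⟨⟩-+(suc i N.* suc a)(H N.* suc a'))(E.trans(cong₂ F._+_(F.K.⟨⟩-*(suc i)(suc a))(F.K.⟨⟩-* H(suc a')))
       (F.solve 4(\x h a b -> x F.:* a F.:+ h F.:* b F.:=(x F.:- h)F.:* a F.:+ h F.:*(a F.:+ b))E.refl(ι(suc i))(ι H)(ι(suc a))(ι(suc a'))))
      field-eq : ι(suc i N.* suc a' N.+ H N.* suc a)≡ ι(suc i' N.* suc a N.+ H N.* suc a')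
      field-eq = E.trans(image i a' a)(E.trans(cong₂ F._+_ crossed(cong(\t -> ι H F.* t)(F.+-comm s' s)))(E.sym(image i' a a')))

    ν-total : ΣN.Ʃ(rng L)(\i -> ΣN.Ʃ(rng A)(\a -> ν(y H i a)))≤ L N.* A N.* D N.+ A N.* A
    ν-total = ≤-trans(ΣN.Ʃ-mono-≤(rng L){\i -> ΣN.Ʃ(rng A)(\a -> ν(y H i a))}(\{i}i∈ -> ΣN.Ʃ-mono-≤(rng A){\a -> ν(y H i a)}(\{a}a∈ -> ΣN.Ʃ-mono-≤(rng L){\i' -> ΣN.Ʃ(rng A)(\a' -> δ(y H i a)(y H i' a'))}
      (\{i'}i'∈ -> ΣN.Ʃ-mono-≤(rng A){\a' -> δ(y H i a)(y H i' a')}(\{a'}a'∈ -> coincidence{i}{a}{i'}{a'}(∈-rng⁻ i∈)(∈-rng⁻ a∈)(∈-rng⁻ i'∈)(∈-rng⁻ a'∈))))))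
     (Equations.total H L A D(\z≥1 z≤ -> divisors z≥1(≤-<-trans z≤(≤-<-trans(≤-trans(*-monoˡ-≤ A L≤)(m≤m+n((n N.+ n)N.* A)(n N.* A)))small)))(m≤n+m H n))

    ν² : Ʃ elems(\x -> ⟨ ν x ⟩ * ⟨ ν x ⟩)≲ ⟨ L N.* A N.* D N.+ A N.* A ⟩
    ν² = ≲-respˡ(sym(trans(sym(grouped(\x -> ⟨ ν x ⟩)))(trans(Ʃ-cong(rng L)(\i -> Ʃ-⟨⟩(rng A)(\a -> ν(y H i a))))(Ʃ-⟨⟩(rng L)_))))(⟨⟩-mono ν-total)

   -- B² (3p + B² s) bounds the fourth moment of the dyadic blocks.
   burgess-raw : ∀ W s -> ⟨ 1 ⟩ ≲ W ->(∀{κ}-> κ ≢ F.0# -> N(V κ)≲ W)-> ⟨ 2 ⟩ * W + ⟨ 2 ⟩ ≲ ⟨ suc s N.* suc s ⟩ -> B ≤ p ->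
    (⟨ H N.* H ⟩ * N S[ n ])*(⟨ H N.* H ⟩ * N S[ n ])≲
    ⟨(L N.* A N.*(4 N.* suc κ))N.*(L N.* A N.*(4 N.* suc κ))N.*((L N.* A N.* D N.+ A N.* A)N.*(suc κ N.* suc κ N.*(B N.* B N.*(3 N.* p N.+ B N.* B N.* suc s))))⟩
   burgess-raw W s 1≤W weil hs B≤p = ≲-trans(*-mono(pos-*(pos-⟨⟩(H N.* H))(sq S[ n ]))(pos-*(pos-⟨⟩ c)pos-R)first first)
     (≲-respˡ(solve 2(\c r ->(c :* c):*(r :* r):=(c :* r):*(c :* r))refl ⟨ c ⟩ R)(≲-respʳ(sym merge)(*-monoˡ(pos-*(pos-⟨⟩ c)(pos-⟨⟩ c))
      (≲-respˡ(sym(*-cong(grouped w)(grouped w)))(≲-trans(Ʃ²-weighted elems ν w(\x -> pos-self(pos-Q κ _)))(*-mono(pos-Ʃ elems(\{x}_ -> pos-*(pos-⟨⟩(ν x))(pos-⟨⟩(ν x))))(pos-*(pos-*(pos-⟨⟩ k)(pos-⟨⟩ k))(pos-*(pos-*(pos-⟨⟩ B)(pos-⟨⟩ B))(pos-⟨⟩ U)))ν² mean))))))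
    where
    k = suc κ
    c = L N.* A N.*(4 N.* k)
    U = 3 N.* p N.+ B N.* B N.* suc s
    w : K -> Carrier
    w x = Q κ(tail x)
    R : Carrier
    R = Ʃ(rng L)(\i -> Ʃ(rng A)(\a -> w(y H i a)))
    pos-R : Pos R
    pos-R = pos-Ʃ(rng L)(\_ -> pos-Ʃ(rng A)(\_ -> pos-Q κ _))
    first : ⟨ H N.* H ⟩ * N S[ n ] ≲ ⟨ c ⟩ * R
    first = ≲-respˡ(square-H H S[ n ])(averaging n A κ(\a<A -> unit(units a<A)))
    pow≤ : ∀{i}-> i ≤ κ -> 2 N.^ i ≤ B
    pow≤ le = ^-monoʳ-≤ 2 le
    mean : Ʃ elems(\x -> w x * w x)≲ ⟨ k ⟩ * ⟨ k ⟩ *(⟨ B ⟩ * ⟨ B ⟩ * ⟨ U ⟩)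
    mean = ≲-respˡ(Ʃ-cong elems(\x -> *-cong(unshift κ x)(unshift κ x)))(Avg.second-average U κ(\i c i≤κ le ->
      ≲-trans(ShiftMoments.fourth-moment S Φ isχ(\b -> ι(b N.+ c))(2 N.^ i)(window-inj le)W s 1≤W weil hs)
       (≲-respʳ(trans(⟨⟩-*(2 N.^ i N.* 2 N.^ i)U)(*-congʳ(⟨⟩-*(2 N.^ i)(2 N.^ i))))
        (⟨⟩-mono(≤-trans(≡⇒≤(cong(\t -> t N.*(3 N.*(2 N.^ i N.* 2 N.^ i))N.+(2 N.^ i N.* 2 N.^ i)N.*(2 N.^ i N.* 2 N.^ i)N.* suc s)size≡p))
         (moment-numeric p(2 N.^ i)B(suc s)(pow≤ i≤κ))))))κ 0 ≤-refl(≤-trans(≡⇒≤(N.+-identityʳ _))B≤p))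
    E = L N.* A N.* D N.+ A N.* A
    merge : ⟨ c N.* c N.*(E N.*(k N.* k N.*(B N.* B N.* U)))⟩ ≈(⟨ c ⟩ * ⟨ c ⟩)*(⟨ E ⟩ *(⟨ k ⟩ * ⟨ k ⟩ *(⟨ B ⟩ * ⟨ B ⟩ * ⟨ U ⟩)))
    merge = trans(⟨⟩-*(c N.* c)(E N.*(k N.* k N.*(B N.* B N.* U))))(*-cong(⟨⟩-* c c)(trans(⟨⟩-* E(k N.* k N.*(B N.* B N.* U)))(*-congˡ
     (trans(⟨⟩-*(k N.* k)(B N.* B N.* U))(*-cong(⟨⟩-* k k)(trans(⟨⟩-*(B N.* B)U)(*-congʳ(⟨⟩-* B B))))))))

module Bound where
 open import Data.Nat.DivMod using (_/_)
 open Alg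
 open Cone
 open Field
 open Char
 open Moment
 open Shift
 open Count
 open Burgess2

 dyadic : ∀ n -> 1 ≤ n -> ∃ \κ -> 2 N.^ κ ≤ n × n < 2 N.* 2 N.^ κ
 dyadic(suc zero)_ = 0 , s≤s z≤n , s≤s(s≤s z≤n)
 dyadic(suc(suc n))_ = step(dyadic(suc n)(s≤s z≤n))
  where
  step :(∃ \κ -> 2 N.^ κ ≤ suc n × suc n < 2 N.* 2 N.^ κ)-> ∃ \κ -> 2 N.^ κ ≤ suc(suc n)× suc(suc n)< 2 N.* 2 N.^ κ
  step(κ , lo , hi)= go(suc(suc n)N.<? 2 N.* 2 N.^ κ)
   where
   go : Dec(suc(suc n)< 2 N.* 2 N.^ κ)-> ∃ \κ -> 2 N.^ κ ≤ suc(suc n)× suc(suc n)< 2 N.* 2 N.^ κ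
   go(yes p)= κ , ≤-trans lo(n≤1+n _), p
   go(no ¬p)= suc κ , ≮⇒≥ ¬p , ≤-<-trans hi(<-≤-trans(N.m<m*n X 2{{N.>-nonZero(≤-trans(s≤s z≤n)hi)}}(s≤s(s≤s z≤n)))(≡⇒≤(N.*-comm X 2)))
    where
    X = 2 N.* 2 N.^ κ

 open N.≤-Reasoning

 module _ (T : ℕ) (1000≤T : 1000 ≤ T) where
  1≤T : 1 ≤ T
  1≤T = ≤-trans(s≤s z≤n)1000≤T

  T-up : ∀ x -> x ≤ T N.* x
  T-up x = ≤-trans(≡⇒≤(E.sym(N.*-identityˡ x)))(*-monoˡ-≤ x 1≤T)

  c-up : ∀ c x -> c ≤ 1000 -> c N.* x ≤ T N.* x
  c-up c x h = *-monoˡ-≤ x(≤-trans h 1000≤T)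

  burgess-numeric : ∀ n A B k L p v -> let w = v N.* v ; H = A N.* B in
   k ≤ T -> L ≤ n N.+ n -> A ≤ n -> n ≤ 2 N.* H -> B ≤ w -> w ≤ 2 N.* B -> p ≤(w N.* w)N.*(w N.* w)->
   (L N.* A N.*(4 N.* k))N.*(L N.* A N.*(4 N.* k))N.*((L N.* A N.* T N.+ A N.* A)N.*(k N.* k N.*(B N.* B N.*(3 N.* p N.+ B N.* B N.*(T N.* T N.*(w N.* w))))))N.* w
   ≤(H N.* H)N.*(H N.* H)N.*(((T N.* T N.* T N.* T N.* T N.* T)N.* n N.*(v N.* w))N.*((T N.* T N.* T N.* T N.* T N.* T)N.* n N.*(v N.* w)))N.* w
  burgess-numeric n A B k L p v k≤ L≤ A≤ n≤ B≤ w≤ p≤ = begin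
   _ ≤⟨ *-mono-≤(*-mono-≤(*-mono-≤ c≤ c≤)(*-mono-≤ E≤(*-mono-≤(*-mono-≤ k≤ k≤)(*-monoʳ-≤(B N.* B)G≤))))w≤ ⟩
   _ ≡⟨ alg₁ T n A B W ⟩
   _ ≤⟨ *-monoˡ-≤(384 N.*(T N.* T N.* T N.* T N.* T N.* T N.* T N.* T)N.*(n N.* n)N.*(H N.* H N.* H)N.* W)n≤ ⟩
   _ ≡⟨ alg₂ T n H W ⟩
   _ ≤⟨ c-up 768 R(≤ᵇ⇒≤ 768 1000 _)⟩
   _ ≤⟨ ≤-trans(T-up(T N.* R))(≤-trans(T-up _)(T-up _))⟩
   _ ≡⟨ alg₃ T n H v ⟩
   _ ∎
   where
   w = v N.* v
   H = A N.* B
   W =(w N.* w)N.*(w N.* w)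
   R =(T N.* T N.* T N.* T N.* T N.* T N.* T N.* T)N.*(n N.* n)N.*((H N.* H)N.*(H N.* H))N.* W
   c₀ = L N.* A N.*(4 N.* k)
   c₁ =(n N.+ n)N.* A N.*(4 N.* T)
   E₀ = L N.* A N.* T N.+ A N.* A
   G₀ = 3 N.* p N.+ B N.* B N.*(T N.* T N.*(w N.* w))
   c≤ : c₀ ≤ c₁
   c≤ = *-mono-≤(*-monoˡ-≤ A L≤)(*-monoʳ-≤ 4 k≤)
   E-alg : ∀ n A T ->(n N.+ n)N.* A N.* T N.+ T N.*(n N.* A)≡ 3 N.*(T N.*(n N.* A))
   E-alg = solve-∀
   E≤ : E₀ ≤ 3 N.*(T N.*(n N.* A))
   E≤ = ≤-trans(+-mono-≤(*-monoˡ-≤ T(*-monoˡ-≤ A L≤))(≤-trans(*-monoˡ-≤ A A≤)(T-up(n N.* A))))(≡⇒≤(E-alg n A T))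
   G-alg : ∀ T w -> 3 N.*((w N.* w)N.*(w N.* w))N.+ w N.* w N.*(T N.* T N.*(w N.* w))≡(3 N.+ T N.* T)N.*((w N.* w)N.*(w N.* w))
   G-alg = solve-∀
   four-alg : ∀ x -> 3 N.* x N.+ x ≡ 4 N.* x
   four-alg = solve-∀
   cube : 3 N.+ T N.* T ≤ T N.* T N.* T
   cube = ≤-trans(+-monoˡ-≤(T N.* T)(*-monoʳ-≤ 3(*-mono-≤ 1≤T 1≤T)))(≤-trans(≡⇒≤(four-alg(T N.* T)))
    (≤-trans(c-up 4(T N.* T)(≤ᵇ⇒≤ 4 1000 _))(≡⇒≤(E.sym(N.*-assoc T T T)))))
   G≤ : G₀ ≤ T N.* T N.* T N.* W
   G≤ = ≤-trans(+-mono-≤(*-monoʳ-≤ 3 p≤)(*-monoˡ-≤(T N.* T N.*(w N.* w))(*-mono-≤ B≤ B≤)))(≤-trans(≡⇒≤(G-alg T w))(*-monoˡ-≤ W cube))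
   alg₁ : ∀ T n A B W ->(n N.+ n)N.* A N.*(4 N.* T)N.*((n N.+ n)N.* A N.*(4 N.* T))N.*((3 N.*(T N.*(n N.* A)))N.*(T N.* T N.*(B N.* B N.*(T N.* T N.* T N.* W))))N.*(2 N.* B)
    ≡ n N.*(384 N.*(T N.* T N.* T N.* T N.* T N.* T N.* T N.* T)N.*(n N.* n)N.*(A N.* B N.*(A N.* B)N.*(A N.* B))N.* W)
   alg₁ = solve-∀
   alg₂ : ∀ T n H W ->(2 N.* H)N.*(384 N.*(T N.* T N.* T N.* T N.* T N.* T N.* T N.* T)N.*(n N.* n)N.*(H N.* H N.* H)N.* W)≡ 768 N.*((T N.* T N.* T N.* T N.* T N.* T N.* T N.* T)N.*(n N.* n)N.*((H N.* H)N.*(H N.* H))N.* W)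
   alg₂ = solve-∀
   alg₃ : ∀ T n H v -> T N.*(T N.*(T N.*(T N.*((T N.* T N.* T N.* T N.* T N.* T N.* T N.* T)N.*(n N.* n)N.*((H N.* H)N.*(H N.* H))N.*((v N.* v N.*(v N.* v))N.*(v N.* v N.*(v N.* v)))))))
    ≡(H N.* H)N.*(H N.* H)N.*(((T N.* T N.* T N.* T N.* T N.* T)N.* n N.*(v N.*(v N.* v)))N.*((T N.* T N.* T N.* T N.* T N.* T)N.* n N.*(v N.*(v N.* v))))N.*(v N.* v)
   alg₃ = solve-∀

  -- If the shift range is too long for the counting step then n is so large that Pólya–Vinogradov is stronger.
  long-numeric : ∀ n A B p v -> let w = v N.* v in
   A N.* B ≤ n -> p ≤(n N.+ n)N.* A N.+ n N.* A -> w ≤ 2 N.* B ->(w N.* w)N.*(w N.* w)≤ T N.* p ->(w N.* w)N.*(w N.* w)≤ T N.* T N.* n N.*(v N.* w)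
  long-numeric n A B p v H≤ p≤ w≤ W≤ = ≤-trans(≡⇒≤(alg v))(≤-trans(*-monoˡ-≤(v N.*(v N.* v))root)≤-refl)
   where
   w = v N.* v
   alg : ∀ v -> v N.* v N.*(v N.* v)N.*(v N.* v N.*(v N.* v))≡(v N.* v N.* v N.* v N.* v)N.*(v N.*(v N.* v))
   alg = solve-∀
   alg₂ : ∀ v ->(v N.* v N.* v N.* v N.* v)N.*(v N.* v N.* v N.* v N.* v)≡ v N.* v N.*(v N.* v)N.*(v N.* v N.*(v N.* v))N.*(v N.* v)
   alg₂ = solve-∀
   alg₃ : ∀ T n A B -> T N.*((n N.+ n)N.* A N.+ n N.* A)N.*(2 N.* B)≡ 6 N.*(T N.*(n N.*(A N.* B)))
   alg₃ = solve-∀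
   alg₄ : ∀ T n -> T N.*(T N.*(T N.*(T N.*(n N.* n))))≡ T N.* T N.* n N.*(T N.* T N.* n)
   alg₄ = solve-∀
   squares :(v N.* v N.* v N.* v N.* v)N.*(v N.* v N.* v N.* v N.* v)≤ T N.* T N.* n N.*(T N.* T N.* n)
   squares = begin
    _ ≡⟨ alg₂ v ⟩
    _ ≤⟨ *-mono-≤(≤-trans W≤(*-monoʳ-≤ T p≤))w≤ ⟩
    _ ≡⟨ alg₃ T n A B ⟩
    _ ≤⟨ *-monoʳ-≤ 6(*-monoʳ-≤ T(*-monoʳ-≤ n H≤))⟩
    _ ≤⟨ c-up 6(T N.*(n N.* n))(≤ᵇ⇒≤ 6 1000 _)⟩
    _ ≤⟨ ≤-trans(T-up(T N.*(T N.*(n N.* n))))(T-up _)⟩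
    _ ≡⟨ alg₄ T n ⟩
    _ ∎
   root :(v N.* v N.* v N.* v N.* v)≤ T N.* T N.* n
   root = ≮⇒≥(\lt -> <⇒≱(*-mono-< lt lt)squares)

 module CharacterBounds (S : StarRing){p : ℕ}(PF : PrimeField p)
             {χ : FiniteField.Carrier(PrimeField.Φ PF)-> CommutativeRing.Carrier(StarRing.cring S)}
             (isχ : Characters.Character S(PrimeField.Φ PF)χ)
             (T v : ℕ)(1000≤T : 1000 ≤ T)(1≤v : 1 ≤ v)
             (p≤ : p ≤(v N.* v N.*(v N.* v))N.*(v N.* v N.*(v N.* v)))
             (≤Tp :(v N.* v N.*(v N.* v))N.*(v N.* v N.*(v N.* v))≤ T N.* p)
             (logs : ∀ κ -> 2 N.^ κ ≤ p -> suc κ ≤ T)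
             (divisors : ∀{z}-> 1 ≤ z -> z < p -> DivBound T z)where
  open Positivity S hiding (begin_; _∎; step-≡; step-≡-∣; step-≡-⟩)
  open PrimeField PF using (Φ)
  open ShiftTrick S Φ isχ using (S[_]; ι)
  open ShortSums S PF isχ
  open Characters S Φ using (module F)
  open Characters.Character isχ
  open FourthMoment S Φ isχ using (V)

  private
   w = v N.* v
   W =(w N.* w)N.*(w N.* w)
   1≤w : 1 ≤ w
   1≤w = *-mono-≤ 1≤v 1≤v

  trivial-bound : ∀ n -> N S[ n ] ≲ ⟨ n N.* n ⟩
  trivial-bound n = ≲-trans(N-Ʃ(rng n)(\i -> χ(ι(suc i))))(≲-trans(*-monoˡ(pos-⟨⟩(length(rng n)))(≲-respʳ(trans(Ʃ-const(rng n)1#)(*-identityʳ _))(Ʃ-mono(rng n)(\{i}_ -> N-ψ≲1(ι(suc i))))))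
   (≈⇒≲(trans(sym(⟨⟩-*(length(rng n))(length(rng n))))(reflexive(cong ⟨_⟩(cong₂ N._*_(length-rng n)(length-rng n)))))))

  pv-bound : ∀ n -> 1 ≤ n -> n < p -> N S[ n ] ≲ ⟨ T N.* T N.* T N.* p ⟩
  pv-bound n 1≤n n<p = go(dyadic n 1≤n)
   where
   go :(∃ \κ -> 2 N.^ κ ≤ n × n < 2 N.* 2 N.^ κ)-> N S[ n ] ≲ ⟨ T N.* T N.* T N.* p ⟩
   go(κ , lo , hi)= ≲-trans(polya-vinogradov n κ n<p lo(<⇒≤ hi))(⟨⟩-mono(*-monoˡ-≤ p(≤-trans(*-mono-≤(≤-trans(≤ᵇ⇒≤ 24 1000 _)1000≤T)(*-mono-≤ k≤ k≤))(≡⇒≤(E.sym(N.*-assoc T T T))))))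
    where
    k≤ : suc κ ≤ T
    k≤ = logs κ(≤-trans lo(<⇒≤ n<p))

  module _ (weil : ∀{κ}-> κ ≢ F.0# -> N (V κ) ≲ ⟨ T N.* T N.* p ⟩) (1≤p : 1 ≤ p) where
   private
    K : ℕ -> ℕ
    K n =(T N.* T N.* T N.* T N.* T N.* T)N.* n N.*(v N.* w)

    T²≤T⁶ : T N.* T ≤(T N.* T N.* T N.* T N.* T N.* T)
    T²≤T⁶ = ≤-trans(≤-trans(T-up T 1000≤T(T N.* T))(≤-trans(T-up T 1000≤T _)(≤-trans(T-up T 1000≤T _)(T-up T 1000≤T _))))(≡⇒≤(alg T))
     where
     alg : ∀ T -> T N.*(T N.*(T N.*(T N.*(T N.* T))))≡(T N.* T N.* T N.* T N.* T N.* T)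
     alg = solve-∀

    root-bound : ∀ s -> suc s ≡ T N.* T N.*(w N.* w)-> ⟨ 2 ⟩ * ⟨ T N.* T N.* p ⟩ + ⟨ 2 ⟩ ≲ ⟨ suc s N.* suc s ⟩
    root-bound s e = ≲-respˡ(trans(⟨⟩-+(2 N.*(T N.* T N.* p))2)(+-congʳ(⟨⟩-* 2(T N.* T N.* p))))(⟨⟩-mono(≤-trans step(≡⇒≤(cong₂ N._*_(E.sym e)(E.sym e)))))
     where
     alg : ∀ T W -> 2 N.*(T N.* T N.* W)N.+ 2 N.*(T N.* T N.* W)≡ 4 N.*(T N.*(T N.* W))
     alg = solve-∀
     alg₂ : ∀ T w -> T N.*(T N.*(T N.*(T N.*(w N.* w N.*(w N.* w)))))≡(T N.* T N.*(w N.* w))N.*(T N.* T N.*(w N.* w))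
     alg₂ = solve-∀
     1≤TTp : 1 ≤ T N.* T N.* W
     1≤TTp = *-mono-≤(*-mono-≤(1≤T T 1000≤T)(1≤T T 1000≤T))(≤-trans 1≤p p≤)
     step : 2 N.*(T N.* T N.* p)N.+ 2 ≤(T N.* T N.*(w N.* w))N.*(T N.* T N.*(w N.* w))
     step = ≤-trans(+-mono-≤(*-monoʳ-≤ 2(*-monoʳ-≤(T N.* T)p≤))(*-monoʳ-≤ 2 1≤TTp))(≤-trans(≡⇒≤(alg T W))
      (≤-trans(c-up T 1000≤T 4(T N.*(T N.* W))(≤ᵇ⇒≤ 4 1000 _))(≤-trans(T-up T 1000≤T(T N.*(T N.*(T N.* W))))(≡⇒≤(alg₂ T w)))))

    extract : ∀ h K raw X -> 1 ≤ h -> 1 ≤ K -> Pos X -> raw N.* w ≤ h N.* h N.*(K N.* K)N.* w ->(⟨ h ⟩ * X)*(⟨ h ⟩ * X)≲ ⟨ raw ⟩ -> X ≲ ⟨ K ⟩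
    extract(suc h)(suc K)raw X _ _ pX num le = sq-≲⇒≲ K pX(≲-div h(≲-div h(≲-resp
      (solve 2(\h x ->(h :* x):*(h :* x):= h :*(h :*(x :* x)))refl ⟨ suc h ⟩ X)
      (trans(⟨⟩-*(suc h N.* suc h)(suc K N.* suc K))(trans(*-cong(⟨⟩-*(suc h)(suc h))(⟨⟩-*(suc K)(suc K)))(*-assoc _ _ _)))
      (≲-trans le(⟨⟩-mono(N.*-cancelʳ-≤ raw(suc h N.* suc h N.*(suc K N.* suc K))w{{N.>-nonZero 1≤w}}num))))))

   burgess-bound : ∀ n -> 1 ≤ n -> n < p -> N S[ n ] ≲ ⟨ K n ⟩
   burgess-bound n 1≤n n<p = size-case(n N.≤? v N.* w)
    where
    1≤K : 1 ≤ K n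
    1≤K = *-mono-≤(*-mono-≤(≤-trans(*-mono-≤(1≤T T 1000≤T)(1≤T T 1000≤T))T²≤T⁶)1≤n)(*-mono-≤ 1≤v 1≤w)
    long-case : ∀ κ -> 2 N.^ κ ≤ w -> w < 2 N.* 2 N.^ κ -> v N.* w < n -> ∀ A -> A ≡(_/_ n(2 N.^ κ){{m^n≢0 2 κ}})-> Dec((n N.+ n)N.* A N.+ n N.* A < p)-> N S[ n ] ≲ ⟨ K n ⟩
    long-case κ lo hi n> A A≡ d = go d
     where
     B = 2 N.^ κ
     H = A N.* B
     instance
      B≢0 : N.NonZero B
      B≢0 = m^n≢0 2 κ
     B≤n : B ≤ n
     B≤n = ≤-trans lo(≤-trans(≤-trans(≡⇒≤(E.sym(N.*-identityˡ w)))(*-monoˡ-≤ w 1≤v))(<⇒≤ n>))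
     H≤n : H ≤ n
     H≤n = ≤-trans(≡⇒≤(cong(N._* B)A≡))(m/n*n≤m n B)
     n<H+B : n < B N.+ H
     n<H+B = ≤-<-trans(≡⇒≤(E.trans(m≡m%n+[m/n]*n n B)(cong(\t -> _ N.+ t N.* B)(E.sym A≡))))(+-monoˡ-< H(m%n<n n B))
     1≤A : 1 ≤ A
     1≤A = nonzero A E.refl
      where
      nonzero : ∀ a -> A ≡ a -> 1 ≤ a
      nonzero zero e with ()← <⇒≱ n<H+B(≤-trans(≡⇒≤(E.trans(cong(\t -> B N.+ t N.* B)e)(N.+-identityʳ B)))B≤n)
      nonzero(suc a)e = s≤s z≤n
     n≤2H : n ≤ 2 N.* H
     n≤2H = ≤-trans(<⇒≤ n<H+B)(≤-trans(+-monoˡ-≤ H(≤-trans(≡⇒≤(E.sym(N.*-identityˡ B)))(*-monoˡ-≤ B 1≤A)))(≡⇒≤(cong(H N.+_)(E.sym(N.+-identityʳ H)))))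
     A≤n : A ≤ n
     A≤n = ≤-trans(≤-trans(≡⇒≤(E.sym(N.*-identityʳ A)))(*-monoʳ-≤ A(m^n>0 2 κ)))H≤n
     B≤p : B ≤ p
     B≤p = ≤-trans B≤n(<⇒≤ n<p)
     go : Dec((n N.+ n)N.* A N.+ n N.* A < p)-> N S[ n ] ≲ ⟨ K n ⟩
     go(yes small)= with-s(T N.* T N.*(w N.* w))E.refl(*-mono-≤(*-mono-≤(1≤T T 1000≤T)(1≤T T 1000≤T))(*-mono-≤ 1≤w 1≤w))
      where
      with-s : ∀ s -> s ≡ T N.* T N.*(w N.* w)-> 1 ≤ s -> N S[ n ] ≲ ⟨ K n ⟩
      with-s(suc s)e _ = extract(H N.* H)(K n)(raw(suc s))(N S[ n ])(*-mono-≤{1}{H}{1}{H}1≤H 1≤H)1≤K(sq S[ n ])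
       (subst(\t -> raw t N.* w ≤(H N.* H)N.*(H N.* H)N.*(K n N.* K n)N.* w)(E.sym e)
        (burgess-numeric T 1000≤T n A B(suc κ)L p v(logs κ B≤p)(+-monoʳ-≤ n H≤n)A≤n n≤2H lo(<⇒≤ hi)p≤))
       (burgess-raw n A κ T 1≤A H≤n small divisors ⟨ T N.* T N.* p ⟩ s(⟨⟩-mono(*-mono-≤(*-mono-≤(1≤T T 1000≤T)(1≤T T 1000≤T))1≤p))weil(root-bound s e)B≤p)
       where
       L = n N.+ H
       raw : ℕ -> ℕ
       raw t =(L N.* A N.*(4 N.* suc κ))N.*(L N.* A N.*(4 N.* suc κ))N.*((L N.* A N.* T N.+ A N.* A)N.*(suc κ N.* suc κ N.*(B N.* B N.*(3 N.* p N.+ B N.* B N.* t))))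
       1≤H : 1 ≤ H
       1≤H = *-mono-≤ 1≤A(m^n>0 2 κ)
     go(no big)= ≲-trans(pv-bound n 1≤n n<p)(⟨⟩-mono(≤-trans(*-monoʳ-≤(T N.* T N.* T)(≤-trans p≤(long-numeric T 1000≤T n A B p v H≤n(≮⇒≥ big)(<⇒≤ hi)≤Tp)))
       (≤-trans(T-up T 1000≤T _)(≡⇒≤(alg T n(v N.* w))))))
      where
      alg : ∀ T n x -> T N.*(T N.* T N.* T N.*(T N.* T N.* n N.* x))≡(T N.* T N.* T N.* T N.* T N.* T)N.* n N.* x
      alg = solve-∀
    size-case : Dec(n ≤ v N.* w)-> N S[ n ] ≲ ⟨ K n ⟩
    size-case(yes p)= ≲-trans(trivial-bound n)(⟨⟩-mono(≤-trans(*-monoʳ-≤ n p)(*-monoˡ-≤(v N.* w)(≤-trans(≡⇒≤(E.sym(N.*-identityˡ n)))(*-monoˡ-≤ n(≤-trans(*-mono-≤(1≤T T 1000≤T)(1≤T T 1000≤T))T²≤T⁶))))))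
    size-case(no ¬p)= go(dyadic w 1≤w)
     where
     go :(∃ \κ -> 2 N.^ κ ≤ w × w < 2 N.* 2 N.^ κ)-> N S[ n ] ≲ ⟨ K n ⟩
     go(κ , lo , hi)= long-case κ lo hi(≰⇒> ¬p)_ E.refl((n N.+ n)N.*(_/_ n(2 N.^ κ){{m^n≢0 2 κ}})N.+ n N.*(_/_ n(2 N.^ κ){{m^n≢0 2 κ}})N.<? p)

module GroupRings where
 open import Data.Integer as ℤ using (ℤ; +_; 0ℤ; 1ℤ) renaming (_+_ to _⊕_; _*_ to _⊗_; -_ to ⊖_)
 open E
 open Alg
 open Cone
 open Field
 open Char

 private
  module Z = RingKit ℤ.+-*-commutativeRing
  module ΣN = NatSums

 -- The group ring ℤ[F*] modulo the sum of all group elements: equality is tested against the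
 -- functions on F* of sum zero.
 module GroupRing (Φ : FiniteField) where
  module F = FieldKit Φ
  open F using (elems; nz; δ; _⁻¹) renaming (Carrier to K; _*_ to _·_; 0# to 0ᶠ; 1# to 1ᶠ)

  Element : Set
  Element = List(ℤ × K)

  infixr 7 _▹_
  _▹_ : Element ->(K -> ℤ)-> ℤ
  a ▹ φ = Z.Ʃ a(\t -> proj₁ t ⊗ φ(proj₂ t))

  record Test(φ : K -> ℤ): Set where
   constructor test
   field
    at-0 : φ 0ᶠ ≡ 0ℤ
    total : Z.Ʃ elems φ ≡ 0ℤ

  infix 4 _≋_
  record _≋_(a b : Element): Set where
   constructor eq
   field pairing : ∀ φ -> Test φ -> a ▹ φ ≡ b ▹ φ
  open _≋_ public

  translate : ∀{φ}-> Test φ -> ∀ g -> Test(\h -> φ(g · h))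
  translate{φ}(test z t)g with g F.≟ 0ᶠ
  ... | yes refl = test(trans(cong φ(F.zeroˡ 0ᶠ))z)(Z.Ʃ-≈0 elems(\{x}_ -> trans(cong φ(F.zeroˡ x))z))
  ... | no g≢0 = test(trans(cong φ(F.zeroʳ g))z)(trans(F.Reindex.Ʃ-reindex ℤ.+-*-commutativeRing(F.scale-bij g g≢0)φ)t)

  infixl 7 _✶_
  _✶_ : Element -> Element -> Element
  a ✶ b = concatMap(\s -> map(\t -> proj₁ s ⊗ proj₁ t , proj₂ s · proj₂ t)b)a

  negate conj : Element -> Element
  negate = map(\t -> ⊖ proj₁ t , proj₂ t)
  conj = map(\t -> proj₁ t , proj₂ t ⁻¹)

  ▹-cong : ∀ a{φ ψ : K -> ℤ}->(∀ g -> φ g ≡ ψ g)-> a ▹ φ ≡ a ▹ ψ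
  ▹-cong a h = Z.Ʃ-cong a(\t -> cong(proj₁ t ⊗_)(h(proj₂ t)))

  ▹-✶ : ∀ a b φ ->(a ✶ b)▹ φ ≡ a ▹(\g -> b ▹(\h -> φ(g · h)))
  ▹-✶ a b φ = trans(Z.Ʃ-concatMap _ a _)(Z.Ʃ-cong a(\s -> trans(Z.Ʃ-map _ b _)
   (trans(Z.Ʃ-cong b(\t -> ℤ.*-assoc(proj₁ s)(proj₁ t)_))(Z.Ʃ-*ˡ b(proj₁ s)_))))

  ▹-swap : ∀ a b(φ : K -> K -> ℤ)-> a ▹(\g -> b ▹ φ g)≡ b ▹(\h -> a ▹(\g -> φ g h))
  ▹-swap a b φ = trans(Z.Ʃ-cong a(\s -> sym(Z.Ʃ-*ˡ b(proj₁ s)_)))(trans(Z.Ʃ-swap a b _)(Z.Ʃ-cong b(\t ->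
   trans(Z.Ʃ-cong a(\s -> Z.solve 3(\x y z -> x Z.:*(y Z.:* z)Z.:= y Z.:*(x Z.:* z))refl(proj₁ s)(proj₁ t)(φ(proj₂ s)(proj₂ t))))(Z.Ʃ-*ˡ a(proj₁ t)_))))

  ▹-negate : ∀ a φ -> negate a ▹ φ ≡ ⊖(a ▹ φ)
  ▹-negate a φ = trans(Z.Ʃ-map _ a _)(trans(Z.Ʃ-cong a(\t -> sym(ℤ.neg-distribˡ-*(proj₁ t)(φ(proj₂ t)))))(Z.Ʃ-neg a _))

  ▹-conj : ∀ a φ -> conj a ▹ φ ≡ a ▹(φ ∘ _⁻¹)
  ▹-conj a φ = Z.Ʃ-map _ a _

  ▹-++ : ∀ a b φ ->(a ++ b)▹ φ ≡(a ▹ φ)⊕(b ▹ φ)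
  ▹-++ a b φ = Z.Ʃ-++ a b _

  ▹-one : ∀ φ ->((1ℤ , 1ᶠ)∷ [])▹ φ ≡ φ 1ᶠ
  ▹-one φ = trans(ℤ.+-identityʳ _)(ℤ.*-identityˡ _)

  ▹-+ : ∀ a(φ ψ : K -> ℤ)-> a ▹(\g -> φ g ⊕ ψ g)≡(a ▹ φ)⊕(a ▹ ψ)
  ▹-+ a φ ψ = trans(Z.Ʃ-cong a(\t -> ℤ.*-distribˡ-+(proj₁ t)_ _))(Z.Ʃ-+ a _ _)

  private
   ✶-cong : ∀{a a' b b'}-> a ≋ a' -> b ≋ b' -> a ✶ b ≋ a' ✶ b'
   ✶-cong{a}{a'}{b}{b'}(eq p)(eq q)= eq \φ T -> begin
    _ ≡⟨ ▹-✶ a b φ ⟩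
    _ ≡⟨ ▹-cong a(\g -> q _(translate T g))⟩
    _ ≡⟨ ▹-swap a b' _ ⟩
    _ ≡⟨ ▹-cong b'(\h -> p _(translateʳ T h))⟩
    _ ≡⟨ ▹-swap b' a'(\h g -> φ(g · h))⟩
    _ ≡⟨ sym(▹-✶ a' b' φ)⟩
    _ ∎
    where
    open ≡-Reasoning
    translateʳ : ∀{φ}-> Test φ -> ∀ h -> Test(\g -> φ(g · h))
    translateʳ{φ}T h = test(trans(cong φ(F.*-comm 0ᶠ h))(Test.at-0(translate T h)))(trans(Z.Ʃ-cong elems(\g -> cong φ(F.*-comm g h)))(Test.total(translate T h)))

   assoc : ∀ a b c φ ->((a ✶ b)✶ c)▹ φ ≡(a ✶(b ✶ c))▹ φ
   assoc a b c φ = trans(▹-✶(a ✶ b)c φ)(trans(▹-✶ a b _)(sym(trans(▹-✶ a(b ✶ c)φ)(▹-cong a(\g -> trans(▹-✶ b c _)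
    (▹-cong b(\h -> ▹-cong c(\k -> cong φ(sym(F.*-assoc g h k))))))))))

   comm : ∀ a b φ ->(a ✶ b)▹ φ ≡(b ✶ a)▹ φ
   comm a b φ = trans(▹-✶ a b φ)(trans(▹-swap a b _)(trans(▹-cong b(\h -> ▹-cong a(\g -> cong φ(F.*-comm g h))))(sym(▹-✶ b a φ))))

   one : Element
   one =(1ℤ , 1ᶠ)∷ []

   identityˡ : ∀ a φ ->(one ✶ a)▹ φ ≡ a ▹ φ
   identityˡ a φ = trans(▹-✶ one a φ)(trans(▹-one(\g -> a ▹(\h -> φ(g · h))))(▹-cong a(\g -> cong φ(F.*-identityˡ g))))

   distribʳ : ∀ c a b φ ->((a ++ b)✶ c)▹ φ ≡((a ✶ c)++(b ✶ c))▹ φ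
   distribʳ c a b φ = trans(▹-✶(a ++ b)c φ)(trans(▹-++ a b _)(sym(trans(▹-++(a ✶ c)(b ✶ c)φ)(cong₂ _⊕_(▹-✶ a c φ)(▹-✶ b c φ)))))

   distribˡ : ∀ a b c φ ->(a ✶(b ++ c))▹ φ ≡((a ✶ b)++(a ✶ c))▹ φ
   distribˡ a b c φ = trans(comm a(b ++ c)φ)(trans(distribʳ a b c φ)(trans(▹-++(b ✶ a)(c ✶ a)φ)
    (trans(cong₂ _⊕_(comm b a φ)(comm c a φ))(sym(▹-++(a ✶ b)(a ✶ c)φ)))))

   +-comm' : ∀ a b φ ->(a ++ b)▹ φ ≡(b ++ a)▹ φ
   +-comm' a b φ = trans(▹-++ a b φ)(trans(ℤ.+-comm(a ▹ φ)(b ▹ φ))(sym(▹-++ b a φ)))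

   inverseˡ : ∀ a φ ->(negate a ++ a)▹ φ ≡ 0ℤ
   inverseˡ a φ = trans(▹-++(negate a)a φ)(trans(cong(_⊕(a ▹ φ))(▹-negate a φ))(ℤ.+-inverseˡ(a ▹ φ)))

   ++-cong : ∀{a a' b b'}-> a ≋ a' -> b ≋ b' -> a ++ b ≋ a' ++ b'
   ++-cong{a}{a'}{b}{b'}(eq p)(eq q)= eq \φ T -> trans(▹-++ a b φ)(trans(cong₂ _⊕_(p φ T)(q φ T))(sym(▹-++ a' b' φ)))

  ring : CommutativeRing 0ℓ 0ℓ
  ring = record
   {Carrier = Element ; _≈_ = _≋_ ; _+_ = _++_ ; _*_ = _✶_ ; -_ = negate ; 0# = [] ; 1# = one
   ; isCommutativeRing = record
    {isRing = record
     {+-isAbelianGroup = record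
      {isGroup = record
       {isMonoid = record
        {isSemigroup = record
         {isMagma = record
          {isEquivalence = record{refl = eq \_ _ -> refl ; sym = \p -> eq \φ T -> sym(pairing p φ T); trans = \p q -> eq \φ T -> trans(pairing p φ T)(pairing q φ T)}
          ; ∙-cong = ++-cong}
         ; assoc = \a b c -> eq \φ _ -> cong(_▹ φ)(List.++-assoc a b c)}
        ; identity =(\a -> eq \_ _ -> refl),(\a -> eq \φ _ -> cong(_▹ φ)(List.++-identityʳ a))}
       ; inverse =(\a -> eq \φ _ -> inverseˡ a φ),(\a -> eq \φ _ -> trans(+-comm' a(negate a)φ)(inverseˡ a φ))
       ; ⁻¹-cong = \{a}{b}p -> eq \φ T -> trans(▹-negate a φ)(trans(cong ⊖_(pairing p φ T))(sym(▹-negate b φ)))}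
      ; comm = \a b -> eq \φ _ -> +-comm' a b φ}
     ; *-cong = ✶-cong
     ; *-assoc = \a b c -> eq \φ _ -> assoc a b c φ
     ; *-identity =(\a -> eq \φ _ -> identityˡ a φ),(\a -> eq \φ _ -> trans(comm a one φ)(identityˡ a φ))
     ; distrib =(\a b c -> eq \φ _ -> distribˡ a b c φ),(\a b c -> eq \φ _ -> distribʳ a b c φ)}
    ; *-comm = \a b -> eq \φ _ -> comm a b φ}}

  private
   module R = RingKit ring

   ▹-⟨⟩ : ∀ n φ -> R.⟨ n ⟩ ▹ φ ≡(+ n)⊗ φ 1ᶠ
   ▹-⟨⟩ zero φ = sym(ℤ.*-zeroˡ(φ 1ᶠ))
   ▹-⟨⟩(suc n)φ = trans(cong₂ _⊕_(ℤ.*-identityˡ(φ 1ᶠ))(▹-⟨⟩ n φ))(sym(ℤ.suc-*(+ n)(φ 1ᶠ)))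

  ▹-⟨⟩✶ : ∀ n a φ ->(R.⟨ n ⟩ ✶ a)▹ φ ≡(+ n)⊗(a ▹ φ)
  ▹-⟨⟩✶ n a φ = trans(▹-✶ R.⟨ n ⟩ a φ)(trans(▹-⟨⟩ n _)(cong((+ n)⊗_)(▹-cong a(\g -> cong φ(F.*-identityˡ g)))))

  test-inv : ∀{φ}-> Test φ -> Test(φ ∘ _⁻¹)
  test-inv{φ}(test z t)= test(trans(cong φ F.0⁻¹)z)(trans(F.Reindex.Ʃ-reindex ℤ.+-*-commutativeRing F.inv-bij φ)t)

  starRing : StarRing
  starRing = record
   {cring = ring
   ; _⋆ = conj
   ; ⋆-cong = \{a}{b}p -> eq \φ T -> trans(▹-conj a φ)(trans(pairing p _(test-inv T))(sym(▹-conj b φ)))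
   ; ⋆-+ = \a b -> eq \φ _ -> cong(_▹ φ)(List.map-++ _ a b)
   ; ⋆-* = \a b -> eq \φ _ -> trans(▹-conj(a ✶ b)φ)(trans(▹-✶ a b _)(sym(trans(▹-✶(conj a)(conj b)φ)(trans(▹-conj a _)(▹-cong a(\g -> trans(▹-conj b _)(▹-cong b(\h -> cong φ(sym(F.⁻¹-* g h))))))))))
   ; ⋆-involutive = \a -> eq \φ _ -> trans(▹-conj(conj a)φ)(trans(▹-conj a _)(▹-cong a(\g -> cong φ(F.⁻¹-involutive g))))
   ; torsion-free = \n a p -> eq \φ T -> cancel n(a ▹ φ)(trans(sym(▹-⟨⟩✶(suc n)a φ))(pairing p φ T))}
   where
   cancel : ∀ n x ->(+ suc n)⊗ x ≡ 0ℤ -> x ≡ 0ℤ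
   cancel n x e with ℤ.i*j≡0⇒i≡0∨j≡0(+ suc n)e
   ... | inj₂ p = p

  χ : K -> Element
  χ x =(1ℤ , x)∷ []

  ▹-χ : ∀ x φ -> χ x ▹ φ ≡ φ x
  ▹-χ x φ = trans(ℤ.+-identityʳ _)(ℤ.*-identityˡ _)

  private
   ▹-Ʃχ :{I : Set}(xs : List I)(f : I -> K)(φ : K -> ℤ)-> R.Ʃ xs(χ ∘ f)▹ φ ≡ Z.Ʃ xs(φ ∘ f)
   ▹-Ʃχ [] f φ = refl
   ▹-Ʃχ(x ∷ xs)f φ = cong₂ _⊕_(ℤ.*-identityˡ(φ(f x)))(▹-Ʃχ xs f φ)

  isCharacter : Characters.Character starRing Φ χ
  isCharacter = record
   {multiplicative = record
    {ψ-* = \x y -> eq \φ _ -> trans(▹-χ(x · y)φ)(sym(trans(▹-✶(χ x)(χ y)φ)(trans(▹-χ x(\g -> χ y ▹(\h -> φ(g · h))))(▹-χ y(\h -> φ(x · h))))))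
    ; ψ-0 = eq \φ T -> trans(▹-χ 0ᶠ φ)(Test.at-0 T)
    ; ψ-1 = eq \_ _ -> refl
    ; ψ-N = \{x}x≢0 -> eq \φ _ -> trans(▹-✶(χ x)(conj(χ x))φ)(trans(▹-χ x(\g -> conj(χ x)▹(\h -> φ(g · h))))(trans(▹-χ(x ⁻¹)(\h -> φ(x · h)))(trans(cong φ(F.inverseʳ x≢0))(sym(▹-one φ)))))}
   ; ψ-Ʃ = eq \φ T -> trans(▹-Ʃχ elems(\x -> x)φ)(Test.total T)}

  ℓ : ℕ
  ℓ = length nz

  -- The indicator of nonzero elements minus its mean, centred at 1.
  φ₁ : K -> ℤ
  φ₁ x =(+ ℓ)⊗(+ δ x 1ᶠ)⊕ ⊖(1ℤ ⊕ ⊖(+ δ x 0ᶠ))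

  private
   Ʃδ : ∀ y -> Z.Ʃ elems(\x -> + δ x y)≡ 1ℤ
   Ʃδ y = trans(pos-Ʃ elems(\x -> δ x y))(cong +_(F.Ʃ-δℕ y))
    where
    pos-Ʃ : ∀(xs : List K)f -> Z.Ʃ xs(\x -> + f x)≡ + ΣN.Ʃ xs f
    pos-Ʃ [] f = refl
    pos-Ʃ(x ∷ xs)f = cong((+ f x)⊕_)(pos-Ʃ xs f)

   Ʃ1 : ∀(xs : List K)-> Z.Ʃ xs(\_ -> 1ℤ)≡ + length xs
   Ʃ1 [] = refl
   Ʃ1(x ∷ xs)= cong(1ℤ ⊕_)(Ʃ1 xs)

   minus-one : ∀ l ->(1ℤ ⊕ l)⊕ ⊖ 1ℤ ≡ l
   minus-one l = Z.solve 2(\o l ->(o Z.:+ l)Z.:- o Z.:= l)refl 1ℤ l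

   test₁ : Test φ₁
   test₁ = test(trans(cong₂(\a b ->(+ ℓ)⊗(+ a)⊕ ⊖(1ℤ ⊕ ⊖(+ b)))(F.δ-≢(F.1≢0 ∘ sym))(F.δ-≡{0ᶠ}refl))(trans(ℤ.+-identityʳ _)(ℤ.*-zeroʳ(+ ℓ))))
    (trans(Z.Ʃ-+ elems _ _)(trans(cong₂ _⊕_(trans(Z.Ʃ-*ˡ elems(+ ℓ)_)(trans(cong((+ ℓ)⊗_)(Ʃδ 1ᶠ))(ℤ.*-identityʳ(+ ℓ))))
     (trans(Z.Ʃ-neg elems _)(cong ⊖_(trans(Z.Ʃ-+ elems _ _)(cong₂ _⊕_(trans(Ʃ1 elems)(cong +_ F.size-nz))(trans(Z.Ʃ-neg elems _)(cong ⊖_(Ʃδ 0ᶠ))))))))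
     (trans(cong(\t ->(+ ℓ)⊕ ⊖ t)(minus-one(+ ℓ)))(ℤ.+-inverseʳ(+ ℓ)))))

  τ : Element -> ℤ
  τ a = a ▹ φ₁

  τ-cong : ∀{a b}-> a ≋ b -> τ a ≡ τ b
  τ-cong p = pairing p φ₁ test₁

  private
   e : K -> K -> ℤ
   e g x = + δ g x

   Ʃe : ∀ g -> Z.Ʃ nz(e g)≡ 1ℤ ⊕ ⊖(e g 0ᶠ)
   Ʃe g = trans(Z.solve 2(\a b -> b Z.:=(a Z.:+ b)Z.:- a)refl(e g 0ᶠ)(Z.Ʃ nz(e g)))(cong(_⊕ ⊖ e g 0ᶠ)
    (trans(sym(Z.Ʃ-↭ F.elems-↭(e g)))(trans(Z.Ʃ-cong elems(\x -> cong +_(δ-comm g x)))(Ʃδ g))))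
    where
    δ-comm : ∀ g x -> δ g x ≡ δ x g
    δ-comm g x with g F.≟ x
    ... | yes refl = sym(F.δ-≡{g}refl)
    ... | no p = sym(F.δ-≢(p ∘ sym))

   Ʃee : ∀ g k -> Z.Ʃ nz(\x -> e g x ⊗ e k x)≡ + δ(g · k ⁻¹)1ᶠ
   Ʃee g k = go(g F.≟ k)(k F.≟ 0ᶠ)
    where
    go : Dec(g ≡ k)-> Dec(k ≡ 0ᶠ)-> Z.Ʃ nz(\x -> e g x ⊗ e k x)≡ + δ(g · k ⁻¹)1ᶠ
    go(no g≢k)(no k≢0)= trans(Z.Ʃ-≈0 nz(\{x}_ -> disjoint x(g F.≟ x)(k F.≟ x)))(cong +_(sym(F.δ-≢(\p -> g≢k
     (trans(sym(F.*-identityʳ g))(trans(cong(g ·_)(sym(F.inverseˡ k≢0)))(trans(sym(F.*-assoc g _ k))(trans(cong(_· k)p)(F.*-identityˡ k)))))))))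
     where
     disjoint : ∀ x -> Dec(g ≡ x)-> Dec(k ≡ x)-> e g x ⊗ e k x ≡ 0ℤ
     disjoint x(no p)_ = trans(cong(\t -> + t ⊗ e k x)(F.δ-≢ p))refl
     disjoint x(yes p)(no q)= trans(cong(\t -> e g x ⊗ + t)(F.δ-≢ q))(ℤ.*-zeroʳ(e g x))
     disjoint x(yes p)(yes q)= contradiction(trans p(sym q))g≢k
    go _(yes refl)= trans(Z.Ʃ-≈0 nz(\{x}x∈ -> trans(cong(\t -> e g x ⊗ + t)(F.δ-≢(F.∈-nz⁻ x∈ ∘ sym)))(ℤ.*-zeroʳ(e g x))))
     (cong +_(sym(F.δ-≢(\p -> F.1≢0(trans(sym p)(trans(cong(g ·_)F.0⁻¹)(F.zeroʳ g)))))))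
    go(yes refl)(no k≢0)= trans(Z.Ʃ-cong nz(\x -> idem x(g F.≟ x)))(trans(Ʃe g)(trans(cong(\t -> 1ℤ ⊕ ⊖(+ t))(F.δ-≢ k≢0))(cong +_(sym(F.δ-≡(F.inverseʳ k≢0))))))
     where
     idem : ∀ x -> Dec(g ≡ x)-> e g x ⊗ e g x ≡ e g x
     idem x(yes p)= trans(cong₂(\s t -> + s ⊗ + t)(F.δ-≡ p)(F.δ-≡ p))(cong +_(sym(F.δ-≡ p)))
     idem x(no p)= trans(cong₂(\s t -> + s ⊗ + t)(F.δ-≢ p)(F.δ-≢ p))(cong +_(sym(F.δ-≢ p)))

   nonzero-product : ∀ g k ->(1ℤ ⊕ ⊖(e g 0ᶠ))⊗(1ℤ ⊕ ⊖(e k 0ᶠ))≡ 1ℤ ⊕ ⊖(+ δ(g · k ⁻¹)0ᶠ)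
   nonzero-product g k = go(g F.≟ 0ᶠ)(k F.≟ 0ᶠ)
    where
    Goal : ℕ -> ℕ -> ℕ -> Set
    Goal a b c =(1ℤ ⊕ ⊖(+ a))⊗(1ℤ ⊕ ⊖(+ b))≡ 1ℤ ⊕ ⊖(+ c)
    use : ∀{a b c}-> δ g 0ᶠ ≡ a -> δ k 0ᶠ ≡ b -> δ(g · k ⁻¹)0ᶠ ≡ c -> Goal a b c -> Goal(δ g 0ᶠ)(δ k 0ᶠ)(δ(g · k ⁻¹)0ᶠ)
    use refl refl refl p = p
    go : Dec(g ≡ 0ᶠ)-> Dec(k ≡ 0ᶠ)-> Goal(δ g 0ᶠ)(δ k 0ᶠ)(δ(g · k ⁻¹)0ᶠ)
    go(yes refl)_ = use(F.δ-≡{0ᶠ}refl)refl(F.δ-≡(F.zeroˡ _))(ℤ.*-zeroˡ(1ℤ ⊕ ⊖(+ δ k 0ᶠ)))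
    go(no p)(yes refl)= use(F.δ-≢ p)(F.δ-≡{0ᶠ}refl)(F.δ-≡(trans(cong(g ·_)F.0⁻¹)(F.zeroʳ g)))refl
    go(no p)(no q)= use(F.δ-≢ p)(F.δ-≢ q)(F.δ-≢(F.*-nonzero p(F.⁻¹-nonzero q)))refl

   -- 2 φ₁(g k⁻¹) is a Gram matrix, so the functional τ is nonnegative on squares.
   polarised : ∀ g k -> Z.Ʃ nz(\x -> Z.Ʃ nz(\y ->(e g x ⊕ ⊖ e g y)⊗(e k x ⊕ ⊖ e k y)))≡ φ₁(g · k ⁻¹)⊕ φ₁(g · k ⁻¹)
   polarised g k = begin
    _ ≡⟨ Z.Ʃ-cong nz(\x -> trans(Z.Ʃ-cong nz(\y -> Z.solve 4(\a b c d ->(a Z.:- b)Z.:*(c Z.:- d)Z.:=(a Z.:* c Z.:+ b Z.:* d)Z.:-(a Z.:* d Z.:+ c Z.:* b))refl(e g x)(e g y)(e k x)(e k y)))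
        (trans(Z.Ʃ-− nz _ _)(cong₂(\s t -> s ⊕ ⊖ t)(trans(Z.Ʃ-+ nz _ _)(cong(_⊕ P)(trans(Z.Ʃ-const nz _)(cong(_⊗(e g x ⊗ e k x))⟨⟩-pos))))(trans(Z.Ʃ-+ nz _ _)(cong₂ _⊕_(Z.Ʃ-*ˡ nz(e g x)_)(Z.Ʃ-*ˡ nz(e k x)_))))))⟩
    _ ≡⟨ trans(Z.Ʃ-− nz _ _)(cong₂(\s t -> s ⊕ ⊖ t)(trans(Z.Ʃ-+ nz _ _)(cong₂ _⊕_(Z.Ʃ-*ˡ nz L _)(trans(Z.Ʃ-const nz P)(cong(_⊗ P)⟨⟩-pos))))(trans(Z.Ʃ-+ nz _ _)(cong₂ _⊕_(Z.Ʃ-*ʳ nz Sk _)(Z.Ʃ-*ʳ nz Sg _))))⟩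
    _ ≡⟨ Z.solve 4(\l p g k ->(l Z.:* p Z.:+ l Z.:* p)Z.:-(g Z.:* k Z.:+ k Z.:* g)Z.:=(l Z.:* p Z.:- g Z.:* k)Z.:+(l Z.:* p Z.:- g Z.:* k))refl L P Sg Sk ⟩
    _ ≡⟨ cong(\t -> t ⊕ t)(cong₂(\s t -> L ⊗ s ⊕ ⊖ t)(Ʃee g k)(trans(cong₂ _⊗_(Ʃe g)(Ʃe k))(nonzero-product g k)))⟩
    _ ∎
    where
    open ≡-Reasoning
    L P Sg Sk : ℤ
    L = + ℓ
    P = Z.Ʃ nz(\y -> e g y ⊗ e k y)
    Sg = Z.Ʃ nz(e g)
    Sk = Z.Ʃ nz(e k)
    ⟨⟩-pos : Z.⟨ ℓ ⟩ ≡ + ℓ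
    ⟨⟩-pos = go ℓ
     where
     go : ∀ n -> Z.⟨ n ⟩ ≡ + n
     go zero = refl
     go(suc n)= cong(1ℤ ⊕_)(go n)

   square-nonneg : ∀ i -> 0ℤ ℤ.≤ i ⊗ i
   square-nonneg(+ n)= ℤ.≤-trans(ℤ.+≤+ N.z≤n)(ℤ.≤-reflexive(ℤ.pos-* n n))
   square-nonneg ℤ.-[1+ n ] = ℤ.+≤+ N.z≤n

   Ʃ-nonneg :{I : Set}(xs : List I){f : I -> ℤ}->(∀ x -> 0ℤ ℤ.≤ f x)-> 0ℤ ℤ.≤ Z.Ʃ xs f
   Ʃ-nonneg [] h = ℤ.≤-refl
   Ʃ-nonneg(x ∷ xs)h = ℤ.+-mono-≤(h x)(Ʃ-nonneg xs h)

   ▹-Ʃ :{I : Set}(a : Element)(xs : List I)(φ : I -> K -> ℤ)-> a ▹(\g -> Z.Ʃ xs(\x -> φ x g))≡ Z.Ʃ xs(\x -> a ▹ φ x)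
   ▹-Ʃ a xs φ = trans(Z.Ʃ-cong a(\t -> sym(Z.Ʃ-*ˡ xs(proj₁ t)_)))(Z.Ʃ-swap a xs _)

   ▹-*ˡ : ∀ a c(φ : K -> ℤ)-> a ▹(\g -> c ⊗ φ g)≡ c ⊗(a ▹ φ)
   ▹-*ˡ a c φ = trans(Z.Ʃ-cong a(\t -> Z.solve 3(\x y z -> x Z.:*(y Z.:* z)Z.:= y Z.:*(x Z.:* z))refl(proj₁ t)c(φ(proj₂ t))))(Z.Ʃ-*ˡ a c _)

   ▹-*ʳ : ∀ a c(φ : K -> ℤ)-> a ▹(\g -> φ g ⊗ c)≡(a ▹ φ)⊗ c
   ▹-*ʳ a c φ = trans(▹-cong a(\g -> ℤ.*-comm(φ g)c))(trans(▹-*ˡ a c φ)(ℤ.*-comm c _))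

   τ-✶conj : ∀ h -> τ(h ✶ conj h)≡ h ▹(\g -> h ▹(\k -> φ₁(g · k ⁻¹)))
   τ-✶conj h = trans(▹-✶ h(conj h)φ₁)(▹-cong h(\g -> ▹-conj h _))

   double-τ : ∀ h -> τ(h ✶ conj h)⊕ τ(h ✶ conj h)≡ Z.Ʃ nz(\x -> Z.Ʃ nz(\y ->(h ▹(\g -> e g x ⊕ ⊖ e g y))⊗(h ▹(\g -> e g x ⊕ ⊖ e g y))))
   double-τ h = trans(cong₂ _⊕_(τ-✶conj h)(τ-✶conj h))(trans(sym(▹-+ h _ _))(trans(▹-cong h(\g -> trans(sym(▹-+ h _ _))(▹-cong h(\k -> sym(polarised g k)))))
    (trans(▹-cong h(\g -> trans(▹-Ʃ h nz _)(Z.Ʃ-cong nz(\x -> trans(▹-Ʃ h nz _)(Z.Ʃ-cong nz(\y -> ▹-*ˡ h(e g x ⊕ ⊖ e g y)_))))))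
     (trans(▹-Ʃ h nz _)(Z.Ʃ-cong nz(\x -> trans(▹-Ʃ h nz _)(Z.Ʃ-cong nz(\y -> ▹-*ʳ h _ _))))))))

   halve : ∀ i -> 0ℤ ℤ.≤ i ⊕ i -> 0ℤ ℤ.≤ i
   halve(+ n)_ = ℤ.+≤+ N.z≤n
   halve ℤ.-[1+ n ] ()

  open Positivity starRing using (Pos; sq; add; div; resp; _≲_; by; N; _-_; ⟨_⟩; Ʃ)

  τ-nonneg : ∀{a}-> Pos a -> 0ℤ ℤ.≤ τ a
  τ-nonneg(sq h)= halve _(subst(0ℤ ℤ.≤_)(sym(double-τ h))(Ʃ-nonneg nz(\x -> Ʃ-nonneg nz(\y -> square-nonneg(h ▹(\g -> e g x ⊕ ⊖ e g y))))))
  τ-nonneg(add{a}{b}p q)= subst(0ℤ ℤ.≤_)(sym(▹-++ a b φ₁))(ℤ.+-mono-≤(τ-nonneg p)(τ-nonneg q))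
  τ-nonneg(resp p q)= subst(0ℤ ℤ.≤_)(τ-cong p)(τ-nonneg q)
  τ-nonneg(div n{a}p)= ℤ.*-cancelˡ-≤-pos 0ℤ(τ a)(+ suc n)(subst₂ ℤ._≤_(sym(ℤ.*-zeroʳ(+ suc n)))(▹-⟨⟩✶(suc n)a φ₁)(τ-nonneg p))

  τ-mono : ∀{a b}-> a ≲ b -> τ a ℤ.≤ τ b
  τ-mono{a}{b}(by p)= ℤ.0≤i-j⇒j≤i(subst(0ℤ ℤ.≤_)(trans(▹-++ b(negate a)φ₁)(cong(τ b ⊕_)(▹-negate a φ₁)))(τ-nonneg p))

  τ-⟨⟩ : ∀ n a -> τ(⟨ n ⟩ ✶ a)≡(+ n)⊗ τ a
  τ-⟨⟩ n a = ▹-⟨⟩✶ n a φ₁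

  τ-N :{I : Set}(xs : List I)(f : I -> K)->(∀{x}-> x ∈ xs -> f x ≢ 0ᶠ)->
     τ(N(Ʃ xs(χ ∘ f)))≡(+(ℓ N.* ΣN.Ʃ xs(\i -> ΣN.Ʃ xs(\j -> δ(f i)(f j)))))⊕ ⊖(+(length xs N.* length xs))
  τ-N{I}xs f nonzero = trans(τ-✶conj(Ʃ xs(χ ∘ f)))(trans(▹-Ʃχ xs f _)(trans(Z.Ʃ-cong-∈ xs(\{i}i∈ -> trans(▹-Ʃχ xs f _)(Z.Ʃ-cong-∈ xs(\{j}j∈ -> value(nonzero i∈)(nonzero j∈)))))
    (trans(Z.Ʃ-cong xs(\i -> trans(Z.Ʃ-− xs _ _)(cong₂(\s t -> s ⊕ ⊖ t)(Z.Ʃ-*ˡ xs(+ ℓ)_)(ones xs))))(trans(Z.Ʃ-− xs _ _)(cong₂(\s t -> s ⊕ ⊖ t)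
     (trans(Z.Ʃ-*ˡ xs(+ ℓ)_)(trans(cong((+ ℓ)⊗_)(trans(Z.Ʃ-cong xs(\i -> pos-Ʃ xs _))(pos-Ʃ xs _)))(sym(ℤ.pos-* ℓ _))))
     (trans(consts xs)(sym(ℤ.pos-*(length xs)(length xs)))))))))
   where
   value : ∀{g k}-> g ≢ 0ᶠ -> k ≢ 0ᶠ -> φ₁(g · k ⁻¹)≡(+ ℓ)⊗(+ δ g k)⊕ ⊖ 1ℤ
   value{g}{k}g≢0 k≢0 = cong₂(\a b ->(+ ℓ)⊗(+ a)⊕ ⊖(1ℤ ⊕ ⊖(+ b)))(same(g F.≟ k))(F.δ-≢(F.*-nonzero g≢0(F.⁻¹-nonzero k≢0)))
    where
    same : Dec(g ≡ k)-> δ(g · k ⁻¹)1ᶠ ≡ δ g k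
    same(yes refl)= trans(F.δ-≡(F.inverseʳ k≢0))(sym(F.δ-≡{g}refl))
    same(no p)= trans(F.δ-≢(\q -> p(trans(sym(F.*-identityʳ g))(trans(cong(g ·_)(sym(F.inverseˡ k≢0)))(trans(sym(F.*-assoc g _ k))(trans(cong(_· k)q)(F.*-identityˡ k)))))))(sym(F.δ-≢ p))
   ones : ∀(ys : List I)-> Z.Ʃ ys(\_ -> 1ℤ)≡ + length ys
   ones [] = refl
   ones(y ∷ ys)= cong(1ℤ ⊕_)(ones ys)
   pos-Ʃ : ∀(ys : List I)(g : I -> ℕ)-> Z.Ʃ ys(\y -> + g y)≡ + ΣN.Ʃ ys g
   pos-Ʃ [] g = refl
   pos-Ʃ(y ∷ ys)g = cong((+ g y)⊕_)(pos-Ʃ ys g)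
   consts : ∀(ys : List I)-> Z.Ʃ ys(\_ -> + length xs)≡(+ length ys)⊗(+ length xs)
   consts [] = sym(ℤ.*-zeroˡ(+ length xs))
   consts(y ∷ ys)= trans(cong((+ length xs)⊕_)(consts ys))(sym(ℤ.suc-*(+ length ys)(+ length xs)))

module Divisors where
 open import Data.Nat using (_+_; _*_; _∸_; _^_; _/_; _%_)
 open import Data.Nat.Divisibility using (∣-trans; *-cancelˡ-∣; quotient; ∣1⇒≡1)
 open import Data.Nat.Primality using (prime?; prime⇒irreducible; prime⇒nonTrivial; ¬prime[0]; ¬prime[1])
 open import Data.Nat.Primality.Factorisation using (factorise; PrimeFactorisation)
 open import Data.Nat.Coprimality using (Coprime; coprime-divisor)
 open import Data.Nat.ListAction using (product)
 open E hiding ([_])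
 open Alg
 open Count

 ^-distribʳ-* : ∀ n a b ->(a * b)^ n ≡ a ^ n * b ^ n
 ^-distribʳ-* zero a b = refl
 ^-distribʳ-*(suc n)a b = trans(cong(a * b *_)(^-distribʳ-* n a b))(alg a b(a ^ n)(b ^ n))
  where
  alg : ∀ a b c d -> a * b *(c * d)≡ a * c *(b * d)
  alg = solve-∀

 suc≤2^ : ∀ n -> suc n ≤ 2 ^ n
 suc≤2^ zero = s≤s z≤n
 suc≤2^(suc n)= +-mono-≤(m^n>0 2 n)(≤-trans(suc≤2^ n)(m≤m+n(2 ^ n)0))

 suc-^≤ : ∀ E -> 1 ≤ E -> ∀ a -> suc a ^ E ≤ E ^ E * 2 ^ a
 suc-^≤ E@(suc _)_ a = begin
  _ ≤⟨ ^-monoˡ-≤ E a< ⟩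
  _ ≡⟨ ^-distribʳ-* E E(suc b)⟩
  _ ≤⟨ *-monoʳ-≤(E ^ E)(^-monoˡ-≤ E(suc≤2^ b))⟩
  _ ≡⟨ cong(E ^ E *_)(^-*-assoc 2 b E)⟩
  _ ≤⟨ *-monoʳ-≤(E ^ E)(^-monoʳ-≤ 2(m/n*n≤m a E))⟩
  _ ∎
  where
  open N.≤-Reasoning
  b = a / E
  a< : suc a ≤ E * suc b
  a< = ≤-trans(s≤s(≡⇒≤(m≡m%n+[m/n]*n a E)))(≤-trans(+-monoˡ-≤(b * E)(m%n<n a E))(≡⇒≤(N.*-comm(suc b)E)))

 DivBound-1 : DivBound 1 1
 DivBound-1 [] _ _ = z≤n
 DivBound-1(_ ∷ [])_ _ = s≤s z≤n
 DivBound-1(x ∷ y ∷ ys)((x≢y ∷ _)∷ _)h = contradiction(trans(∣1⇒≡1(h(here refl)))(sym(∣1⇒≡1(h(there(here refl))))))x≢y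

 length-split :{A : Set}{P : A -> Set}(P? : ∀ x -> Dec(P x))(xs : List A)-> length xs ≡ length(filter P? xs)+ length(filter(¬? ∘ P?)xs)
 length-split P? [] = refl
 length-split P?(x ∷ xs)with does(P? x)
 ... | true = cong suc(length-split P? xs)
 ... | false = trans(cong suc(length-split P? xs))(sym(+-suc _ _))

 -- The divisors of z n are the multiples of z among them and those prime to z.
 peel : ∀{z n m d₁ d₂}.{{_ : NonZero z}}-> DivBound d₁ n ->(∀{x}-> x ∣ z * n -> ¬ z ∣ x -> x ∣ m)-> DivBound d₂ m -> DivBound(d₁ + d₂)(z * n)
 peel{z}{n}{m}h₁ sep h₂ xs u h = ≤-trans(≡⇒≤(length-split(z ∣?_)xs))(+-mono-≤
   (≤-trans(≡⇒≤(sym(List.length-map(_/ z)ys)))(h₁(map(_/ z)ys)(unique-map ys(Unique.filter⁺(z ∣?_)u)(\x∈ -> proj₂(∈-filter⁻(z ∣?_){xs = xs}x∈)))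
    (\{y}y∈ -> let x , x∈ , e = ∈-map⁻(_/ z)y∈ ; x∈xs , z∣x = ∈-filter⁻(z ∣?_){xs = xs}x∈ in
     subst(_∣ n)(sym e)(*-cancelˡ-∣ z(subst(_∣ z * n)(sym(back z∣x))(h x∈xs))))))
   (h₂(filter(¬? ∘(z ∣?_))xs)(Unique.filter⁺(¬? ∘(z ∣?_))u)(\y∈ -> let y∈xs , ¬z∣y = ∈-filter⁻(¬? ∘(z ∣?_)){xs = xs}y∈ in sep(h y∈xs)¬z∣y)))
  where
  open import Data.Nat.DivMod using (m*[n/m]≡n)
  ys = filter(z ∣?_)xs
  back : ∀{x}-> z ∣ x -> z *(x / z)≡ x
  back = m*[n/m]≡n
  unique-map : ∀ ws -> Unique ws ->(∀{w}-> w ∈ ws -> z ∣ w)-> Unique(map(_/ z)ws)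
  unique-map [] _ _ = []
  unique-map(w ∷ ws)(w∉ ∷ v)g = All.tabulate(\q e -> let x , x∈ , e' = ∈-map⁻(_/ z)q in
   All.lookup w∉ x∈(trans(sym(back(g(here refl))))(trans(cong(z *_)(trans e e'))(back(g(there x∈))))))∷ unique-map ws v(g ∘ there)

 coprime-prime : ∀{z x}-> Prime z -> ¬ z ∣ x -> Coprime x z
 coprime-prime{z}{x}pr z∤x{d}(d∣x , d∣z)with prime⇒irreducible pr d∣z
 ... | inj₁ d≡1 = d≡1
 ... | inj₂ refl = contradiction d∣x z∤x

 DivBound-prime-power : ∀{z m d}-> Prime z -> DivBound d m -> ∀ a -> DivBound(suc a * d)(z ^ a * m)
 DivBound-prime-power{z}{m}{d}pr h zero = subst₂ DivBound(sym(N.+-identityʳ d))(sym(N.+-identityʳ m))h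
 DivBound-prime-power{z}{m}{d}pr h(suc a)= subst₂ DivBound(N.+-comm(suc a * d)d)(sym(N.*-assoc z(z ^ a)m))
   (peel{z}{z ^ a * m}{m}{{prime⇒nonZero pr}}(DivBound-prime-power pr h a)(\{x}x∣ z∤x -> strip(suc a)z∤x(subst(x ∣_)(sym(N.*-assoc z(z ^ a)m))x∣))h)
  where
  strip : ∀ b{x}-> ¬ z ∣ x -> x ∣ z ^ b * m -> x ∣ m
  strip zero{x}z∤x x∣ = subst(x ∣_)(N.+-identityʳ m)x∣
  strip(suc b){x}z∤x x∣ = strip b z∤x(coprime-divisor(coprime-prime pr z∤x)(subst(x ∣_)(N.*-assoc z(z ^ b)m)x∣))

 module DivisorBound (E : ℕ) (1≤E : 1 ≤ E) where
  Small : ℕ -> ℕ -> Set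
  Small C n = ∃ \d -> DivBound d n × d ^ E ≤ C * n

  private
   AllFrom : ℕ -> List ℕ -> Set
   AllFrom z = All(\x -> Prime x × z ≤ x)

   large : ∀ zs -> AllFrom(2 ^ E)zs -> Small 1(product zs)
   large [] [] = 1 , DivBound-1 , ≡⇒≤(N.^-zeroˡ E)
   large(z ∷ zs)((pr , z≥)∷ ps)= let d , h , le = large zs ps in
    suc 1 * d , subst(DivBound(2 * d))(cong(_* product zs)(N.*-identityʳ z))(DivBound-prime-power pr h 1),
    ≤-trans(≡⇒≤(^-distribʳ-* E 2 d))(≤-trans(*-mono-≤ z≥ le)(≡⇒≤(alg z(product zs))))
    where
    alg : ∀ z m -> z *(1 * m)≡ 1 *(z * m)
    alg = solve-∀

   extract : ∀ z zs -> AllFrom z zs -> ∃ \a -> ∃ \ys -> AllFrom(suc z)ys × product zs ≡ z ^ a * product ys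
   extract z [] [] = 0 , [] , [] , refl
   extract z(x ∷ xs)((pr , z≤)∷ ps)= go(z N.≟ x)(extract z xs ps)
    where
    swap : ∀ x a m -> x *(a * m)≡ a *(x * m)
    swap = solve-∀
    go : Dec(z ≡ x)->(∃ \a -> ∃ \ys -> AllFrom(suc z)ys × product xs ≡ z ^ a * product ys)-> ∃ \a -> ∃ \ys -> AllFrom(suc z)ys × product(x ∷ xs)≡ z ^ a * product ys
    go(yes refl)(a , ys , h , e)= suc a , ys , h , trans(cong(z *_)e)(sym(N.*-assoc z(z ^ a)_))
    go(no z≢x)(a , ys , h , e)= a , x ∷ ys ,(pr , ≤∧≢⇒< z≤ z≢x)∷ h , trans(cong(x *_)e)(swap x(z ^ a)(product ys))

   c = E ^ E

   1≤c : 1 ≤ c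
   1≤c = ≤-trans(≡⇒≤(sym(N.^-zeroˡ E)))(^-monoˡ-≤ E 1≤E)

   from : ∀ k z -> z + k ≡ 2 ^ E -> ∀ zs -> AllFrom z zs -> Small(c ^ k)(product zs)
   from zero z e zs ps = large zs(All.map(\(pr , le)-> pr , ≤-trans(≡⇒≤(sym(trans(sym(N.+-identityʳ z))e)))le)ps)
   from(suc k)z e zs ps = go(prime? z)
    where
    next : ∀ ys -> AllFrom(suc z)ys -> Small(c ^ k)(product ys)
    next = from k(suc z)(trans(sym(+-suc z k))e)
    go : Dec(Prime z)-> Small(c ^ suc k)(product zs)
    go(no ¬pr)= let d , h , le = next zs(All.map(\(pr , z≤)-> pr , ≤∧≢⇒< z≤(\{refl -> ¬pr pr}))ps)in
     d , h , ≤-trans le(*-monoˡ-≤(product zs)(≤-trans(≡⇒≤(sym(N.*-identityˡ(c ^ k))))(*-monoˡ-≤(c ^ k)1≤c)))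
    go(yes pr)= let a , ys , hy , e' = extract z zs ps ; d , h , le = next ys hy in
     suc a * d , subst(DivBound(suc a * d))(sym e')(DivBound-prime-power pr h a),(begin
      _ ≡⟨ ^-distribʳ-* E(suc a)d ⟩
      _ ≤⟨ *-mono-≤(suc-^≤ E 1≤E a)le ⟩
      _ ≤⟨ *-monoˡ-≤(c ^ k * product ys)(*-monoʳ-≤ c(^-monoˡ-≤ a(N.nonTrivial⇒n>1 z{{prime⇒nonTrivial pr}})))⟩
      _ ≡⟨ alg c(z ^ a)(c ^ k)(product ys)⟩
      _ ≡⟨ cong(c * c ^ k *_)(sym e')⟩
      _ ∎)
     where
     open N.≤-Reasoning
     alg : ∀ a b c d -> a * b *(c * d)≡ a * c *(b * d)
     alg = solve-∀

  C : ℕ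
  C = c ^(2 ^ E)

  divisor-bound : ∀ n -> 1 ≤ n -> Small C n
  divisor-bound n 1≤n = subst(Small C)(sym(PrimeFactorisation.isFactorisation f))(from(2 ^ E)0 refl(PrimeFactorisation.factors f)(All.map(\pr -> pr , z≤n)(PrimeFactorisation.factorsPrime f)))
   where
   instance
    n≢0 : NonZero n
    n≢0 = N.>-nonZero 1≤n
   f = factorise n

module Products where
 open import Data.Nat using (_+_; _*_; _/_; _%_)
 open E hiding ([_])
 open Alg
 open Count
 open NatSums

 residue-count :{I : Set}(ts : List I)(F : I -> ℕ)(p Y R : ℕ).{{_ : NonZero p}}->(∀{t}-> t ∈ ts -> F t ≤ Y)->
         (∀ y -> y ≤ Y -> Ʃ ts(\t -> [ F t N.≟ y ])≤ R)-> ∀ r -> Ʃ ts(\t -> [ F t % p N.≟ r ])≤ suc(Y / p)* R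
 residue-count ts F p Y R F≤ count r = begin
  _ ≤⟨ Ʃ-mono-≤ ts(\t∈ -> lift t∈(F _ % p N.≟ r))⟩
  _ ≡⟨ Ʃ-swap ts(rng(suc(Y / p)))(\t j -> [ F t N.≟ r + j * p ])⟩
  _ ≤⟨ Ʃ-≤-const(rng(suc(Y / p)))R(\{j}_ -> every(r + j * p))⟩
  _ ≡⟨ cong(_* R)(length-rng(suc(Y / p)))⟩
  _ ∎
  where
  open N.≤-Reasoning
  lift : ∀{t}-> t ∈ ts ->(d : Dec(F t % p ≡ r))-> [ d ] ≤ Ʃ(rng(suc(Y / p)))(\j -> [ F t N.≟ r + j * p ])
  lift{t}t∈(no _)= z≤n
  lift{t}t∈(yes e)= ≤-trans(≡⇒≤(sym([yes](F t N.≟ r +(F t / p)* p)(trans(m≡m%n+[m/n]*n(F t)p)(cong(_+(F t / p)* p)e)))))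
   (∈⇒≤Ʃ(\j -> [ F t N.≟ r + j * p ])(∈-rng⁺(s≤s(/-monoˡ-≤ p(F≤ t∈)))))
  every : ∀ y -> Ʃ ts(\t -> [ F t N.≟ y ])≤ R
  every y = go(y N.≤? Y)
   where
   go : Dec(y ≤ Y)-> Ʃ ts(\t -> [ F t N.≟ y ])≤ R
   go(yes p)= count y p
   go(no ¬p)= ≤-trans(≡⇒≤(Ʃ-≈0 ts(\{t}t∈ -> [no](F t N.≟ y)(\e -> ¬p(subst(_≤ Y)e(F≤ t∈))))))z≤n

 module _{A B : Set}where
  Ʃ-× :(xs : List A)(ys : List B)(f : A × B -> ℕ)-> Ʃ(cartesianProduct xs ys)f ≡ Ʃ xs(\x -> Ʃ ys(\y -> f(x , y)))
  Ʃ-× [] ys f = refl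
  Ʃ-×(x ∷ xs)ys f = trans(Ʃ-++(map(x ,_)ys)(cartesianProduct xs ys)f)(cong₂ _+_(Ʃ-map(x ,_)ys f)(Ʃ-× xs ys f))

 pair-product : ℕ × ℕ -> ℕ
 pair-product(i , j)= suc i * suc j

 triple-product : ℕ ×(ℕ × ℕ)-> ℕ
 triple-product(i , t)= suc i * pair-product t

 private
  fibre≤1 : ∀ m c y -> Ʃ(rng m)(\j -> [ suc c * suc j N.≟ y ])≤ 1
  fibre≤1 m c y = at-most-one(\j -> suc c * suc j N.≟ y)(rng m)(rng-unique m)(\{j}{k}e f -> suc-injective(*-cancelˡ-≡(suc j)(suc k)(suc c)(trans e(sym f))))

 pair-count : ∀ m n D y ->(1 ≤ y -> DivBound D y)-> Ʃ(cartesianProduct(rng m)(rng n))(\t -> [ pair-product t N.≟ y ])≤ D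
 pair-count m n D zero h = ≤-trans(≡⇒≤(Ʃ-≈0(cartesianProduct(rng m)(rng n))(\{t}_ -> [no](pair-product t N.≟ 0)(\ ()))))z≤n
 pair-count m n D y@(suc _)h = begin
  _ ≡⟨ Ʃ-×(rng m)(rng n)_ ⟩
  _ ≤⟨ Ʃ-mono-≤(rng m)(\{i}_ -> row i(suc i ∣? y))⟩
  _ ≤⟨ divisor-count(h(s≤s z≤n))m ⟩
  D ∎
  where
  open N.≤-Reasoning
  row : ∀ i(d : Dec(suc i ∣ y))-> Ʃ(rng n)(\j -> [ suc i * suc j N.≟ y ])≤ [ d ]
  row i(yes _)= fibre≤1 n i y
  row i(no ¬p)= ≡⇒≤(Ʃ-≈0(rng n)(\{j}_ -> [no](suc i * suc j N.≟ y)(\e -> ¬p(divides(suc j)(trans(sym e)(N.*-comm(suc i)(suc j)))))))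

 triple-count : ∀ m D y ->(1 ≤ y -> DivBound D y)-> Ʃ(cartesianProduct(rng m)(cartesianProduct(rng m)(rng m)))(\t -> [ triple-product t N.≟ y ])≤ D * D
 triple-count m D zero h = ≤-trans(≡⇒≤(Ʃ-≈0(cartesianProduct(rng m)(cartesianProduct(rng m)(rng m)))(\{t}_ -> [no](triple-product t N.≟ 0)(\ ()))))z≤n
 triple-count m D y@(suc _)h = begin
  _ ≡⟨ trans(Ʃ-×(rng m)(cartesianProduct(rng m)(rng m))_)(Ʃ-cong(rng m)(\i -> Ʃ-×(rng m)(rng m)_))⟩
  _ ≤⟨ Ʃ-mono-≤(rng m){\i -> Ʃ(rng m)(\j -> Ʃ(rng m)(\k -> [ suc i *(suc j * suc k)N.≟ y ]))}(\{i}_ -> Ʃ-mono-≤(rng m)(\{j}_ -> entry i j(suc i ∣? y)(suc j ∣? y)))⟩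
  _ ≡⟨ sym(Ʃ-*Ʃ(rng m)(rng m)_ _)⟩
  _ ≤⟨ *-mono-≤(divisor-count(h(s≤s z≤n))m)(divisor-count(h(s≤s z≤n))m)⟩
  D * D ∎
  where
  open N.≤-Reasoning
  empty : ∀ i j ->(∀ k -> suc i *(suc j * suc k)≢ y)-> Ʃ(rng m)(\k -> [ suc i *(suc j * suc k)N.≟ y ])≤ 0
  empty i j h = ≡⇒≤(Ʃ-≈0(rng m)(\{k}_ -> [no](suc i *(suc j * suc k)N.≟ y)(h k)))
  middle : ∀ a b c -> a *(b * c)≡(a * c)* b
  middle a b c = trans(cong(a *_)(N.*-comm b c))(sym(N.*-assoc a c b))
  entry : ∀ i j(d : Dec(suc i ∣ y))(e : Dec(suc j ∣ y))-> Ʃ(rng m)(\k -> [ suc i *(suc j * suc k)N.≟ y ])≤ [ d ] * [ e ]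
  entry i j(no ¬p)_ = empty i j(\k e -> ¬p(divides(suc j * suc k)(trans(sym e)(N.*-comm(suc i)(suc j * suc k)))))
  entry i j(yes _)(no ¬p)= empty i j(\k e -> ¬p(divides(suc i * suc k)(trans(sym e)(middle(suc i)(suc j)(suc k)))))
  entry i j(yes _)(yes _)= at-most-one(\k -> suc i *(suc j * suc k)N.≟ y)(rng m)(rng-unique m)
   (\{k}{l}e f -> suc-injective(*-cancelˡ-≡(suc k)(suc l)(suc j)(*-cancelˡ-≡(suc j * suc k)(suc j * suc l)(suc i)(trans e(sym f)))))

 length-× :{A B : Set}(xs : List A)(ys : List B)-> length(cartesianProduct xs ys)≡ length xs * length ys
 length-× xs ys = trans(sym(trans(Ʃ-const(cartesianProduct xs ys)1)(N.*-identityʳ _)))(trans(Ʃ-× xs ys _)(trans(Ʃ-cong xs(\_ -> trans(Ʃ-const ys 1)(N.*-identityʳ _)))(Ʃ-const xs(length ys))))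

 ∈-pairs : ∀{m n t}-> t ∈ cartesianProduct(rng m)(rng n)-> proj₁ t < m × proj₂ t < n
 ∈-pairs{m}{n}t∈ = let a , b = ∈-cartesianProduct⁻(rng m)(rng n)t∈ in ∈-rng⁻ a , ∈-rng⁻ b

 pair-energy : ∀ n D p .{{_ : NonZero p}}->(∀{y}-> 1 ≤ y -> y ≤ n * n -> DivBound D y)->
  Ʃ(cartesianProduct(rng n)(rng n))(\t -> Ʃ(cartesianProduct(rng n)(rng n))(\s -> [ pair-product s % p N.≟ pair-product t % p ]))≤ n * n *(suc(n * n / p)* D)
 pair-energy n D p h = ≤-trans(Ʃ-≤-const ts(suc(n * n / p)* D)(\{t}_ -> residue-count ts pair-product p(n * n)D(\s∈ -> let a , b = ∈-pairs{n}{n}s∈ in *-mono-≤ a b)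
   (\y y≤ -> pair-count n n D y(\ 1≤y -> h 1≤y y≤))(pair-product t % p)))
  (≡⇒≤(cong(_*(suc(n * n / p)* D))(trans(length-×(rng n)(rng n))(cong₂ _*_(length-rng n)(length-rng n)))))
  where
  ts = cartesianProduct(rng n)(rng n)

 triples : ℕ -> List(ℕ ×(ℕ × ℕ))
 triples n = cartesianProduct(rng n)(cartesianProduct(rng n)(rng n))

 triple-energy : ∀ n D p .{{_ : NonZero p}}->(∀{y}-> 1 ≤ y -> y ≤ n *(n * n)-> DivBound D y)->
  Ʃ(triples n)(\t -> Ʃ(triples n)(\s -> [ triple-product s % p N.≟ triple-product t % p ]))≤ n *(n * n)*(suc(n *(n * n)/ p)*(D * D))
 triple-energy n D p h = ≤-trans(Ʃ-≤-const(triples n)(suc(n *(n * n)/ p)*(D * D))(\{t}_ -> residue-count(triples n)triple-product p(n *(n * n))(D * D)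
   (\{s}s∈ -> let a , b = ∈-cartesianProduct⁻(rng n)(cartesianProduct(rng n)(rng n))s∈ ; c , d = ∈-pairs{n}{n}b in *-mono-≤(∈-rng⁻ a)(*-mono-≤ c d))
   (\y y≤ -> triple-count n D y(\ 1≤y -> h 1≤y y≤))(triple-product t % p)))
  (≡⇒≤(cong(_*(suc(n *(n * n)/ p)*(D * D)))(trans(length-×(rng n)(cartesianProduct(rng n)(rng n)))(cong₂ _*_(length-rng n)(trans(length-×(rng n)(rng n))(cong₂ _*_(length-rng n)(length-rng n)))))))

module Lattice where
 open import Data.Nat using (_+_; _*_; _∸_; _/_; _%_; ∣_-_∣)
 open import Data.Nat.DivMod using (m/n≤m; /-monoʳ-≤; m*n/n≡m)
 open import Data.Nat.Divisibility using (∣m+n∣m⇒∣n; ∣m∣n⇒∣m+n; m∣m*n; n∣m*n; ∣m⇒∣m*n)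
 open import Data.Nat.Coprimality using (Coprime; coprime-divisor; coprime-Bézout) renaming (sym to coprime-sym)
 open import Data.Nat.GCD using (module Bézout)
 open E hiding ([_])
 open Alg
 open Count
 open Products
 open NatSums
 open N.≤-Reasoning

 module _{A : Set}where
  at-most-one-∈ :{P : A -> Set}(P? : ∀ x -> Dec(P x))(xs : List A)-> Unique xs ->(∀{x y}-> x ∈ xs -> y ∈ xs -> P x -> P y -> x ≡ y)-> Ʃ xs(\x -> [ P? x ])≤ 1
  at-most-one-∈ P? xs u h = ≤-trans(≡⇒≤(Ʃ-[] P? xs))(short(filter P? xs)(Unique.filter⁺ P? u)(∈-filter⁻ P?{xs = xs}))
   where
   short : ∀ ys -> Unique ys ->(∀{y}-> y ∈ ys -> y ∈ xs × _)-> length ys ≤ 1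
   short [] _ _ = z≤n
   short(y ∷ [])_ _ = s≤s z≤n
   short(y ∷ z ∷ ys)((p ∷ _)∷ _)q = let a , b = q(here refl); c , d = q(there(here refl))in contradiction(h a c b d)p

  Ʃ-injection :(ts : List A)-> Unique ts ->(F : A -> ℕ)-> ∀ Y ->(∀{t}-> t ∈ ts -> F t < Y)->(∀{s t}-> s ∈ ts -> t ∈ ts -> F s ≡ F t -> s ≡ t)->
         (g : ℕ -> ℕ)-> Ʃ ts(g ∘ F)≤ Ʃ(rng Y)g
  Ʃ-injection ts u F Y F< inj g = begin
   _ ≤⟨ Ʃ-mono-≤ ts one ⟩
   _ ≡⟨ Ʃ-swap ts(rng Y)(\t y -> [ F t N.≟ y ] * g y)⟩
   _ ≤⟨ Ʃ-mono-≤(rng Y)(\{y}_ -> ≤-trans(≡⇒≤(Ʃ-*ʳ ts(g y)(\t -> [ F t N.≟ y ])))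
                                 (≤-trans(*-monoˡ-≤(g y)(at-most-one-∈(\t -> F t N.≟ y)ts u(\a b e f -> inj a b(trans e(sym f)))))(≡⇒≤(N.*-identityˡ(g y)))))⟩
   _ ∎
   where
   one : ∀{t}-> t ∈ ts -> g(F t)≤ Ʃ(rng Y)(\y -> [ F t N.≟ y ] * g y)
   one{t}t∈ = ≤-trans(≡⇒≤(sym(trans(cong(_* g(F t))([yes](F t N.≟ F t)refl))(N.*-identityˡ _))))(∈⇒≤Ʃ(\y -> [ F t N.≟ y ] * g y)(∈-rng⁺(F< t∈)))

 ∣-difference : ∀ p a b c -> a ≤ b -> p ∣ a + c -> p ∣ b + c -> p ∣ b ∸ a
 ∣-difference p a b c a≤b d₁ d₂ = ∣m+n∣m⇒∣n(subst(p ∣_)(trans(cong(_+ c)(sym(m+[n∸m]≡n a≤b)))(alg a(b ∸ a)c))d₂)d₁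
  where
  alg : ∀ a d c -> a + d + c ≡ a + c + d
  alg = solve-∀

 multiples-unique : ∀ p c{y z}-> y < p -> z < p -> p ∣ y + c -> p ∣ z + c -> y ≡ z
 multiples-unique p c{y}{z}y< z< d e = go(≤-total y z)
  where
  close : ∀{a b}-> a ≤ b -> b < p -> p ∣ a + c -> p ∣ b + c -> a ≡ b
  close{a}{b}a≤b b< d e = go(b ∸ a)refl
   where
   go : ∀ k -> b ∸ a ≡ k -> a ≡ b
   go zero q = ≤-antisym a≤b(m∸n≡0⇒m≤n q)
   go(suc k)q = contradiction(∣⇒≤(subst(p ∣_)q(∣-difference p a b c a≤b d e)))(<⇒≱(≤-<-trans(≡⇒≤(sym q))(≤-<-trans(m∸n≤m b a)b<)))
  go : y ≤ z ⊎ z ≤ y -> y ≡ z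
  go(inj₁ le)= close le z< d e
  go(inj₂ le)= sym(close le y< e d)

 multiple-count : ∀ p .{{_ : NonZero p}}c Y -> p * Ʃ(rng Y)(\y -> [ p ∣? y + c ])≤ Y + p
 multiple-count p c Y = begin
  _ ≤⟨ *-monoʳ-≤ p(≤-trans(m≤n+m(Ʃ(rng Y)g)_)(≡⇒≤(trans(N.+-comm _(Ʃ(rng Y)g))(trans(sym(Ʃ-rng-+ Y k g))(cong(\t -> Ʃ(rng t)g)k+Y)))))⟩
  _ ≤⟨ *-monoʳ-≤ p(blocks(suc(Y / p))c)⟩
  _ ≡⟨ alg p(Y / p)⟩
  _ ≤⟨ +-monoˡ-≤ p(m/n*n≤m Y p)⟩
  Y + p ∎
  where
  g : ℕ -> ℕ
  g y = [ p ∣? y + c ]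
  k = suc(Y / p)* p ∸ Y
  Y≤ : Y ≤ suc(Y / p)* p
  Y≤ = ≤-trans(≡⇒≤(m≡m%n+[m/n]*n Y p))(+-monoˡ-≤((Y / p)* p)(<⇒≤(m%n<n Y p)))
  k+Y : k + Y ≡ suc(Y / p)* p
  k+Y = m∸n+n≡m Y≤
  alg : ∀ p b -> p * suc b ≡ b * p + p
  alg = solve-∀
  blocks : ∀ b c -> Ʃ(rng(b * p))(\y -> [ p ∣? y + c ])≤ b
  blocks zero c = z≤n
  blocks(suc b)c = ≤-trans(≡⇒≤(trans(Ʃ-rng-+(b * p)p(\y -> [ p ∣? y + c ]))(N.+-comm(Ʃ(rng(b * p))(\y -> [ p ∣? y + c ]))_)))
   (+-mono-≤(≤-trans(≡⇒≤(Ʃ-cong(rng p)(\y -> cong(\t -> [ p ∣? t ])(N.+-assoc y(b * p)c))))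
    (at-most-one-∈(\y -> p ∣? y +(b * p + c))(rng p)(rng-unique p)(\y∈ z∈ -> multiples-unique p(b * p + c)(∈-rng⁻ y∈)(∈-rng⁻ z∈))))(blocks b c))

 solve-congruence : ∀ p v w .{{_ : NonZero p}}-> Coprime v p -> ∃ \m -> m < p × p ∣ v * m + w
 solve-congruence p v w cop = m₀ % p , m%n<n m₀ p , reduced
  where
  raw : ∃ \m -> p ∣ v * m + w
  raw with coprime-Bézout cop
  ... | Bézout.+- a b e = a *(w *(p ∸ 1)), divides(w + b *(w *(p ∸ 1)))(main p refl)
   where
   main : ∀ q .{{_ : NonZero q}}-> q ≡ p -> v *(a *(w *(p ∸ 1)))+ w ≡(w + b *(w *(p ∸ 1)))* p
   main(suc q)refl = trans(cong(_+ w)(trans(alg₁ v a(w * q))(cong(_*(w * q))(sym e))))(alg₂ b(suc q)w q refl)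
    where
    alg₁ : ∀ v a x -> v *(a * x)≡ a * v * x
    alg₁ = solve-∀
    alg₂ : ∀ b p w q -> p ≡ suc q ->(1 + b * p)*(w * q)+ w ≡(w + b *(w * q))* p
    alg₂ b _ w q refl = lemma b w q
     where
     lemma : ∀ b w q ->(1 + b * suc q)*(w * q)+ w ≡(w + b *(w * q))* suc q
     lemma = solve-∀
  ... | Bézout.-+ a b e = a * w , divides(w * b)(trans(alg v a w)(trans(cong(w *_)e)(sym(N.*-assoc w b p))))
   where
   alg : ∀ v a w -> v *(a * w)+ w ≡ w *(1 + a * v)
   alg = solve-∀
  m₀ = proj₁ raw
  reduced : p ∣ v *(m₀ % p)+ w
  reduced = ∣m+n∣m⇒∣n(subst(p ∣_)(trans(cong(\t -> v * t + w)(m≡m%n+[m/n]*n m₀ p))(alg v(m₀ % p)((m₀ / p)* p)w))(proj₂ raw))(∣-trans'(n∣m*n(m₀ / p)) )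
   where
   alg : ∀ v a b w -> v *(a + b)+ w ≡ v * b +(v * a + w)
   alg = solve-∀
   ∣-trans' : p ∣(m₀ / p)* p -> p ∣ v *((m₀ / p)* p)
   ∣-trans'(divides k e)= divides(v * k)(trans(cong(v *_)e)(sym(N.*-assoc v k p)))

 -- Points of the affine lattice p ∣ v m + u j + c in the box [0, K) × [0, J).
 Z : ℕ -> ℕ -> ℕ -> ℕ -> ℕ -> ℕ -> ℕ
 Z p v u K J c = Ʃ(rng K)(\m -> Ʃ(rng J)(\j -> [ p ∣? v * m + u * j + c ]))

 module Box (p v u : ℕ) .{{_ : NonZero p}}(1≤v : 1 ≤ v) (cop : Coprime v u) (uv≤p : u * v ≤ p) where
  private
   instance
    v≢0 : NonZero v
    v≢0 = N.>-nonZero 1≤v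

   j-unique : ∀{m j m' j'}-> j < v -> j' < v -> v * m + u * j ≡ v * m' + u * j' ->(m , j)≡(m' , j')
   j-unique{m}{j}{m'}{j'}j< j'< e = go(≤-total j j')
    where
    one-sided : ∀{m j m' j'}-> j ≤ j' -> j' < v -> v * m + u * j ≡ v * m' + u * j' -> j ≡ j'
    one-sided{m}{j}{m'}{j'}le j'< e = diff(j' ∸ j)refl
     where
     shifted : v * m ≡ v * m' + u *(j' ∸ j)
     shifted = +-cancelʳ-≡(u * j)(v * m)(v * m' + u *(j' ∸ j))(trans e(trans(cong(\t -> v * m' + u * t)(sym(m∸n+n≡m le)))(alg v u m'(j' ∸ j)j)))
      where
      alg : ∀ v u m d j -> v * m + u *(d + j)≡ v * m + u * d + u * j
      alg = solve-∀
     diff : ∀ k -> j' ∸ j ≡ k -> j ≡ j'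
     diff zero q = ≤-antisym le(m∸n≡0⇒m≤n q)
     diff(suc k)q = contradiction(∣⇒≤(coprime-divisor cop(subst(\t -> v ∣ u * t)q(∣m+n∣m⇒∣n(subst(v ∣_)shifted(m∣m*n m))(m∣m*n m')))))
      (<⇒≱(≤-<-trans(≡⇒≤(sym q))(≤-<-trans(m∸n≤m j' j)j'<)))
    pair : j ≡ j' ->(m , j)≡(m' , j')
    pair refl = cong(_, j)(*-cancelˡ-≡ m m' v(+-cancelʳ-≡(u * j)(v * m)(v * m')e))
    go : j ≤ j' ⊎ j' ≤ j ->(m , j)≡(m' , j')
    go(inj₁ le)= pair(one-sided{m}{j}{m'}{j'}le j'< e)
    go(inj₂ le)= pair(sym(one-sided{m'}{j'}{m}{j}le j<(sym e)))

  block-upper : ∀ K c -> p * Z p v u K v c ≤ v * K + 2 * p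
  block-upper K c = begin
   _ ≡⟨ cong(p *_)(sym(Ʃ-×(rng K)(rng v)(\t -> [ p ∣? v * proj₁ t + u * proj₂ t + c ])))⟩
   _ ≤⟨ *-monoʳ-≤ p(Ʃ-injection ts(Unique.cartesianProduct⁺(rng-unique K)(rng-unique v))F Y F<(\{s}{t}s∈ t∈ -> j-unique{proj₁ s}{proj₂ s}{proj₁ t}{proj₂ t}(proj₂(∈-pairs{K}{v}s∈))(proj₂(∈-pairs{K}{v}t∈)))g)⟩
   _ ≤⟨ multiple-count p c Y ⟩
   _ ≤⟨ +-monoˡ-≤ p(+-monoʳ-≤(v * K)uv≤p)⟩
   _ ≡⟨ alg(v * K)p ⟩
   _ ∎
   where
   alg : ∀ a p -> a + p + p ≡ a + 2 * p
   alg = solve-∀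
   ts = cartesianProduct(rng K)(rng v)
   F : ℕ × ℕ -> ℕ
   F(m , j)= v * m + u * j
   g : ℕ -> ℕ
   g y = [ p ∣? y + c ]
   Y = v * K + u * v
   F< : ∀{t}-> t ∈ ts -> F t < Y
   F<{m , j}t∈ = let m< , j< = ∈-pairs{K}{v}t∈ in N.+-mono-<-≤(N.*-monoʳ-< v m<)(*-monoʳ-≤ u(<⇒≤ j<))

  module _ (copp : Coprime v p) where
   block-complete : ∀ c -> v ≤ Z p v u p v c
   block-complete c = begin
    v ≡⟨ sym(trans(Ʃ-const(rng v)1)(trans(N.*-identityʳ _)(length-rng v)))⟩
    _ ≤⟨ Ʃ-mono-≤(rng v)(\{j}_ -> hit j)⟩
    _ ≡⟨ Ʃ-swap(rng v)(rng p)(\j m -> [ p ∣? v * m + u * j + c ])⟩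
    _ ∎
    where
    hit : ∀ j -> 1 ≤ Ʃ(rng p)(\m -> [ p ∣? v * m + u * j + c ])
    hit j = let m , m< , d = solve-congruence p v(u * j + c)copp in
     ≤-trans(≡⇒≤(sym([yes](p ∣? v * m + u * j + c)(subst(p ∣_)(sym(N.+-assoc(v * m)(u * j)c))d))))(∈⇒≤Ʃ(\m -> [ p ∣? v * m + u * j + c ])(∈-rng⁺ m<))

   block-lower : ∀ K c -> K ≤ p -> v * K ≤ p * Z p v u K v c + 2 * p
   block-lower K c K≤p = N.+-cancelˡ-≤(v *(p ∸ K))(v * K)(p * Z p v u K v c + 2 * p)(begin
    _ ≡⟨ trans(sym(N.*-distribˡ-+ v(p ∸ K)K))(trans(cong(v *_)(m∸n+n≡m K≤p))(N.*-comm v p))⟩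
    p * v ≤⟨ *-monoʳ-≤ p(block-complete c)⟩
    _ ≡⟨ cong(p *_)split ⟩
    _ ≡⟨ N.*-distribˡ-+ p(Z p v u K v c)_ ⟩
    _ ≤⟨ +-monoʳ-≤(p * Z p v u K v c)(block-upper(p ∸ K)(v * K + c))⟩
    _ ≡⟨ alg(p * Z p v u K v c)(v *(p ∸ K))(2 * p)⟩
    _ ∎)
    where
    alg : ∀ a b c -> a +(b + c)≡ b +(a + c)
    alg = solve-∀
    shift : ∀ v m K j c -> v *(m + K)+ j + c ≡ v * m + j +(v * K + c)
    shift = solve-∀
    split : Z p v u p v c ≡ Z p v u K v c + Z p v u(p ∸ K)v(v * K + c)
    split = trans(cong(\t -> Z p v u t v c)(sym(m∸n+n≡m K≤p)))(trans(Ʃ-rng-+ K(p ∸ K)(\m -> Ʃ(rng v)(\j -> [ p ∣? v * m + u * j + c ])))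
     (cong(Z p v u K v c +_)(Ʃ-cong(rng(p ∸ K))(\m -> Ʃ-cong(rng v)(\j -> cong(\t -> [ p ∣? t ])(shift v m K(u * j)c))))))

   append : ∀ K J₁ J₂ c -> Z p v u K(J₂ + J₁)c ≡ Z p v u K J₁ c + Z p v u K J₂(u * J₁ + c)
   append K J₁ J₂ c = trans(Ʃ-cong(rng K)(\m -> trans(Ʃ-rng-+ J₁ J₂(\j -> [ p ∣? v * m + u * j + c ]))(cong(_ +_)(Ʃ-cong(rng J₂)(\j -> cong(\t -> [ p ∣? t ])(shift(v * m)u j J₁ c))))))
    (Ʃ-+(rng K)(\m -> Ʃ(rng J₁)(\j -> [ p ∣? v * m + u * j + c ]))(\m -> Ʃ(rng J₂)(\j -> [ p ∣? v * m + u * j +(u * J₁ + c)])))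
    where
    shift : ∀ a u j J c -> a + u *(j + J)+ c ≡ a + u * j +(u * J + c)
    shift = solve-∀

   blocks-upper : ∀ K w c -> p * Z p v u K(w * v)c ≤ w *(v * K + 2 * p)
   blocks-upper K zero c = ≡⇒≤(trans(cong(p *_)(Ʃ-zero(rng K)))(N.*-zeroʳ p))
   blocks-upper K(suc w)c = ≤-trans(≡⇒≤(trans(cong(p *_)(append K(w * v)v c))(trans(N.*-distribˡ-+ p(Z p v u K(w * v)c)_)(N.+-comm(p * Z p v u K(w * v)c)_))))
    (+-mono-≤(block-upper K(u *(w * v)+ c))(blocks-upper K w c))

   blocks-lower : ∀ K w c -> K ≤ p -> w *(v * K)≤ p * Z p v u K(w * v)c + w *(2 * p)
   blocks-lower K zero c K≤p = z≤n
   blocks-lower K(suc w)c K≤p = ≤-trans(+-mono-≤(block-lower K(u *(w * v)+ c)K≤p)(blocks-lower K w c K≤p))(≡⇒≤(trans(alg p(Z p v u K v(u *(w * v)+ c))(Z p v u K(w * v)c)w)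
     (cong(\t -> p * t + suc w *(2 * p))(sym(append K(w * v)v c)))))
    where
    alg : ∀ p a b w -> p * a + 2 * p +(p * b + w *(2 * p))≡ p *(b + a)+ suc w *(2 * p)
    alg = solve-∀

   mono-J : ∀ K J J' c -> J ≤ J' -> Z p v u K J c ≤ Z p v u K J' c
   mono-J K J J' c J≤ = ≤-trans(m≤m+n(Z p v u K J c)_)(≡⇒≤(trans(sym(append K J(J' ∸ J)c))(cong(\t -> Z p v u K t c)(m∸n+n≡m J≤))))

   discrepancy : ∀ N c -> N ≤ p -> v ≤ N -> v * v ≤ p -> v * ∣ p * Z p v u N N c - N * N ∣ ≤ 5 *(p * N)
   discrepancy N c N≤p v≤N vv≤p = ≤-trans(≡⇒≤(N.*-distribˡ-∣-∣ v(p * X)(N * N)))(close(v *(p * X))(v *(N * N))(5 *(p * N))upper lower)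
    where
    w = N / v
    X = Z p v u N N c
    wv≤N : w * v ≤ N
    wv≤N = m/n*n≤m N v
    N≤ : N ≤ suc w * v
    N≤ = ≤-trans(≡⇒≤(m≡m%n+[m/n]*n N v))(+-monoˡ-≤(w * v)(<⇒≤(m%n<n N v)))
    close : ∀ a b e -> a ≤ b + e -> b ≤ a + e -> ∣ a - b ∣ ≤ e
    close a b e h₁ h₂ = go(≤-total a b)
     where
     go : a ≤ b ⊎ b ≤ a -> ∣ a - b ∣ ≤ e
     go(inj₁ le)= ≤-trans(≡⇒≤(N.m≤n⇒∣m-n∣≡n∸m le))(m≤n+o⇒m∸n≤o b a h₂)
     go(inj₂ le)= ≤-trans(≡⇒≤(N.m≤n⇒∣n-m∣≡n∸m le))(m≤n+o⇒m∸n≤o a b h₁)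
    vvN : v *(v * N)≤ p * N
    vvN = ≤-trans(≡⇒≤(sym(N.*-assoc v v N)))(*-monoˡ-≤ N vv≤p)
    upper : v *(p * X)≤ v *(N * N)+ 5 *(p * N)
    upper = begin
     _ ≤⟨ *-monoʳ-≤ v(*-monoʳ-≤ p(mono-J N N(suc w * v)c N≤))⟩
     _ ≤⟨ *-monoʳ-≤ v(blocks-upper N(suc w)c)⟩
     _ ≡⟨ alg₁ v w N p ⟩
     _ ≤⟨ +-mono-≤(+-mono-≤(+-mono-≤(*-monoʳ-≤ v(*-monoˡ-≤ N wv≤N))vvN)(*-monoʳ-≤ 2(*-monoʳ-≤ p wv≤N)))(*-monoʳ-≤ 2(*-monoʳ-≤ p v≤N))⟩
     _ ≡⟨ alg₂(v *(N * N))(p * N)⟩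
     _ ∎
     where
     alg₁ : ∀ v w N p -> v *(suc w *(v * N + 2 * p))≡ v *((w * v)* N)+ v *(v * N)+ 2 *(p *(w * v))+ 2 *(p * v)
     alg₁ = solve-∀
     alg₂ : ∀ a b -> a + b + 2 * b + 2 * b ≡ a + 5 * b
     alg₂ = solve-∀
    lower : v *(N * N)≤ v *(p * X)+ 5 *(p * N)
    lower = begin
     _ ≤⟨ *-monoʳ-≤ v(*-monoˡ-≤ N N≤)⟩
     _ ≡⟨ alg₁ v w N ⟩
     _ ≤⟨ +-mono-≤(*-monoʳ-≤ v(≤-trans(blocks-lower N w c N≤p)(+-monoˡ-≤(w *(2 * p))(*-monoʳ-≤ p(mono-J N(w * v)N c wv≤N)))))vvN ⟩
     _ ≡⟨ alg₂ v(p * X)w p(p * N)⟩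
     _ ≤⟨ +-monoˡ-≤(p * N)(+-monoʳ-≤(v *(p * X))(*-monoʳ-≤ 2(*-monoʳ-≤ p wv≤N)))⟩
     _ ≤⟨ m≤m+n _(2 *(p * N))⟩
     _ ≡⟨ alg₃(v *(p * X))(p * N)⟩
     _ ∎
     where
     alg₁ : ∀ v w N -> v *(suc w * v * N)≡ v *(w *(v * N))+ v *(v * N)
     alg₁ = solve-∀
     alg₂ : ∀ v x w p b -> v *(x + w *(2 * p))+ b ≡ v * x + 2 *(p *(w * v))+ b
     alg₂ = solve-∀
     alg₃ : ∀ a b -> a + 2 * b + b + 2 * b ≡ a + 5 * b
     alg₃ = solve-∀

 Z-swap : ∀ p v u K J c -> Z p v u K J c ≡ Z p u v J K c
 Z-swap p v u K J c = trans(Ʃ-swap(rng K)(rng J)(\m j -> [ p ∣? v * m + u * j + c ]))(Ʃ-cong(rng J)(\j -> Ʃ-cong(rng K)(\m -> cong(\t -> [ p ∣? t + c ])(N.+-comm(v * m)(u * j)))))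

 harmonic : ∀ M κ -> Ʃ(rng(2 N.^ κ))(\i -> M / suc i)≤ suc κ * M
 harmonic M zero = +-monoˡ-≤ 0(m/n≤m M 1)
 harmonic M(suc κ)= begin
  _ ≡⟨ trans(cong(\t -> Ʃ(rng(B + t))f)(N.+-identityʳ B))(Ʃ-rng-+ B B f)⟩
  _ ≤⟨ +-mono-≤(harmonic M κ)(Ʃ-≤-const(rng B)(M / B)(\{i}_ -> /-monoʳ-≤ M(N.m≤n⇒m≤1+n(m≤n+m B i))))⟩
  _ ≤⟨ +-monoʳ-≤(suc κ * M)(≤-trans(≡⇒≤(trans(cong(_*(M / B))(length-rng B))(N.*-comm B(M / B))))(m/n*n≤m M B))⟩
  _ ≡⟨ N.+-comm(suc κ * M)M ⟩
  _ ∎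
  where
  B = 2 N.^ κ
  instance
   B≢0 : NonZero B
   B≢0 = m^n≢0 2 κ
  f : ℕ -> ℕ
  f i = M / suc i

module Energy where
 open import Data.Nat using (_+_; _*_; _∸_; _/_; _%_; ∣_-_∣)
 open import Data.Nat.DivMod using (m*n/n≡m; m<n*o⇒m/o<n; m<n⇒m%n≡m)
 open import Data.Nat.Divisibility using (m%n≡0⇒n∣m; n∣m⇒m%n≡0)
 open import Data.Nat.Primality using (prime⇒irreducible)
 open import Data.Nat.Coprimality using (Coprime; coprime-/gcd) renaming (sym to coprime-sym)
 open import Data.Nat.GCD using (gcd; gcd[m,n]∣m; gcd[m,n]∣n; gcd[m,n]≢0)
 open import Data.Fin as Fin using (Fin; toℕ)
 open import Data.Integer using () renaming (+_ to int)
 import Data.List.Relation.Unary.Any as Any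
 open import Data.List.Relation.Unary.Any.Properties using (lookup-index)
 open E hiding ([_])
 open Alg
 open Field
 open Burgess2
 open Count
 open Products
 open Lattice
 open Bound using (dyadic)
 open NatSums
 open N.≤-Reasoning

 ∣-∣-square : ∀ a b -> a * a + b * b ≡ ∣ a - b ∣ * ∣ a - b ∣ + 2 *(a * b)
 ∣-∣-square a b = go(≤-total a b)
  where
  alg : ∀ a d -> a * a +(a + d)*(a + d)≡ d * d + 2 *(a *(a + d))
  alg = solve-∀
  up : ∀ a b -> a ≤ b -> a * a + b * b ≡(b ∸ a)*(b ∸ a)+ 2 *(a * b)
  up a b le = subst(\t -> a * a + t * t ≡(b ∸ a)*(b ∸ a)+ 2 *(a * t))(m+[n∸m]≡n le)(alg a(b ∸ a))
  go : a ≤ b ⊎ b ≤ a -> a * a + b * b ≡ ∣ a - b ∣ * ∣ a - b ∣ + 2 *(a * b)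
  go(inj₁ le)= trans(up a b le)(cong(\t -> t * t + 2 *(a * b))(sym(N.m≤n⇒∣m-n∣≡n∸m le)))
  go(inj₂ le)= trans(N.+-comm(a * a)(b * b))(trans(up b a le)(cong₂(\t c -> t * t + 2 * c)(sym(N.m≤n⇒∣n-m∣≡n∸m le))(N.*-comm b a)))

 Ʃ-reverse : ∀ n(f : ℕ -> ℕ)-> Ʃ(rng n)(\j -> f(n ∸ suc j))≡ Ʃ(rng n)f
 Ʃ-reverse zero f = refl
 Ʃ-reverse(suc n)f = trans(cong(\t -> f t + Ʃ(rng n)(\j -> f(n ∸ j)))(N.n∸n≡0 n))
  (trans(cong(f 0 +_)(trans(Ʃ-cong-∈(rng n)(\{j}j∈ -> cong f(step(∈-rng⁻ j∈))))(Ʃ-reverse n(f ∘ suc))))(sym(bottom n f)))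
  where
  step : ∀{n j}-> j < n -> n ∸ j ≡ suc(n ∸ suc j)
  step{suc n}{j}(s≤s j≤n)= N.+-∸-assoc 1 j≤n
  bottom : ∀ n f -> Ʃ(rng(suc n))f ≡ f 0 + Ʃ(rng n)(f ∘ suc)
  bottom zero f = refl
  bottom(suc n)f = trans(cong(f(suc n)+_)(bottom n f))(alg(f(suc n))(f 0)(Ʃ(rng n)(f ∘ suc)))
   where
   alg : ∀ a b c -> a +(b + c)≡ b +(a + c)
   alg = solve-∀

 isqrt : ∀ n -> ∃ \s -> s * s ≤ n × n < suc s * suc s
 isqrt zero = 0 , z≤n , s≤s z≤n
 isqrt(suc n)= step(isqrt n)
  where
  step :(∃ \s -> s * s ≤ n × n < suc s * suc s)-> ∃ \s -> s * s ≤ suc n × suc n < suc s * suc s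
  step(s , lo , hi)= go(suc n N.<? suc s * suc s)
   where
   go : Dec(suc n < suc s * suc s)-> ∃ \s -> s * s ≤ suc n × suc n < suc s * suc s
   go(yes h)= s , ≤-trans lo(n≤1+n n), h
   go(no ¬h)= suc s , ≮⇒≥ ¬h , ≤-<-trans hi(*-mono-<(n<1+n(suc s))(n<1+n(suc s)))

 module FourthEnergy{p : ℕ}(PF : PrimeField p) (pr : Prime p) where
  open PrimeField PF using (module F; ⟨⟩-inj; ⟨p⟩≡0; size≡p)
  open F using () renaming (Carrier to K)
  open F using (δ; nz) renaming (_*_ to _·_; _+_ to _⊹_; -_ to –_; 0# to 0ᶠ; 1# to 1ᶠ; _-_ to _−_)
  private
   ι : ℕ -> K
   ι = F.K.⟨_⟩

   instance
    p≢0 : NonZero p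
    p≢0 = prime⇒nonZero pr

   ι-% : ∀ k -> ι k ≡ ι(k % p)
   ι-% k = trans(cong ι(m≡m%n+[m/n]*n k p))(trans(F.K.⟨⟩-+(k % p)((k / p)* p))(trans(cong(ι(k % p)⊹_)(trans(F.K.⟨⟩-*(k / p)p)(trans(cong(ι(k / p)·_)⟨p⟩≡0)(F.zeroʳ _))))(F.+-identityʳ _)))

   ∣⇒ι≡0 : ∀{k}-> p ∣ k -> ι k ≡ 0ᶠ
   ∣⇒ι≡0{k}d = trans(ι-% k)(cong ι(n∣m⇒m%n≡0 k p d))

   ι≡0⇒∣ : ∀{k}-> ι k ≡ 0ᶠ -> p ∣ k
   ι≡0⇒∣{k}e = m%n≡0⇒n∣m k p(⟨⟩-inj(m%n<n k p)(N.>-nonZero⁻¹ p)(trans(sym(ι-% k))e))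

   ι≢0 : ∀{k}-> 1 ≤ k -> k < p -> ι k ≢ 0ᶠ
   ι≢0 1≤k k<p e = <⇒≱ k<p(∣⇒≤{{N.>-nonZero 1≤k}}(ι≡0⇒∣ e))

   ι-pred : ι(p ∸ 1)≡ – 1ᶠ
   ι-pred = trans(F.solve 2(\a b -> a F.:=(b F.:+ a)F.:- b)refl(ι(p ∸ 1))1ᶠ)(trans(cong(_− 1ᶠ)(trans(cong ι(m+[n∸m]≡n(N.>-nonZero⁻¹ p)))⟨p⟩≡0))(F.+-identityˡ(– 1ᶠ)))

  ι-≡-% : ∀{m n}-> ι m ≡ ι n -> m % p ≡ n % p
  ι-≡-%{m}{n}e = ⟨⟩-inj(m%n<n m p)(m%n<n n p)(trans(sym(ι-% m))(trans e(ι-% n)))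

  %-≡-ι : ∀{m n}-> m % p ≡ n % p -> ι m ≡ ι n
  %-≡-ι{m}{n}e = trans(ι-% m)(trans(cong ι e)(sym(ι-% n)))

  Representation : ℕ -> K -> ℕ -> ℕ -> Set
  Representation s x u v =(1 ≤ u × u ≤ s)×(1 ≤ v × v ≤ s)× Coprime v u ×(ι v · x ≡ ι u ⊎ ι v · x ≡ – ι u)

  thue : ∀ s -> s * s ≤ p -> p < suc s * suc s -> s < p -> ∀{x}-> x ≢ 0ᶠ -> ∃ \u -> ∃ \v -> Representation s x u v
  thue s lo hi s<p{x}x≢0 = from-collision(let i , j , i<j , e = Fin.pigeonhole(≤-<-trans(≡⇒≤ size≡p)hi)(position ∘ f)in i , j , i<j , position-injective e)
   where
   n = suc s
   position : K -> Fin F.size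
   position x = Any.index(F.complete x)
   position-injective : ∀{x y}-> position x ≡ position y -> x ≡ y
   position-injective{x}{y}e = trans(lookup-index(F.complete x))(trans(cong(lookup F.elems)e)(sym(lookup-index(F.complete y))))
   f : Fin(n * n)-> K
   f k = ι(toℕ k % n)⊹ ι(toℕ k / n)· x
   reduce : ∀ d e -> 1 ≤ d -> d ≤ s -> 1 ≤ e -> e ≤ s ->(ι d · x ≡ ι e ⊎ ι d · x ≡ – ι e)-> ∃ \u -> ∃ \v -> Representation s x u v
   reduce d e 1≤d d≤s 1≤e e≤s h = e / g , d / g ,(pos(gcd[m,n]∣n d e)1≤e , below e≤s),(pos(gcd[m,n]∣m d e)1≤d , below d≤s), coprime-/gcd d e ,
     [ inj₁ ∘(\q -> F.*-cancelˡ g≢0'(trans(left q)(ι-split(gcd[m,n]∣n d e)))),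
      inj₂ ∘(\q -> F.*-cancelˡ g≢0'(trans(left q)(trans(cong –_(ι-split(gcd[m,n]∣n d e)))(F.solve 2(\a b -> F.:-(a F.:* b)F.:= a F.:*(F.:- b))refl(ι g)(ι(e / g))))))]′ h
    where
    g = gcd d e
    instance
     g≢0 : NonZero g
     g≢0 = N.≢-nonZero(gcd[m,n]≢0 d e(inj₁(N.m<n⇒n≢0 1≤d)))
    1≤g : 1 ≤ g
    1≤g = N.>-nonZero⁻¹ g
    g<p : g < p
    g<p = ≤-<-trans(≤-trans(∣⇒≤{{N.>-nonZero 1≤d}}(gcd[m,n]∣m d e))d≤s)s<p
    g≢0' : ι g ≢ 0ᶠ
    g≢0' = ι≢0 1≤g g<p
    back : ∀{m}-> g ∣ m -> g *(m / g)≡ m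
    back = m*[n/m]≡n
     where open import Data.Nat.DivMod using (m*[n/m]≡n)
    pos : ∀{m}-> g ∣ m -> 1 ≤ m -> 1 ≤ m / g
    pos{m}g∣m 1≤m = n≢0⇒n>0(\e -> N.m<n⇒n≢0 1≤m(trans(sym(back g∣m))(trans(cong(g *_)e)(N.*-zeroʳ g))))
    below : ∀{m}-> m ≤ s -> m / g ≤ s
    below{m}m≤s = ≤-trans(≤-trans(≤-trans(≡⇒≤(sym(N.*-identityʳ _)))(*-monoʳ-≤(m / g)1≤g))(m/n*n≤m m g))m≤s
    ι-split : ∀{m}-> g ∣ m -> ι m ≡ ι g · ι(m / g)
    ι-split{m}g∣m = trans(cong ι(sym(back g∣m)))(F.K.⟨⟩-* g(m / g))
    left : ∀{y}-> ι d · x ≡ y -> ι g ·(ι(d / g)· x)≡ y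
    left q = trans(sym(F.*-assoc(ι g)(ι(d / g))x))(trans(cong(_· x)(sym(ι-split(gcd[m,n]∣m d e))))q)
   core : ∀ a b a' b' -> a ≤ s -> a' ≤ s -> b' ≤ s -> b ≤ b' -> ¬(a ≡ a' × b ≡ b')-> ι a ⊹ ι b · x ≡ ι a' ⊹ ι b' · x -> ∃ \u -> ∃ \v -> Representation s x u v
   core a b a' b' a≤ a'≤ b'≤ b≤b' ne eq = go(≤-total a a')
    where
    d = b' ∸ b
    ι-diff : ∀{m n}-> m ≤ n -> ι n ≡ ι(n ∸ m)⊹ ι m
    ι-diff{m}{n}le = trans(cong ι(sym(m∸n+n≡m le)))(F.K.⟨⟩-+(n ∸ m)m)
    dx : ι d · x ≡ ι a − ι a'
    dx = trans(F.solve 4(\d x b a' -> d F.:* x F.:=(a' F.:+(d F.:+ b)F.:* x)F.:- b F.:* x F.:- a')refl(ι d)x(ι b)(ι a'))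
     (trans(cong(\t -> t − ι b · x − ι a')(trans(cong(\t -> ι a' ⊹ t · x)(sym(ι-diff b≤b')))(sym eq)))(F.solve 3(\a y c ->(a F.:+ y)F.:- y F.:- c F.:= a F.:- c)refl(ι a)(ι b · x)(ι a')))
    d≤s : d ≤ s
    d≤s = ≤-trans(m∸n≤m b' b)b'≤
    a≡ : d ≡ 0 -> a ≡ a'
    a≡ e = ⟨⟩-inj{a}{a'}(≤-<-trans a≤ s<p)(≤-<-trans a'≤ s<p)(F.x-y≡0⇒x≡y(trans(sym dx)(trans(cong(\t -> ι t · x)e)(F.zeroˡ x))))
    1≤d : 1 ≤ d
    1≤d = n≢0⇒n>0(\e -> ne(a≡ e , ≤-antisym b≤b'(m∸n≡0⇒m≤n e)))
    dx≢0 : ι d · x ≢ 0ᶠ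
    dx≢0 = F.*-nonzero(ι≢0 1≤d(≤-<-trans d≤s s<p))x≢0
    1≤diff : ∀{m n}-> m ≤ n -> ι n − ι m ≢ 0ᶠ -> 1 ≤ n ∸ m
    1≤diff{m}{n}le h = n≢0⇒n>0(\e -> h(trans(cong(\t -> ι t − ι m)(≤-antisym(m∸n≡0⇒m≤n e)le))(F.-‿inverseʳ(ι m))))
    go : a ≤ a' ⊎ a' ≤ a -> ∃ \u -> ∃ \v -> Representation s x u v
    go(inj₁ le)= reduce d(a' ∸ a)1≤d d≤s(1≤diff le(\z -> dx≢0(trans dx(trans(F.solve 2(\a b -> a F.:- b F.:= F.:-(b F.:- a))refl(ι a)(ι a'))(trans(cong –_ z)(F.solve 0(F.:- F.con 0 F.:= F.con 0)refl))))))
     (≤-trans(m∸n≤m a' a)a'≤)(inj₂(trans dx(trans(cong(\t -> ι a − t)(ι-diff le))(F.solve 2(\a e -> a F.:-(e F.:+ a)F.:= F.:- e)refl(ι a)(ι(a' ∸ a))))))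
    go(inj₂ le)= reduce d(a ∸ a')1≤d d≤s(1≤diff le(\z -> dx≢0(trans dx z)))(≤-trans(m∸n≤m a a')a≤)
     (inj₁(trans dx(trans(cong(_− ι a')(ι-diff le))(F.solve 2(\e b ->(e F.:+ b)F.:- b F.:= e)refl(ι(a ∸ a'))(ι a')))))
   from-collision :(∃ \i -> ∃ \j -> i Fin.< j × f i ≡ f j)-> ∃ \u -> ∃ \v -> Representation s x u v
   from-collision(i , j , i<j , e)= go(≤-total(toℕ i / n)(toℕ j / n))
    where
    rem≤ : ∀ k -> k % n ≤ s
    rem≤ k = ≤-pred(m%n<n k n)
    quo≤ : ∀(k : Fin(n * n))-> toℕ k / n ≤ s
    quo≤ k = ≤-pred(m<n*o⇒m/o<n{toℕ k}{n}{n}(Fin.toℕ<n k))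
    distinct : ∀{a b}-> a < b -> ¬(a % n ≡ b % n × a / n ≡ b / n)
    distinct{a}{b}a<b(h , h')= <⇒≢ a<b(trans(m≡m%n+[m/n]*n a n)(trans(cong₂(\r q -> r + q * n)h h')(sym(m≡m%n+[m/n]*n b n))))
    go : toℕ i / n ≤ toℕ j / n ⊎ toℕ j / n ≤ toℕ i / n -> ∃ \u -> ∃ \v -> Representation s x u v
    go(inj₁ le)= core(toℕ i % n)(toℕ i / n)(toℕ j % n)(toℕ j / n)(rem≤(toℕ i))(rem≤(toℕ j))(quo≤ j)le(distinct i<j)e
    go(inj₂ le)= core(toℕ j % n)(toℕ j / n)(toℕ i % n)(toℕ i / n)(rem≤(toℕ j))(rem≤(toℕ i))(quo≤ i)le(\(h , h')-> distinct i<j(sym h , sym h'))(sym e)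

  module _ (N : ℕ) where
   r : K -> ℕ
   r x = Ʃ(rng N)(\m -> Ʃ(rng N)(\n -> δ(ι(suc m))(x · ι(suc n))))

   private
    δ-∣ : ∀{a b k c}-> c ≢ 0ᶠ -> ι k ≡ c ·(a − b)-> δ a b ≡ [ p ∣? k ]
    δ-∣{a}{b}{k}{c}c≢0 e = go(a F.≟ b)
     where
     go : Dec(a ≡ b)-> δ a b ≡ [ p ∣? k ]
     go(yes refl)= trans(F.δ-≡{a}refl)(sym([yes](p ∣? k)(ι≡0⇒∣(trans e(trans(cong(c ·_)(F.-‿inverseʳ a))(F.zeroʳ c))))))
     go(no a≢b)= trans(F.δ-≢ a≢b)(sym([no](p ∣? k)(\d -> F.*-nonzero c≢0(F.x≢y⇒x-y≢0 a≢b)(trans(sym e)(∣⇒ι≡0 d)))))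

    ι-linear : ∀ v m u j -> ι(v * m + u * j)≡ ι v · ι m ⊹ ι u · ι j
    ι-linear v m u j = trans(F.K.⟨⟩-+(v * m)(u * j))(cong₂ _⊹_(F.K.⟨⟩-* v m)(F.K.⟨⟩-* u j))

    minus-Z : ∀ x u v -> ι v ≢ 0ᶠ -> ι v · x ≡ – ι u -> r x ≡ Z p v u N N(v + u)
    minus-Z x u v v≢0 h = Ʃ-cong(rng N)(\m -> Ʃ-cong(rng N)(\j -> δ-∣ v≢0(point m j)))
     where
     point : ∀ m j -> ι(v * m + u * j +(v + u))≡ ι v ·(ι(suc m)− x · ι(suc j))
     point m j = trans(trans(F.K.⟨⟩-+(v * m + u * j)(v + u))(cong₂ _⊹_(ι-linear v m u j)(F.K.⟨⟩-+ v u)))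
      (trans(trans(cong₂(\s t ->(ι v · ι m ⊹ ι u · ι j)⊹(s ⊹ t))(sym(F.*-identityʳ(ι v)))(sym(F.*-identityʳ(ι u))))
       (F.solve 5(\v u m j o ->(v F.:* m F.:+ u F.:* j)F.:+(v F.:* o F.:+ u F.:* o)F.:= v F.:*(o F.:+ m)F.:-(F.:- u)F.:*(o F.:+ j))refl(ι v)(ι u)(ι m)(ι j)1ᶠ))
       (trans(cong(\t -> ι v · ι(suc m)− t · ι(suc j))(sym h))(F.solve 4(\v a x b -> v F.:* a F.:-(v F.:* x)F.:* b F.:= v F.:*(a F.:- x F.:* b))refl(ι v)(ι(suc m))x(ι(suc j)))))

    plus-Z : ∀ x u v -> ι v ≢ 0ᶠ -> ι v · x ≡ ι u -> r x ≡ Z p v u N N(v +(p ∸ 1)*(u * N))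
    plus-Z x u v v≢0 h = trans(Ʃ-cong(rng N)(\m -> sym(Ʃ-reverse N(\n -> δ(ι(suc m))(x · ι(suc n))))))(Ʃ-cong(rng N)(\m -> Ʃ-cong-∈(rng N)(\{j}j∈ -> δ-∣ v≢0(point m j(∈-rng⁻ j∈)))))
     where
     c = v +(p ∸ 1)*(u * N)
     ι-c : ι c ≡ ι v · 1ᶠ ⊹(– 1ᶠ)·(ι u · ι N)
     ι-c = trans(F.K.⟨⟩-+ v((p ∸ 1)*(u * N)))(cong₂ _⊹_(sym(F.*-identityʳ(ι v)))(trans(F.K.⟨⟩-*(p ∸ 1)(u * N))(cong₂ _·_ ι-pred(F.K.⟨⟩-* u N))))
     point : ∀ m j -> j < N -> ι(v * m + u * j + c)≡ ι v ·(ι(suc m)− x · ι(suc(N ∸ suc j)))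
     point m j j<N = trans(trans(F.K.⟨⟩-+(v * m + u * j)c)(cong₂ _⊹_(ι-linear v m u j)ι-c))
      (trans(trans(cong(\t ->(ι v · ι m ⊹ ι u · ι j)⊹(ι v · 1ᶠ ⊹(– 1ᶠ)·(ι u · t)))N≡)
       (trans(F.solve 6(\v u m j o k ->(v F.:* m F.:+ u F.:* j)F.:+(v F.:* o F.:+(F.:- o)F.:*(u F.:*(k F.:+ j)))F.:= v F.:*(o F.:+ m)F.:+ u F.:* j F.:- o F.:*(u F.:*(k F.:+ j)))refl(ι v)(ι u)(ι m)(ι j)1ᶠ(ι k))
        (trans(cong(\t -> ι v · ι(suc m)⊹ ι u · ι j − t)(F.*-identityˡ(ι u ·(ι k ⊹ ι j))))(F.solve 4(\a u j k -> a F.:+ u F.:* j F.:- u F.:*(k F.:+ j)F.:= a F.:- u F.:* k)refl(ι v · ι(suc m))(ι u)(ι j)(ι k)))))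
       (trans(cong(\t -> ι v · ι(suc m)− t · ι k)(sym h))(F.solve 4(\v a x b -> v F.:* a F.:-(v F.:* x)F.:* b F.:= v F.:*(a F.:- x F.:* b))refl(ι v)(ι(suc m))x(ι k))))
      where
      k = suc(N ∸ suc j)
      N≡ : ι N ≡ ι k ⊹ ι j
      N≡ = trans(cong ι(sym(trans(sym(+-suc(N ∸ suc j)j))(m∸n+n≡m j<N))))(F.K.⟨⟩-+ k j)

    coprime-p : ∀{v}-> 1 ≤ v -> v < p -> Coprime v p
    coprime-p{v}1≤v v<p{d}(d∣v , d∣p)with prime⇒irreducible pr d∣p
    ... | inj₁ d≡1 = d≡1
    ... | inj₂ refl = contradiction(∣⇒≤{{N.>-nonZero 1≤v}}d∣v)(<⇒≱ v<p)

   deviation : K -> ℕ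
   deviation x = ∣ p * r x - N * N ∣

   module _ (1≤N : 1 ≤ N) (N<p : N < p) (s : ℕ) (lo : s * s ≤ p) (hi : p < suc s * suc s) (s<p : s < p) (s≤N : s ≤ N) where
    private
     M = 5 *(p * N)

    deviation-bound : ∀{x u v}-> Representation s x u v -> deviation x * v ≤ M × deviation x * u ≤ M
    deviation-bound{x}{u}{v}((1≤u , u≤s),(1≤v , v≤s), cop , h)= go h
     where
     v<p = ≤-<-trans v≤s s<p
     u<p = ≤-<-trans u≤s s<p
     square : ∀{a b}-> a ≤ s -> b ≤ s -> a * b ≤ p
     square a≤ b≤ = ≤-trans(*-mono-≤ a≤ b≤)lo
     use : ∀ c -> r x ≡ Z p v u N N c -> deviation x * v ≤ M × deviation x * u ≤ M
     use c e = ≤-trans(≡⇒≤(trans(N.*-comm(deviation x)v)(cong(\t -> v * ∣ p * t - N * N ∣)e)))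
           (Box.discrepancy p v u 1≤v cop(square u≤s v≤s)(coprime-p 1≤v v<p)N c(<⇒≤ N<p)(≤-trans v≤s s≤N)(square v≤s v≤s)),
          ≤-trans(≡⇒≤(trans(N.*-comm(deviation x)u)(cong(\t -> u * ∣ p * t - N * N ∣)(trans e(Z-swap p v u N N c)))))
           (Box.discrepancy p u v 1≤u(coprime-sym cop)(square v≤s u≤s)(coprime-p 1≤u u<p)N c(<⇒≤ N<p)(≤-trans u≤s s≤N)(square u≤s u≤s))
     go : ι v · x ≡ ι u ⊎ ι v · x ≡ – ι u -> deviation x * v ≤ M × deviation x * u ≤ M
     go(inj₁ q)= use _(plus-Z x u v(ι≢0 1≤v v<p)q)
     go(inj₂ q)= use _(minus-Z x u v(ι≢0 1≤v v<p)q)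

    private
     weight : ℕ -> ℕ -> ℕ
     weight i j =(M / suc i)*(M / suc j)

     hits : K -> ℕ -> ℕ -> ℕ
     hits x i j = δ(ι(suc i)· x)(ι(suc j))+ δ(ι(suc i)· x)(– ι(suc j))

     divide : ∀{d v}-> d * suc v ≤ M -> d ≤ M / suc v
     divide{d}{v}le = ≤-trans(≡⇒≤(sym(m*n/n≡m d(suc v))))(/-monoˡ-≤(suc v)le)

     pointwise : ∀{x}-> x ≢ 0ᶠ -> deviation x * deviation x ≤ Ʃ(rng s)(\i -> Ʃ(rng s)(\j -> hits x i j * weight i j))
     pointwise{x}x≢0 = go(thue s lo hi s<p x≢0)
      where
      go :(∃ \u -> ∃ \v -> Representation s x u v)-> deviation x * deviation x ≤ Ʃ(rng s)(\i -> Ʃ(rng s)(\j -> hits x i j * weight i j))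
      go(suc j , suc i , R@((_ , j<s),(_ , i<s), _ , h))= begin
       _ ≤⟨ *-mono-≤{deviation x}{M / suc i}{deviation x}{M / suc j}(divide{deviation x}{i}(proj₁(deviation-bound R)))(divide{deviation x}{j}(proj₂(deviation-bound R)))⟩
       _ ≤⟨ ≤-trans(≡⇒≤(sym(N.*-identityˡ(weight i j))))(*-monoˡ-≤(weight i j)(hit h))⟩
       _ ≤⟨ ∈⇒≤Ʃ(\j -> hits x i j * weight i j)(∈-rng⁺ j<s)⟩
       _ ≤⟨ ∈⇒≤Ʃ(\i -> Ʃ(rng s)(\j -> hits x i j * weight i j))(∈-rng⁺ i<s)⟩
       _ ∎
       where
       hit : ι(suc i)· x ≡ ι(suc j)⊎ ι(suc i)· x ≡ – ι(suc j)-> 1 ≤ hits x i j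
       hit(inj₁ q)= ≤-trans(≡⇒≤(sym(F.δ-≡ q)))(m≤m+n(δ(ι(suc i)· x)(ι(suc j)))(δ(ι(suc i)· x)(– ι(suc j))))
       hit(inj₂ q)= ≤-trans(≡⇒≤(sym(F.δ-≡ q)))(m≤n+m(δ(ι(suc i)· x)(– ι(suc j)))(δ(ι(suc i)· x)(ι(suc j))))

     solutions : ∀{i}-> i < s -> ∀ w -> Ʃ nz(\x -> δ(ι(suc i)· x)w)≤ 1
     solutions{i}i<s w = at-most-one(\x ->(ι(suc i)· x)F.≟ w)nz F.nz-unique(\e f -> F.*-cancelˡ(ι≢0(s≤s z≤n)(≤-<-trans i<s s<p))(trans e(sym f)))

    variance : ∀ H -> Ʃ(rng s)(\i -> M / suc i)≤ H -> Ʃ nz(\x -> deviation x * deviation x)≤ 2 *(H * H)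
    variance H harm = begin
     _ ≤⟨ Ʃ-mono-≤ nz(\x∈ -> pointwise(F.∈-nz⁻ x∈))⟩
     _ ≡⟨ trans(Ʃ-swap nz(rng s)(\x i -> Ʃ(rng s)(\j -> hits x i j * weight i j)))(Ʃ-cong(rng s)(\i -> Ʃ-swap nz(rng s)(\x j -> hits x i j * weight i j)))⟩
     _ ≤⟨ Ʃ-mono-≤(rng s){\i -> Ʃ(rng s)(\j -> Ʃ nz(\x -> hits x i j * weight i j))}(\{i}i∈ -> Ʃ-mono-≤(rng s)(\{j}_ -> ≤-trans(≡⇒≤(trans(Ʃ-*ʳ nz(weight i j)(\x -> hits x i j))(cong(_* weight i j)(Ʃ-+ nz _ _))))
        (*-monoˡ-≤(weight i j)(+-mono-≤(solutions(∈-rng⁻ i∈)(ι(suc j)))(solutions(∈-rng⁻ i∈)(– ι(suc j)))))))⟩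
     _ ≡⟨ trans(Ʃ-cong(rng s)(\i -> Ʃ-*ˡ(rng s)2(weight i)))(trans(Ʃ-*ˡ(rng s)2 _)(cong(2 *_)(sym(Ʃ-*Ʃ(rng s)(rng s)_ _))))⟩
     _ ≤⟨ *-monoʳ-≤ 2(*-mono-≤ harm harm)⟩
     _ ∎

   pairs : List(ℕ × ℕ)
   pairs = cartesianProduct(rng N)(rng N)

   energy : ℕ
   energy = Ʃ pairs(\t -> Ʃ pairs(\t' -> δ(ι(pair-product t))(ι(pair-product t'))))

   module _ (N<p : N < p) where
    private
     unit : ∀{i}-> i < N -> ι(suc i)≢ 0ᶠ
     unit i<N = ι≢0(s≤s z≤n)(≤-<-trans i<N N<p)

    Ʃr≤ : Ʃ nz r ≤ N * N
    Ʃr≤ = begin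
     Ʃ nz r
      ≡⟨ trans(Ʃ-swap nz(rng N)(\x m -> Ʃ(rng N)(\n -> δ(ι(suc m))(x · ι(suc n)))))(Ʃ-cong(rng N)(\m -> Ʃ-swap nz(rng N)(\x n -> δ(ι(suc m))(x · ι(suc n)))))⟩
     _ ≤⟨ Ʃ-≤-const(rng N)(length(rng N)* 1)(\{m}_ -> Ʃ-≤-const(rng N)1(\{n}n∈ -> at-most-one(\x -> ι(suc m)F.≟(x · ι(suc n)))nz F.nz-unique
         (\{x}{y}e f -> F.*-cancelˡ(unit(∈-rng⁻ n∈))(trans(F.*-comm(ι(suc n))x)(trans(sym e)(trans f(F.*-comm y(ι(suc n)))))))))⟩
     _ ≡⟨ cong₂ _*_(length-rng N)(trans(N.*-identityʳ _)(length-rng N))⟩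
     N * N ∎

    energy≤ : energy ≤ Ʃ nz(\x -> r x * r x)
    energy≤ = begin
     energy
      ≡⟨ trans(Ʃ-×(rng N)(rng N)_)(Ʃ-cong(rng N)(\i -> Ʃ-cong(rng N)(\j -> Ʃ-×(rng N)(rng N)_)))⟩
     _ ≤⟨ Ʃ-mono-≤(rng N){\i -> Ʃ(rng N)(\j -> Ʃ(rng N)(\k -> Ʃ(rng N)(\l -> δ(ι(suc i * suc j))(ι(suc k * suc l)))))}(\{i}i∈ -> Ʃ-mono-≤(rng N){\j -> Ʃ(rng N)(\k -> Ʃ(rng N)(\l -> δ(ι(suc i * suc j))(ι(suc k * suc l))))}(\{j}_ ->
         Ʃ-mono-≤(rng N){\k -> Ʃ(rng N)(\l -> δ(ι(suc i * suc j))(ι(suc k * suc l)))}(\{k}k∈ -> Ʃ-mono-≤(rng N)(\{l}_ -> ratio(∈-rng⁻ i∈)(∈-rng⁻ k∈)j l))))⟩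
     _ ≡⟨ sym collect ⟩
     _ ∎
     where
     A : K -> ℕ -> ℕ -> ℕ
     A x m n = δ(ι(suc m))(x · ι(suc n))
     ratio : ∀{i k}-> i < N -> k < N -> ∀ j l -> δ(ι(suc i * suc j))(ι(suc k * suc l))≤ Ʃ nz(\x -> A x i k * A x l j)
     ratio{i}{k}i<N k<N j l = go(ι(suc i * suc j)F.≟ ι(suc k * suc l))
      where
      x = ι(suc i)· F._⁻¹(ι(suc k))
      x≢0 : x ≢ 0ᶠ
      x≢0 = F.*-nonzero(unit i<N)(F.⁻¹-nonzero(unit k<N))
      xk : ι(suc i)≡ x · ι(suc k)
      xk = sym(trans(F.*-assoc(ι(suc i))_ _)(trans(cong(ι(suc i)·_)(F.inverseˡ(unit k<N)))(F.*-identityʳ _)))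
      go : Dec(ι(suc i * suc j)≡ ι(suc k * suc l))-> δ(ι(suc i * suc j))(ι(suc k * suc l))≤ Ʃ nz(\x -> A x i k * A x l j)
      go(no ne)= ≤-trans(≡⇒≤(F.δ-≢ ne))z≤n
      go(yes e)= ≤-trans(≡⇒≤(trans(F.δ-≡ e)(sym(cong₂ _*_(F.δ-≡ xk)(F.δ-≡ xl)))))(∈⇒≤Ʃ(\x -> A x i k * A x l j)(F.∈-nz⁺ x≢0))
       where
       xl : ι(suc l)≡ x · ι(suc j)
       xl = F.*-cancelˡ(unit k<N)(trans(sym(F.K.⟨⟩-*(suc k)(suc l)))(trans(sym e)(trans(F.K.⟨⟩-*(suc i)(suc j))(trans(cong(_· ι(suc j))xk)
        (F.solve 3(\x k j ->(x F.:* k)F.:* j F.:= k F.:*(x F.:* j))refl x(ι(suc k))(ι(suc j)))))))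
     collect : Ʃ nz(\x -> r x * r x)≡ Ʃ(rng N)(\i -> Ʃ(rng N)(\j -> Ʃ(rng N)(\k -> Ʃ(rng N)(\l -> Ʃ nz(\x -> A x i k * A x l j)))))
     collect = begin-equality
      _ ≡⟨ Ʃ-cong nz(\x -> trans(cong(r x *_)(Ʃ-swap(rng N)(rng N)(A x)))(trans(Ʃ-*Ʃ(rng N)(rng N)_ _)(Ʃ-cong(rng N)(\i -> Ʃ-cong(rng N)(\j -> Ʃ-*Ʃ(rng N)(rng N)(A x i)(\l -> A x l j))))))⟩
      _ ≡⟨ trans(Ʃ-swap nz(rng N)_)(Ʃ-cong(rng N)(\i -> trans(Ʃ-swap nz(rng N)_)(Ʃ-cong(rng N)(\j -> trans(Ʃ-swap nz(rng N)_)(Ʃ-cong(rng N)(\k -> Ʃ-swap nz(rng N)_))))))⟩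
      _ ∎

    p≡1+ℓ : p ≡ suc(length nz)
    p≡1+ℓ = trans(sym size≡p)F.size-nz

    expand : p * p * Ʃ nz(\x -> r x * r x)+ length nz *(N * N *(N * N))≤ Ʃ nz(\x -> deviation x * deviation x)+ 2 *(p *(N * N *(N * N)))
    expand = begin
     _ ≡⟨ cong₂ _+_(sym(Ʃ-*ˡ nz(p * p)_))(sym(Ʃ-const nz(N * N *(N * N))))⟩
     _ ≡⟨ trans(sym(Ʃ-+ nz _ _))(Ʃ-cong nz(\x -> trans(alg₁ p(r x)(N * N))(trans(∣-∣-square(p * r x)(N * N))(cong(deviation x * deviation x +_)(alg₂ p(r x)(N * N))))))⟩
     _ ≡⟨ trans(Ʃ-+ nz _ _)(cong(Ʃ nz(\x -> deviation x * deviation x)+_)(Ʃ-*ˡ nz(2 * p *(N * N))r))⟩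
     _ ≤⟨ +-monoʳ-≤(Ʃ nz(\x -> deviation x * deviation x))(≤-trans(*-monoʳ-≤(2 * p *(N * N))Ʃr≤)(≡⇒≤(alg₃ p(N * N))))⟩
     _ ∎
     where
     alg₁ : ∀ p r n -> p * p *(r * r)+ n * n ≡ p * r *(p * r)+ n * n
     alg₁ = solve-∀
     alg₂ : ∀ p r n -> 2 *(p * r * n)≡ 2 * p * n * r
     alg₂ = solve-∀
     alg₃ : ∀ p n -> 2 * p * n * n ≡ 2 *(p *(n * n))
     alg₃ = solve-∀

    energy-residues : energy ≤ Ʃ pairs(\t -> Ʃ pairs(\t' -> [ pair-product t' % p N.≟ pair-product t % p ]))
    energy-residues = Ʃ-mono-≤ pairs{\t -> Ʃ pairs(\t' -> δ(ι(pair-product t))(ι(pair-product t')))}(\{t}_ -> Ʃ-mono-≤ pairs(\{t'}_ -> []-mono(ι(pair-product t)F.≟ ι(pair-product t'))(pair-product t' % p N.≟ pair-product t % p)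
     (\e -> sym(ι-≡-% e))))

    module _ (1≤N : 1 ≤ N) (2≤p : 2 ≤ p) (T : ℕ) (1000≤T : 1000 ≤ T) (logs : ∀ κ -> 2 N.^ κ ≤ p -> suc κ ≤ T) (divisors : ∀{z}-> 1 ≤ z -> z < p -> DivBound T z) where
     private
      ℓ = length nz
      Q = N * N *(N * N)

      ℓ≤p : ℓ ≤ p
      ℓ≤p = ≤-trans(n≤1+n ℓ)(≡⇒≤(sym p≡1+ℓ))

      small-case : N * N < p -> ℓ * energy ≤ Q + T * T * T *(p *(N * N))
      small-case h = begin
       _ ≤⟨ *-mono-≤ ℓ≤p(≤-trans energy-residues(pair-energy N T p(\ 1≤y y≤ -> divisors 1≤y(≤-<-trans y≤ h))))⟩
       _ ≡⟨ cong(\t -> p *(N * N *(suc t * T)))(m<n⇒m/n≡0 h)⟩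
       _ ≡⟨ alg p(N * N)T ⟩
       _ ≤⟨ *-monoˡ-≤(p *(N * N))(*-monoˡ-≤ T(*-mono-≤ 1≤T 1≤T))⟩
       _ ≤⟨ m≤n+m _ Q ⟩
       _ ∎
       where
       1≤T : 1 ≤ T
       1≤T = ≤-trans(s≤s z≤n)1000≤T
       alg : ∀ p n T -> p *(n *(1 * T))≡ 1 * 1 * T *(p * n)
       alg = solve-∀

      large-case : p ≤ N * N ->(∃ \s -> s * s ≤ p × p < suc s * suc s)-> ℓ * energy ≤ Q + T * T * T *(p *(N * N))
      large-case p≤(s , lo , hi)= *-cancelˡ-≤(p * p){{N.m*n≢0 p p}}(begin
       _ ≤⟨ *-monoʳ-≤(p * p)(*-monoʳ-≤ ℓ energy≤)⟩
       _ ≤⟨ +-cancelʳ-≤(ℓ * ℓ * Q)(p * p *(ℓ * R))(p *(2 *(H * H))+ p * p * Q)combined ⟩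
       _ ≡⟨ alg₁ p T N Q ⟩
       _ ≤⟨ *-monoʳ-≤(p * p)(+-monoʳ-≤ Q(≤-trans(*-monoˡ-≤(T * T *(p *(N * N)))(≤-trans(≤ᵇ⇒≤ 200 1000 _)1000≤T))(≡⇒≤(alg₂ T(p *(N * N))))))⟩
       _ ∎)
       where
       R = Ʃ nz(\x -> r x * r x)
       M = 5 *(p * N)
       H = 2 * T * M
       alg₁ : ∀ p T N Q -> p *(2 *(2 * T *(5 *(p * N))*(2 * T *(5 *(p * N)))))+ p * p * Q ≡ p * p *(Q + 200 *(T * T *(p *(N * N))))
       alg₁ = solve-∀
       alg₂ : ∀ T x -> T *(T * T * x)≡ T * T * T * x
       alg₂ = solve-∀
       1≤s : 1 ≤ s
       1≤s = ≮⇒≥ \{(s≤s z≤n)-> <⇒≱ hi(≤-trans(s≤s z≤n)2≤p)}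
       s<p : s < p
       s<p = ≰⇒>(\p≤s -> <⇒≱(N.m<m*n p p{{p≢0}}2≤p)(≤-trans(*-mono-≤ p≤s p≤s)lo))
       s≤N : s ≤ N
       s≤N = ≮⇒≥(\N<s -> <⇒≱(*-mono-< N<s N<s)(≤-trans lo p≤))
       harm : Ʃ(rng s)(\i -> M / suc i)≤ H
       harm = go(dyadic s 1≤s)
        where
        go :(∃ \κ -> 2 N.^ κ ≤ s × s < 2 * 2 N.^ κ)-> Ʃ(rng s)(\i -> M / suc i)≤ H
        go(κ , l , h)= ≤-trans(≤-trans(extend(<⇒≤ h))(harmonic M(suc κ)))(*-monoˡ-≤ M(≤-trans(+-mono-≤{1}{T}(≤-trans(s≤s z≤n)1000≤T)k≤)(≡⇒≤(sym(cong(T +_)(N.+-identityʳ T))))))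
         where
         k≤ : suc κ ≤ T
         k≤ = logs κ(≤-trans l(<⇒≤ s<p))
         extend : ∀{b}-> s ≤ b -> Ʃ(rng s)(\i -> M / suc i)≤ Ʃ(rng b)(\i -> M / suc i)
         extend{b}le = ≤-trans(m≤m+n(Ʃ(rng s)(\i -> M / suc i))_)(≡⇒≤(trans(sym(Ʃ-rng-+ s(b ∸ s)(\i -> M / suc i)))(cong(\t -> Ʃ(rng t)(\i -> M / suc i))(m∸n+n≡m le))))
       combined : p * p *(ℓ * R)+ ℓ * ℓ * Q ≤ p *(2 *(H * H))+ p * p * Q + ℓ * ℓ * Q
       combined = begin
        _ ≡⟨ alg₃(p * p)ℓ R Q ⟩
        _ ≤⟨ *-monoʳ-≤ ℓ(≤-trans expand(+-monoˡ-≤(2 *(p * Q))(variance 1≤N N<p s lo hi s<p s≤N H harm)))⟩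
        _ ≡⟨ cong(\t -> ℓ *(2 *(H * H)+ 2 *(t * Q)))p≡1+ℓ ⟩
        _ ≤⟨ m≤m+n _(2 *(H * H)+ Q)⟩
        _ ≡⟨ alg₄ ℓ(2 *(H * H))Q ⟩
        _ ≡⟨ cong(\t -> t *(2 *(H * H))+ t * t * Q + ℓ * ℓ * Q)(sym p≡1+ℓ)⟩
        _ ∎
        where
        alg₃ : ∀ p l r q -> p *(l * r)+ l * l * q ≡ l *(p * r + l * q)
        alg₃ = solve-∀
        alg₄ : ∀ l h q -> l *(h + 2 *(suc l * q))+(h + q)≡ suc l * h + suc l * suc l * q + l * l * q
        alg₄ = solve-∀

     fourth-energy : ℓ * energy ≤ Q + T * T * T *(p *(N * N))
     fourth-energy = go(N * N N.<? p)
      where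
      go : Dec(N * N < p)-> ℓ * energy ≤ Q + T * T * T *(p *(N * N))
      go(yes h)= small-case h
      go(no ¬h)= large-case(≮⇒≥ ¬h)(isqrt p)

module Residues where
 open import Data.Nat using (_+_; _*_; _∸_; _%_; _/_)
 open import Data.Nat.DivMod using (m%n%n≡m%n; [m+kn]%n≡m%n; m<n⇒m%n≡m; %-distribˡ-+; %-distribˡ-*; n%n≡0)
 open import Data.Nat.Divisibility using (m%n≡0⇒n∣m)
 open import Data.Nat.Primality using (prime⇒irreducible; prime⇒nonTrivial)
 open import Data.Nat.Coprimality using (Coprime; coprime-Bézout)
 open import Data.Nat.GCD using (module Bézout)
 open import Data.Fin using (Fin; toℕ; fromℕ<)
 open import Data.List using (allFin)
 open import Data.List.Membership.Propositional.Properties using (∈-allFin)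
 open E
 open Alg
 open Field
 open Quad
 open Tower
 open Burgess2

 module PrimeResidues (p₂ : ℕ) (pr : Prime (suc (suc p₂))) where
  p : ℕ
  p = suc(suc p₂)

  K : Set
  K = Fin p

  red : ℕ -> K
  red n = fromℕ<(m%n<n n p)

  toℕ-red : ∀ n -> toℕ(red n)≡ n % p
  toℕ-red n = Fin.toℕ-fromℕ<(m%n<n n p)

  red-cong : ∀ m n -> m % p ≡ n % p -> red m ≡ red n
  red-cong m n e = Fin.toℕ-injective(trans(toℕ-red m)(trans e(sym(toℕ-red n))))

  red-toℕ : ∀ x -> red(toℕ x)≡ x
  red-toℕ x = Fin.toℕ-injective(trans(toℕ-red(toℕ x))(m<n⇒m%n≡m(Fin.toℕ<n x)))

  infixl 6 _⊞_
  infixl 7 _⊠_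
  _⊞_ _⊠_ : K -> K -> K
  x ⊞ y = red(toℕ x + toℕ y)
  x ⊠ y = red(toℕ x * toℕ y)

  ⊟_ : K -> K
  ⊟ x = red(p ∸ toℕ x)

  red-+ : ∀ m n -> red m ⊞ red n ≡ red(m + n)
  red-+ m n = red-cong(toℕ(red m)+ toℕ(red n))(m + n)(trans(cong₂(\a b ->(a + b)% p)(toℕ-red m)(toℕ-red n))(sym(%-distribˡ-+ m n p)))

  red-* : ∀ m n -> red m ⊠ red n ≡ red(m * n)
  red-* m n = red-cong(toℕ(red m)* toℕ(red n))(m * n)(trans(cong₂(\a b ->(a * b)% p)(toℕ-red m)(toℕ-red n))(sym(%-distribˡ-* m n p)))

  private
   +-left : ∀ m x -> red m ⊞ x ≡ red(m + toℕ x)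
   +-left m x = trans(cong(red m ⊞_)(sym(red-toℕ x)))(red-+ m(toℕ x))

   *-left : ∀ m x -> red m ⊠ x ≡ red(m * toℕ x)
   *-left m x = trans(cong(red m ⊠_)(sym(red-toℕ x)))(red-* m(toℕ x))

   ⊞-comm : ∀ x y -> x ⊞ y ≡ y ⊞ x
   ⊞-comm x y = cong red(N.+-comm(toℕ x)(toℕ y))

   ⊠-comm : ∀ x y -> x ⊠ y ≡ y ⊠ x
   ⊠-comm x y = cong red(N.*-comm(toℕ x)(toℕ y))

   ⊞-assoc : ∀ x y z ->(x ⊞ y)⊞ z ≡ x ⊞(y ⊞ z)
   ⊞-assoc x y z = trans(+-left(toℕ x + toℕ y)z)(trans(cong red(trans(N.+-assoc(toℕ x)(toℕ y)(toℕ z))(N.+-comm(toℕ x)(toℕ y + toℕ z))))(trans(sym(+-left(toℕ y + toℕ z)x))(⊞-comm(y ⊞ z)x)))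

   ⊠-assoc : ∀ x y z ->(x ⊠ y)⊠ z ≡ x ⊠(y ⊠ z)
   ⊠-assoc x y z = trans(*-left(toℕ x * toℕ y)z)(trans(cong red(trans(N.*-assoc(toℕ x)(toℕ y)(toℕ z))(N.*-comm(toℕ x)(toℕ y * toℕ z))))(trans(sym(*-left(toℕ y * toℕ z)x))(⊠-comm(y ⊠ z)x)))

   ⊞-identityˡ : ∀ x -> red 0 ⊞ x ≡ x
   ⊞-identityˡ x = trans(+-left 0 x)(red-toℕ x)

   ⊠-identityˡ : ∀ x -> red 1 ⊠ x ≡ x
   ⊠-identityˡ x = trans(*-left 1 x)(trans(cong red(N.*-identityˡ(toℕ x)))(red-toℕ x))

   red-p : red p ≡ red 0
   red-p = red-cong p 0(n%n≡0 p)

   ⊟-inverseˡ : ∀ x -> ⊟ x ⊞ x ≡ red 0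
   ⊟-inverseˡ x = trans(+-left(p ∸ toℕ x)x)(trans(cong red(m∸n+n≡m(<⇒≤(Fin.toℕ<n x))))red-p)

   distribʳ : ∀ z x y ->(x ⊞ y)⊠ z ≡(x ⊠ z)⊞(y ⊠ z)
   distribʳ z x y = trans(*-left(toℕ x + toℕ y)z)(trans(cong red(N.*-distribʳ-+(toℕ z)(toℕ x)(toℕ y)))(sym(red-+(toℕ x * toℕ z)(toℕ y * toℕ z))))

   0≢1 : red 1 ≢ red 0
   0≢1 e = N.1+n≢0(trans(sym(toℕ-red 1))(trans(cong toℕ e)(toℕ-red 0)))

   nonzero : ∀{x}-> x ≢ red 0 -> toℕ x ≢ 0
   nonzero{x}x≢0 e = x≢0(trans(sym(red-toℕ x))(cong red e))

   coprime : ∀{x}-> x ≢ red 0 -> Coprime(toℕ x)p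
   coprime{x}x≢0{d}(d∣x , d∣p)with prime⇒irreducible pr d∣p
   ... | inj₁ d≡1 = d≡1
   ... | inj₂ refl = contradiction(∣⇒≤{{N.≢-nonZero(nonzero x≢0)}}d∣x)(<⇒≱(Fin.toℕ<n x))

   solveInverse : ∀ x -> x ≢ red 0 -> ∃ \y -> x ⊠ y ≡ red 1
   solveInverse x x≢0 with coprime-Bézout(coprime x≢0)
   ... | Bézout.+- a b e = red a , trans(⊠-comm x(red a))(trans(*-left a x)(red-cong(a * toℕ x)1(trans(cong(_% p)(sym e))([m+kn]%n≡m%n 1 b p))))
   ... | Bézout.-+ a b e = ⊟(red a), trans(⊠-comm x(⊟(red a)))(trans(sym cancel)(trans(cong(_⊞ red 1)zero')(⊞-identityˡ(red 1))))
    where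
    one-plus : red 1 ⊞(red a ⊠ x)≡ red 0
    one-plus = trans(cong(red 1 ⊞_)(*-left a x))(trans(red-+ 1(a * toℕ x))(red-cong(1 + a * toℕ x)0(trans(cong(_% p)e)([m+kn]%n≡m%n 0 b p))))
    -- both sides differ from the inverse of a x by the relation 1 + a x = 0
    zero' : red 0 ⊠ x ≡ red 0
    zero' = *-left 0 x
    cancel :(red 0 ⊠ x)⊞ red 1 ≡ ⊟(red a)⊠ x
    cancel = begin
     _ ≡⟨ cong(\t ->(t ⊠ x)⊞ red 1)(sym(⊟-inverseˡ(red a)))⟩
     _ ≡⟨ cong(_⊞ red 1)(distribʳ x(⊟ red a)(red a))⟩
     _ ≡⟨ ⊞-assoc(⊟ red a ⊠ x)(red a ⊠ x)(red 1)⟩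
     _ ≡⟨ cong((⊟ red a ⊠ x)⊞_)(trans(⊞-comm(red a ⊠ x)(red 1))one-plus)⟩
     _ ≡⟨ trans(⊞-comm(⊟ red a ⊠ x)(red 0))(⊞-identityˡ(⊟ red a ⊠ x))⟩
     _ ∎
     where open ≡-Reasoning

   inverse : K -> K
   inverse x with x Fin.≟ red 0
   ... | yes _ = red 0
   ... | no q = let y , _ = solveInverse x q in y

   inverse-spec : ∀{x}-> x ≢ red 0 -> x ⊠ inverse x ≡ red 1
   inverse-spec{x}q with x Fin.≟ red 0
   ... | yes e = contradiction e q
   ... | no q' = let _ , e = solveInverse x q' in e

   inverse-0 : inverse(red 0)≡ red 0
   inverse-0 with red 0 Fin.≟ red 0
   ... | yes _ = refl
   ... | no q = contradiction refl q

  Φ : FiniteField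
  Φ = record
   {Carrier = K ; _+_ = _⊞_ ; _*_ = _⊠_ ; -_ = ⊟_ ; 0# = red 0 ; 1# = red 1
   ; isCommutativeRing = record
    {isRing = record
     {+-isAbelianGroup = record
      {isGroup = record
       {isMonoid = record
        {isSemigroup = record
         {isMagma = record{isEquivalence = isEquivalence ; ∙-cong = cong₂ _⊞_}
         ; assoc = ⊞-assoc}
        ; identity = ⊞-identityˡ ,(\x -> trans(⊞-comm x(red 0))(⊞-identityˡ x))}
       ; inverse = ⊟-inverseˡ ,(\x -> trans(⊞-comm x(⊟ x))(⊟-inverseˡ x))
       ; ⁻¹-cong = cong ⊟_}
      ; comm = ⊞-comm}
     ; *-cong = cong₂ _⊠_
     ; *-assoc = ⊠-assoc
     ; *-identity = ⊠-identityˡ ,(\x -> trans(⊠-comm x(red 1))(⊠-identityˡ x))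
     ; distrib =(\z x y -> trans(⊠-comm z(x ⊞ y))(trans(distribʳ z x y)(cong₂ _⊞_(⊠-comm x z)(⊠-comm y z)))), distribʳ}
    ; *-comm = ⊠-comm}
   ; _⁻¹ = inverse ; inverseʳ = inverse-spec ; 0⁻¹ = inverse-0 ; 1≢0 = 0≢1
   ; _≟_ = Fin._≟_ ; elems = allFin p ; complete = ∈-allFin ; unique = Unique.allFin⁺ p}

  module F = FieldKit Φ

  ⟨⟩≡red : ∀ n -> F.K.⟨ n ⟩ ≡ red n
  ⟨⟩≡red zero = refl
  ⟨⟩≡red(suc n)= trans(cong(red 1 ⊞_)(⟨⟩≡red n))(red-+ 1 n)

  ⟨⟩-≡% : ∀ m n -> F.K.⟨ m ⟩ ≡ F.K.⟨ n ⟩ -> m % p ≡ n % p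
  ⟨⟩-≡% m n e = trans(sym(toℕ-red m))(trans(cong toℕ(trans(sym(⟨⟩≡red m))(trans e(⟨⟩≡red n))))(toℕ-red n))

  ⟨⟩-injective : ∀{i j}-> i < p -> j < p -> F.K.⟨ i ⟩ ≡ F.K.⟨ j ⟩ -> i ≡ j
  ⟨⟩-injective{i}{j}i< j< e = trans(sym(m<n⇒m%n≡m i<))(trans(⟨⟩-≡% i j e)(m<n⇒m%n≡m j<))

  primeField : PrimeField p
  primeField = record
   {Φ = Φ
   ; enumerated = unique-↭(Unique.allFin⁺ p)(distinct p ≤-refl)covered(\_ -> ∈-allFin _)
   ; ⟨⟩-inj = ⟨⟩-injective
   ; ⟨p⟩≡0 = trans(⟨⟩≡red p)red-p}
   where
   distinct : ∀ n -> n ≤ p -> Unique(map F.K.⟨_⟩(rng n))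
   distinct zero _ = []
   distinct(suc n)n<p = All.tabulate(\q e -> let i , i∈ , e' = ∈-map⁻ F.K.⟨_⟩ q in
    <-irrefl(⟨⟩-injective(<-trans(∈-rng⁻ i∈)n<p)n<p(trans(sym e')(sym e)))(∈-rng⁻ i∈))∷ distinct n(<⇒≤ n<p)
   covered : ∀{x}-> x ∈ allFin p -> x ∈ map F.K.⟨_⟩(rng p)
   covered{x}_ = subst(_∈ map F.K.⟨_⟩(rng p))(trans(⟨⟩≡red(toℕ x))(red-toℕ x))(∈-map⁺ F.K.⟨_⟩(∈-rng⁺(Fin.toℕ<n x)))

  module OddPrime (2<p : 2 < p) where
   odd : OddField.Odd Φ
   odd e = <-irrefl(trans refl(trans(trans(sym(toℕ-red 1))(trans(cong toℕ(trans e neg-one))(toℕ-red(suc p₂))))(m<n⇒m%n≡m{n = p}(n<1+n(suc p₂)))))(≤-pred 2<p)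
    where
    neg-one : ⊟ red 1 ≡ red(suc p₂)
    neg-one = cong(\t -> red(p ∸ t))(toℕ-red 1)

   half : ∃ \c -> suc p₂ ≡ 2 * c
   half = go(p % 2)refl(m%n<n p 2)
    where
    go : ∀ r -> p % 2 ≡ r -> r < 2 -> ∃ \c -> suc p₂ ≡ 2 * c
    go 0 e _ with prime⇒irreducible pr(m%n≡0⇒n∣m p 2 e)
    ... | inj₂ 2≡p = contradiction 2≡p(<⇒≢ 2<p)
    go 1 e _ = p / 2 , suc-injective(trans(m≡m%n+[m/n]*n p 2)(trans(cong(_+(p / 2)* 2)e)(cong suc(N.*-comm(p / 2)2))))
    go(suc(suc _))_(s≤s(s≤s ()))

   base : Extension Φ p₂
   base = record
    {F = Φ ; ι = \x -> x ; ι-* = \_ _ -> refl ; ι-0 = refl ; ι-inj = \e -> e ; Φ = \x -> x ; M = 1 ; h = 1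
    ; ι-Φ = \z -> sym(F.*-identityʳ z)
    ; size≡ = trans size(sym(N.*-identityʳ p)); size-M = trans size(sym(cong(\t -> suc t)(N.*-identityʳ(suc p₂))))
    ; odd = odd ; char = PrimeField.⟨p⟩≡0 primeField}
    where
    size : F.size ≡ p
    size = PrimeField.size≡p primeField

module Spectral where
 open import Data.Integer as ℤ using (ℤ; +_; 0ℤ) renaming (_+_ to _⊕_; _*_ to _⊗_; -_ to ⊖_; _≤_ to _≤ᶻ_)
 open Alg
 open Cone
 open Field
 open Char
 open Moment
 open Burgess2
 open Shift
 open Count
 open Products
 open Energy
 open Bound

 private module ΣN = NatSums

 module PairSums (S : StarRing) where
  open Positivity S
  Ʃ-pairs :{A B : Set}(xs : List A)(ys : List B)(f : A × B -> Carrier)-> Ʃ(cartesianProduct xs ys)f ≈ Ʃ xs(\x -> Ʃ ys(\y -> f(x , y)))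
  Ʃ-pairs [] ys f = refl
  Ʃ-pairs(x ∷ xs)ys f = trans(Ʃ-++(map(x ,_)ys)(cartesianProduct xs ys)f)(+-cong(Ʃ-map(x ,_)ys f)(Ʃ-pairs xs ys f))

 record Trace(S : StarRing)(Φ : FiniteField)(χ : FiniteField.Carrier Φ -> CommutativeRing.Carrier(StarRing.cring S)): Set₁ where
  open Positivity S
  module F = FieldKit Φ
  field
   τ : Carrier -> ℤ
   τ-cong : ∀{a b}-> a ≈ b -> τ a ≡ τ b
   τ-+ : ∀ a b -> τ(a + b)≡ τ a ⊕ τ b
   τ-⟨⟩ : ∀ n a -> τ(⟨ n ⟩ * a)≡(+ n)⊗ τ a
   τ-mono : ∀{a b}-> a ≲ b -> τ a ≤ᶻ τ b
   τ-N :{I : Set}(xs : List I)(f : I -> F.Carrier)->(∀{x}-> x ∈ xs -> f x ≢ F.0#)->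
        τ(N(Ʃ xs(\i -> χ(f i))))≡(+(length F.nz N.* ΣN.Ʃ xs(\i -> ΣN.Ʃ xs(\j -> F.δ(f i)(f j)))))⊕ ⊖(+(length xs N.* length xs))

 pow₂₄ : ℕ -> ℕ
 pow₂₄ u = let v = u N.* u N.* u in(v N.* v N.*(v N.* v))N.*(v N.* v N.*(v N.* v))

 module SpectralBounds (S : StarRing){p : ℕ}(PF : PrimeField p){χ : FiniteField.Carrier (PrimeField.Φ PF) -> CommutativeRing.Carrier (StarRing.cring S)}
  (isCharacter : Characters.Character S(PrimeField.Φ PF)χ)(trace : Trace S(PrimeField.Φ PF)χ)(pr : Prime p)(2≤p : 2 ≤ p)
  (T u : ℕ)(1000≤T : 1000 ≤ T)(1≤u : 1 ≤ u)
  (p≤ : p ≤ pow₂₄ u)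
  (≤Tp : pow₂₄ u ≤ T N.* p)
  (logs : ∀ κ -> 2 N.^ κ ≤ p -> suc κ ≤ T)
  (divisors : ∀{z}-> 1 ≤ z -> z ≤ p N.*(p N.* p)-> DivBound T z)where

  open PrimeField PF using (Φ; ⟨⟩-inj; size≡p)
  open Trace trace hiding (module F)
  open PrimeField PF using (module F)
  private
   ℓ : ℕ
   ℓ = length F.nz
  open Positivity S using (N; Pos; sq; pos-*; pos-⟨⟩; pos-sq; pos-self; self-*; self-+; self-neg; self-⟨⟩; _≲_; by; resp; ≲-trans; ≲-resp; ≲-respˡ; ≲-respʳ; *-mono; *-monoˡ; *-monoʳ; ⟨⟩-mono; cubic; ⟨_⟩; ⟨⟩-*; Ʃ; Ʃ-*Ʃ; Ʃ-cong; N-*; N-cong; solve; _:=_; _:+_; _:*_; _:-_; con; refl; sym; trans; *-cong; *-congˡ; *-congʳ; *-assoc; *-comm; _≈_; Carrier; ≲-refl; +-mono)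
  open Positivity S using () renaming (_*_ to _∙_; _+_ to _∔_)
  open ShiftTrick S Φ isCharacter using (S[_]; ι)
  open Characters.Character isCharacter using (ψ-*)
  open FourthMoment S Φ isCharacter using (V)
  open FourthEnergy PF pr using (pairs; energy; fourth-energy)
  open PairSums S

  private
   small-divisors : ∀{z}-> 1 ≤ z -> z < p -> DivBound T z
   small-divisors 1≤z z<p = divisors 1≤z(≤-trans(<⇒≤ z<p)(≤-trans(≡⇒≤(E.sym(N.*-identityʳ p)))(*-monoʳ-≤ p(*-mono-≤ 1≤p 1≤p))))
    where
    1≤p : 1 ≤ p
    1≤p = ≤-trans(s≤s z≤n)2≤p
   module CB = CharacterBounds S PF isCharacter T (u N.* u N.* u) 1000≤T (*-mono-≤ (*-mono-≤ 1≤u 1≤u) 1≤u) p≤ ≤Tp logs small-divisors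

   instance
    p≢0 : NonZero p
    p≢0 = prime⇒nonZero pr

   unit : ∀{i n}-> i < n -> n < p -> ι(suc i)≢ F.0#
   unit{i}i<n n<p e with ()← ⟨⟩-inj(≤-<-trans i<n n<p)(≤-<-trans z≤n n<p)e

  A : ℕ -> Carrier
  A n = N S[ n ]

  pos-A : ∀ n -> Pos(A n)
  pos-A n = sq S[ n ]

  private
   f₂ : ℕ × ℕ -> F.Carrier
   f₂ t = ι(pair-product t)

   f₃ : ℕ ×(ℕ × ℕ)-> F.Carrier
   f₃ t = ι(triple-product t)

   χ-ι-* : ∀ a b -> χ(ι(a N.* b))≈ χ(ι a)∙ χ(ι b)
   χ-ι-* a b = trans(Positivity.reflexive S(cong χ(F.K.⟨⟩-* a b)))(ψ-*(ι a)(ι b))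

   square≈ : ∀ n -> Ʃ(pairs n)(χ ∘ f₂)≈ S[ n ] ∙ S[ n ]
   square≈ n = trans(Ʃ-pairs(rng n)(rng n)_)(trans(Ʃ-cong(rng n)(\i -> Ʃ-cong(rng n)(\j -> χ-ι-*(suc i)(suc j))))(sym(Ʃ-*Ʃ(rng n)(rng n)_ _)))

   cube≈ : ∀ n -> Ʃ(triples n)(χ ∘ f₃)≈ S[ n ] ∙(S[ n ] ∙ S[ n ])
   cube≈ n = trans(Ʃ-pairs(rng n)(pairs n)_)(trans(Ʃ-cong(rng n)(\i -> Ʃ-cong(pairs n)(\t -> χ-ι-*(suc i)(pair-product t))))(trans(sym(Ʃ-*Ʃ(rng n)(pairs n)_ _))(*-congˡ(square≈ n))))

   minus-≤ : ∀{a b c}-> a ≤ b N.+ c ->(+ a)⊕ ⊖(+ b)≤ᶻ + c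
   minus-≤{a}{b}{c}h = ℤ.≤-trans(ℤ.+-monoˡ-≤(⊖(+ b))(ℤ.+≤+ h))(ℤ.≤-reflexive(E.trans(cong(_⊕ ⊖(+ b))(ℤ.pos-+ b c))(E.trans(cong(_⊕ ⊖(+ b))(ℤ.+-comm(+ b)(+ c)))(E.trans(ℤ.+-assoc(+ c)(+ b)(⊖(+ b)))(E.trans(cong((+ c)⊕_)(ℤ.+-inverseʳ(+ b)))(ℤ.+-identityʳ(+ c)))))))

   length-pairs : ∀ n -> length(pairs n)≡ n N.* n
   length-pairs n = E.trans(length-×(rng n)(rng n))(cong₂ N._*_(length-rng n)(length-rng n))

  fourth : ∀ n -> 1 ≤ n -> n < p -> τ(A n ∙ A n)≤ᶻ +(T N.* T N.* T N.*(p N.*(n N.* n)))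
  fourth n 1≤n n<p = ℤ.≤-trans(ℤ.≤-reflexive(E.trans(τ-cong(trans(sym(N-* S[ n ] S[ n ]))(sym(N-cong(square≈ n)))))(τ-N(pairs n)f₂(\{t}t∈ -> nonzero(proj₁ t)(proj₂ t)(∈-pairs{n}{n}t∈)))))
    (minus-≤(subst(\t -> ℓ N.* energy n ≤ t N.* t N.+ T N.* T N.* T N.*(p N.*(n N.* n)))(E.sym(length-pairs n))(fourth-energy n n<p 1≤n 2≤p T 1000≤T logs small-divisors)))
   where
   nonzero : ∀ i j -> i < n × j < n -> ι(suc i N.* suc j)≢ F.0#
   nonzero i j(i< , j<)e = F.*-nonzero(unit i< n<p)(unit j< n<p)(E.trans(E.sym(F.K.⟨⟩-*(suc i)(suc j)))e)

  sixth : ∀ n -> n < p -> τ(A n ∙(A n ∙ A n))≤ᶻ +(p N.*(n N.*(n N.* n)N.*(suc(n N.*(n N.* n)N./ p)N.*(T N.* T))))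
  sixth n n<p = ℤ.≤-trans(ℤ.≤-reflexive(E.trans(τ-cong(trans(sym(trans(N-* S[ n ](S[ n ] ∙ S[ n ]))(*-congˡ(N-* S[ n ] S[ n ]))))(sym(N-cong(cube≈ n)))))(τ-N(triples n)f₃(\{t}t∈ -> nonzero t(∈-cartesianProduct⁻(rng n)(pairs n)t∈)))))
    (minus-≤(≤-trans(*-mono-≤ ℓ≤p(≤-trans residues(triple-energy n T p(\ 1≤y y≤ -> divisors 1≤y(≤-trans y≤(*-mono-≤ n≤p(*-mono-≤ n≤p n≤p)))))))(m≤n+m _(length(triples n)N.* length(triples n)))))
   where
   n≤p = <⇒≤ n<p
   ℓ≤p : ℓ ≤ p
   ℓ≤p = ≤-trans(n≤1+n ℓ)(≡⇒≤(E.trans(E.sym F.size-nz)size≡p))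
   nonzero : ∀ t -> proj₁ t ∈ rng n × proj₂ t ∈ pairs n -> ι(triple-product t)≢ F.0#
   nonzero(i ,(j , k))(a , b)e = let j< , k< = ∈-pairs{n}{n}b in
    F.*-nonzero(unit(∈-rng⁻ a)n<p)(F.*-nonzero(unit j< n<p)(unit k< n<p))(E.trans(cong(\t -> ι(suc i)F.* t)(E.sym(F.K.⟨⟩-*(suc j)(suc k))))(E.trans(E.sym(F.K.⟨⟩-*(suc i)(suc j N.* suc k)))e))
   residues : ΣN.Ʃ(triples n)(\t -> ΣN.Ʃ(triples n)(\s -> F.δ(f₃ t)(f₃ s)))≤ ΣN.Ʃ(triples n)(\t -> ΣN.Ʃ(triples n)(\s -> [ triple-product s N.% p N.≟ triple-product t N.% p ]))
   residues = ΣN.Ʃ-mono-≤(triples n){\t -> ΣN.Ʃ(triples n)(\s -> F.δ(f₃ t)(f₃ s))}(\{t}_ -> ΣN.Ʃ-mono-≤(triples n)(\{s}_ -> []-mono(f₃ t F.≟ f₃ s)(triple-product s N.% p N.≟ triple-product t N.% p)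
    (\e -> E.sym(FourthEnergy.ι-≡-% PF pr e))))

  private
   pos-⊗ : ∀ a b ->(+ a)⊗(+ b)≡ +(a N.* b)
   pos-⊗ a b = E.sym(ℤ.pos-* a b)

   cancel-⊗ : ∀ k x y -> 1 ≤ k ->(+ k)⊗ x ≤ᶻ(+ k)⊗ y -> x ≤ᶻ y
   cancel-⊗(suc k)x y _ h = ℤ.*-cancelˡ-≤-pos x y(+ suc k)h

   scale-⊗ : ∀ k{x y}-> x ≤ᶻ y ->(+ k)⊗ x ≤ᶻ(+ k)⊗ y
   scale-⊗ k h = ℤ.*-monoˡ-≤-nonNeg(+ k)h

  mixed : ∀ m n -> 1 ≤ m -> m < p -> 1 ≤ n -> n < p -> τ(A m ∙ A n)≤ᶻ +(T N.* T N.* T N.*(p N.*(m N.* n)))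
  mixed m n 1≤m m<p 1≤n n<p = cancel-⊗(2 N.*(m N.* n))_ _(*-mono-≤{1}{2}(s≤s z≤n)(*-mono-≤ 1≤m 1≤n))(ℤ.≤-trans(ℤ.≤-reflexive(E.sym(τ-⟨⟩(2 N.*(m N.* n))(A m ∙ A n))))(ℤ.≤-trans(τ-mono am-gm)
    (ℤ.≤-trans(ℤ.≤-reflexive(E.trans(τ-+(⟨ n N.* n ⟩ ∙(A m ∙ A m))(⟨ m N.* m ⟩ ∙(A n ∙ A n)))(cong₂ _⊕_(τ-⟨⟩(n N.* n)(A m ∙ A m))(τ-⟨⟩(m N.* m)(A n ∙ A n)))))
     (ℤ.≤-trans(ℤ.+-mono-≤(scale-⊗(n N.* n)(fourth m 1≤m m<p))(scale-⊗(m N.* m)(fourth n 1≤n n<p)))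
      (ℤ.≤-reflexive(E.trans(cong₂ _⊕_(pos-⊗(n N.* n)_)(pos-⊗(m N.* m)_))(E.trans(E.sym(ℤ.pos-+(n N.* n N.*(T N.* T N.* T N.*(p N.*(m N.* m))))_))(E.trans(cong +_(alg m n T p))(E.sym(pos-⊗(2 N.*(m N.* n))_))))))))))
   where
   alg : ∀ m n T p -> n N.* n N.*(T N.* T N.* T N.*(p N.*(m N.* m)))N.+ m N.* m N.*(T N.* T N.* T N.*(p N.*(n N.* n)))≡ 2 N.*(m N.* n)N.*(T N.* T N.* T N.*(p N.*(m N.* n)))
   alg = solve-∀
   am-gm : ⟨ 2 N.*(m N.* n)⟩ ∙(A m ∙ A n)≲(⟨ n N.* n ⟩ ∙(A m ∙ A m))∔(⟨ m N.* m ⟩ ∙(A n ∙ A n))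
   am-gm = ≲-resp(*-congʳ(sym(trans(⟨⟩-* 2(m N.* n))(*-congˡ(⟨⟩-* m n)))))(Positivity.+-cong S(*-congʳ(sym(⟨⟩-* n n)))(*-congʳ(sym(⟨⟩-* m m))))
    (by(resp(solve 4(\m n a b ->(n :* a :- m :* b):*(n :* a :- m :* b):=(n :* n :*(a :* a):+ m :* m :*(b :* b)):-(con 2 :*(m :* n)):*(a :* b))refl ⟨ m ⟩ ⟨ n ⟩(A m)(A n))
     (pos-sq(self-+(self-*(self-⟨⟩ n)(pos-self(pos-A m)))(self-neg(self-*(self-⟨⟩ m)(pos-self(pos-A n))))))))

  module _ (weil : ∀{κ}-> κ ≢ F.0# -> N (V κ) ≲ ⟨ T N.* T N.* p ⟩) (m n k : ℕ)
       (1≤m : 1 ≤ m)(m<p : m < p)(1≤n : 1 ≤ n)(n<p : n < p)(1≤k : 1 ≤ k)(k<p : k < p)where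
   third : Carrier
   third = A m ∙ A n ∙ A k

   private
    1≤p : 1 ≤ p
    1≤p = ≤-trans(s≤s z≤n)2≤p

    MN = T N.* T N.* T N.*(p N.*(m N.* n))

    burgess : ∀ n -> 1 ≤ n -> n < p -> A n ≲ ⟨(T N.* T N.* T N.* T N.* T N.* T)N.* n N.*(u N.* u N.* u N.*(u N.* u N.* u N.*(u N.* u N.* u)))⟩
    burgess = CB.burgess-bound weil 1≤p

   pointwise : ∀ c -> A k ≲ ⟨ c ⟩ -> τ third ≤ᶻ +(c N.* MN)
   pointwise c h = ℤ.≤-trans(τ-mono(≲-respʳ(*-comm(A m ∙ A n)⟨ c ⟩)(*-monoˡ(pos-*(pos-A m)(pos-A n))h)))(ℤ.≤-trans(ℤ.≤-reflexive(τ-⟨⟩ c(A m ∙ A n)))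
    (ℤ.≤-trans(scale-⊗ c(mixed m n 1≤m m<p 1≤n n<p))(ℤ.≤-reflexive(pos-⊗ c MN))))

   by-pv : τ third ≤ᶻ +(T N.* T N.* T N.* p N.* MN)
   by-pv = pointwise(T N.* T N.* T N.* p)(CB.pv-bound k 1≤k k<p)

   by-trivial : τ third ≤ᶻ +(k N.* k N.* MN)
   by-trivial = pointwise(k N.* k)(CB.trivial-bound k)

   by-burgess : τ third ≤ᶻ +((T N.* T N.* T N.* T N.* T N.* T)N.* k N.*(u N.* u N.* u N.*(u N.* u N.* u N.*(u N.* u N.* u)))N.* MN)
   by-burgess = pointwise((T N.* T N.* T N.* T N.* T N.* T)N.* k N.*(u N.* u N.* u N.*(u N.* u N.* u N.*(u N.* u N.* u))))(burgess k 1≤k k<p)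

   by-cubic : ∀ a b ->(+(a N.* a N.* b))⊗ τ third ≤ᶻ +(a N.* a N.* a N.* MN N.+ b N.* b N.* b N.*
    (((T N.* T N.* T N.* T N.* T N.* T)N.* m N.*(u N.* u N.* u N.*(u N.* u N.* u N.*(u N.* u N.* u))))N.*((T N.* T N.* T N.* T N.* T N.* T)N.* n N.*(u N.* u N.* u N.*(u N.* u N.* u N.*(u N.* u N.* u))))N.*
     (p N.*(k N.*(k N.* k)N.*(suc(k N.*(k N.* k)N./ p)N.*(T N.* T))))))
   by-cubic a b = ℤ.≤-trans(ℤ.≤-reflexive(E.sym(τ-⟨⟩(a N.* a N.* b)third)))(ℤ.≤-trans(τ-mono step)(ℤ.≤-trans(ℤ.≤-reflexive(E.trans(τ-+(⟨ a³ ⟩ ∙(A m ∙ A n))(⟨ b³ ⟩ ∙(⟨ c N.* d ⟩ ∙ l³)))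
     (cong₂ _⊕_(τ-⟨⟩ a³(A m ∙ A n))(E.trans(τ-⟨⟩ b³(⟨ c N.* d ⟩ ∙ l³))(cong((+ b³)⊗_)(τ-⟨⟩(c N.* d)l³))))))
     (ℤ.≤-trans(ℤ.+-mono-≤(scale-⊗ a³(mixed m n 1≤m m<p 1≤n n<p))(scale-⊗ b³(scale-⊗(c N.* d)(sixth k k<p))))
      (ℤ.≤-reflexive(E.trans(cong₂ _⊕_(pos-⊗ a³ MN)(E.trans(cong((+ b³)⊗_)(pos-⊗(c N.* d)six))(pos-⊗ b³(c N.* d N.* six))))(E.sym(ℤ.pos-+(a³ N.* MN)(b³ N.*(c N.* d N.* six)))))))))
    where
    a³ = a N.* a N.* a
    b³ = b N.* b N.* b
    l³ = A k ∙(A k ∙ A k)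
    c =(T N.* T N.* T N.* T N.* T N.* T)N.* m N.*(u N.* u N.* u N.*(u N.* u N.* u N.*(u N.* u N.* u)))
    d =(T N.* T N.* T N.* T N.* T N.* T)N.* n N.*(u N.* u N.* u N.*(u N.* u N.* u N.*(u N.* u N.* u)))
    six = p N.*(k N.*(k N.* k)N.*(suc(k N.*(k N.* k)N./ p)N.*(T N.* T)))
    AB = A m ∙ A n
    three : ∀ a b c -> ⟨ a ⟩ ∙ ⟨ b ⟩ ∙ ⟨ c ⟩ ≈ ⟨ a N.* b N.* c ⟩
    three a b c = sym(trans(⟨⟩-*(a N.* b)c)(*-congʳ(⟨⟩-* a b)))
    AB≲ : AB ≲ ⟨ c N.* d ⟩
    AB≲ = ≲-respʳ(sym(⟨⟩-* c d))(*-mono(pos-A m)(pos-⟨⟩ d)(burgess m 1≤m m<p)(burgess n 1≤n n<p))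
    step : ⟨ a N.* a N.* b ⟩ ∙ third ≲(⟨ a³ ⟩ ∙ AB)∔(⟨ b³ ⟩ ∙(⟨ c N.* d ⟩ ∙ l³))
    step = ≲-trans(≲-resp
      (trans(solve 5(\a b c x l -> x :*(a :* b :* c :* l):=(a :* b :* c):*(x :* l))refl ⟨ a ⟩ ⟨ a ⟩ ⟨ b ⟩ AB(A k))(*-congʳ(three a a b)))
      (trans(solve 4(\x a b l -> x :*(a :+ b :*(l :* l :* l)):=(a :* x):+(b :*(x :*(l :*(l :* l)))))refl AB(⟨ a ⟩ ∙ ⟨ a ⟩ ∙ ⟨ a ⟩)(⟨ b ⟩ ∙ ⟨ b ⟩ ∙ ⟨ b ⟩)(A k))(Positivity.+-cong S(*-congʳ(three a a a))(*-congʳ(three b b b))))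
      (*-monoˡ(pos-*(pos-A m)(pos-A n))(cubic a b(pos-A k))))
     (+-mono(≲-refl{⟨ a³ ⟩ ∙ AB})(*-monoˡ(pos-⟨⟩ b³)(*-monoʳ(pos-*(pos-A k)(pos-*(pos-A k)(pos-A k)))AB≲)))

module Reduction where
 open import Data.Nat using (_+_; _*_; _%_; ∣_-_∣)
 open import Data.Integer as ℤ using () renaming (+_ to int; _⊖_ to _⊖ᶻ_)
 open E using (refl; sym; trans; cong; cong₂; subst)
 open Alg
 open Cone
 open Field
 open Char
 open Burgess2
 open Shift
 open Count
 open Products
 open Energy
 open Spectral
 open import Defs using (sumℕ; innerSum; tau; ind)
 open NatSums
 open N.≤-Reasoning

 sumℕ≡Ʃ : ∀ n f -> sumℕ n f ≡ Ʃ(rng n)(f ∘ suc)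
 sumℕ≡Ʃ zero f = refl
 sumℕ≡Ʃ(suc n)f = trans(N.+-comm(sumℕ n f)(f(suc n)))(cong(f(suc n)+_)(sumℕ≡Ʃ n f))

 select : ∀ n y(h : ℕ -> ℕ)-> y < n -> Ʃ(rng n)(\k -> h k * [ suc y N.≟ suc k ])≡ h y
 select(suc n)y h y<1+n = go(y N.≟ n)
  where
  none : ∀ m -> m ≤ y -> Ʃ(rng m)(\k -> h k * [ suc y N.≟ suc k ])≡ 0
  none m m≤y = Ʃ-≈0(rng m)(\{k}k∈ -> trans(cong(h k *_)([no](suc y N.≟ suc k)(\e -> <⇒≢(<-≤-trans(∈-rng⁻ k∈)m≤y)(sym(suc-injective e)))))(N.*-zeroʳ(h k)))
  go : Dec(y ≡ n)-> Ʃ(rng(suc n))(\k -> h k * [ suc y N.≟ suc k ])≡ h y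
  go(yes refl)= trans(cong₂ _+_(trans(cong(h y *_)([yes](suc y N.≟ suc y)refl))(N.*-identityʳ(h y)))(none y ≤-refl))(N.+-identityʳ(h y))
  go(no y≢n)= trans(cong(_+ Ʃ(rng n)(\k -> h k * [ suc y N.≟ suc k ]))(trans(cong(h n *_)([no](suc y N.≟ suc n)(y≢n ∘ suc-injective)))(N.*-zeroʳ(h n))))(select n y h(≤∧≢⇒<(≤-pred y<1+n)y≢n))

 solutions : ∀(q : ℕ).{{_ : NonZero q}}-> ℕ -> ℕ -> ℕ -> ℕ -> ℕ
 solutions q M N R a = Ʃ(rng R)(\k -> Ʃ(rng M)(\i -> Ʃ(rng N)(\j -> [(suc i * suc j)% q N.≟(a * suc k)% q ])))

 innerSum≡ : ∀ q₁ M N a r -> innerSum(suc q₁)M N a r ≡ Ʃ(rng M)(\i -> Ʃ(rng N)(\j -> [(suc i * suc j)% suc q₁ N.≟(a * r)% suc q₁ ]))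
 innerSum≡ q₁ M N a r = begin-equality
  _ ≡⟨ sumℕ≡Ʃ(M * N)_ ⟩
  _ ≡⟨ Ʃ-cong(rng(M * N))(\k -> cong(g(suc k)*_)(trans(sumℕ≡Ʃ M _)(Ʃ-cong(rng M)(\i -> sumℕ≡Ʃ N _))))⟩
  _ ≡⟨ Ʃ-cong(rng(M * N))(\k -> trans(sym(Ʃ-*ˡ(rng M)(g(suc k))_))(Ʃ-cong(rng M)(\i -> sym(Ʃ-*ˡ(rng N)(g(suc k))_))))⟩
  _ ≡⟨ trans(Ʃ-swap(rng(M * N))(rng M)_)(Ʃ-cong(rng M)(\i -> Ʃ-swap(rng(M * N))(rng N)_))⟩
  _ ≡⟨ Ʃ-cong-∈(rng M)(\{i}i∈ -> Ʃ-cong-∈(rng N)(\{j}j∈ -> select(M * N)(j + i * suc j)(g ∘ suc)(*-mono-≤(∈-rng⁻ i∈)(∈-rng⁻ j∈))))⟩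
  _ ∎
  where
  g : ℕ -> ℕ
  g k = [ k % suc q₁ N.≟(a * r)% suc q₁ ]

 solutions≡ : ∀ q₁ M N R a -> sumℕ R(\r -> innerSum(suc q₁)M N a r)≡ solutions(suc q₁)M N R a
 solutions≡ q₁ M N R a = trans(sumℕ≡Ʃ R _)(Ʃ-cong(rng R)(\k -> innerSum≡ q₁ M N a(suc k)))

 -- q² Γ_q(M, N, R)
 scaledΓ : ∀(q : ℕ).{{_ : NonZero q}}-> ℕ -> ℕ -> ℕ -> ℕ -> ℕ
 scaledΓ q n M N R = Ʃ(rng n)(\a -> ∣ q * solutions q M N R(suc a)- M * N * R ∣ * ∣ q * solutions q M N R(suc a)- M * N * R ∣)

 module Variance (S : StarRing){p : ℕ}(PF : PrimeField p){χ : FiniteField.Carrier (PrimeField.Φ PF) -> CommutativeRing.Carrier (StarRing.cring S)}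
  (isCharacter : Characters.Character S(PrimeField.Φ PF)χ)(trace : Trace S(PrimeField.Φ PF)χ)(pr : Prime p)
  (M N R : ℕ)(M<p : M < p)(N<p : N < p)(R<p : R < p)where
  open PrimeField PF using (Φ; module F; ⟨⟩-inj; size≡p; enumerated)
  open Trace trace hiding (module F)
  private
   module P = Positivity S
   module ST = ShiftTrick S Φ isCharacter
   module PS = PairSums S
   module χ = Characters.Character isCharacter
   instance
    p≢0 : NonZero p
    p≢0 = prime⇒nonZero pr

   open F using (δ; nz; _⁻¹)

   ι = F.K.⟨_⟩
   ℓ = length nz

   unit : ∀{i n}-> i < n -> n < p -> ι(suc i)≢ F.0#
   unit{i}i<n n<p e with ()← ⟨⟩-inj(≤-<-trans i<n n<p)(≤-<-trans z≤n n<p)e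

   Index = ℕ ×(ℕ × ℕ)

   box : List Index
   box = cartesianProduct(rng R)(cartesianProduct(rng M)(rng N))

   f : Index -> F.Carrier
   f(k ,(i , j))= ι(suc k)⁻¹ F.*(ι(suc i)F.* ι(suc j))

   f-nonzero : ∀{t}-> t ∈ box -> f t ≢ F.0#
   f-nonzero{k ,(i , j)}t∈ = let a , b = ∈-cartesianProduct⁻(rng R)(cartesianProduct(rng M)(rng N))t∈ ; c , d = ∈-pairs{M}{N}b in
    F.*-nonzero(F.⁻¹-nonzero(unit(∈-rng⁻ a)R<p))(F.*-nonzero(unit c M<p)(unit d N<p))

   E = Ʃ box(\t -> Ʃ box(\t' -> δ(f t)(f t')))
   P' = M * N * R

   length-box : length box ≡ P'
   length-box = trans(length-×(rng R)(cartesianProduct(rng M)(rng N)))(trans(cong₂ _*_(length-rng R)(trans(length-×(rng M)(rng N))(cong₂ _*_(length-rng M)(length-rng N))))(N.*-comm R(M * N)))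

   factor : P.N(P.Ʃ box(χ ∘ f))P.≈(P.N ST.S[ M ] P.* P.N ST.S[ N ])P.* P.N ST.S[ R ]
   factor = P.trans(P.N-cong sum)(P.trans(P.N-* _ _)(P.trans(P.*-cong(P.N-⋆ _)(P.N-* _ _))(P.*-comm _ _)))
    where
    sum : P.Ʃ box(χ ∘ f)P.≈ ST.S[ R ] P.⋆ P.*(ST.S[ M ] P.* ST.S[ N ])
    sum = P.trans(PS.Ʃ-pairs(rng R)(cartesianProduct(rng M)(rng N))_)(P.trans(P.Ʃ-cong(rng R)(\k -> P.trans(P.Ʃ-cong(cartesianProduct(rng M)(rng N))(\t -> P.trans(χ.ψ-* _ _)(P.*-cong(P.sym(χ.ψ-⋆(ι(suc k))))(χ.ψ-* _ _))))
      (P.trans(P.Ʃ-*ˡ(cartesianProduct(rng M)(rng N))(χ(ι(suc k))P.⋆)_)(P.*-congˡ(P.trans(PS.Ʃ-pairs(rng M)(rng N)_)(P.sym(P.Ʃ-*Ʃ(rng M)(rng N)_ _)))))))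
     (P.trans(P.Ʃ-*ʳ(rng R)_ _)(P.*-congʳ(P.sym(P.⋆-Ʃ(rng R)_)))))

  V : ℤ.ℤ
  V = τ((P.N ST.S[ M ] P.* P.N ST.S[ N ])P.* P.N ST.S[ R ])

  private
   V≡ : V ≡ int(ℓ * E)ℤ.+ ℤ.-(int(P' * P'))
   V≡ = trans(τ-cong(P.sym factor))(trans(τ-N box f f-nonzero)(cong(\t -> int(ℓ * E)ℤ.+ ℤ.-(int(t * t)))length-box))

   energy-bound : ∀ w B -> int w ℤ.* V ℤ.≤ int B -> w *(ℓ * E)≤ w *(P' * P')+ B
   energy-bound w B h = ℤ.drop‿+≤+(ℤ.≤-trans(ℤ.≤-reflexive split)(ℤ.≤-trans(ℤ.+-monoʳ-≤(int(w *(P' * P')))h)(ℤ.≤-reflexive(sym(ℤ.pos-+(w *(P' * P'))B)))))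
    where
    split : int(w *(ℓ * E))≡ int(w *(P' * P'))ℤ.+ int w ℤ.* V
    split = trans(ℤ.pos-* w(ℓ * E))(trans(ring(int w)(int(ℓ * E))(int(P' * P')))(cong₂ ℤ._+_(sym(ℤ.pos-* w(P' * P')))(cong(int w ℤ.*_)(sym V≡))))
     where
     ring : ∀ w a b -> w ℤ.* a ≡ w ℤ.* b ℤ.+ w ℤ.*(a ℤ.+ ℤ.- b)
     ring w a b = Z.solve 3(\w a b -> w Z.:* a Z.:= w Z.:* b Z.:+ w Z.:*(a Z.:- b))refl w a b
      where module Z = RingKit ℤ.+-*-commutativeRing

   c : F.Carrier -> ℕ
   c x = Ʃ box(\t -> δ(f t)x)

   p≡ : p ≡ suc ℓ
   p≡ = trans(sym size≡p)F.size-nz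

   Ʃ-nonzero : ∀(g : F.Carrier -> ℕ)-> Ʃ(rng ℓ)(\a -> g(ι(suc a)))≡ Ʃ nz g
   Ʃ-nonzero g = N.+-cancelˡ-≡(g F.0#)_ _(trans(sym lower)(trans(cong(\t -> Ʃ(rng t)(g ∘ ι))(sym p≡))(trans(sym(trans(Ʃ-↭ enumerated g)(Ʃ-map ι(rng p)g)))(Ʃ-↭ F.elems-↭ g))))
    where
    lower : Ʃ(rng(suc ℓ))(g ∘ ι)≡ g F.0# + Ʃ(rng ℓ)(\a -> g(ι(suc a)))
    lower = trans(cong(\t -> Ʃ(rng t)(g ∘ ι))(N.+-comm 1 ℓ))(trans(Ʃ-rng-+ 1 ℓ(g ∘ ι))(cong₂ _+_(N.+-identityʳ(g F.0#))(Ʃ-cong(rng ℓ)(\a -> cong(g ∘ ι)(N.+-comm a 1)))))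

   c≡ : ∀{a}-> a < ℓ -> solutions p M N R(suc a)≡ c(ι(suc a))
   c≡{a}a<ℓ = sym(trans(Ʃ-×(rng R)(cartesianProduct(rng M)(rng N))_)(Ʃ-cong-∈(rng R)(\{k}k∈ -> trans(Ʃ-×(rng M)(rng N)_)(Ʃ-cong(rng M)(\i -> Ʃ-cong(rng N)(\j -> match(∈-rng⁻ k∈)i j))))))
    where
    match : ∀{k}-> k < R -> ∀ i j -> δ(f(k ,(i , j)))(ι(suc a))≡ [(suc i * suc j)% p N.≟(suc a * suc k)% p ]
    match{k}k<R i j = ≤-antisym([]-mono(f(k ,(i , j))F.≟ ι(suc a))((suc i * suc j)% p N.≟(suc a * suc k)% p)to)([]-mono((suc i * suc j)% p N.≟(suc a * suc k)% p)(f(k ,(i , j))F.≟ ι(suc a))from)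
     where
     k≢0 = unit k<R R<p
     product : ι(suc i * suc j)≡ ι(suc k)F.* f(k ,(i , j))
     product = trans(F.K.⟨⟩-*(suc i)(suc j))(trans(sym(F.*-identityˡ _))(trans(cong(F._*(ι(suc i)F.* ι(suc j)))(sym(F.inverseʳ k≢0)))(F.*-assoc _ _ _)))
     to : f(k ,(i , j))≡ ι(suc a)->(suc i * suc j)% p ≡(suc a * suc k)% p
     to e = FourthEnergy.ι-≡-% PF pr(trans product(trans(cong(ι(suc k)F.*_)e)(trans(F.*-comm _ _)(sym(F.K.⟨⟩-*(suc a)(suc k))))))
     from :(suc i * suc j)% p ≡(suc a * suc k)% p -> f(k ,(i , j))≡ ι(suc a)
     from e = F.*-cancelˡ k≢0(trans(sym product)(trans(FourthEnergy.%-≡-ι PF pr e)(trans(F.K.⟨⟩-*(suc a)(suc k))(F.*-comm _ _))))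

   Ʃc : Ʃ nz c ≡ P'
   Ʃc = trans(Ʃ-swap nz box(\x t -> δ(f t)x))(trans(Ʃ-cong-∈ box(\{t}t∈ -> once(f t)(f-nonzero t∈)))(trans(Ʃ-const box 1)(trans(N.*-identityʳ _)length-box)))
    where
    once : ∀ y -> y ≢ F.0# -> Ʃ nz(\x -> δ y x)≡ 1
    once y y≢0 = ≤-antisym(at-most-one(\x -> y F.≟ x)nz F.nz-unique(\e e' -> trans(sym e)e'))(≤-trans(≡⇒≤(sym(F.δ-≡{y}refl)))(∈⇒≤Ʃ(δ y)(F.∈-nz⁺ y≢0)))

   Ʃc² : Ʃ nz(\x -> c x * c x)≤ E
   Ʃc² = begin
    _ ≡⟨ Ʃ-cong nz(\x -> Ʃ-*Ʃ box box _ _)⟩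
    _ ≡⟨ trans(Ʃ-swap nz box _)(Ʃ-cong box(\t -> Ʃ-swap nz box _))⟩
    _ ≤⟨ Ʃ-mono-≤ box{\t -> Ʃ box(\t' -> Ʃ nz(\x -> δ(f t)x * δ(f t')x))}(\{t}_ -> Ʃ-mono-≤ box(\{t'}_ -> both(f t)(f t')))⟩
    E ∎
    where
    both : ∀ y z -> Ʃ nz(\x -> δ y x * δ z x)≤ δ y z
    both y z = go(y F.≟ z)
     where
     go : Dec(y ≡ z)-> Ʃ nz(\x -> δ y x * δ z x)≤ δ y z
     go(yes refl)= ≤-trans(Ʃ-mono-≤ nz(\{x}_ -> ≤-trans(*-monoʳ-≤(δ y x)([]≤1(y F.≟ x)))(≡⇒≤(N.*-identityʳ(δ y x)))))
      (≤-trans(at-most-one(\x -> y F.≟ x)nz F.nz-unique(\e e' -> trans(sym e)e'))(≡⇒≤(sym(F.δ-≡{y}refl))))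
     go(no y≢z)= ≡⇒≤(trans(Ʃ-≈0 nz(\{x}_ -> apart x(y F.≟ x)))(sym(F.δ-≢ y≢z)))
      where
      apart : ∀ x -> Dec(y ≡ x)-> δ y x * δ z x ≡ 0
      apart x(yes e)= trans(cong(δ y x *_)(F.δ-≢(\e' -> y≢z(trans e(sym e')))))(N.*-zeroʳ(δ y x))
      apart x(no ne)= cong(_* δ z x)(F.δ-≢ ne)

  G : ℕ
  G = scaledΓ p ℓ M N R

  private
   dev : F.Carrier -> ℕ
   dev x = ∣ p * c x - P' ∣

   G≡ : G ≡ Ʃ nz(\x -> dev x * dev x)
   G≡ = trans(Ʃ-cong-∈(rng ℓ)(\a∈ -> cong(\t -> ∣ p * t - P' ∣ * ∣ p * t - P' ∣)(c≡(∈-rng⁻ a∈))))(Ʃ-nonzero(\x -> dev x * dev x))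

   expand : G + 2 *(p *(P' * P'))≡ p * p * Ʃ nz(\x -> c x * c x)+ ℓ *(P' * P')
   expand = sym(begin-equality
    _ ≡⟨ cong₂ _+_(sym(Ʃ-*ˡ nz(p * p)_))(sym(Ʃ-const nz(P' * P')))⟩
    _ ≡⟨ trans(sym(Ʃ-+ nz _ _))(Ʃ-cong nz(\x -> trans(alg₁ p(c x)P')(trans(∣-∣-square(p * c x)P')(cong(dev x * dev x +_)(alg₂ p(c x)P')))))⟩
    _ ≡⟨ trans(Ʃ-+ nz _ _)(cong₂ _+_(sym G≡)(trans(Ʃ-*ˡ nz(2 * p * P')c)(trans(cong(2 * p * P' *_)Ʃc)(alg₃ p P'))))⟩
    _ ∎)
    where
    alg₁ : ∀ p r n -> p * p *(r * r)+ n * n ≡ p * r *(p * r)+ n * n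
    alg₁ = solve-∀
    alg₂ : ∀ p r n -> 2 *(p * r * n)≡ 2 * p * n * r
    alg₂ = solve-∀
    alg₃ : ∀ p n -> 2 * p * n * n ≡ 2 *(p *(n * n))
    alg₃ = solve-∀

  variance-bound : ∀ w B -> int w ℤ.* V ℤ.≤ int B -> w *(ℓ * G)≤ p * p * B + w *(P' * P')
  variance-bound w B h = +-cancelʳ-≤(w *(ℓ *(2 *(p * Q))))(w *(ℓ * G))(p * p * B + w * Q)(begin
   _ ≡⟨ alg₁ w ℓ G(2 *(p * Q))⟩
   _ ≡⟨ cong(\t -> w *(ℓ * t))expand ⟩
   _ ≤⟨ *-monoʳ-≤ w(*-monoʳ-≤ ℓ(+-monoˡ-≤(ℓ * Q)(*-monoʳ-≤(p * p)Ʃc²)))⟩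
   _ ≡⟨ alg₂ w ℓ(p * p)E Q ⟩
   _ ≤⟨ +-monoˡ-≤(w *(ℓ * ℓ * Q))(*-monoʳ-≤(p * p)(energy-bound w B h))⟩
   _ ≡⟨ cong(\t -> t * t *(w * Q + B)+ w *(ℓ * ℓ * Q))p≡ ⟩
   _ ≡⟨ alg₃ w ℓ B Q ⟩
   _ ≡⟨ cong(\t -> t * t * B + w * Q + w *(ℓ *(2 *(t * Q))))(sym p≡)⟩
   _ ∎)
   where
   Q = P' * P'
   C₂ = Ʃ nz(\x -> c x * c x)
   alg₁ : ∀ w l g q -> w *(l * g)+ w *(l * q)≡ w *(l *(g + q))
   alg₁ = solve-∀
   alg₂ : ∀ w l p e q -> w *(l *(p * e + l * q))≡ p *(w *(l * e))+ w *(l * l * q)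
   alg₂ = solve-∀
   alg₃ : ∀ w l b q -> suc l * suc l *(w * q + b)+ w *(l * l * q)≡ suc l * suc l * b + w * q + w *(l *(2 *(suc l * q)))
   alg₃ = solve-∀

module Savings where
 open import Data.Nat using (_+_; _*_; _^_)
 open E using (refl; sym; trans; cong; cong₂; subst)
 open Divisors using (^-distribʳ-*)
 open N.≤-Reasoning

 ^-cancel-≤ : ∀ n a b -> a ^ suc n ≤ b ^ suc n -> a ≤ b
 ^-cancel-≤ n a b h = ≮⇒≥(\b<a -> <⇒≱(N.^-monoˡ-<(suc n)b<a)h)

 ^-fuse : ∀ a m n -> a ^ m * a ^ n ≡ a ^(m + n)
 ^-fuse a m n = sym(^-distribˡ-+-* a m n)

 1≤^ : ∀{a}n -> 1 ≤ a -> 1 ≤ a ^ n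
 1≤^{suc a}n _ = m^n>0(suc a)n

 ^-double : ∀ a n ->(a * a)^ n ≡ a ^(2 * n)
 ^-double a n = trans(^-distribʳ-* n a a)(trans(^-fuse a n n)(cong(\t -> a ^(n + t))(sym(N.+-identityʳ n))))

 -- w V ≤ T¹⁶ q M N X is available for these savings X / w; u²⁴ is about q.
 data Available(q u k : ℕ): ℕ -> ℕ -> Set where
  pólya-vinogradov : Available q u k 1 q
  trivial : Available q u k 1(k * k)
  burgess : Available q u k 1(k * u ^ 9)
  cubic-short : k * k * k ≤ q -> Available q u k 1(k * u ^ 6)
  cubic-long : q ≤ k * k * k -> Available q u k(u * u)(k * k)

 module Choice (q u k T : ℕ) (1≤q : 1 ≤ q) (1≤k : 1 ≤ k) (1≤T : 1 ≤ T) (q≤U : q ≤ u ^ 24) (U≤Tq : u ^ 24 ≤ T * q) where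
  private
   instance
    q≢0 : NonZero q
    q≢0 = N.>-nonZero 1≤q
    k≢0 : NonZero k
    k≢0 = N.>-nonZero 1≤k
    T≢0 : NonZero T
    T≢0 = N.>-nonZero 1≤T

  Enough : ℕ -> ℕ -> ℕ -> Set
  Enough ν w X = X ^(2 * ν * ν)* k ^(4 * ν)≤ T ^(ν * ν)*(w ^(2 * ν * ν)*(k ^(4 * ν * ν)* q ^(ν + 1)))

  private
   pad : ∀ ν{x y}-> x ≤ y -> x ≤ T ^(ν * ν)*(1 ^(2 * ν * ν)* y)
   pad ν{x}{y}h = begin
    x ≤⟨ h ⟩
    y ≡⟨ sym(trans(N.*-identityˡ(1 * y))(N.*-identityˡ y))⟩
    _ ≤⟨ *-mono-≤(m^n>0 T(ν * ν))(*-monoˡ-≤ y(m^n>0 1(2 * ν * ν)))⟩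
    _ ∎

   one : Enough 1 1 q
   one = pad 1(≡⇒≤(N.*-comm(q ^ 2)(k ^ 4)))

   short : ∀ ν -> k ^(4 * ν)≤ q ^(ν + 1)-> Enough ν 1(k * k)
   short ν h = pad ν(*-mono-≤(≡⇒≤(trans(^-double k(2 * ν * ν))(cong(k ^_)(alg ν))))h)
    where
    alg : ∀ ν -> 2 *(2 * ν * ν)≡ 4 * ν * ν
    alg = solve-∀

   strip-1 : ∀ ν Y -> T ^(ν * ν)* Y ≡ T ^(ν * ν)*(1 ^(2 * ν * ν)* Y)
   strip-1 ν Y = cong(T ^(ν * ν)*_)(sym(trans(cong(_* Y)(N.^-zeroˡ(2 * ν * ν)))(N.*-identityˡ Y)))

   -- The claim raised to the power r = suc r′, after replacing u²⁴ by T q.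
   raise : ∀ r' s j ν -> 24 * s ≡ j *(2 * suc r')-> s ≤ suc r' ->
    q ^(s *(ν * ν))* k ^(suc r' *(2 * ν * ν + 4 * ν))≤ k ^(suc r' *(4 * ν * ν))* q ^(suc r' *(ν + 1))-> Enough ν 1(k * u ^ j)
   raise r' s j ν s≡ s≤r h = ≤-trans(^-cancel-≤ r'(X ^(2 * ν * ν)* k ^(4 * ν))(T ^(ν * ν)* Y)(begin
    _ ≡⟨ trans(cong(\t ->(t * k ^(4 * ν))^ r)(^-distribʳ-*(2 * ν * ν)k(u ^ j)))(trans(^-distribʳ-* r(k ^(2 * ν * ν)*(u ^ j)^(2 * ν * ν))(k ^(4 * ν)))(cong(_*(k ^(4 * ν))^ r)(^-distribʳ-* r(k ^(2 * ν * ν))((u ^ j)^(2 * ν * ν)))))⟩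
    _ ≡⟨ cong₂ _*_(cong₂ _*_(^-*-assoc k(2 * ν * ν)r)u-power)(^-*-assoc k(4 * ν)r)⟩
    _ ≤⟨ *-monoˡ-≤(k ^(4 * ν * r))(*-monoʳ-≤(k ^(2 * ν * ν * r))(≤-trans(^-monoˡ-≤(s *(ν * ν))U≤Tq)(≡⇒≤(^-distribʳ-*(s *(ν * ν))T q))))⟩
    _ ≡⟨ alg₁(k ^(2 * ν * ν * r))(T ^(s *(ν * ν)))(q ^(s *(ν * ν)))(k ^(4 * ν * r))⟩
    _ ≡⟨ cong(\t -> T ^(s *(ν * ν))*(q ^(s *(ν * ν))* t))(trans(^-fuse k(2 * ν * ν * r)(4 * ν * r))(cong(k ^_)(alg₂ ν r)))⟩
    _ ≤⟨ *-mono-≤(^-monoʳ-≤ T(*-monoˡ-≤(ν * ν)s≤r))h ⟩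
    _ ≡⟨ sym(trans(^-distribʳ-* r(T ^(ν * ν))Y)(cong₂ _*_(swap T(ν * ν))(trans(^-distribʳ-* r(k ^(4 * ν * ν))(q ^(ν + 1)))(cong₂ _*_(swap k(4 * ν * ν))(swap q(ν + 1))))))⟩
    _ ∎))(≡⇒≤(strip-1 ν Y))
    where
    r = suc r'
    X = k * u ^ j
    Y = k ^(4 * ν * ν)* q ^(ν + 1)
    swap : ∀ a m ->(a ^ m)^ r ≡ a ^(r * m)
    swap a m = trans(^-*-assoc a m r)(cong(a ^_)(N.*-comm m r))
    alg₁ : ∀ a b c d -> a *(b * c)* d ≡ b *(c *(a * d))
    alg₁ = solve-∀
    alg₂ : ∀ ν r -> 2 * ν * ν * r + 4 * ν * r ≡ r *(2 * ν * ν + 4 * ν)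
    alg₂ = solve-∀
    u-power :((u ^ j)^(2 * ν * ν))^ r ≡(u ^ 24)^(s *(ν * ν))
    u-power = trans(cong(_^ r)(^-*-assoc u j(2 * ν * ν)))(trans(^-*-assoc u(j *(2 * ν * ν))r)(trans(cong(u ^_)(trans(alg₃ j ν r)(trans(cong(_*(ν * ν))(sym s≡))(N.*-assoc 24 s(ν * ν)))))(sym(^-*-assoc u 24(s *(ν * ν))))))
     where
     alg₃ : ∀ j ν r -> j *(2 * ν * ν)* r ≡ j *(2 * r)*(ν * ν)
     alg₃ = solve-∀

   middle : ∀ μ -> let ν = 2 + μ in q ^(ν + 1)≤ k ^(4 * ν)-> Enough ν 1(k * u ^ 6)
   middle μ h = raise 1 1 6 ν refl(s≤s z≤n)(begin
    _ ≤⟨ *-monoˡ-≤ K(^-monoʳ-≤ q(≤-trans(m≤m+n(1 *(ν * ν))ν)(≡⇒≤(alg₁ μ))))⟩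
    _ ≡⟨ cong(_* K)(trans(sym(^-fuse q((ν + 1)* μ)(2 *(ν + 1))))(cong(_* q ^(2 *(ν + 1)))(sym(^-*-assoc q(ν + 1)μ))))⟩
    _ ≤⟨ *-monoˡ-≤ K(*-monoˡ-≤(q ^(2 *(ν + 1)))(^-monoˡ-≤ μ h))⟩
    _ ≡⟨ alg₂((k ^(4 * ν))^ μ)(q ^(2 *(ν + 1)))K ⟩
    _ ≡⟨ cong(_* q ^(2 *(ν + 1)))(trans(cong(_* K)(^-*-assoc k(4 * ν)μ))(trans(^-fuse k(4 * ν * μ)(2 *(2 * ν * ν + 4 * ν)))(cong(k ^_)(alg₃ μ))))⟩
    _ ∎)
    where
    ν = 2 + μ
    K = k ^(2 *(2 * ν * ν + 4 * ν))
    alg₁ : ∀ μ -> 1 *((2 + μ)*(2 + μ))+(2 + μ)≡(2 + μ + 1)* μ + 2 *(2 + μ + 1)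
    alg₁ = solve-∀
    alg₂ : ∀ a b c -> a * b * c ≡ a * c * b
    alg₂ = solve-∀
    alg₃ : ∀ μ -> 4 *(2 + μ)* μ + 2 *(2 *(2 + μ)*(2 + μ)+ 4 *(2 + μ))≡ 2 *(4 *(2 + μ)*(2 + μ))
    alg₃ = solve-∀

   square≥ : ∀ μ -> μ ≤ μ * μ
   square≥ zero = z≤n
   square≥(suc μ)= m≤m+n(suc μ)(μ * suc μ)

   long : ∀ μ -> let ν = 2 + μ in q ^ 11 ≤ k ^ 24 -> Enough ν 1(k * u ^ 9)
   long μ h = raise 11 9 9 ν refl(≤ᵇ⇒≤ 9 12 _)(begin
    _ ≤⟨ *-monoˡ-≤ K(^-monoʳ-≤ q(+-cancelʳ-≤(2 * μ)(9 *(ν * ν))(11 *(ν * μ)+ 12 *(ν + 1))exponent))⟩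
    _ ≡⟨ cong(_* K)(trans(sym(^-fuse q(11 *(ν * μ))(12 *(ν + 1))))(cong(_* q ^(12 *(ν + 1)))(sym(^-*-assoc q 11(ν * μ)))))⟩
    _ ≤⟨ *-monoˡ-≤ K(*-monoˡ-≤(q ^(12 *(ν + 1)))(^-monoˡ-≤(ν * μ)h))⟩
    _ ≡⟨ alg₂((k ^ 24)^(ν * μ))(q ^(12 *(ν + 1)))K ⟩
    _ ≡⟨ cong(_* q ^(12 *(ν + 1)))(trans(cong(_* K)(^-*-assoc k 24(ν * μ)))(trans(^-fuse k(24 *(ν * μ))(12 *(2 * ν * ν + 4 * ν)))(cong(k ^_)(alg₃ μ))))⟩
    _ ∎)
    where
    ν = 2 + μ
    K = k ^(12 *(2 * ν * ν + 4 * ν))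
    alg₀ : ∀ μ -> 9 *((2 + μ)*(2 + μ))+ 2 * μ + 2 *(μ * μ)≡ 11 *((2 + μ)* μ)+ 12 *(2 + μ + 1)+ 4 * μ
    alg₀ = solve-∀
    alg₂ : ∀ a b c -> a * b * c ≡ a * c * b
    alg₂ = solve-∀
    alg₃ : ∀ μ -> 24 *((2 + μ)* μ)+ 12 *(2 *(2 + μ)*(2 + μ)+ 4 *(2 + μ))≡ 12 *(4 *(2 + μ)*(2 + μ))
    alg₃ = solve-∀
    exponent : 9 *(ν * ν)+ 2 * μ ≤ 11 *(ν * μ)+ 12 *(ν + 1)+ 2 * μ
    exponent = +-cancelʳ-≤(2 *(μ * μ))_ _(≤-trans(≡⇒≤(alg₀ μ))(≤-trans(≡⇒≤(alg₄(11 *(ν * μ)+ 12 *(ν + 1))μ))(+-monoʳ-≤(11 *(ν * μ)+ 12 *(ν + 1)+ 2 * μ)(*-monoʳ-≤ 2(square≥ μ)))))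
     where
     alg₄ : ∀ a μ -> a + 4 * μ ≡ a + 2 * μ + 2 * μ
     alg₄ = solve-∀

   gap : ∀ μ -> let ν = 2 + μ in k ^ 24 ≤ q ^ 11 -> Enough ν(u * u)(k * k)
   gap μ h = begin
    _ ≡⟨ cong(_* k ^(4 * ν))(trans(^-double k(2 * ν * ν))(cong(k ^_)(alg₁ ν)))⟩
    _ ≤⟨ *-monoʳ-≤(k ^(4 * ν * ν))(^-cancel-≤ 5(k ^(4 * ν))(w * q ^(ν + 1))sixth)⟩
    _ ≡⟨ alg₂(k ^(4 * ν * ν))w(q ^(ν + 1))⟩
    _ ≤⟨ *-monoˡ-≤(w *(k ^(4 * ν * ν)* q ^(ν + 1)))(m^n>0 T(ν * ν))⟩
    _ ∎
    where
    ν = 2 + μ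
    w =(u * u)^(2 * ν * ν)
    alg₁ : ∀ ν -> 2 *(2 * ν * ν)≡ 4 * ν * ν
    alg₁ = solve-∀
    alg₂ : ∀ a b c -> a *(b * c)≡ 1 *(b *(a * c))
    alg₂ = solve-∀
    alg₃ : ∀ μ -> 11 *(2 + μ)+ μ * μ ≡(2 + μ)*(2 + μ)+(2 + μ + 1)* 6 + μ
    alg₃ μ = lemma μ
     where
     lemma : ∀ μ -> 11 *(2 + μ)+ μ * μ ≡(2 + μ)*(2 + μ)+(2 + μ + 1)* 6 + μ
     lemma = solve-∀
    alg₅ : ∀ ν -> 4 * ν * 6 ≡ 24 * ν
    alg₅ = solve-∀
    alg₆ : ∀ ν -> 2 *(2 * ν * ν)* 6 ≡ 24 *(ν * ν)
    alg₆ = solve-∀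
    w⁶ : w ^ 6 ≡(u ^ 24)^(ν * ν)
    w⁶ = trans(cong(_^ 6)(^-double u(2 * ν * ν)))(trans(^-*-assoc u(2 *(2 * ν * ν))6)(trans(cong(u ^_)(alg₆ ν))(sym(^-*-assoc u 24(ν * ν)))))
    sixth :(k ^(4 * ν))^ 6 ≤(w * q ^(ν + 1))^ 6
    sixth = begin
     _ ≡⟨ trans(^-*-assoc k(4 * ν)6)(trans(cong(k ^_)(alg₅ ν))(sym(^-*-assoc k 24 ν)))⟩
     _ ≤⟨ ^-monoˡ-≤ ν h ⟩
     _ ≡⟨ ^-*-assoc q 11 ν ⟩
     _ ≤⟨ ^-monoʳ-≤ q(+-cancelʳ-≤(μ * μ)(11 * ν)(ν * ν +(ν + 1)* 6)(≤-trans(≡⇒≤(alg₃ μ))(+-monoʳ-≤(ν * ν +(ν + 1)* 6)(square≥ μ))))⟩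
     _ ≡⟨ trans(sym(^-fuse q(ν * ν)((ν + 1)* 6)))(cong(q ^(ν * ν)*_)(sym(^-*-assoc q(ν + 1)6)))⟩
     _ ≤⟨ *-monoˡ-≤((q ^(ν + 1))^ 6)(^-monoˡ-≤(ν * ν)q≤U)⟩
     _ ≡⟨ trans(cong(_*(q ^(ν + 1))^ 6)(sym w⁶))(sym(^-distribʳ-* 6 w(q ^(ν + 1))))⟩
     _ ∎

  choose : ∀ ν -> 1 ≤ ν -> ∃ \w -> ∃ \X -> Available q u k w X × Enough ν w X
  choose(suc zero)_ = 1 , q , pólya-vinogradov , one
  choose(suc(suc μ))_ = go(k ^(4 * ν)N.≤? q ^(ν + 1))(≤-total(k * k * k)q)(≤-total(k ^ 24)(q ^ 11))
   where
   ν = 2 + μ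
   open import Data.Sum using (_⊎_)
   go : Dec(k ^(4 * ν)≤ q ^(ν + 1))->(k * k * k ≤ q)⊎(q ≤ k * k * k)->(k ^ 24 ≤ q ^ 11)⊎(q ^ 11 ≤ k ^ 24)-> ∃ \w -> ∃ \X -> Available q u k w X × Enough ν w X
   go(yes h)_ _ = 1 , k * k , trivial , short ν h
   go(no h)(inj₁ s)_ = 1 , k * u ^ 6 , cubic-short s , middle μ(<⇒≤(≰⇒> h))
   go(no _)(inj₂ l)(inj₁ s)= u * u , k * k , cubic-long l , gap μ s
   go(no _)(inj₂ _)(inj₂ l)= 1 , k * u ^ 9 , burgess , long μ l

module Realise where
 open import Data.Nat using (_+_; _*_; _^_; _/_)
 open import Data.Nat.DivMod using (n/n≡1)
 open import Data.Integer as ℤ using () renaming (+_ to int)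
 open E using (refl; sym; trans; cong; cong₂; subst)
 open Cone
 open Field
 open Char
 open Moment
 open Burgess2 using (PrimeField)
 open Count
 open Spectral
 open Reduction
 open Savings
 open N.≤-Reasoning

 sixteen : ℕ -> ℕ
 sixteen T = T * T * T * T *(T * T * T * T)*(T * T * T * T *(T * T * T * T))

 module Numerics (T : ℕ) (1000≤T : 1000 ≤ T) where
  private
   T-up : ∀ x -> x ≤ T * x
   T-up x = ≤-trans(≡⇒≤(sym(N.*-identityˡ x)))(*-monoˡ-≤ x(≤-trans(s≤s z≤n)1000≤T))

   powers : ℕ -> ℕ -> ℕ
   powers zero x = x
   powers(suc n)x = T * powers n x

   powers-up : ∀ n x -> x ≤ powers n x
   powers-up zero x = ≤-refl
   powers-up(suc n)x = ≤-trans(powers-up n x)(T-up(powers n x))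

   const-up : ∀ c x -> c ≤ 1000 -> c * x ≤ T * x
   const-up c x h = *-monoˡ-≤ x(≤-trans h 1000≤T)

  pv-numeric : ∀ q mn -> T * T * T * q *(T * T * T *(q * mn))≤ sixteen T *(q * mn)* q
  pv-numeric q mn = ≤-trans(powers-up 10(T * T * T * q *(T * T * T *(q * mn))))(≡⇒≤(alg T q mn))
   where
   alg : ∀ T q mn -> T *(T *(T *(T *(T *(T *(T *(T *(T *(T *(T * T * T * q *(T * T * T *(q * mn))))))))))))≡ T * T * T * T *(T * T * T * T)*(T * T * T * T *(T * T * T * T))*(q * mn)* q
   alg = solve-∀

  trivial-numeric : ∀ k2 q mn -> k2 *(T * T * T *(q * mn))≤ sixteen T *(q * mn)* k2
  trivial-numeric k2 q mn = ≤-trans(powers-up 13(k2 *(T * T * T *(q * mn))))(≡⇒≤(alg T k2(q * mn)))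
   where
   alg : ∀ T k x -> T *(T *(T *(T *(T *(T *(T *(T *(T *(T *(T *(T *(T *(k *(T * T * T * x))))))))))))))≡ T * T * T * T *(T * T * T * T)*(T * T * T * T *(T * T * T * T))* x * k
   alg = solve-∀

  burgess-numeric : ∀ k W q mn ->(T * T * T * T * T * T)* k * W *(T * T * T *(q * mn))≤ sixteen T *(q * mn)*(k * W)
  burgess-numeric k W q mn = ≤-trans(powers-up 7((T * T * T * T * T * T)* k * W *(T * T * T *(q * mn))))(≡⇒≤(alg T k W(q * mn)))
   where
   alg : ∀ T k W x -> T *(T *(T *(T *(T *(T *(T *((T * T * T * T * T * T)* k * W *(T * T * T * x))))))))≡ T * T * T * T *(T * T * T * T)*(T * T * T * T *(T * T * T * T))* x *(k * W)
   alg = solve-∀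

  -- z = u³; z² = u⁶
  short-numeric : ∀ k z q m n s -> s ≤ 2 -> let a = k *(z * z)in
   a * a * a *(T * T * T *(q *(m * n)))+ 1 * 1 * 1 *(((T * T * T * T * T * T)* m *(z *(z * z)))*((T * T * T * T * T * T)* n *(z *(z * z)))*(q *(k *(k * k)*(s *(T * T)))))
   ≤ a * a *(sixteen T *(q *(m * n))* a)
  short-numeric k z q m n s s≤2 = begin
   _ ≤⟨ +-mono-≤(powers-up 11(a * a * a *(T * T * T *(q *(m * n)))))(*-monoʳ-≤ 1(*-monoʳ-≤(((T * T * T * T * T * T)* m *(z *(z * z)))*((T * T * T * T * T * T)* n *(z *(z * z))))(*-monoʳ-≤ q(*-monoʳ-≤(k *(k * k))(*-monoˡ-≤(T * T)s≤2)))))⟩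
   _ ≡⟨ alg₁ T k z q m n ⟩
   3 * Y
    ≤⟨ const-up 3 Y(≤ᵇ⇒≤ 3 1000 _)⟩
   T * Y
    ≤⟨ T-up(T * Y)⟩
   _ ≡⟨ alg₂ T a(q *(m * n))⟩
   _ ∎
   where
   a = k *(z * z)
   Y = T * T * T * T * T * T * T *(T * T * T * T * T * T * T)*(a * a * a *(q *(m * n)))
   alg₁ : ∀ T k z q m n -> T *(T *(T *(T *(T *(T *(T *(T *(T *(T *(T *(k *(z * z)*(k *(z * z))*(k *(z * z))*(T * T * T *(q *(m * n))))))))))))))+ 1 * 1 * 1 *(((T * T * T * T * T * T)* m *(z *(z * z)))*((T * T * T * T * T * T)* n *(z *(z * z)))*(q *(k *(k * k)*(2 *(T * T)))))
    ≡ 3 *(T * T * T * T * T * T * T *(T * T * T * T * T * T * T)*(k *(z * z)*(k *(z * z))*(k *(z * z))*(q *(m * n))))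
   alg₁ = solve-∀
   alg₂ : ∀ T a x -> T *(T *(T * T * T * T * T * T * T *(T * T * T * T * T * T * T)*(a * a * a * x)))≡ a * a *(T * T * T * T *(T * T * T * T)*(T * T * T * T *(T * T * T * T))* x * a)
   alg₂ = solve-∀

  long-numeric : ∀ k u q m n s -> let a = k * k ; b = u * u ; z = u * u * u ; U =(z * z *(z * z))*(z * z *(z * z))in U ≤ T * q -> q * s ≤ 2 *(k *(k * k))->
   a * a * a *(T * T * T *(q *(m * n)))+ b * b * b *(((T * T * T * T * T * T)* m *(z *(z * z)))*((T * T * T * T * T * T)* n *(z *(z * z)))*(q *(k *(k * k)*(s *(T * T)))))
   ≤ a * a *(sixteen T *(q *(m * n))*(k * k))
  long-numeric k u q m n s U≤ s≤ = begin
   _ ≡⟨ cong(a * a * a *(T * T * T *(q *(m * n)))+_)(trans(cong(\t -> t *(((T * T * T * T * T * T)* m *(z *(z * z)))*((T * T * T * T * T * T)* n *(z *(z * z)))*(q *(k *(k * k)*(s *(T * T))))))(alg₀ u))(alg₁ T z m n q(k *(k * k))s))⟩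
   _ ≤⟨ +-mono-≤(powers-up 12(a * a * a *(T * T * T *(q *(m * n)))))(*-monoˡ-≤(F *(m * n *(k *(k * k))))(*-mono-≤ U≤ s≤))⟩
   _ ≡⟨ alg₂ T k q(m * n)⟩
   3 * Y
    ≤⟨ const-up 3 Y(≤ᵇ⇒≤ 3 1000 _)⟩
   T * Y
    ≡⟨ alg₃ T k(q *(m * n))⟩
   _ ∎
   where
   a = k * k
   b = u * u
   z = u * u * u
   U =(z * z *(z * z))*(z * z *(z * z))
   F = T * T * T * T * T * T * T *(T * T * T * T * T * T * T)
   Y = T * T * T * T * T * T * T *(T * T * T * T * T * T * T)* T *(k * k *(k * k)*(k * k)*(q *(m * n)))
   alg₀ : ∀ u -> u * u *(u * u)*(u * u)≡ u * u * u *(u * u * u)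
   alg₀ = solve-∀
   alg₁ : ∀ T z m n q K s -> z * z *(((T * T * T * T * T * T)* m *(z *(z * z)))*((T * T * T * T * T * T)* n *(z *(z * z)))*(q *(K *(s *(T * T)))))≡
    (z * z *(z * z))*(z * z *(z * z))*(q * s)*(T * T * T * T * T * T * T *(T * T * T * T * T * T * T)*(m * n * K))
   alg₁ = solve-∀
   alg₂ : ∀ T k q mn -> T *(T *(T *(T *(T *(T *(T *(T *(T *(T *(T *(T *(k * k *(k * k)*(k * k)*(T * T * T *(q * mn))))))))))))))+ T * q *(2 *(k *(k * k)))*(T * T * T * T * T * T * T *(T * T * T * T * T * T * T)*(mn *(k *(k * k))))
    ≡ 3 *(T * T * T * T * T * T * T *(T * T * T * T * T * T * T)* T *(k * k *(k * k)*(k * k)*(q * mn)))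
   alg₂ = solve-∀
   alg₃ : ∀ T k x -> T *(T * T * T * T * T * T * T *(T * T * T * T * T * T * T)* T *(k * k *(k * k)*(k * k)* x))≡ k * k *(k * k)*(T * T * T * T *(T * T * T * T)*(T * T * T * T *(T * T * T * T))* x *(k * k))
   alg₃ = solve-∀

 u³ : ℕ -> ℕ
 u³ u = u * u * u

 u⁹≡ : ∀ u -> u ^ 9 ≡ u * u * u *(u * u * u *(u * u * u))
 u⁹≡ u = trans(^-distribˡ-+-* u 3 6)(trans(cong₂ _*_(three u)(trans(^-distribˡ-+-* u 3 3)(cong₂ _*_(three u)(three u))))refl)
  where
  three : ∀ u -> u ^ 3 ≡ u * u * u
  three u = alg u
   where
   alg : ∀ u -> u *(u *(u * 1))≡ u * u * u
   alg = solve-∀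

 u⁶≡ : ∀ u -> u ^ 6 ≡ u * u * u *(u * u * u)
 u⁶≡ = alg
  where
  alg : ∀ u -> u *(u *(u *(u *(u *(u * 1)))))≡ u * u * u *(u * u * u)
  alg = solve-∀

 u²⁴≡ : ∀ u -> u ^ 24 ≡(u * u * u *(u * u * u)*(u * u * u *(u * u * u)))*(u * u * u *(u * u * u)*(u * u * u *(u * u * u)))
 u²⁴≡ u = trans(sym(^-*-assoc u 6 4))(trans(cong(_^ 4)(u⁶≡ u))(alg(u * u * u *(u * u * u))))
  where
  alg : ∀ w -> w *(w *(w *(w * 1)))≡(w * w)*(w * w)
  alg = solve-∀

 module Realisation (S : StarRing){p : ℕ}(PF : PrimeField p){χ : FiniteField.Carrier (PrimeField.Φ PF) -> CommutativeRing.Carrier (StarRing.cring S)}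
  (isCharacter : Characters.Character S(PrimeField.Φ PF)χ)(trace : Trace S(PrimeField.Φ PF)χ)(pr : Prime p)(2≤p : 2 ≤ p)
  (T u : ℕ)(1000≤T : 1000 ≤ T)(1≤u : 1 ≤ u)(p≤ : p ≤ u ^ 24)(≤Tp : u ^ 24 ≤ T * p)
  (logs : ∀ κ -> 2 ^ κ ≤ p -> suc κ ≤ T)
  (divisors : ∀{z}-> 1 ≤ z -> z ≤ p *(p * p)-> DivBound T z)
  (weil : ∀{κ}-> κ ≢ FiniteField.0#(PrimeField.Φ PF)-> Positivity._≲_ S(Positivity.N S(FourthMoment.V S(PrimeField.Φ PF)isCharacter κ))(Positivity.⟨_⟩ S(T * T * p)))
  (m n k : ℕ)(1≤m : 1 ≤ m)(m<p : m < p)(1≤n : 1 ≤ n)(n<p : n < p)(1≤k : 1 ≤ k)(k<p : k < p)where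

  private
   ≤Tp' = subst(_≤ T * p)(u²⁴≡ u)≤Tp
   module SB = SpectralBounds S PF isCharacter trace pr 2≤p T u 1000≤T 1≤u (subst (p ≤_) (u²⁴≡ u) p≤) ≤Tp' logs divisors
   module Nu = Numerics T 1000≤T
   V₀ = Trace.τ trace(SB.third weil m n k 1≤m m<p 1≤n n<p 1≤k k<p)
   instance
    p≢0 : NonZero p
    p≢0 = prime⇒nonZero pr
   bound : ℕ -> ℕ
   bound X = sixteen T *(p *(m * n))* X

   unscaled : ∀{B C}-> V₀ ℤ.≤ int B -> B ≤ C -> int 1 ℤ.* V₀ ℤ.≤ int C
   unscaled h le = ℤ.≤-trans(ℤ.≤-reflexive(ℤ.*-identityˡ V₀))(ℤ.≤-trans h(ℤ.+≤+ le))

   cancel : ∀ c x B -> 1 ≤ c -> int c ℤ.* x ℤ.≤ int(c * B)-> x ℤ.≤ int B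
   cancel(suc c)x B _ h = ℤ.*-cancelˡ-≤-pos x(int B)(int(suc c))(ℤ.≤-trans h(ℤ.≤-reflexive(ℤ.pos-*(suc c)B)))

  realise : ∀{w X}-> Available p u k w X -> int w ℤ.* V₀ ℤ.≤ int(bound X)
  realise pólya-vinogradov = unscaled(SB.by-pv weil m n k 1≤m m<p 1≤n n<p 1≤k k<p)(Nu.pv-numeric p(m * n))
  realise trivial = unscaled(SB.by-trivial weil m n k 1≤m m<p 1≤n n<p 1≤k k<p)(Nu.trivial-numeric(k * k)p(m * n))
  realise burgess = unscaled(SB.by-burgess weil m n k 1≤m m<p 1≤n n<p 1≤k k<p)
   (≤-trans(Nu.burgess-numeric k _ p(m * n))(≡⇒≤(cong(\t -> bound(k * t))(sym(u⁹≡ u)))))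
  realise(cubic-short h)= unscaled{bound(k *(u³ u * u³ u))}(cancel(a * a)V₀(bound a)(*-mono-≤ 1≤a 1≤a)
    (ℤ.≤-trans(ℤ.≤-reflexive(cong(\t -> int t ℤ.* V₀)(sym(N.*-identityʳ(a * a)))))(ℤ.≤-trans(SB.by-cubic weil m n k 1≤m m<p 1≤n n<p 1≤k k<p a 1)(ℤ.+≤+(Nu.short-numeric k(u³ u)p m n _(s≤s small))))))
    (≡⇒≤(cong(\t -> bound(k * t))(sym(u⁶≡ u))))
   where
   a = k *(u³ u * u³ u)
   1≤z : 1 ≤ u³ u
   1≤z = *-mono-≤(*-mono-≤ 1≤u 1≤u)1≤u
   1≤a : 1 ≤ a
   1≤a = *-mono-≤ 1≤k(*-mono-≤ 1≤z 1≤z)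
   small : k *(k * k)/ p ≤ 1
   small = ≤-trans(/-monoˡ-≤ p(≤-trans(≡⇒≤(sym(N.*-assoc k k k)))h))(≡⇒≤(n/n≡1 p))
  realise(cubic-long h)= cancel(a * a)(int(u * u)ℤ.* V₀)(bound(k * k))(*-mono-≤(*-mono-≤ 1≤k 1≤k)(*-mono-≤ 1≤k 1≤k))
    (ℤ.≤-trans(ℤ.≤-reflexive(trans(sym(ℤ.*-assoc(int(a * a))(int(u * u))V₀))(cong(ℤ._* V₀)(sym(ℤ.pos-*(a * a)(u * u))))))(ℤ.≤-trans(SB.by-cubic weil m n k 1≤m m<p 1≤n n<p 1≤k k<p a(u * u))
     (ℤ.+≤+(Nu.long-numeric k u p m n _ ≤Tp' rounding))))
   where
   a = k * k
   K = k *(k * k)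
   rounding : p * suc(K / p)≤ 2 * K
   rounding = ≤-trans(≡⇒≤(*-suc p(K / p)))(≤-trans(+-mono-≤(≤-trans h(≡⇒≤(N.*-assoc k k k)))(≤-trans(≡⇒≤(N.*-comm p(K / p)))(m/n*n≤m K p)))(≡⇒≤(cong(K +_)(sym(N.+-identityʳ K)))))

  -- The main term P² is absorbed by the same bound.
  main-term : ∀{w X}-> Available p u k w X -> w *(k * k)≤ p *(sixteen T * X)
  main-term a = ≤-trans(go a)(*-monoʳ-≤ p(*-monoˡ-≤ _ T≤16))
   where
   k≤p = <⇒≤ k<p
   1≤T = ≤-trans(s≤s z≤n)1000≤T
   T≤16 : T ≤ sixteen T
   T≤16 = ≤-trans(≤-trans(≡⇒≤(sym(one T)))(*-mono-≤(*-mono-≤(*-mono-≤(*-mono-≤(≤-refl{T})1≤T)1≤T)1≤T)(four)))(≤-trans(≡⇒≤(sym(N.*-identityʳ _)))(*-monoʳ-≤(T * T * T * T *(T * T * T * T))(*-mono-≤ four four)))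
    where
    four : 1 ≤ T * T * T * T
    four = *-mono-≤(*-mono-≤(*-mono-≤ 1≤T 1≤T)1≤T)1≤T
    one : ∀ T -> T * 1 * 1 * 1 * 1 ≡ T
    one = solve-∀
   T-up : ∀ x -> x ≤ T * x
   T-up x = ≤-trans(≡⇒≤(sym(N.*-identityˡ x)))(*-monoˡ-≤ x 1≤T)
   scale : ∀{x}y -> x ≤ p * y -> 1 * x ≤ p *(T * y)
   scale{x}y h = ≤-trans(≡⇒≤(N.*-identityˡ x))(≤-trans h(*-monoʳ-≤ p(T-up y)))
   u^ : ∀ j -> 1 ≤ u ^ j
   u^ j = 1≤^ j 1≤u
   power : ∀ j -> k * k ≤ p *(k * u ^ j)
   power j = *-mono-≤ k≤p(≤-trans(≡⇒≤(sym(N.*-identityʳ k)))(*-monoʳ-≤ k(u^ j)))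
   go : ∀{w X}-> Available p u k w X -> w *(k * k)≤ p *(T * X)
   go pólya-vinogradov = scale p(*-mono-≤ k≤p k≤p)
   go trivial = scale(k * k)(≤-trans(≡⇒≤(sym(N.*-identityˡ(k * k))))(*-monoˡ-≤(k * k)(≤-trans(s≤s z≤n)2≤p)))
   go burgess = scale(k * u ^ 9)(power 9)
   go(cubic-short _)= scale(k * u ^ 6)(power 6)
   go(cubic-long _)= ≤-trans(*-monoˡ-≤(k * k)(≤-trans square(≤-trans ≤Tp(≡⇒≤(N.*-comm T p)))))(≡⇒≤(N.*-assoc p T(k * k)))
    where
    square : u * u ≤ u ^ 24
    square = ≤-trans(≡⇒≤(cong(u *_)(sym(N.*-identityʳ u))))(^-monoʳ-≤ u{{N.>-nonZero 1≤u}}{2}{24}(≤ᵇ⇒≤ 2 24 _))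

module Assemble where
 open import Data.Nat using (_+_; _*_; _^_; _⊓_)
 open import Data.Integer as ℤ using () renaming (+_ to int)
 open E using (refl; sym; trans; cong; cong₂; subst)
 open Cone
 open Field
 open Char
 open Moment
 open Burgess2 using (PrimeField)
 open Count using (DivBound)
 open Divisors
 open Residues
 open Weil
 open Shift
 open GroupRings
 open Spectral
 open Reduction
 open Savings
 open Realise
 open N.≤-Reasoning

 integer-root : ∀ E q -> 1 ≤ q -> ∃ \T -> 1 ≤ T × q ≤ T ^ suc E × T ^ suc E ≤ 2 ^ suc E * q
 integer-root E q 1≤q = go q(≤-trans(n≤1+n q)(≤-trans(≡⇒≤(sym(N.^-identityʳ(suc q))))(^-monoʳ-≤(suc q){1}{suc E}(s≤s z≤n))))
  where
  go : ∀ n -> q ≤ suc n ^ suc E -> ∃ \T -> 1 ≤ T × q ≤ T ^ suc E × T ^ suc E ≤ 2 ^ suc E * q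
  go zero h = 1 , s≤s z≤n , h , ≤-trans(≡⇒≤(N.^-zeroˡ(suc E)))(*-mono-≤(m^n>0 2(suc E))1≤q)
  go(suc n)h = step(q N.≤? suc n ^ suc E)
   where
   step : Dec(q ≤ suc n ^ suc E)-> ∃ \T -> 1 ≤ T × q ≤ T ^ suc E × T ^ suc E ≤ 2 ^ suc E * q
   step(yes h')= go n h'
   step(no h')= suc(suc n), s≤s z≤n , h , ≤-trans(^-monoˡ-≤(suc E)double)(≤-trans(≡⇒≤(^-distribʳ-*(suc E)2(suc n)))(*-monoʳ-≤(2 ^ suc E)(<⇒≤(≰⇒> h'))))
    where
    double : suc(suc n)≤ 2 * suc n
    double = s≤s(≤-trans(≡⇒≤(N.+-comm 1 n))(+-monoʳ-≤ n(s≤s z≤n)))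

 -- The scale on which all factors q^{o(1)} are powers of T.
 module Scale (e : ℕ) where
  E : ℕ
  E = 24 * suc e

  module DB = DivisorBound E (s≤s z≤n)

  c₀ : ℕ
  c₀ = 1000 + DB.C + 2 ^ E + E

  record Parameters(q : ℕ): Set where
   field
    T₀ : ℕ
    1≤T₀ : 1 ≤ T₀
    q≤ : q ≤ T₀ ^ E
    ≤2q : T₀ ^ E ≤ 2 ^ E * q

   T u : ℕ
   T = c₀ *(T₀ * T₀ * T₀)
   u = T₀ ^ suc e

   1≤T₀³ : 1 ≤ T₀ * T₀ * T₀
   1≤T₀³ = *-mono-≤(*-mono-≤ 1≤T₀ 1≤T₀)1≤T₀

   c₀≤T : ∀{x}-> x ≤ c₀ -> x ≤ T
   c₀≤T h = ≤-trans h(≤-trans(≡⇒≤(sym(N.*-identityʳ c₀)))(*-monoʳ-≤ c₀ 1≤T₀³))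

   1000≤c₀ : 1000 ≤ c₀
   1000≤c₀ = ≤-trans(m≤m+n 1000 DB.C)(≤-trans(m≤m+n(1000 + DB.C)(2 ^ E))(m≤m+n(1000 + DB.C + 2 ^ E)E))

   1000≤T : 1000 ≤ T
   1000≤T = c₀≤T 1000≤c₀

   T₀≤T₀³ : T₀ ≤ T₀ * T₀ * T₀
   T₀≤T₀³ = ≤-trans(≡⇒≤(trans(sym(N.*-identityˡ T₀))(cong(_* T₀)(sym(N.*-identityˡ 1)))))(*-monoˡ-≤ T₀(*-mono-≤ 1≤T₀ 1≤T₀))

   T₀≤T : T₀ ≤ T
   T₀≤T = ≤-trans(≡⇒≤(sym(N.*-identityˡ T₀)))(*-mono-≤(≤-trans(s≤s z≤n)1000≤c₀)T₀≤T₀³)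

   u²⁴ : u ^ 24 ≡ T₀ ^ E
   u²⁴ = trans(^-*-assoc T₀(suc e)24)(cong(T₀ ^_)(N.*-comm(suc e)24))

   1≤u : 1 ≤ u
   1≤u = 1≤^(suc e)1≤T₀

   q≤u²⁴ : q ≤ u ^ 24
   q≤u²⁴ = ≤-trans q≤(≡⇒≤(sym u²⁴))

   u²⁴≤Tq : u ^ 24 ≤ T * q
   u²⁴≤Tq = ≤-trans(≡⇒≤ u²⁴)(≤-trans ≤2q(*-monoˡ-≤ q(c₀≤T(≤-trans(m≤n+m(2 ^ E)(1000 + DB.C))(m≤m+n(1000 + DB.C + 2 ^ E)E)))))

   logs : ∀ κ -> 2 ^ κ ≤ q -> suc κ ≤ T
   logs κ h = ≤-trans(^-cancel-≤(pred E)(suc κ)(E * T₀)(≤-trans(suc-^≤ E(s≤s z≤n)κ)(≤-trans(*-monoʳ-≤(E ^ E)(≤-trans h q≤))(≡⇒≤(sym(^-distribʳ-* E E T₀))))))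
    (*-mono-≤(m≤n+m E(1000 + DB.C + 2 ^ E))T₀≤T₀³)

   divisors : ∀{z}-> 1 ≤ z -> z ≤ q *(q * q)-> DivBound T z
   divisors{z}1≤z z≤ = weaken(DB.divisor-bound z 1≤z)
    where
    1≤C : 1 ≤ DB.C
    1≤C = 1≤^(2 ^ E)(≤-trans(≡⇒≤(sym(N.^-zeroˡ E)))(^-monoˡ-≤ E{1}{E}(s≤s z≤n)))
    C≤ : DB.C ≤ DB.C ^ E
    C≤ = ≤-trans(≡⇒≤(sym(N.^-identityʳ DB.C)))(^-monoʳ-≤ DB.C{{N.>-nonZero 1≤C}}{1}{E}(s≤s z≤n))
    cube : T₀ ^ E *(T₀ ^ E * T₀ ^ E)≡(T₀ * T₀ * T₀)^ E
    cube = trans(trans(sym(N.*-assoc(T₀ ^ E)(T₀ ^ E)(T₀ ^ E)))(cong(_* T₀ ^ E)(sym(^-distribʳ-* E T₀ T₀))))(sym(^-distribʳ-* E(T₀ * T₀)T₀))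
    weaken : DB.Small DB.C z -> DivBound T z
    weaken(d , h , le)ys uniq div = ≤-trans(h ys uniq div)(≤-trans(^-cancel-≤(pred E)d(DB.C *(T₀ * T₀ * T₀))(≤-trans le(≤-trans(*-mono-≤ C≤(≤-trans z≤(≤-trans(*-mono-≤ q≤(*-mono-≤ q≤ q≤))(≡⇒≤ cube))))
     (≡⇒≤(sym(^-distribʳ-* E DB.C(T₀ * T₀ * T₀)))))))
     (*-monoˡ-≤(T₀ * T₀ * T₀)(≤-trans(m≤n+m DB.C 1000)(≤-trans(m≤m+n(1000 + DB.C)(2 ^ E))(m≤m+n(1000 + DB.C + 2 ^ E)E)))))

   T^e≤ : T ^ e ≤ c₀ ^ e * 2 ^ E * q
   T^e≤ = begin
    T ^ e ≡⟨ ^-distribʳ-* e c₀(T₀ * T₀ * T₀)⟩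
    _ ≡⟨ cong(\t -> c₀ ^ e * t ^ e)(alg T₀)⟩
    _ ≡⟨ cong(c₀ ^ e *_)(^-*-assoc T₀ 3 e)⟩
    _ ≤⟨ *-monoʳ-≤(c₀ ^ e)(≤-trans(^-monoʳ-≤ T₀{{N.>-nonZero 1≤T₀}}(*-mono-≤{3}{24}(≤ᵇ⇒≤ 3 24 _)(n≤1+n e)))≤2q)⟩
    _ ≡⟨ sym(N.*-assoc(c₀ ^ e)(2 ^ E)q)⟩
    _ ∎
    where
    alg : ∀ x -> x * x * x ≡ x *(x *(x * 1))
    alg = solve-∀

  parameters : ∀ q -> 1 ≤ q -> Parameters q
  parameters q 1≤q = let T₀ , a , b , c = integer-root(pred E)q 1≤q in record{T₀ = T₀ ; 1≤T₀ = a ; q≤ = b ; ≤2q = c}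

 groupRingTrace :(Φ : FiniteField)-> Trace(GroupRing.starRing Φ)Φ(GroupRing.χ Φ)
 groupRingTrace Φ = record{τ = τ ; τ-cong = τ-cong ; τ-+ = \a b -> ▹-++ a b φ₁ ; τ-⟨⟩ = τ-⟨⟩ ; τ-mono = τ-mono ; τ-N = τ-N}
  where open GroupRing Φ

 module GapBound (S : StarRing){p : ℕ}(PF : PrimeField p){χ : FiniteField.Carrier (PrimeField.Φ PF) -> CommutativeRing.Carrier (StarRing.cring S)}
  (isCharacter : Characters.Character S(PrimeField.Φ PF)χ)(trace : Trace S(PrimeField.Φ PF)χ)(pr : Prime p)(2≤p : 2 ≤ p)
  (T u : ℕ)(1000≤T : 1000 ≤ T)(1≤u : 1 ≤ u)(p≤ : p ≤ u ^ 24)(≤Tp : u ^ 24 ≤ T * p)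
  (logs : ∀ κ -> 2 ^ κ ≤ p -> suc κ ≤ T)
  (divisors : ∀{z}-> 1 ≤ z -> z ≤ p *(p * p)-> DivBound T z)
  (weil : ∀{κ}-> κ ≢ FiniteField.0#(PrimeField.Φ PF)-> Positivity._≲_ S(Positivity.N S(FourthMoment.V S(PrimeField.Φ PF)isCharacter κ))(Positivity.⟨_⟩ S(T * T * p)))
  (M N R : ℕ)(1≤M : 1 ≤ M)(M<p : M < p)(1≤N : 1 ≤ N)(N<p : N < p)(1≤R : 1 ≤ R)(R<p : R < p)where
  private
   module Φ = FieldKit (PrimeField.Φ PF)
   instance
    p≢0 : NonZero p
    p≢0 = prime⇒nonZero pr
   module Var = Variance S PF isCharacter trace pr M N R M<p N<p R<p
   ℓ = length Φ.nz
   p≡ : p ≡ suc ℓ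
   p≡ = trans(sym(PrimeField.size≡p PF))Φ.size-nz
   1≤ℓ : 1 ≤ ℓ
   1≤ℓ = ≤-pred(≤-trans 2≤p(≡⇒≤ p≡))
   p≤2ℓ : p ≤ 2 * ℓ
   p≤2ℓ = ≤-trans(≡⇒≤ p≡)(≤-trans(+-monoˡ-≤ ℓ 1≤ℓ)(≡⇒≤(cong(ℓ +_)(sym(N.+-identityʳ ℓ)))))
   module P = Positivity S
   A : ℕ -> P.Carrier
   A n = P.N(ShiftTrick.S[_] S(PrimeField.Φ PF)isCharacter n)

  gap : ∀ m n k ->(1≤m : 1 ≤ m)(m<p : m < p)(1≤n : 1 ≤ n)(n<p : n < p)(1≤k : 1 ≤ k)(k<p : k < p)->
     (A M P.* A N)P.* A R P.≈(A m P.* A n)P.* A k -> M * N * R ≡ m * n * k ->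
     ∀{w X}-> Available p u k w X -> w * Var.G ≤ p * p *(T * sixteen T *(m * n * X))
  gap m n k 1≤m m<p 1≤n n<p 1≤k k<p sameV sameP{w}{X}a = *-cancelˡ-≤ p(begin
   _ ≤⟨ *-monoˡ-≤(w * G)p≤2ℓ ⟩
   _ ≡⟨ alg₁ ℓ w G ⟩
   _ ≤⟨ *-monoʳ-≤ 2(Var.variance-bound w B V≤)⟩
   _ ≡⟨ cong(\t -> 2 *(p * p * B + w *(t * t)))sameP ⟩
   _ ≡⟨ cong(\t -> 2 *(p * p * B + t))(alg₂ w(m * n)k)⟩
   _ ≤⟨ *-monoʳ-≤ 2(+-monoʳ-≤(p * p * B)(*-mono-≤(*-monoʳ-≤(m * n)(*-mono-≤(<⇒≤ m<p)(<⇒≤ n<p)))(R.main-term a)))⟩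
   _ ≡⟨ alg₃ p(sixteen T)(m * n)X ⟩
   _ ≤⟨ *-monoˡ-≤(p *(p * p *(sixteen T *(m * n * X))))(≤-trans(≤ᵇ⇒≤ 4 1000 _)1000≤T)⟩
   _ ≡⟨ alg₄ T p(sixteen T)(m * n * X)⟩
   _ ∎)
   where
   G = Var.G
   module R = Realisation S PF isCharacter trace pr 2≤p T u 1000≤T 1≤u p≤ ≤Tp logs divisors weil m n k 1≤m m<p 1≤n n<p 1≤k k<p
   B = sixteen T *(p *(m * n))* X
   V≤ : int w ℤ.* Var.V ℤ.≤ int B
   V≤ = subst(\t -> int w ℤ.* t ℤ.≤ int B)(sym(Trace.τ-cong trace sameV))(R.realise a)
   alg₁ : ∀ l w g -> 2 * l *(w * g)≡ 2 *(w *(l * g))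
   alg₁ = solve-∀
   alg₂ : ∀ w x k -> w *(x * k *(x * k))≡ x * x *(w *(k * k))
   alg₂ = solve-∀
   alg₃ : ∀ p s x X -> 2 *(p * p *(s *(p * x)* X)+ x *(p * p)*(p *(s * X)))≡ 4 *(p *(p * p *(s *(x * X))))
   alg₃ = solve-∀
   alg₄ : ∀ T p s x -> T *(p *(p * p *(s * x)))≡ p *(p * p *(T * s * x))
   alg₄ = solve-∀

  smallest : ∃ \x -> x ≡ M ⊓(N ⊓ R)× 1 ≤ x × x < p × ∃ \mn -> M * N * R ≡ mn * x ×(∀{w X}-> Available p u x w X -> w * Var.G ≤ p * p *(T * sixteen T *(mn * X)))
  smallest = go(N.⊓-sel M(N ⊓ R))(N.⊓-sel N R)
   where
   go : M ⊓(N ⊓ R)≡ M ⊎ M ⊓(N ⊓ R)≡ N ⊓ R -> N ⊓ R ≡ N ⊎ N ⊓ R ≡ R -> _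
   go(inj₁ e)_ = M , sym e , 1≤M , M<p , N * R , alg M N R , \{w}{X}-> gap N R M 1≤N N<p 1≤R R<p 1≤M M<p
    (P.solve 3(\a b c ->(a P.:* b)P.:* c P.:=(b P.:* c)P.:* a)P.refl(A M)(A N)(A R))(alg M N R){w}{X}
    where
    alg : ∀ a b c -> a * b * c ≡ b * c * a
    alg = solve-∀
   go(inj₂ e)(inj₁ f)= N , sym(trans e f), 1≤N , N<p , M * R , alg M N R , \{w}{X}-> gap M R N 1≤M M<p 1≤R R<p 1≤N N<p
    (P.solve 3(\a b c ->(a P.:* b)P.:* c P.:=(a P.:* c)P.:* b)P.refl(A M)(A N)(A R))(alg M N R){w}{X}
    where
    alg : ∀ a b c -> a * b * c ≡ a * c * b
    alg = solve-∀
   go(inj₂ e)(inj₂ f)= R , sym(trans e f), 1≤R , R<p , M * N , refl , \{w}{X}-> gap M N R 1≤M M<p 1≤N N<p 1≤R R<p P.refl refl{w}{X}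

 module PowerBound (ν t p' : ℕ) where
  D K : ℕ
  D = 2 * ν * ν * t
  K = 17 * D + ν * ν * t

  combine : ∀ q T G x mn w X C -> 1 ≤ w -> 1 ≤ q -> w * G ≤ q * q *(T * sixteen T *(mn * X))->
   X ^(2 * ν * ν)* x ^(4 * ν)≤ T ^(ν * ν)*(w ^(2 * ν * ν)*(x ^(4 * ν * ν)* q ^(ν + 1)))->
   T ^ K ≤ C * q -> 1 ≤ 2 * ν * ν * p' ->
   G ^ D * x ^(4 * ν * t)≤ C *((q * q)^ D *((mn * x)^ D *(x ^ D * q ^((ν + 1)* t + 2 * ν * ν * p'))))
  combine q T G x mn w X C 1≤w 1≤q gap enough T≤ 1≤ = *-cancelˡ-≤(w ^ D){{N.>-nonZero(1≤^ D 1≤w)}}(begin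
   _ ≡⟨ trans(sym(N.*-assoc(w ^ D)(G ^ D)(x ^(4 * ν * t))))(cong(_* x ^(4 * ν * t))(sym(^-distribʳ-* D w G)))⟩
   _ ≤⟨ *-monoˡ-≤(x ^(4 * ν * t))(^-monoˡ-≤ D gap)⟩
   _ ≡⟨ cong(_* x ^(4 * ν * t))(trans(^-distribʳ-* D(q * q)_)(cong((q * q)^ D *_)(trans(^-distribʳ-* D(T * sixteen T)(mn * X))(cong₂ _*_ T-power(^-distribʳ-* D mn X)))))⟩
   _ ≡⟨ alg₁((q * q)^ D)(T ^(17 * D))(mn ^ D)(X ^ D)(x ^(4 * ν * t))⟩
   _ ≤⟨ *-monoʳ-≤((q * q)^ D *(T ^(17 * D)* mn ^ D))enough-t ⟩
   _ ≡⟨ cong(\s ->(q * q)^ D *(T ^(17 * D)* mn ^ D)*(T ^(ν * ν * t)*(w ^ D *(s * q ^((ν + 1)* t)))))(trans(cong(\s -> x ^(D + s))(N.+-identityʳ D))(^-distribˡ-+-* x D D))⟩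
   _ ≡⟨ alg₂((q * q)^ D)(T ^(17 * D))(mn ^ D)(T ^(ν * ν * t))(w ^ D)(x ^ D)(q ^((ν + 1)* t))⟩
   _ ≡⟨ cong₂(\a b -> w ^ D *(a *((q * q)^ D *(b *(x ^ D * q ^((ν + 1)* t))))))(^-fuse T(17 * D)(ν * ν * t))(sym(^-distribʳ-* D mn x))⟩
   _ ≤⟨ *-monoʳ-≤(w ^ D)(*-monoˡ-≤((q * q)^ D *((mn * x)^ D *(x ^ D * q ^((ν + 1)* t))))(≤-trans T≤(*-monoʳ-≤ C(≤-trans(≡⇒≤(sym(N.^-identityʳ q)))(^-monoʳ-≤ q{{N.>-nonZero 1≤q}}1≤)))))⟩
   _ ≡⟨ cong(w ^ D *_)(alg₃ C(q ^(2 * ν * ν * p'))((q * q)^ D)((mn * x)^ D)(x ^ D)(q ^((ν + 1)* t)))⟩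
   _ ≡⟨ cong(\s -> w ^ D *(C *((q * q)^ D *((mn * x)^ D *(x ^ D * s)))))(^-fuse q((ν + 1)* t)(2 * ν * ν * p'))⟩
   _ ∎)
   where
   alg₀ : ∀ T -> T *(T * T * T * T *(T * T * T * T)*(T * T * T * T *(T * T * T * T)))≡ T *(T *(T *(T *(T *(T *(T *(T *(T *(T *(T *(T *(T *(T *(T *(T *(T * 1))))))))))))))))
   alg₀ = solve-∀
   T-power :(T * sixteen T)^ D ≡ T ^(17 * D)
   T-power = trans(cong(_^ D)(alg₀ T))(^-*-assoc T 17 D)
   alg₁ : ∀ a b c d e -> a *(b *(c * d))* e ≡ a *(b * c)*(d * e)
   alg₁ = solve-∀
   alg₂ : ∀ a b c d e f g -> a *(b * c)*(d *(e *(f * f * g)))≡ e *(b * d *(a *(c * f *(f * g))))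
   alg₂ = solve-∀
   alg₃ : ∀ c r a b x s -> c * r *(a *(b *(x * s)))≡ c *(a *(b *(x *(s * r))))
   alg₃ = solve-∀
   alg₄ : ∀ ν t -> 4 * ν * ν * t ≡ 2 *(2 * ν * ν * t)
   alg₄ = solve-∀
   enough-t : X ^ D * x ^(4 * ν * t)≤ T ^(ν * ν * t)*(w ^ D *(x ^(2 * D)* q ^((ν + 1)* t)))
   enough-t = begin
    _ ≡⟨ sym(trans(^-distribʳ-* t(X ^(2 * ν * ν))(x ^(4 * ν)))(cong₂ _*_(^-*-assoc X(2 * ν * ν)t)(^-*-assoc x(4 * ν)t)))⟩
    _ ≤⟨ ^-monoˡ-≤ t enough ⟩
    _ ≡⟨ trans(^-distribʳ-* t(T ^(ν * ν))_)(cong₂ _*_(^-*-assoc T(ν * ν)t)(trans(^-distribʳ-* t(w ^(2 * ν * ν))_)(cong₂ _*_(^-*-assoc w(2 * ν * ν)t)(trans(^-distribʳ-* t(x ^(4 * ν * ν))(q ^(ν + 1)))(cong₂ _*_(trans(^-*-assoc x(4 * ν * ν)t)(cong(x ^_)(alg₄ ν t)))(^-*-assoc q(ν + 1)t))))))⟩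
    _ ∎

 1≤weight : ∀{q u k w X}-> 1 ≤ u -> Available q u k w X -> 1 ≤ w
 1≤weight h pólya-vinogradov = s≤s z≤n
 1≤weight h trivial = s≤s z≤n
 1≤weight h burgess = s≤s z≤n
 1≤weight h(cubic-short _)= s≤s z≤n
 1≤weight h(cubic-long _)= *-mono-≤ h h

 module Uniform (ν : ℕ) (1≤ν : 1 ≤ ν) (p' t : ℕ) (1≤p' : 1 ≤ p') where
  open PowerBound ν t p' using (D; K; combine)
  open Scale K using (E; c₀; Parameters; parameters)

  C : ℕ
  C = c₀ ^ K * 2 ^ E

  private
   1≤exponent : 1 ≤ 2 * ν * ν * p'
   1≤exponent = *-mono-≤(*-mono-≤(*-mono-≤{1}{2}(s≤s z≤n)1≤ν)1≤ν)1≤p'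

  Bound :(q : ℕ).{{_ : NonZero q}}-> ℕ -> ℕ -> ℕ -> Set
  Bound q M N R = scaledΓ q(pred q)M N R ^ D *(M ⊓(N ⊓ R))^(4 * ν * t)≤ C *((q * q)^ D *((M * N * R)^ D *((M ⊓(N ⊓ R))^ D * q ^((ν + 1)* t + 2 * ν * ν * p'))))

  module Odd (p₂ : ℕ) (pr : Prime (suc (suc (suc p₂)))) (M N R : ℕ) (1≤M : 1 ≤ M) (M<q : M < 3 + p₂) (1≤N : 1 ≤ N) (N<q : N < 3 + p₂) (1≤R : 1 ≤ R) (R<q : R < 3 + p₂) where
   private
    q = 3 + p₂
    module PR = PrimeResidues (suc p₂) pr
    module OP = PR.OddPrime (s≤s (s≤s (s≤s z≤n)))
    PF = PR.primeField
    module GR = GroupRing PR.Φ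
    open Parameters (parameters q (s≤s z≤n))
    module P = Positivity GR.starRing
    1≤half : 1 ≤ proj₁ OP.half
    1≤half = positive(proj₁ OP.half)(proj₂ OP.half)
     where
     positive : ∀ c -> suc(suc p₂)≡ 2 * c -> 1 ≤ c
     positive(suc c)_ = s≤s z≤n

    q≤iterated : q ≤ T₀ ^(2 ^ E)
    q≤iterated = ≤-trans q≤(^-monoʳ-≤ T₀{{N.>-nonZero 1≤T₀}}(≤-trans(n≤1+n E)(suc≤2^ E)))

    weil : ∀{κ}-> κ ≢ FiniteField.0# PR.Φ -> P.N(FourthMoment.V GR.starRing PR.Φ GR.isCharacter κ)P.≲ P.⟨ T * T * q ⟩
    weil{κ}κ≢0 = P.≲-trans(WeilBound.weil GR.starRing PR.Φ(suc p₂)pr(proj₁ OP.half)(proj₂ OP.half)1≤half(PrimeField.size≡p PF)GR.isCharacter E T₀ 1≤T₀ q≤iterated OP.base GR.isCharacter κ≢0)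
     (P.⟨⟩-mono(*-mono-≤(*-mono-≤(≤-trans(≤ᵇ⇒≤ 121 1000 _)1000≤T)T₀≤T)(≡⇒≤(PrimeField.size≡p PF))))

    module GB = GapBound GR.starRing PF GR.isCharacter (groupRingTrace PR.Φ) pr (s≤s (s≤s z≤n)) T u 1000≤T 1≤u q≤u²⁴ u²⁴≤Tq logs divisors weil M N R 1≤M M<q 1≤N N<q 1≤R R<q

    ℓ≡ : length(FieldKit.nz PR.Φ)≡ pred q
    ℓ≡ = suc-injective(trans(sym(FieldKit.size-nz PR.Φ))(PrimeField.size≡p PF))

   odd-bound : Bound q M N R
   odd-bound = from-smallest GB.smallest
    where
    from-smallest :(∃ \x -> x ≡ M ⊓(N ⊓ R)× 1 ≤ x × x < q × ∃ \mn -> M * N * R ≡ mn * x ×(∀{w X}-> Available q u x w X -> w * scaledΓ q(length(FieldKit.nz PR.Φ))M N R ≤ q * q *(T * sixteen T *(mn * X))))-> Bound q M N R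
    from-smallest(x , x≡ , 1≤x , x<q , mn , P≡ , gap)= subst(\m -> scaledΓ q(pred q)M N R ^ D * m ^(4 * ν * t)≤ C *((q * q)^ D *((M * N * R)^ D *(m ^ D * q ^((ν + 1)* t + 2 * ν * ν * p')))))x≡
     (subst(\m -> scaledΓ q(pred q)M N R ^ D * x ^(4 * ν * t)≤ C *((q * q)^ D *(m ^ D *(x ^ D * q ^((ν + 1)* t + 2 * ν * ν * p')))))(sym P≡)
      (finish(Choice.choose q u x T(s≤s z≤n)1≤x(≤-trans(s≤s z≤n)1000≤T)q≤u²⁴ u²⁴≤Tq ν 1≤ν)))
     where
     finish :(∃ \w -> ∃ \X -> Available q u x w X × Choice.Enough q u x T(s≤s z≤n)1≤x(≤-trans(s≤s z≤n)1000≤T)q≤u²⁴ u²⁴≤Tq ν w X)->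
          scaledΓ q(pred q)M N R ^ D * x ^(4 * ν * t)≤ C *((q * q)^ D *((mn * x)^ D *(x ^ D * q ^((ν + 1)* t + 2 * ν * ν * p'))))
     finish(w , X , a , enough)= combine q T(scaledΓ q(pred q)M N R)x mn w X C(1≤weight 1≤u a)(s≤s z≤n)
      (subst(\l -> w * scaledΓ q l M N R ≤ q * q *(T * sixteen T *(mn * X)))ℓ≡(gap a))enough T^e≤ 1≤exponent

  two-bound : Bound 2 1 1 1
  two-bound = begin
   _ ≡⟨ cong₂ _*_(N.^-zeroˡ D)(N.^-zeroˡ(4 * ν * t))⟩
   1 ≤⟨ *-mono-≤ 1≤C(*-mono-≤(1≤^{4}D(s≤s z≤n))(*-mono-≤(1≤^{1}D(s≤s z≤n))(*-mono-≤(1≤^{1}D(s≤s z≤n))(1≤^{2}((ν + 1)* t + 2 * ν * ν * p')(s≤s z≤n)))))⟩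
   _ ∎
   where
   1≤C : 1 ≤ C
   1≤C = *-mono-≤(1≤^ K(s≤s z≤n))(m^n>0 2 E)

  bound : ∀ q₁ -> Prime(suc q₁)-> ∀ M N R -> 1 ≤ M -> M < suc q₁ -> 1 ≤ N -> N < suc q₁ -> 1 ≤ R -> R < suc q₁ -> Bound(suc q₁)M N R
  bound(suc(suc p₂))pr M N R a b c d e f = Odd.odd-bound p₂ pr M N R a b c d e f
  bound(suc zero)pr(suc zero)(suc zero)(suc zero)_ _ _ _ _ _ = two-bound
  bound(suc zero)pr(suc(suc M))N R _(s≤s(s≤s ()))_ _ _ _
  bound(suc zero)pr(suc zero)(suc(suc N))R _ _ _(s≤s(s≤s ()))_ _
  bound(suc zero)pr(suc zero)(suc zero)(suc(suc R))_ _ _ _ _(s≤s(s≤s ()))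
  bound zero pr zero N R ()_ _ _ _ _
  bound zero pr(suc M)N R _(s≤s ())_ _ _ _

module Rational where
 open import Data.Nat using (∣_-_∣)
 open import Data.Integer as ℤ using (ℤ; +_)
 open import Data.Rational as ℚ using (ℚ; 0ℚ; 1ℚ; _+_; _*_; _-_; -_; _/_; fromℚᵘ; toℚᵘ)
 import Data.Rational.Properties as ℚ
 open import Data.Rational.Unnormalised as ℚᵘ using (ℚᵘ; mkℚᵘ; *≡*; *≤*)
 import Data.Rational.Unnormalised.Properties as ℚᵘ
 open E
 open import Defs using (sumℚ; _^ℚ_; ℕtoℚ; Gamma; minL; sumℕ; innerSum)
 open Alg
 open Energy using (∣-∣-square)
 open Reduction using (solutions; solutions≡; scaledΓ)

 private
  module Q = RingKit ℚ.+-*-commutativeRing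
  module ΣN = NatSums

  fromℚᵘ-* : ∀ x y -> fromℚᵘ x * fromℚᵘ y ≡ fromℚᵘ(x ℚᵘ.* y)
  fromℚᵘ-* x y = ℚ.toℚᵘ-injective(ℚᵘ.≃-trans(ℚ.toℚᵘ-homo-*(fromℚᵘ x)(fromℚᵘ y))(ℚᵘ.≃-trans(ℚᵘ.*-cong(ℚ.toℚᵘ-fromℚᵘ x)(ℚ.toℚᵘ-fromℚᵘ y))(ℚᵘ.≃-sym(ℚ.toℚᵘ-fromℚᵘ(x ℚᵘ.* y)))))

  fromℚᵘ-+ : ∀ x y -> fromℚᵘ x + fromℚᵘ y ≡ fromℚᵘ(x ℚᵘ.+ y)
  fromℚᵘ-+ x y = ℚ.toℚᵘ-injective(ℚᵘ.≃-trans(ℚ.toℚᵘ-homo-+(fromℚᵘ x)(fromℚᵘ y))(ℚᵘ.≃-trans(ℚᵘ.+-cong(ℚ.toℚᵘ-fromℚᵘ x)(ℚ.toℚᵘ-fromℚᵘ y))(ℚᵘ.≃-sym(ℚ.toℚᵘ-fromℚᵘ(x ℚᵘ.+ y)))))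

 ℕtoℚ-* : ∀ a b -> ℕtoℚ(a N.* b)≡ ℕtoℚ a * ℕtoℚ b
 ℕtoℚ-* a b = trans(cong(\t -> fromℚᵘ(mkℚᵘ t 0))(ℤ.pos-* a b))(sym(fromℚᵘ-*(mkℚᵘ(+ a)0)(mkℚᵘ(+ b)0)))

 ℕtoℚ-+ : ∀ a b -> ℕtoℚ(a N.+ b)≡ ℕtoℚ a + ℕtoℚ b
 ℕtoℚ-+ a b = trans(cong(\t -> fromℚᵘ(mkℚᵘ t 0))(sym(cong₂ ℤ._+_(ℤ.*-identityʳ(+ a))(ℤ.*-identityʳ(+ b)))))(sym(fromℚᵘ-+(mkℚᵘ(+ a)0)(mkℚᵘ(+ b)0)))

 ℕtoℚ-^ : ∀ a n -> ℕtoℚ a ^ℚ n ≡ ℕtoℚ(a N.^ n)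
 ℕtoℚ-^ a zero = refl
 ℕtoℚ-^ a(suc n)= trans(cong(ℕtoℚ a *_)(ℕtoℚ-^ a n))(sym(ℕtoℚ-* a(a N.^ n)))

 ℕtoℚ-mono : ∀{a b}-> a ≤ b -> ℕtoℚ a ℚ.≤ ℕtoℚ b
 ℕtoℚ-mono{a}{b}h = ℚ.toℚᵘ-cancel-≤(ℚᵘ.≤-respˡ-≃(ℚᵘ.≃-sym(ℚ.toℚᵘ-fromℚᵘ(mkℚᵘ(+ a)0)))(ℚᵘ.≤-respʳ-≃(ℚᵘ.≃-sym(ℚ.toℚᵘ-fromℚᵘ(mkℚᵘ(+ b)0)))
  (*≤*(subst₂ ℤ._≤_(sym(ℤ.*-identityʳ(+ a)))(sym(ℤ.*-identityʳ(+ b)))(ℤ.+≤+ h)))))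

 ^ℚ-distrib-* : ∀ x y n ->(x * y)^ℚ n ≡ x ^ℚ n * y ^ℚ n
 ^ℚ-distrib-* x y zero = sym(ℚ.*-identityˡ 1ℚ)
 ^ℚ-distrib-* x y(suc n)= trans(cong(x * y *_)(^ℚ-distrib-* x y n))(Q.solve 4(\a b c d ->(a Q.:* b)Q.:*(c Q.:* d)Q.:=(a Q.:* c)Q.:*(b Q.:* d))refl x y(x ^ℚ n)(y ^ℚ n))

 private
  clear : ∀ P q₁ ->((+ P)/ suc q₁)* ℕtoℚ(suc q₁)≡ ℕtoℚ P
  clear P q₁ = trans(fromℚᵘ-*(mkℚᵘ(+ P)q₁)(mkℚᵘ(+ suc q₁)0))(ℚ.fromℚᵘ-cong{mkℚᵘ(+ P)q₁ ℚᵘ.* mkℚᵘ(+ suc q₁)0}{mkℚᵘ(+ P)0}(*≡*(ℤ.*-assoc(+ P)(+ suc q₁)(+ 1))))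

  square-difference : ∀ a b ->(ℕtoℚ a - ℕtoℚ b)*(ℕtoℚ a - ℕtoℚ b)≡ ℕtoℚ(∣ a - b ∣ N.* ∣ a - b ∣)
  square-difference a b = begin
   _ ≡⟨ Q.solve 2(\x y ->(x Q.:- y)Q.:*(x Q.:- y)Q.:=(x Q.:* x Q.:+ y Q.:* y)Q.:-(x Q.:* y Q.:+ x Q.:* y))refl x y ⟩
   _ ≡⟨ cong(_-(x * y + x * y))(trans(sym(trans(ℕtoℚ-+(a N.* a)(b N.* b))(cong₂ _+_(ℕtoℚ-* a a)(ℕtoℚ-* b b))))(trans(cong ℕtoℚ(∣-∣-square a b))(trans(ℕtoℚ-+ d(2 N.*(a N.* b)))(cong(_+_(ℕtoℚ d))twice))))⟩
   _ ≡⟨ Q.solve 2(\d z ->(d Q.:+ z)Q.:- z Q.:= d)refl(ℕtoℚ d)(x * y + x * y)⟩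
   _ ∎
   where
   open ≡-Reasoning
   x = ℕtoℚ a
   y = ℕtoℚ b
   d = ∣ a - b ∣ N.* ∣ a - b ∣
   twice : ℕtoℚ(2 N.*(a N.* b))≡ x * y + x * y
   twice = trans(cong(\t -> ℕtoℚ(a N.* b N.+ t))(N.+-identityʳ(a N.* b)))(trans(ℕtoℚ-+(a N.* b)(a N.* b))(cong₂ _+_(ℕtoℚ-* a b)(ℕtoℚ-* a b)))

  sumℚ-scaled : ∀ n(f : ℕ -> ℚ)c(g : ℕ -> ℕ)->(∀ a -> f(suc a)* c ≡ ℕtoℚ(g a))-> sumℚ n f * c ≡ ℕtoℚ(ΣN.Ʃ(rng n)g)
  sumℚ-scaled zero f c g h = ℚ.*-zeroˡ c
  sumℚ-scaled(suc n)f c g h = trans(ℚ.*-distribʳ-+ c(sumℚ n f)(f(suc n)))(trans(cong₂ _+_(sumℚ-scaled n f c g h)(h n))(trans(ℚ.+-comm(ℕtoℚ(ΣN.Ʃ(rng n)g))(ℕtoℚ(g n)))(sym(ℕtoℚ-+(g n)(ΣN.Ʃ(rng n)g)))))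

 Gamma-scaled : ∀ q₁ M N R -> Gamma(suc q₁)M N R * ℕtoℚ(suc q₁ N.* suc q₁)≡ ℕtoℚ(scaledΓ(suc q₁)q₁ M N R)
 Gamma-scaled q₁ M N R = sumℚ-scaled q₁ _(ℕtoℚ(suc q₁ N.* suc q₁))_ \a -> term a
  where
  q = suc q₁
  P = M N.* N N.* R
  term : ∀ a -> let d = ℕtoℚ(sumℕ R(\r -> innerSum q M N(suc a)r))-((+ P)/ q)in
   (d * d)* ℕtoℚ(q N.* q)≡ ℕtoℚ(∣ q N.* solutions q M N R(suc a)- P ∣ N.* ∣ q N.* solutions q M N R(suc a)- P ∣)
  term a = trans(cong(\t ->(ℕtoℚ t - r)*(ℕtoℚ t - r)* ℕtoℚ(q N.* q))(solutions≡ q₁ M N R(suc a)))(trans(cong((ℕtoℚ c - r)*(ℕtoℚ c - r)*_)(ℕtoℚ-* q q))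
   (trans(Q.solve 3(\c r q ->(c Q.:- r)Q.:*(c Q.:- r)Q.:*(q Q.:* q)Q.:=(q Q.:* c Q.:- r Q.:* q)Q.:*(q Q.:* c Q.:- r Q.:* q))refl(ℕtoℚ c)r(ℕtoℚ q))
    (trans(cong₂(\s t ->(s - t)*(s - t))(sym(ℕtoℚ-* q c))(clear P q₁))(square-difference(q N.* c)P))))
   where
   c = solutions q M N R(suc a)
   r =(+ P)/ q

 transfer : ∀ q₁ M N R D a b e C ->
  scaledΓ(suc q₁)q₁ M N R N.^ D N.* minL M N R N.^ a ≤ C N.*((suc q₁ N.* suc q₁)N.^ D N.*((M N.* N N.* R)N.^ D N.*(minL M N R N.^ b N.* suc q₁ N.^ e)))->
  (Gamma(suc q₁)M N R ^ℚ D)*(ℕtoℚ(minL M N R)^ℚ a)ℚ.≤ ℕtoℚ C *(ℕtoℚ(M N.* N N.* R)^ℚ D)*(ℕtoℚ(minL M N R)^ℚ b)*(ℕtoℚ(suc q₁)^ℚ e)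
 transfer q₁ M N R D a b e C h = cancel((q N.* q)N.^ D)(m^n>0(q N.* q)D)left right h
  where
  q = suc q₁
  P = M N.* N N.* R
  L = minL M N R
  Γ = Gamma q M N R
  G = scaledΓ q q₁ M N R
  cancel : ∀{x y m n}c -> 1 ≤ c -> x * ℕtoℚ c ≡ ℕtoℚ m -> y * ℕtoℚ c ≡ ℕtoℚ n -> m ≤ n -> x ℚ.≤ y
  cancel{x}{y}(suc c)_ p q h = ℚ.*-cancelʳ-≤-pos(ℕtoℚ(suc c)){{ℚ.normalize-pos(suc c)1}}(subst₂ ℚ._≤_(sym p)(sym q)(ℕtoℚ-mono h))
  left :(Γ ^ℚ D)*(ℕtoℚ L ^ℚ a)* ℕtoℚ((q N.* q)N.^ D)≡ ℕtoℚ(G N.^ D N.* L N.^ a)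
  left = trans(Q.solve 3(\x y z ->(x Q.:* y)Q.:* z Q.:=(x Q.:* z)Q.:* y)refl(Γ ^ℚ D)(ℕtoℚ L ^ℚ a)(ℕtoℚ((q N.* q)N.^ D)))
   (trans(cong₂ _*_(trans(cong((Γ ^ℚ D)*_)(sym(ℕtoℚ-^(q N.* q)D)))(trans(sym(^ℚ-distrib-* Γ(ℕtoℚ(q N.* q))D))(trans(cong(_^ℚ D)(Gamma-scaled q₁ M N R))(ℕtoℚ-^ G D))))(ℕtoℚ-^ L a))
    (sym(ℕtoℚ-*(G N.^ D)(L N.^ a))))
  right : ℕtoℚ C *(ℕtoℚ P ^ℚ D)*(ℕtoℚ L ^ℚ b)*(ℕtoℚ q ^ℚ e)* ℕtoℚ((q N.* q)N.^ D)≡ ℕtoℚ(C N.*((q N.* q)N.^ D N.*(P N.^ D N.*(L N.^ b N.* q N.^ e))))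
  right = trans(cong₂(\s t -> ℕtoℚ C * s *(ℕtoℚ L ^ℚ b)* t * z)(ℕtoℚ-^ P D)(ℕtoℚ-^ q e))(trans(cong(\s -> ℕtoℚ C * ℕtoℚ(P N.^ D)* s * ℕtoℚ(q N.^ e)* z)(ℕtoℚ-^ L b))
   (trans(Q.solve 5(\c p l e z -> c Q.:* p Q.:* l Q.:* e Q.:* z Q.:= c Q.:*(z Q.:*(p Q.:*(l Q.:* e))))refl(ℕtoℚ C)(ℕtoℚ(P N.^ D))(ℕtoℚ(L N.^ b))(ℕtoℚ(q N.^ e))z)
    (sym(trans(ℕtoℚ-* C _)(cong(ℕtoℚ C *_)(trans(ℕtoℚ-*((q N.* q)N.^ D)_)(cong(z *_)(trans(ℕtoℚ-*(P N.^ D)_)(cong(ℕtoℚ(P N.^ D)*_)(ℕtoℚ-*(L N.^ b)(q N.^ e)))))))))))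
   where
   z = ℕtoℚ((q N.* q)N.^ D)

open import Defs
open import Data.Nat using (ℕ; _+_; _*_; _≤_; _<_)
open import Data.Nat.Primality using (Prime)
open import Data.Product using (∃)
open import Data.Rational as ℚ using (ℚ)
open Assemble using (module Uniform)
open Rational using (transfer)

theorem6 : (ν : ℕ) → 1 ≤ ν → (p t : ℕ) → 1 ≤ p → 1 ≤ t →
    ∃ λ (C : ℚ) → (q M N R : ℕ) → Prime q →
    1 ≤ M → M < q → 1 ≤ N → N < q → 1 ≤ R → R < q →
    ((Gamma q M N R) ^ℚ (2 * ν * ν * t)) ℚ.* (ℕtoℚ (minL M N R) ^ℚ (4 * ν * t))
    ℚ.≤ C ℚ.* (ℕtoℚ (M * N * R) ^ℚ (2 * ν * ν * t))
    ℚ.* (ℕtoℚ (minL M N R) ^ℚ (2 * ν * ν * t))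
    ℚ.* (ℕtoℚ q ^ℚ ((ν + 1) * t + 2 * ν * ν * p))
theorem6 ν 1≤ν p t 1≤p _ = ℕtoℚ U.C , λ { (suc q₁) M N R pr a b c d e f →
    transfer q₁ M N R (2 * ν * ν * t) (4 * ν * t) (2 * ν * ν * t) ((ν + 1) * t + 2 * ν * ν * p) U.C (U.bound q₁ pr M N R a b c d e f) }
  where
  module U = Uniform ν 1≤ν p t 1≤p
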